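{- There exist constants $C$ and $m_0$ such that for all integers $n,m\geq m_0$ with $\frac{n}{2}\leq m< n$, $$2n+2m-2\leq R(C_{2m}, F_n)\leq R(C_{2m}, W_{2n})\leq 2n+2m+C.$$
   Context: $C_\ell$ denotes the cycle of length $\ell$. For $k\ge 3$, the wheel $W_k$ is the graph on $k+1$ vertices obtained by joining one vertex to every vertex of a cycle of length $k$. The fan $F_n$ is the graph on $2n+1$ vertices obtained by joining one vertex to every vertex of a matching with $n$ edges. For graphs $H_1,H_2$, the Ramsey number $R(H_1,H_2)$ is the smallest integer $N$ such that in every coloring of the edges of $K_N$ with colors 1 and 2 there is a copy of $H_1$ in color 1 or a copy of $H_2$ in color 2. -}

module Defs where

open import Data.Nat using (ℕ; zero; suc; _+_; _*_; _∸_; _≤_)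
open import Data.Nat.Properties using ()
open import Data.Fin using (Fin; toℕ) renaming (zero to fzero; suc to fsuc)
open import Data.Product using (Σ; _×_; _,_)
open import Data.Sum using (_⊎_)
open import Data.Empty using (⊥)
open import Data.Unit using (⊤)
open import Relation.Binary.PropositionalEquality using (_≡_)
open import Function.Definitions using (Injective)

-- A (pattern) graph: a vertex count and an edge relation on Fin V.
-- Each edge may be listed in one or both orientations; colourings are
-- symmetric, so this does not matter.
record Graph : Set₁ where
  field
    V : ℕ
    E : Fin V → Fin V → Set
open Graph public

cycAdj : (ℓ : ℕ) → Fin ℓ → Fin ℓ → Set
cycAdj ℓ i j = (suc (toℕ i) ≡ toℕ j) ⊎ ((suc (toℕ i) ≡ ℓ) × (toℕ j ≡ 0))

Cycle : ℕ → Graph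
Cycle ℓ = record { V = ℓ ; E = cycAdj ℓ }

wheelAdj : (k : ℕ) → Fin (suc k) → Fin (suc k) → Set
wheelAdj k fzero    fzero    = ⊥
wheelAdj k fzero    (fsuc j) = ⊤
wheelAdj k (fsuc i) fzero    = ⊥
wheelAdj k (fsuc i) (fsuc j) = cycAdj k i j

Wheel : ℕ → Graph
Wheel k = record { V = suc k ; E = wheelAdj k }

-- The fan F_n: hub fzero joined to every vertex of the perfect matching
-- {0,1},{2,3},...,{2n-2,2n-1} on fsuc _ (2n+1 vertices).
data Even : ℕ → Set where
  ev0  : Even 0
  ev+2 : ∀ {k} → Even k → Even (suc (suc k))

fanAdj : (n : ℕ) → Fin (suc (2 * n)) → Fin (suc (2 * n)) → Set
fanAdj n fzero    fzero    = ⊥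
fanAdj n fzero    (fsuc j) = ⊤
fanAdj n (fsuc i) fzero    = ⊥
fanAdj n (fsuc i) (fsuc j) = Even (toℕ i) × (suc (toℕ i) ≡ toℕ j)

Fan : ℕ → Graph
Fan n = record { V = suc (2 * n) ; E = fanAdj n }

data Colour : Set where
  col1 col2 : Colour

record Colouring (N : ℕ) : Set where
  field
    χ   : Fin N → Fin N → Colour
    sym : ∀ i j → χ i j ≡ χ j i
open Colouring public

CopyIn : {N : ℕ} → Colouring N → Colour → Graph → Set
CopyIn {N} κ c H =
  Σ (Fin (V H) → Fin N) λ f →
    Injective _≡_ _≡_ f × (∀ u v → E H u v → χ κ (f u) (f v) ≡ c)

Arrows : ℕ → Graph → Graph → Set
Arrows N H₁ H₂ = (κ : Colouring N) → CopyIn κ col1 H₁ ⊎ CopyIn κ col2 H₂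

IsRamseyNumber : ℕ → Graph → Graph → Set
IsRamseyNumber r H₁ H₂ = Arrows r H₁ H₂ × (∀ N → Arrows N H₁ H₂ → r ≤ N)

{-# OPTIONS --safe #-}
module Submission where

-- Upper bound. Suppose that N = 2n + 2m + C vertices span neither a red C_{2m} nor a blue W_{2n}. Any
-- 2n + m + K vertices contain a red C_{2m} or a blue C_{2n}: a blue C_{2n-2} is extended by two vertices
-- unless the edges between it and the other vertices are so red that Jackson's lemma yields a red C_{2m}.
-- Hence every blue neighbourhood is smaller than that, and every red degree is at least m + O(1). Up to
-- O(1) deleted vertices, the red graph splits into pieces without red edges between them, each of which
-- stays connected when boundedly many vertices are deleted. A piece has at most 7m vertices and minimum
-- degree above m, so among any eight of its vertices two have many common neighbours; thus any two vertices
-- are joined by a path of at most 24 vertices, and long paths can be shortened by a bounded amount. If a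
-- piece has at least 2m + O(1) vertices, any two of its vertices are joined by a path on at least 2m vertices,
-- as in Dirac's theorem. Shortened suitably, this path is closed up by a connector of adjustable length, which
-- is a chain of 4-cycles, together with a short odd cycle if the piece is not bipartite, and becomes a red
-- cycle of length exactly 2m. So all pieces have fewer than 2m + O(1) vertices, and then the blue complete
-- multipartite graph between them contains W_{2n}.
--
-- Lower bound. Colour three disjoint cliques on 2m - 1, n - 1 and n - 1 vertices red and the rest blue.
--
-- Vertex sets, walks and cycles are lists, compared by the number of entries that satisfy a predicate.

open import Defs renaming (sym to χ-sym)
open import Data.Nat using (ℕ; zero; suc; _+_; _*_; _∸_; _^_; _≤_; _<_; z≤n; s≤s; s≤s⁻¹; _≡ᵇ_; _≤ᵇ_; _<ᵇ_; _≟_; _<?_)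
open import Data.Nat.Properties
open import Data.Nat.DivMod using (_/_; _%_; m%n<n; m≡m%n+[m/n]*n)
open import Data.Bool using (Bool; true; false; T; _∧_; _∨_; not; _xor_; if_then_else_)
open import Data.Fin using (Fin; toℕ; fromℕ<) renaming (zero to fzero; suc to fsuc)
open import Data.Fin.Properties using (any?; all?; toℕ-injective; toℕ<n; toℕ-fromℕ<; fromℕ<-injective; pigeonhole) renaming (_≟_ to _≟ᶠ_)
open import Data.List using (List; []; _∷_; _++_; length; map; reverse; concat)
open import Data.List.Properties using (++-assoc; length-++; length-reverse; unfold-reverse; reverse-++)
open import Data.List.Relation.Unary.All using (All; []; _∷_)
open import Data.List.Relation.Unary.AllPairs using (AllPairs; []; _∷_)
open import Data.Product using (Σ; _×_; _,_; proj₁; proj₂)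
open import Data.Sum using (_⊎_; inj₁; inj₂; [_,_]′)
open import Data.Empty using (⊥; ⊥-elim)
open import Data.Unit using (tt)
open import Relation.Nullary using (Dec; yes; no; ¬_; ¬?; _×-dec_; _⊎-dec_; _→-dec_)
open import Relation.Nullary.Decidable using (map′)
open import Function.Definitions using (Injective)
open import Relation.Binary.PropositionalEquality using (_≡_; refl; sym; trans; cong; cong₂; subst; subst₂; module ≡-Reasoning)

-- Linear arithmetic over ℕ, with counts and lengths of lists

-- The additive constant shapes the whole argument: path lengths are controlled only up to a bounded
-- error, while the cycle must have exactly 2m vertices. With the constants chosen below, a path can
-- be placed in a window of 424 vertices and a parity change costs at most 45 more; a connector with
-- 235 adjustable 4-cycles covers both. Its size fixes the two numbers that govern the pieces, 6298
-- for the deletions that a piece must survive and 6317 for its surplus degree. A cut leaves more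
-- than m vertices on each side and there are at most 7m in all, so the decomposition has depth at
-- most 7 and deletes at most 127 * 6298 = 799846 vertices, which 900000 covers with room to spare.
-- The other summand 2^40 forces a monochromatic clique on 20 vertices, with which the induction for
-- two even cycles starts at m = n = 10. Neither robustness nor the presence of an odd cycle is ever
-- decided: the upper bound only refutes that both copies are absent, and then a copy is obtained
-- because its existence is decidable.

swap4 : ∀ a b c d → (a + b) + (c + d) ≡ (a + c) + (b + d)
swap4 a b c d = begin
  (a + b) + (c + d) ≡⟨ +-assoc a b (c + d) ⟩
  a + (b + (c + d)) ≡⟨ cong (a +_) (sym (+-assoc b c d)) ⟩
  a + ((b + c) + d) ≡⟨ cong (λ z → a + (z + d)) (+-comm b c) ⟩
  a + ((c + b) + d) ≡⟨ cong (a +_) (+-assoc c b d) ⟩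
  a + (c + (b + d)) ≡⟨ sym (+-assoc a c (b + d)) ⟩
  (a + c) + (b + d) ∎
  where open ≡-Reasoning

b2n : Bool → ℕ
b2n true = 1
b2n false = 0

cnt : ∀ {A : Set} → (A → Bool) → List A → ℕ
cnt p [] = 0
cnt p (x ∷ xs) = b2n (p x) + cnt p xs

cnt-++ : ∀ {A : Set} (p : A → Bool) xs ys → cnt p (xs ++ ys) ≡ cnt p xs + cnt p ys
cnt-++ p [] ys = refl
cnt-++ p (x ∷ xs) ys = trans (cong (b2n (p x) +_) (cnt-++ p xs ys)) (sym (+-assoc (b2n (p x)) _ _))

cnt-rev : ∀ {A : Set} (p : A → Bool) xs → cnt p (reverse xs) ≡ cnt p xs
cnt-rev p [] = refl
cnt-rev p (x ∷ xs) = begin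
  cnt p (reverse (x ∷ xs))                   ≡⟨ cong (cnt p) (unfold-reverse x xs) ⟩
  cnt p (reverse xs ++ x ∷ [])               ≡⟨ cnt-++ p (reverse xs) (x ∷ []) ⟩
  cnt p (reverse xs) + (b2n (p x) + 0)       ≡⟨ cong₂ _+_ (cnt-rev p xs) (+-identityʳ _) ⟩
  cnt p xs + b2n (p x)                       ≡⟨ +-comm (cnt p xs) _ ⟩
  b2n (p x) + cnt p xs                       ∎
  where open ≡-Reasoning

-- A list expression is counted by a predicate or measured, and both are linear in its atoms.
infixr 5 _▹_ _⧺_

data LEx : Set where
  atom : ℕ → LEx
  nil : LEx
  _▹_ : ℕ → LEx → LEx
  _⧺_ : LEx → LEx → LEx
  rev : LEx → LEx

infixl 6 _⊕_
infixr 7 _⊛_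

data Ex : Set where
  var lit bit : ℕ → Ex
  # ∥ : LEx → Ex
  _⊕_ : Ex → Ex → Ex
  _⊛_ : ℕ → Ex → Ex
  1+ : Ex → Ex

pattern ` n = lit n
pattern x0 = var 0
pattern x1 = var 1
pattern x2 = var 2
pattern x3 = var 3
pattern x4 = var 4
pattern x5 = var 5
pattern x6 = var 6
pattern x7 = var 7
pattern x8 = var 8
pattern x9 = var 9
pattern L0 = atom 0
pattern L1 = atom 1
pattern L2 = atom 2
pattern L3 = atom 3
pattern L4 = atom 4
pattern L5 = atom 5
pattern L6 = atom 6
pattern L7 = atom 7
pattern L8 = atom 8
pattern L9 = atom 9

nth : List ℕ → ℕ → ℕ
nth [] _ = 0
nth (x ∷ xs) zero = x
nth (x ∷ xs) (suc i) = nth xs i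

nthL : List (List ℕ) → ℕ → List ℕ
nthL [] _ = []
nthL (x ∷ xs) zero = x
nthL (x ∷ xs) (suc i) = nthL xs i

-- Here `p` is the predicate under which lists are counted, `es` are the vertices, `Ls` the list
-- atoms and `ρ` the numbers. One predicate at a time suffices, because multiset statements are
-- instantiated before they are quoted.
record Env : Set where
  constructor env
  field
    p : ℕ → Bool
    es : List ℕ
    Ls : List (List ℕ)
    ρ : List ℕ

lists : List ℕ → List (List ℕ) → List ℕ → Env
lists = env (λ _ → true)

nums : List ℕ → Env
nums = lists [] []

listOf : Env → LEx → List ℕ
listOf Γ (atom i) = nthL (Env.Ls Γ) i
listOf Γ nil = []
listOf Γ (i ▹ L) = nth (Env.es Γ) i ∷ listOf Γ L
listOf Γ (L ⧺ M) = listOf Γ L ++ listOf Γ M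
listOf Γ (rev L) = reverse (listOf Γ L)

eval : Env → Ex → ℕ
eval Γ (var i) = nth (Env.ρ Γ) i
eval Γ (lit n) = n
eval Γ (bit i) = b2n (Env.p Γ (nth (Env.es Γ) i))
eval Γ (# L) = cnt (Env.p Γ) (listOf Γ L)
eval Γ (∥ L) = length (listOf Γ L)
eval Γ (a ⊕ b) = eval Γ a + eval Γ b
eval Γ (k ⊛ a) = k * eval Γ a
eval Γ (1+ a) = suc (eval Γ a)

addF : List ℕ → List ℕ → List ℕ
addF [] g = g
addF f [] = f
addF (a ∷ f) (b ∷ g) = a + b ∷ addF f g

unitF : ℕ → List ℕ
unitF zero = 1 ∷ []
unitF (suc i) = 0 ∷ unitF i

leqF : List ℕ → List ℕ → Bool
leqF [] g = true
leqF (a ∷ f) [] = (a ≡ᵇ 0) ∧ leqF f []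
leqF (a ∷ f) (b ∷ g) = (a ≤ᵇ b) ∧ leqF f g

dot : List ℕ → (ℕ → ℕ) → ℕ
dot [] v = 0
dot (c ∷ f) v = c * v 0 + dot f (λ i → v (suc i))

∧-T : ∀ {a b} → T (a ∧ b) → T a × T b
∧-T {true} {true} _ = tt , tt

dot-add : ∀ f g v → dot (addF f g) v ≡ dot f v + dot g v
dot-add [] g v = refl
dot-add (a ∷ f) [] v = sym (+-identityʳ _)
dot-add (a ∷ f) (b ∷ g) v =
  trans (cong₂ _+_ (*-distribʳ-+ (v 0) a b) (dot-add f g _)) (swap4 (a * v 0) (b * v 0) _ _)

dot-scale : ∀ k f v → dot (map (k *_) f) v ≡ k * dot f v
dot-scale k [] v = sym (*-zeroʳ k)
dot-scale k (a ∷ f) v =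
  trans (cong₂ _+_ (*-assoc k a (v 0)) (dot-scale k f _)) (sym (*-distribˡ-+ k (a * v 0) _))

dot-unit : ∀ i v → dot (unitF i) v ≡ v i
dot-unit zero v = trans (+-identityʳ _) (+-identityʳ _)
dot-unit (suc i) v = dot-unit i _

dot-mono : ∀ f g v → T (leqF f g) → dot f v ≤ dot g v
dot-mono [] g v _ = z≤n
dot-mono (zero ∷ f) [] v h = dot-mono f [] _ h
dot-mono (a ∷ f) (b ∷ g) v h with ∧-T {a ≤ᵇ b} h
... | p , q = +-mono-≤ (*-monoˡ-≤ (v 0) (≤ᵇ⇒≤ a b p)) (dot-mono f g _ q)

-- A linear form in the constant 1, the variables, the counts and lengths of the list atoms, and the
-- indicators of the vertices.
record Form : Set where
  constructor form
  field
    one : ℕ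
    vars counts lengths bits : List ℕ

value : Env → Form → ℕ
value Γ (form k f c l b) = k + (dot f (nth (Env.ρ Γ)) + (dot c (λ i → cnt (Env.p Γ) (nthL (Env.Ls Γ) i)) +
  (dot l (λ i → length (nthL (Env.Ls Γ) i)) + dot b (λ i → b2n (Env.p Γ (nth (Env.es Γ) i))))))

_⊞_ : Form → Form → Form
form k f c l b ⊞ form k' f' c' l' b' = form (k + k') (addF f f') (addF c c') (addF l l') (addF b b')

scale : ℕ → Form → Form
scale n (form k f c l b) = form (n * k) (map (n *_) f) (map (n *_) c) (map (n *_) l) (map (n *_) b)

_≼ᵇ_ : Form → Form → Bool
form k f c l b ≼ᵇ form k' f' c' l' b' = (k ≤ᵇ k') ∧ (leqF f f' ∧ (leqF c c' ∧ (leqF l l' ∧ leqF b b')))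

value-⊞ : ∀ Γ F G → value Γ (F ⊞ G) ≡ value Γ F + value Γ G
value-⊞ Γ (form k f c l b) (form k' f' c' l' b')
  rewrite dot-add f f' (nth (Env.ρ Γ)) | dot-add c c' (λ i → cnt (Env.p Γ) (nthL (Env.Ls Γ) i))
        | dot-add l l' (λ i → length (nthL (Env.Ls Γ) i)) | dot-add b b' (λ i → b2n (Env.p Γ (nth (Env.es Γ) i))) =
  trans (cong (k + k' +_) (trans (cong (F + F' +_) (trans (cong (C + C' +_) (swap4 L L' B B')) (swap4 C C' (L + B) (L' + B'))))
    (swap4 F F' (C + (L + B)) (C' + (L' + B'))))) (swap4 k k' (F + (C + (L + B))) (F' + (C' + (L' + B'))))
  where
  F = dot f (nth (Env.ρ Γ))
  F' = dot f' (nth (Env.ρ Γ))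
  C = dot c (λ i → cnt (Env.p Γ) (nthL (Env.Ls Γ) i))
  C' = dot c' (λ i → cnt (Env.p Γ) (nthL (Env.Ls Γ) i))
  L = dot l (λ i → length (nthL (Env.Ls Γ) i))
  L' = dot l' (λ i → length (nthL (Env.Ls Γ) i))
  B = dot b (λ i → b2n (Env.p Γ (nth (Env.es Γ) i)))
  B' = dot b' (λ i → b2n (Env.p Γ (nth (Env.es Γ) i)))

value-scale : ∀ Γ n F → value Γ (scale n F) ≡ n * value Γ F
value-scale Γ n (form k f c l b)
  rewrite dot-scale n f (nth (Env.ρ Γ)) | dot-scale n c (λ i → cnt (Env.p Γ) (nthL (Env.Ls Γ) i))
        | dot-scale n l (λ i → length (nthL (Env.Ls Γ) i)) | dot-scale n b (λ i → b2n (Env.p Γ (nth (Env.es Γ) i)))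
        | sym (*-distribˡ-+ n (dot l (λ i → length (nthL (Env.Ls Γ) i))) (dot b (λ i → b2n (Env.p Γ (nth (Env.es Γ) i)))))
        | sym (*-distribˡ-+ n (dot c (λ i → cnt (Env.p Γ) (nthL (Env.Ls Γ) i))) (dot l (λ i → length (nthL (Env.Ls Γ) i)) + dot b (λ i → b2n (Env.p Γ (nth (Env.es Γ) i)))))
        | sym (*-distribˡ-+ n (dot f (nth (Env.ρ Γ))) (dot c (λ i → cnt (Env.p Γ) (nthL (Env.Ls Γ) i)) + (dot l (λ i → length (nthL (Env.Ls Γ) i)) + dot b (λ i → b2n (Env.p Γ (nth (Env.es Γ) i)))))) =
  sym (*-distribˡ-+ n k _)

value-mono : ∀ Γ F G → T (F ≼ᵇ G) → value Γ F ≤ value Γ G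
value-mono Γ (form k f c l b) (form k' f' c' l' b') h with ∧-T {k ≤ᵇ k'} h
... | h₁ , t₁ with ∧-T {leqF f f'} t₁
... | h₂ , t₂ with ∧-T {leqF c c'} t₂
... | h₃ , t₃ with ∧-T {leqF l l'} t₃
... | h₄ , h₅ = +-mono-≤ (≤ᵇ⇒≤ k k' h₁) (+-mono-≤ (dot-mono f f' _ h₂) (+-mono-≤ (dot-mono c c' _ h₃) (+-mono-≤ (dot-mono l l' _ h₄) (dot-mono b b' _ h₅))))

count-form length-form : LEx → Form
count-form (atom i) = form 0 [] (unitF i) [] []
count-form nil = form 0 [] [] [] []
count-form (i ▹ L) = form 0 [] [] [] (unitF i) ⊞ count-form L
count-form (L ⧺ M) = count-form L ⊞ count-form M
count-form (rev L) = count-form L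
length-form (atom i) = form 0 [] [] (unitF i) []
length-form nil = form 0 [] [] [] []
length-form (i ▹ L) = form 1 [] [] [] [] ⊞ length-form L
length-form (L ⧺ M) = length-form L ⊞ length-form M
length-form (rev L) = length-form L

linear : Ex → Form
linear (var i) = form 0 (unitF i) [] [] []
linear (lit n) = form n [] [] [] []
linear (bit i) = form 0 [] [] [] (unitF i)
linear (# L) = count-form L
linear (∥ L) = length-form L
linear (a ⊕ b) = linear a ⊞ linear b
linear (k ⊛ a) = scale k (linear a)
linear (1+ a) = form 1 [] [] [] [] ⊞ linear a

value-bit : ∀ Γ i → value Γ (form 0 [] [] [] (unitF i)) ≡ b2n (Env.p Γ (nth (Env.es Γ) i))
value-bit Γ i = dot-unit i _

count-correct : ∀ Γ L → value Γ (count-form L) ≡ cnt (Env.p Γ) (listOf Γ L)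
count-correct Γ (atom i) = trans (+-identityʳ _) (dot-unit i _)
count-correct Γ nil = refl
count-correct Γ (i ▹ L) = trans (value-⊞ Γ (form 0 [] [] [] (unitF i)) (count-form L)) (cong₂ _+_ (value-bit Γ i) (count-correct Γ L))
count-correct Γ (L ⧺ M) = trans (value-⊞ Γ (count-form L) (count-form M))
  (trans (cong₂ _+_ (count-correct Γ L) (count-correct Γ M)) (sym (cnt-++ (Env.p Γ) (listOf Γ L) _)))
count-correct Γ (rev L) = trans (count-correct Γ L) (sym (cnt-rev (Env.p Γ) (listOf Γ L)))

length-correct : ∀ Γ L → value Γ (length-form L) ≡ length (listOf Γ L)
length-correct Γ (atom i) = trans (+-identityʳ _) (dot-unit i _)
length-correct Γ nil = refl
length-correct Γ (i ▹ L) = trans (value-⊞ Γ (form 1 [] [] [] []) (length-form L)) (cong suc (length-correct Γ L))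
length-correct Γ (L ⧺ M) = trans (value-⊞ Γ (length-form L) (length-form M))
  (trans (cong₂ _+_ (length-correct Γ L) (length-correct Γ M)) (sym (length-++ (listOf Γ L))))
length-correct Γ (rev L) = trans (length-correct Γ L) (sym (length-reverse (listOf Γ L)))

linear-correct : ∀ Γ e → value Γ (linear e) ≡ eval Γ e
linear-correct Γ (var i) = trans (+-identityʳ _) (dot-unit i _)
linear-correct Γ (lit n) = +-identityʳ n
linear-correct Γ (bit i) = value-bit Γ i
linear-correct Γ (# L) = count-correct Γ L
linear-correct Γ (∥ L) = length-correct Γ L
linear-correct Γ (a ⊕ b) = trans (value-⊞ Γ (linear a) (linear b)) (cong₂ _+_ (linear-correct Γ a) (linear-correct Γ b))
linear-correct Γ (k ⊛ a) = trans (value-scale Γ k (linear a)) (cong (k *_) (linear-correct Γ a))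
linear-correct Γ (1+ a) = trans (value-⊞ Γ (form 1 [] [] [] []) (linear a)) (cong suc (linear-correct Γ a))

infixr 6 _×!_

-- A hypothesis travels with the quoted forms of its sides, and `_×!_` attaches its Farkas
-- multiplier. An arithmetic step thus carries a certificate that is checked by evaluation;
-- contradictions appear as proofs of 1 ≤ 0.
data Fact (Γ : Env) : Set where
  ≤! : (a b : Ex) → eval Γ a ≤ eval Γ b → Fact Γ
  ≡! : (a b : Ex) → eval Γ a ≡ eval Γ b → Fact Γ
  ≡˘ : (a b : Ex) → eval Γ b ≡ eval Γ a → Fact Γ
  _×!_ : ℕ → Fact Γ → Fact Γ

lhs rhs : ∀ {Γ} → Fact Γ → Ex
lhs (≤! a b _) = a
lhs (≡! a b _) = a
lhs (≡˘ a b _) = a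
lhs (k ×! f) = k ⊛ lhs f
rhs (≤! a b _) = b
rhs (≡! a b _) = b
rhs (≡˘ a b _) = b
rhs (k ×! f) = k ⊛ rhs f

holds : ∀ {Γ} (f : Fact Γ) → eval Γ (lhs f) ≤ eval Γ (rhs f)
holds (≤! a b h) = h
holds (≡! a b h) = ≤-reflexive h
holds (≡˘ a b h) = ≤-reflexive (sym h)
holds (k ×! f) = *-monoʳ-≤ k (holds f)

sumˡ sumʳ : ∀ {Γ} → List (Fact Γ) → Ex
sumˡ [] = lit 0
sumˡ (f ∷ fs) = lhs f ⊕ sumˡ fs
sumʳ [] = lit 0
sumʳ (f ∷ fs) = rhs f ⊕ sumʳ fs

sum-≤ : ∀ {Γ} (fs : List (Fact Γ)) → eval Γ (sumˡ fs) ≤ eval Γ (sumʳ fs)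
sum-≤ [] = z≤n
sum-≤ (f ∷ fs) = +-mono-≤ (holds f) (sum-≤ fs)

-- Farkas: multiply the goal by k, add the facts with their multipliers, and compare coefficients.
lin : ∀ Γ k (a b : Ex) (fs : List (Fact Γ)) →
      {T (linear (1+ (k ⊛ a ⊕ sumʳ fs)) ≼ᵇ linear (k ⊛ b ⊕ sumˡ fs ⊕ lit k))} → eval Γ a ≤ eval Γ b
lin Γ k a b fs {h} = ≮⇒≥ contra
  where
  L = 1+ (k ⊛ a ⊕ sumʳ fs)
  R = k ⊛ b ⊕ sumˡ fs ⊕ lit k
  bound : suc (k * eval Γ a + eval Γ (sumʳ fs)) ≤ k * eval Γ b + eval Γ (sumˡ fs) + k
  bound = subst₂ _≤_ (linear-correct Γ L) (linear-correct Γ R) (value-mono Γ (linear L) (linear R) h)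
  -- Integrality enters here: the negated goal is b + 1 ≤ a, and its multiple by `k` contributes the
  -- extra `k`. A certificate may therefore round down by less than one unit.
  contra : eval Γ b < eval Γ a → ⊥
  contra lt = <-irrefl refl (begin-strict
    k * eval Γ a + eval Γ (sumʳ fs)            <⟨ bound ⟩
    k * eval Γ b + eval Γ (sumˡ fs) + k        ≤⟨ +-monoˡ-≤ k (+-monoʳ-≤ (k * eval Γ b) (sum-≤ fs)) ⟩
    k * eval Γ b + eval Γ (sumʳ fs) + k        ≡⟨ +-assoc (k * eval Γ b) _ k ⟩
    k * eval Γ b + (eval Γ (sumʳ fs) + k)      ≡⟨ cong (k * eval Γ b +_) (+-comm _ k) ⟩
    k * eval Γ b + (k + eval Γ (sumʳ fs))      ≡⟨ sym (+-assoc (k * eval Γ b) k _) ⟩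
    k * eval Γ b + k + eval Γ (sumʳ fs)        ≡⟨ cong (_+ eval Γ (sumʳ fs)) (trans (+-comm _ k) (sym (*-suc k (eval Γ b)))) ⟩
    k * suc (eval Γ b) + eval Γ (sumʳ fs)      ≤⟨ +-monoˡ-≤ _ (*-monoʳ-≤ k lt) ⟩
    k * eval Γ a + eval Γ (sumʳ fs)            ∎)
    where open ≤-Reasoning

-- Only equations can be read backwards. An inequality becomes 0 ≤ 0, so the second half of `lin≡`
-- rests on the equations alone.
turn : ∀ {Γ} → Fact Γ → Fact Γ
turn (≤! _ _ _) = ≤! (` 0) (` 0) z≤n
turn (≡! a b h) = ≡˘ b a h
turn (≡˘ a b h) = ≡! b a h
turn (k ×! f) = k ×! turn f

lin≡ : ∀ Γ k (a b : Ex) (fs : List (Fact Γ)) →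
       {T (linear (1+ (k ⊛ a ⊕ sumʳ fs)) ≼ᵇ linear (k ⊛ b ⊕ sumˡ fs ⊕ lit k))} →
       {T (linear (1+ (k ⊛ b ⊕ sumʳ (map turn fs))) ≼ᵇ linear (k ⊛ a ⊕ sumˡ (map turn fs) ⊕ lit k))} → eval Γ a ≡ eval Γ b
lin≡ Γ k a b fs {h} {h'} = ≤-antisym (lin Γ k a b fs {h}) (lin Γ k b a (map turn fs) {h'})

-- Classical reasoning under double negation

DN : Set → Set
DN A = (A → ⊥) → ⊥

ret : ∀ {A} → A → DN A
ret a k = k a

_>>=_ : ∀ {A B} → DN A → (A → DN B) → DN B
(m >>= f) k = m (λ a → f a k)

em : ∀ {A} → DN (A ⊎ (A → ⊥))
em k = k (inj₂ (λ a → k (inj₁ a)))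

-- Counting in lists

bool : (b : Bool) → b ≡ true ⊎ b ≡ false
bool true = inj₁ refl
bool false = inj₂ refl

t≢f : ∀ {b} → b ≡ true → b ≡ false → ⊥
t≢f refl ()

b2n-≤1 : ∀ b → b2n b ≤ 1
b2n-≤1 true = ≤-refl
b2n-≤1 false = z≤n

b2n-t : ∀ {b} → b ≡ true → b2n b ≡ 1
b2n-t refl = refl

b2n-f : ∀ {b} → b ≡ false → b2n b ≡ 0
b2n-f refl = refl

b2n-true : ∀ {b} → 1 ≤ b2n b → b ≡ true
b2n-true {true} _ = refl

∧-true : ∀ {a b} → a ∧ b ≡ true → a ≡ true × b ≡ true
∧-true {true} {true} _ = refl , refl

∧-intro : ∀ {a b} → a ≡ true → b ≡ true → a ∧ b ≡ true
∧-intro refl refl = refl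

cnt-all : ∀ {A : Set} (xs : List A) → cnt (λ _ → true) xs ≡ length xs
cnt-all [] = refl
cnt-all (x ∷ xs) = cong suc (cnt-all xs)

cnt-≤ : ∀ {A : Set} (p : A → Bool) xs → cnt p xs ≤ length xs
cnt-≤ p [] = z≤n
cnt-≤ p (x ∷ xs) = +-mono-≤ (b2n-≤1 (p x)) (cnt-≤ p xs)

cnt-cong : ∀ {A : Set} {p q : A → Bool} → (∀ x → p x ≡ q x) → ∀ xs → cnt p xs ≡ cnt q xs
cnt-cong h [] = refl
cnt-cong h (x ∷ xs) = cong₂ _+_ (cong b2n (h x)) (cnt-cong h xs)

b2n-∨∧ : ∀ a b → b2n a + b2n b ≡ b2n (a ∨ b) + b2n (a ∧ b)
b2n-∨∧ true true = refl
b2n-∨∧ true false = refl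
b2n-∨∧ false true = refl
b2n-∨∧ false false = refl

cnt-∨∧ : ∀ {A : Set} (p q : A → Bool) xs →
  cnt p xs + cnt q xs ≡ cnt (λ x → p x ∨ q x) xs + cnt (λ x → p x ∧ q x) xs
cnt-∨∧ p q [] = refl
cnt-∨∧ p q (x ∷ xs) = trans (swap4 (b2n (p x)) (cnt p xs) (b2n (q x)) (cnt q xs))
  (trans (cong₂ _+_ (b2n-∨∧ (p x) (q x)) (cnt-∨∧ p q xs)) (swap4 (b2n (p x ∨ q x)) (b2n (p x ∧ q x)) _ _))

cnt-not : ∀ {A : Set} (p : A → Bool) xs → cnt p xs + cnt (λ x → not (p x)) xs ≡ length xs
cnt-not p [] = refl
cnt-not p (x ∷ xs) with p x
... | true = cong suc (cnt-not p xs)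
... | false = trans (+-suc _ _) (cong suc (cnt-not p xs))

cnt-first : ∀ {A : Set} (p : A → Bool) xs → 1 ≤ cnt p xs →
  Σ (List A) λ ys → Σ A λ x → Σ (List A) λ zs → (xs ≡ ys ++ x ∷ zs) × (p x ≡ true) × (cnt p ys ≡ 0)
cnt-first p (x ∷ xs) h with p x in eq
... | true = [] , x , xs , refl , eq , refl
... | false with cnt-first p xs h
... | ys , y , zs , refl , py , c = x ∷ ys , y , zs , refl , py , trans (cong (λ b → b2n b + cnt p ys) eq) c

cnt-last : ∀ {A : Set} (p : A → Bool) xs → 1 ≤ cnt p xs →
  Σ (List A) λ ys → Σ A λ x → Σ (List A) λ zs → (xs ≡ ys ++ x ∷ zs) × (p x ≡ true) × (cnt p zs ≡ 0)
cnt-last p (x ∷ xs) h with cnt p xs in c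
... | zero = [] , x , xs , refl , b2n-true (subst (1 ≤_) (+-identityʳ _) h) , c
... | suc k with cnt-last p xs (subst (1 ≤_) (sym c) (s≤s z≤n))
... | ys , y , zs , refl , py , d = x ∷ ys , y , zs , refl , py , d

findPair : ∀ {A : Set} (q : A → A → Bool) xs →
  (Σ (List A) λ as → Σ A λ x → Σ (List A) λ bs → Σ A λ y → Σ (List A) λ cs →
    (xs ≡ as ++ x ∷ bs ++ y ∷ cs) × (q x y ≡ true))
  ⊎ AllPairs (λ x y → q x y ≡ false) xs
findPair q [] = inj₂ []
findPair {A} q (x ∷ xs) with cnt (q x) xs in c
... | suc k with cnt-first (q x) xs (subst (1 ≤_) (sym c) (s≤s z≤n))
... | bs , y , cs , eq , qy , _ = inj₁ ([] , x , bs , y , cs , cong (x ∷_) eq , qy)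
findPair {A} q (x ∷ xs) | zero with findPair q xs
... | inj₁ (as , y , bs , z , cs , eq , h) = inj₁ (x ∷ as , y , bs , z , cs , cong (x ∷_) eq , h)
... | inj₂ h = inj₂ (none xs c ∷ h)
  where
  none : ∀ ys → cnt (q x) ys ≡ 0 → All (λ y → q x y ≡ false) ys
  none [] _ = []
  none (y ∷ ys) e with q x y in eq
  ... | false = eq ∷ none ys e

filt : ∀ {A : Set} → (A → Bool) → List A → List A
filt p [] = []
filt p (x ∷ xs) = if p x then x ∷ filt p xs else filt p xs

cnt-filt : ∀ {A : Set} (p q : A → Bool) xs → cnt q (filt p xs) ≡ cnt (λ x → p x ∧ q x) xs
cnt-filt p q [] = refl
cnt-filt p q (x ∷ xs) with p x
... | true = cong (b2n (q x) +_) (cnt-filt p q xs)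
... | false = cnt-filt p q xs

length-filt : ∀ {A : Set} (p : A → Bool) xs → length (filt p xs) ≡ cnt p xs
length-filt p xs = trans (sym (cnt-all (filt p xs))) (trans (cnt-filt p (λ _ → true) xs) (cnt-cong (λ x → ∧t (p x)) xs))
  where
  ∧t : ∀ b → b ∧ true ≡ b
  ∧t true = refl
  ∧t false = refl

-- Lists of natural numbers as finite multisets

==-refl : ∀ n → (n ≡ᵇ n) ≡ true
==-refl zero = refl
==-refl (suc n) = ==-refl n

==-true : ∀ {m n} → (m ≡ᵇ n) ≡ true → m ≡ n
==-true {zero} {zero} _ = refl
==-true {suc m} {suc n} h = cong suc (==-true h)

==-false : ∀ {m n} → ¬ m ≡ n → (m ≡ᵇ n) ≡ false
==-false {m} {n} h with m ≡ᵇ n in eq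
... | true = ⊥-elim (h (==-true eq))
... | false = refl

occ : ℕ → List ℕ → ℕ
occ v = cnt (v ≡ᵇ_)

infix 4 _∈_ _⊑_

_∈_ : ℕ → List ℕ → Set
v ∈ xs = 1 ≤ occ v xs

_∈?_ : ∀ v xs → (v ∈ xs) ⊎ (occ v xs ≡ 0)
v ∈? xs with occ v xs
... | zero = inj₂ refl
... | suc n = inj₁ (s≤s z≤n)

NoDup : List ℕ → Set
NoDup xs = ∀ v → occ v xs ≤ 1

-- Inclusion of multisets. Quantifying over all predicates lets one fact bound memberships
-- (`v ≡ᵇ_`), degrees (`e v`) and lengths (constantly true). It also encodes disjointness: a
-- concatenation below a duplicate-free list consists of disjoint lists without repetitions.
record _⊑_ (xs ys : List ℕ) : Set where
  constructor le:
  field ⊑at : ∀ p → cnt p xs ≤ cnt p ys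
open _⊑_ public

record Split (G A B : List ℕ) : Set where
  constructor sp:
  field spl : ∀ p → cnt p G ≡ cnt p A + cnt p B
open Split public

⊑-refl : ∀ {xs} → xs ⊑ xs
⊑-refl = le: λ p → ≤-refl

⊑-trans : ∀ {xs ys zs} → xs ⊑ ys → ys ⊑ zs → xs ⊑ zs
⊑-trans a b = le: λ p → ≤-trans (⊑at a p) (⊑at b p)

≡⇒⊑ : ∀ {xs ys} → xs ≡ ys → xs ⊑ ys
≡⇒⊑ refl = ⊑-refl

⊑-len : ∀ xs ys → xs ⊑ ys → length xs ≤ length ys
⊑-len xs ys h = subst₂ _≤_ (cnt-all xs) (cnt-all ys) (⊑at h (λ _ → true))

split-len : ∀ G A B → Split G A B → length G ≡ length A + length B
split-len G A B h = trans (sym (cnt-all G)) (trans (spl h (λ _ → true)) (cong₂ _+_ (cnt-all A) (cnt-all B)))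

splitˡ : ∀ {G A B} → Split G A B → A ⊑ G
splitˡ h = le: λ p → ≤-trans (m≤m+n _ _) (≤-reflexive (sym (spl h p)))

splitʳ : ∀ {G A B} → Split G A B → B ⊑ G
splitʳ h = le: λ p → ≤-trans (m≤n+m _ _) (≤-reflexive (sym (spl h p)))

∈-⊑ : ∀ v {xs ys} → xs ⊑ ys → v ∈ xs → v ∈ ys
∈-⊑ v h m = ≤-trans m (⊑at h _)

nodup-⊑ : ∀ {xs ys} → xs ⊑ ys → NoDup ys → NoDup xs
nodup-⊑ h d v = ≤-trans (⊑at h _) (d v)

∈-here : ∀ v xs → v ∈ (v ∷ xs)
∈-here v xs = (lin (env (v ≡ᵇ_) (v ∷ []) (xs ∷ []) []) 1 (` 1) (# (0 ▹ L0)) (≡˘ (` 1) (bit 0) (b2n-t (==-refl v)) ∷ []))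

∈-there : ∀ v x xs → v ∈ xs → v ∈ (x ∷ xs)
∈-there v x xs h = ≤-trans h (m≤n+m _ _)

∈-++ˡ : ∀ v xs ys → v ∈ xs → v ∈ (xs ++ ys)
∈-++ˡ v xs ys h = (lin (env (v ≡ᵇ_) [] (xs ∷ ys ∷ []) []) 1 (` 1) (# (L0 ⧺ L1)) (≤! (` 1) (# L0) h ∷ []))

∈-++ʳ : ∀ v xs ys → v ∈ ys → v ∈ (xs ++ ys)
∈-++ʳ v xs ys h = (lin (env (v ≡ᵇ_) [] (xs ∷ ys ∷ []) []) 1 (` 1) (# (L0 ⧺ L1)) (≤! (` 1) (# L1) h ∷ []))

∈-mid : ∀ xs v ys → v ∈ (xs ++ v ∷ ys)
∈-mid xs v ys = ∈-++ʳ v xs (v ∷ ys) (∈-here v ys)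

∈-∷⁻ : ∀ v x xs → v ∈ (x ∷ xs) → v ≡ x ⊎ v ∈ xs
∈-∷⁻ v x xs h with v ≡ᵇ x in eq
... | true = inj₁ (==-true eq)
... | false = inj₂ h

∈-++⁻ : ∀ v xs ys → v ∈ (xs ++ ys) → v ∈ xs ⊎ v ∈ ys
∈-++⁻ v [] ys h = inj₂ h
∈-++⁻ v (x ∷ xs) ys h with ∈-∷⁻ v x (xs ++ ys) h
... | inj₁ refl = inj₁ (∈-here v xs)
... | inj₂ k with ∈-++⁻ v xs ys k
... | inj₁ a = inj₁ (∈-there v x xs a)
... | inj₂ b = inj₂ b

∈-split : ∀ v xs → v ∈ xs → Σ (List ℕ) λ ys → Σ (List ℕ) λ zs → xs ≡ ys ++ v ∷ zs
∈-split v xs h with cnt-first (v ≡ᵇ_) xs h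
... | ys , x , zs , eq , e , _ rewrite ==-true {v} {x} e = ys , zs , eq

cnt-∈ : ∀ p v xs → v ∈ xs → p v ≡ true → 1 ≤ cnt p xs
cnt-∈ p v xs h pv with ∈-split v xs h
... | ys , zs , refl = (lin (env p (v ∷ []) (ys ∷ zs ∷ []) []) 1 (` 1) (# (L0 ⧺ 0 ▹ L1)) (≡˘ (` 1) (bit 0) (b2n-t pv) ∷ []))

cnt-wit : ∀ p xs → 1 ≤ cnt p xs → Σ ℕ λ v → (v ∈ xs) × (p v ≡ true)
cnt-wit p xs h with cnt-first p xs h
... | ys , x , zs , refl , px , _ = x , ∈-mid ys x zs , px

cnt-zero : ∀ p xs → cnt p xs ≡ 0 → ∀ v → v ∈ xs → p v ≡ false
cnt-zero p xs h v m with p v in eq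
... | false = refl
... | true = (⊥-elim (1+n≰n (lin (env p [] (xs ∷ []) []) 1 (` 1) (` 0) (≤! (` 1) (# L0) (cnt-∈ p v xs m eq) ∷ ≡! (# L0) (` 0) h ∷ []))))

none⇒zero : ∀ p xs → (∀ v → v ∈ xs → p v ≡ true → ⊥) → cnt p xs ≡ 0
none⇒zero p xs h with cnt p xs in c
... | zero = refl
... | suc k with cnt-wit p xs (subst (1 ≤_) (sym c) (s≤s z≤n))
... | v , m , e = ⊥-elim (h v m e)

cnt-imp : ∀ (p q : ℕ → Bool) xs → (∀ v → v ∈ xs → p v ≡ true → q v ≡ true) → cnt p xs ≤ cnt q xs
cnt-imp p q [] h = z≤n
cnt-imp p q (x ∷ xs) h = +-mono-≤ hd (cnt-imp p q xs (λ v m → h v (∈-there v x xs m)))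
  where
  hd : b2n (p x) ≤ b2n (q x)
  hd with p x in eq
  ... | false = z≤n
  ... | true = ≤-reflexive (sym (b2n-t (h x (∈-here x xs) eq)))

-- Comparing multiplicities of single values is enough, since the entries of `xs` can be taken out
-- of `ys` one by one.
diff : ∀ xs ys → (∀ v → occ v xs ≤ occ v ys) → Σ (List ℕ) λ zs → Split ys xs zs
diff [] ys h = ys , sp: λ p → refl
diff (x ∷ xs) ys h with ∈-split x ys (≤-trans (∈-here x xs) (h x))
... | as , bs , refl with diff xs (as ++ bs) (λ v → (lin (env (v ≡ᵇ_) (x ∷ []) (xs ∷ as ∷ bs ∷ []) []) 1 (# L0) (# (L1 ⧺ L2)) (≤! (# (0 ▹ L0)) (# (L1 ⧺ 0 ▹ L2)) (h v) ∷ [])))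
... | zs , e = zs , sp: λ p → (lin≡ (env p (x ∷ []) (as ∷ bs ∷ xs ∷ zs ∷ []) []) 1 (# (L0 ⧺ 0 ▹ L1)) ((# (0 ▹ L2)) ⊕ (# L3)) (≡! (# (L0 ⧺ L1)) ((# L2) ⊕ (# L3)) (spl e p) ∷ []))

diff⊑ : ∀ xs ys → xs ⊑ ys → Σ (List ℕ) λ zs → Split ys xs zs
diff⊑ xs ys h = diff xs ys (λ v → ⊑at h (v ≡ᵇ_))

occ⇒⊑ : ∀ xs ys → (∀ v → occ v xs ≤ occ v ys) → xs ⊑ ys
occ⇒⊑ xs ys h = splitˡ (proj₂ (diff xs ys h))

sub : ∀ xs ys → NoDup xs → (∀ v → v ∈ xs → v ∈ ys) → xs ⊑ ys
sub xs ys d h = occ⇒⊑ xs ys λ v → go v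
  where
  go : ∀ v → occ v xs ≤ occ v ys
  go v with v ∈? xs
  ... | inj₁ m = ≤-trans (d v) (h v m)
  ... | inj₂ z = ≤-trans (≤-reflexive z) z≤n

∉-rest : ∀ {G A B} → NoDup G → Split G A B → ∀ v → v ∈ A → v ∈ B → ⊥
∉-rest {G} {A} {B} d h v a b = (⊥-elim (1+n≰n (lin (env (v ≡ᵇ_) [] (G ∷ A ∷ B ∷ []) []) 1 (` 1) (` 0) (≤! (# L0) (` 1) (d v) ∷ ≡˘ ((# L1) ⊕ (# L2)) (# L0) (spl h (v ≡ᵇ_)) ∷ ≤! (` 1) (# L1) a ∷ ≤! (` 1) (# L2) b ∷ []))))

split-∈ : ∀ {G A B} → Split G A B → ∀ v → v ∈ G → v ∈ A ⊎ v ∈ B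
split-∈ {G} {A} {B} h v m with v ∈? A
... | inj₁ a = inj₁ a
... | inj₂ z = inj₂ (lin (env (v ≡ᵇ_) [] (B ∷ G ∷ A ∷ []) []) 1 (` 1) (# L0) (≤! (` 1) (# L1) m ∷ ≡! (# L1) ((# L2) ⊕ (# L0)) (spl h (v ≡ᵇ_)) ∷ ≡! (# L2) (` 0) z ∷ []))

nodup-∷ : ∀ x xs → occ x xs ≡ 0 → NoDup xs → NoDup (x ∷ xs)
nodup-∷ x xs z d v with v ≡ᵇ x in eq
... | false = d v
... | true rewrite ==-true {v} {x} eq | z = ≤-refl

dup? : ∀ xs → NoDup xs ⊎ (Σ (List ℕ) λ as → Σ ℕ λ x → Σ (List ℕ) λ bs → Σ (List ℕ) λ cs → xs ≡ as ++ x ∷ bs ++ x ∷ cs)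
dup? xs with findPair _≡ᵇ_ xs
... | inj₁ (as , x , bs , y , cs , eq , h) rewrite ==-true {x} {y} h = inj₂ (as , y , bs , cs , eq)
... | inj₂ h = inj₁ (go xs h)
  where
  none : ∀ x ys → All (λ y → (x ≡ᵇ y) ≡ false) ys → occ x ys ≡ 0
  none x [] [] = refl
  none x (y ∷ ys) (e ∷ h) rewrite e = none x ys h
  go : ∀ xs → AllPairs (λ x y → (x ≡ᵇ y) ≡ false) xs → NoDup xs
  go [] _ v = z≤n
  go (x ∷ xs) (h ∷ hs) = nodup-∷ x xs (none x xs h) (go xs hs)

-- Walks and cycles

Rel : Set
Rel = ℕ → ℕ → Bool

SymR : Rel → Set
SymR e = ∀ x y → e x y ≡ e y x

-- The default stands for the vertex that follows the end of the list; on a cycle this is its start.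
hd : List ℕ → ℕ → ℕ
hd [] w = w
hd (x ∷ _) w = x

infixr 5 _◂_

-- The list of a walk contains both ends.
data Walk (e : Rel) : ℕ → List ℕ → ℕ → Set where
  [_] : ∀ u → Walk e u (u ∷ []) u
  _◂_ : ∀ {u w xs v} → e u w ≡ true → Walk e w xs v → Walk e u (u ∷ xs) v

join : ∀ {e u xs v w ys z} → Walk e u xs v → e v w ≡ true → Walk e w ys z → Walk e u (xs ++ ys) z
join [ u ] h W = h ◂ W
join (h' ◂ W') h W = h' ◂ join W' h W

snoc : ∀ {e u xs v w} → Walk e u xs v → e v w ≡ true → Walk e u (xs ++ w ∷ []) w
snoc W h = join W h [ _ ]

wrev : ∀ {e u xs v} → SymR e → Walk e u xs v → Walk e v (reverse xs) u
wrev s [ u ] = [ u ]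
wrev {e} {v = v} s (_◂_ {u} {w} {xs} h W) =
  subst (λ z → Walk e v z u) (sym (unfold-reverse u xs)) (snoc (wrev s W) (trans (s w u) h))

wmap : ∀ {e e' u xs v} → (∀ x y → e x y ≡ true → e' x y ≡ true) → Walk e u xs v → Walk e' u xs v
wmap h [ u ] = [ u ]
wmap h (p ◂ W) = h _ _ p ◂ wmap h W

whd : ∀ {e u xs v} d → Walk e u xs v → hd xs d ≡ u
whd d [ u ] = refl
whd d (h ◂ W) = refl

w∈ˡ : ∀ {e u xs v} → Walk e u xs v → u ∈ xs
w∈ˡ [ u ] = ∈-here u []
w∈ˡ (_◂_ {u} {xs = xs} h W) = ∈-here u xs

w∈ʳ : ∀ {e u xs v} → Walk e u xs v → v ∈ xs
w∈ʳ [ u ] = ∈-here u []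
w∈ʳ {v = v} (_◂_ {u} {xs = xs} h W) = ∈-there v u xs (w∈ʳ W)

wlen : ∀ {e u xs v} → Walk e u xs v → 1 ≤ length xs
wlen [ u ] = s≤s z≤n
wlen (h ◂ W) = s≤s z≤n

wcut : ∀ {e u v} xs a ys → Walk e u (xs ++ a ∷ ys) v → Walk e u (xs ++ a ∷ []) a × Walk e a (a ∷ ys) v
wcut [] a ys W with whd a W
... | refl = [ a ] , W
wcut (x ∷ []) a ys (h ◂ W) with whd a W
... | refl = (h ◂ [ a ]) , W
wcut (x ∷ y ∷ xs) a ys (h ◂ W) with wcut (y ∷ xs) a ys W
... | P , Q = (h ◂ P) , Q

wtail : ∀ {e a v} R d → 1 ≤ length R → Walk e a (a ∷ R) v → (e a (hd R d) ≡ true) × Walk e (hd R d) R v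
wtail (r ∷ R) d _ (h ◂ W) with whd r W
... | refl = h , W

wsingle : ∀ {e a v} → Walk e a (a ∷ []) v → v ≡ a
wsingle [ a ] = refl

rot : ∀ {e u v} xs a ys → Walk e u (xs ++ a ∷ ys) v → e v u ≡ true →
      Walk e (hd ys u) (ys ++ xs ++ a ∷ []) a × (e a (hd ys u) ≡ true)
rot xs a [] W cl with wcut xs a [] W
... | P , Q with wsingle Q
... | refl = P , cl
rot xs a (y ∷ ys) W cl with wcut xs a (y ∷ ys) W
... | P , Q with wtail (y ∷ ys) y (s≤s z≤n) Q
... | h , Q' = join Q' cl P , h

-- Counts the pairs of an entry and its successor, with `w` as successor of the last entry. With `w`
-- the start of a cycle these are the oriented edges of the cycle.
pcnt : (ℕ → ℕ → Bool) → List ℕ → ℕ → ℕ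
pcnt q [] w = 0
pcnt q (x ∷ xs) w = b2n (q x (hd xs w)) + pcnt q xs w

pcnt-first : ∀ q xs w → 1 ≤ pcnt q xs w → Σ (List ℕ) λ ys → Σ ℕ λ a → Σ (List ℕ) λ zs →
  (xs ≡ ys ++ a ∷ zs) × (q a (hd zs w) ≡ true) × (pcnt q xs w ≡ suc (pcnt q zs w))
pcnt-first q (x ∷ xs) w h with q x (hd xs w) in eq
... | true = [] , x , xs , refl , eq , refl
... | false with pcnt-first q xs w h
... | ys , a , zs , refl , qa , c = x ∷ ys , a , zs , refl , qa , c

-- The successors are the entries shifted by one place: the first entry is traded for `w`.
pcnt-right : ∀ (q : ℕ → Bool) xs w → pcnt (λ _ b → q b) xs w + b2n (q (hd xs w)) ≡ cnt q xs + b2n (q w)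
pcnt-right q [] w = refl
pcnt-right q (x ∷ xs) w =
  (lin≡ (nums ((b2n (q (hd xs w))) ∷ (pcnt (λ _ b → q b) xs w) ∷ (b2n (q x)) ∷ (cnt q xs) ∷ (b2n (q w)) ∷ [])) 1 ((x0 ⊕ x1) ⊕ x2) ((x2 ⊕ x3) ⊕ x4) (≡! (x1 ⊕ x0) (x3 ⊕ x4) (pcnt-right q xs w) ∷ []))

pcnt-cyc : ∀ {e u xs v} q → Walk e u xs v → pcnt (λ _ b → q b) xs u ≡ cnt q xs
pcnt-cyc {e} {u} {xs} q W = +-cancelʳ-≡ (b2n (q u)) _ _
  (subst (λ z → pcnt (λ _ b → q b) xs u + b2n (q z) ≡ cnt q xs + b2n (q u)) (whd u W) (pcnt-right q xs u))

succs : (ℕ → Bool) → List ℕ → ℕ → List ℕ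
succs p [] w = []
succs p (x ∷ xs) w = if p x then hd xs w ∷ succs p xs w else succs p xs w

cnt-succs : ∀ (p q : ℕ → Bool) xs w → cnt q (succs p xs w) ≡ pcnt (λ a b → p a ∧ q b) xs w
cnt-succs p q [] w = refl
cnt-succs p q (x ∷ xs) w with p x
... | true = cong (b2n (q (hd xs w)) +_) (cnt-succs p q xs w)
... | false = cnt-succs p q xs w

length-succs : ∀ (p : ℕ → Bool) xs w → length (succs p xs w) ≡ cnt p xs
length-succs p [] w = refl
length-succs p (x ∷ xs) w with p x
... | true = cong suc (length-succs p xs w)
... | false = length-succs p xs w

pcnt-∧ : ∀ (p q : ℕ → Bool) xs w → pcnt (λ a b → p a ∧ q b) xs w ≤ pcnt (λ _ b → q b) xs w
pcnt-∧ p q [] w = z≤n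
pcnt-∧ p q (x ∷ xs) w with p x
... | true = +-monoʳ-≤ (b2n (q (hd xs w))) (pcnt-∧ p q xs w)
... | false = ≤-trans (pcnt-∧ p q xs w) (m≤n+m _ _)

succs-⊑ : ∀ {e u xs v} p → Walk e u xs v → succs p xs u ⊑ xs
succs-⊑ {u = u} {xs} p W = le: λ q → ≤-trans (≤-reflexive (cnt-succs p q xs u))
  (≤-trans (pcnt-∧ p q xs u) (≤-reflexive (pcnt-cyc q W)))

record CycleOn (e : Rel) (f : (ℕ → Bool) → ℕ) : Set where
  constructor cycle
  field
    {u v} : ℕ
    C : List ℕ
    W : Walk e u C v
    cl : e v u ≡ true
    count : ∀ p → cnt p C ≡ f p

record HasCycle (e : Rel) (S : List ℕ) (ℓ : ℕ) : Set where
  constructor cyc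
  field
    {u v} : ℕ
    C : List ℕ
    W : Walk e u C v
    cl : e v u ≡ true
    inS : C ⊑ S
    len : length C ≡ ℓ

cyc-mono : ∀ {e S S' ℓ} → S ⊑ S' → HasCycle e S ℓ → HasCycle e S' ℓ
cyc-mono h (cyc C W cl i l) = cyc C W cl (⊑-trans i h) l

cyc-map : ∀ {e e' S ℓ} → (∀ x y → e x y ≡ true → e' x y ≡ true) → HasCycle e S ℓ → HasCycle e' S ℓ
cyc-map h (cyc C W cl i l) = cyc C (wmap h W) (h _ _ cl) i l

-- If `x` is adjacent to a vertex of the cycle and `z` to its successor, the edge between these two
-- is replaced by the path through `x` and `z`.
insertPair : ∀ {e u v} C → Walk e u C v → e v u ≡ true → ∀ x z → SymR e → e x z ≡ true →
  1 ≤ pcnt (λ a b → e x a ∧ e z b) C u → CycleOn e (λ p → b2n (p x) + b2n (p z) + cnt p C)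
insertPair {e} {u} C W cl x z sy xz h with pcnt-first _ C u h
... | X , a , Y , refl , q , _ with rot X a Y W cl | ∧-true q
... | W' , h' | xa , zσ = cycle (x ∷ z ∷ Y ++ X ++ a ∷ []) (xz ◂ zσ ◂ W') (trans (sy a x) xa)
  λ p → (lin≡ (env p (x ∷ z ∷ a ∷ []) (Y ∷ X ∷ []) []) 1 (# (0 ▹ 1 ▹ L0 ⧺ L1 ⧺ 2 ▹ nil)) (((bit 0) ⊕ (bit 1)) ⊕ (# (L1 ⧺ 2 ▹ L0))) [])

-- If x is adjacent to a, b and z to the successors of a, b on a cycle, then both can be absorbed
-- by reversing one of the two arcs between a and b.
cross : ∀ {e u v} C → Walk e u C v → e v u ≡ true → ∀ x z → SymR e →
  2 ≤ pcnt (λ a b → e x a ∧ e z b) C u → CycleOn e (λ p → b2n (p x) + b2n (p z) + cnt p C)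
cross {e} {u} C W cl x z sy h with pcnt-first _ C u (≤-trans (s≤s z≤n) h)
... | X , a , Y , refl , q , c with pcnt-first _ Y u (s≤s⁻¹ (subst (2 ≤_) c h))
... | Y1 , b , Z , refl , q' , _ with ∧-true q | ∧-true q'
... | xa , zσ | xb , zτ = cycle (x ∷ reverse R ++ z ∷ Y1 ++ b ∷ []) W₁ (trans (sy b x) xb)
  λ p → (lin≡ (env p (x ∷ z ∷ b ∷ a ∷ []) (R ∷ Y1 ∷ X ∷ Z ∷ []) []) 1 (# (0 ▹ (rev L0) ⧺ 1 ▹ L1 ⧺ 2 ▹ nil)) (((bit 0) ⊕ (bit 1)) ⊕ (# (L2 ⧺ 3 ▹ L1 ⧺ 2 ▹ L3))) (≡! (# L0) (# (L3 ⧺ L2 ⧺ 3 ▹ nil)) (refl {x = cnt p R}) ∷ []))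
  where
  R = Z ++ X ++ a ∷ []
  rotated = rot X a (Y1 ++ b ∷ Z) W cl
  σ = hd (Y1 ++ b ∷ Z) u
  cutb = wcut Y1 b R (subst (λ l → Walk e σ l a) (++-assoc Y1 (b ∷ Z) (X ++ a ∷ [])) (proj₁ rotated))
  -- The first vertex of `R` is the successor of b. If b ends the list, this is the start of the
  -- cycle, which then opens `X ++ a ∷ []`.
  hdR : hd R u ≡ hd Z u
  hdR = lemma Z
    where
    hd-++ : ∀ X ys → hd (X ++ a ∷ []) u ≡ hd (X ++ a ∷ ys) u
    hd-++ [] ys = refl
    hd-++ (_ ∷ _) ys = refl
    lemma : ∀ Z → hd (Z ++ X ++ a ∷ []) u ≡ hd Z u
    lemma [] = trans (hd-++ X (Y1 ++ b ∷ _)) (whd u W)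
    lemma (_ ∷ _) = refl
  tl = wtail R u (lin (lists (a ∷ []) (R ∷ Z ∷ X ∷ []) []) 1 (` 1) (∥ L0) (≡˘ (∥ (L1 ⧺ L2 ⧺ 0 ▹ nil)) (∥ L0) (refl {x = length R}) ∷ [])) (proj₂ cutb)
  W₁ : Walk e x (x ∷ reverse R ++ z ∷ Y1 ++ b ∷ []) b
  W₁ = xa ◂ join (wrev sy (proj₂ tl)) (trans (sy (hd R u) z) (subst (λ t → e z t ≡ true) (sym hdR) zτ)) (zσ ◂ proj₁ cutb)

-- Jackson's lemma on cycles through one side of a bipartite graph

sumL : ∀ {A : Set} → (A → ℕ) → List A → ℕ
sumL f [] = 0
sumL f (x ∷ xs) = f x + sumL f xs

sumL-0 : ∀ {A : Set} (xs : List A) → sumL (λ _ → 0) xs ≡ 0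
sumL-0 [] = refl
sumL-0 (x ∷ xs) = sumL-0 xs

sumL-+ : ∀ {A : Set} (f g : A → ℕ) xs → sumL (λ x → f x + g x) xs ≡ sumL f xs + sumL g xs
sumL-+ f g [] = refl
sumL-+ f g (x ∷ xs) = trans (cong (f x + g x +_) (sumL-+ f g xs)) (swap4 (f x) (g x) _ _)

sumL-cnt : ∀ {A : Set} (p : A → Bool) xs → sumL (λ x → b2n (p x)) xs ≡ cnt p xs
sumL-cnt p [] = refl
sumL-cnt p (x ∷ xs) = cong (b2n (p x) +_) (sumL-cnt p xs)

sumL-≤ : ∀ (f : ℕ → ℕ) xs → (∀ v → v ∈ xs → f v ≤ 1) → sumL f xs ≤ length xs
sumL-≤ f [] h = z≤n
sumL-≤ f (x ∷ xs) h = +-mono-≤ (h x (∈-here x xs)) (sumL-≤ f xs (λ v m → h v (∈-there v x xs m)))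

sumL-≥ : ∀ (f : ℕ → ℕ) k c xs → (∀ v → v ∈ xs → k ≤ f v + c) → length xs * k ≤ sumL f xs + length xs * c
sumL-≥ f k c [] h = z≤n
sumL-≥ f k c (x ∷ xs) h = (lin (nums (k ∷ (length xs * k) ∷ (f x) ∷ (sumL f xs) ∷ c ∷ (length xs * c) ∷ [])) 1 (x0 ⊕ x1) ((x2 ⊕ x3) ⊕ (x4 ⊕ x5)) (≤! x0 (x2 ⊕ x4) (h x (∈-here x xs)) ∷ ≤! x1 (x3 ⊕ x5) (sumL-≥ f k c xs (λ v m → h v (∈-there v x xs m))) ∷ []))

double-count : ∀ (e : Rel) xs ys → sumL (λ x → cnt (e x) ys) xs ≡ sumL (λ y → cnt (λ x → e x y) xs) ys
double-count e xs [] = sumL-0 xs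
double-count e xs (y ∷ ys) = trans (sumL-+ (λ x → b2n (e x y)) (λ x → cnt (e x) ys) xs)
  (cong₂ _+_ (sumL-cnt (λ x → e x y) xs) (double-count e xs ys))

pick : ∀ q G → 1 ≤ cnt q G → Σ ℕ λ b → Σ (List ℕ) λ R → Split G (b ∷ []) R × (q b ≡ true)
pick q G h with cnt-first q G h
... | X , b , Y , refl , qb , _ = b , X ++ Y , (sp: λ p → (lin≡ (env p (b ∷ []) (X ∷ Y ∷ []) []) 1 (# (L0 ⧺ 0 ▹ L1)) ((# (0 ▹ nil)) ⊕ (# (L0 ⧺ L1))) [])) , qb

wunsnoc : ∀ {e u v} R b → 1 ≤ length R → Walk e u (R ++ b ∷ []) v → Σ ℕ λ a → Walk e u R a × (e a b ≡ true)
wunsnoc (x ∷ []) b _ (h ◂ W) with whd b W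
... | refl = x , [ x ] , h
wunsnoc (x ∷ y ∷ R) b _ (h ◂ W) with wunsnoc (y ∷ R) b (s≤s z≤n) W
... | a , W' , ab = a , (h ◂ W') , ab

search : ∀ (q : ℕ → Bool) xs → (Σ ℕ λ v → (v ∈ xs) × (q v ≡ true)) ⊎ (∀ v → v ∈ xs → q v ≡ false)
search q xs with cnt q xs in c
... | zero = inj₂ (cnt-zero q xs c)
... | suc k = inj₁ (cnt-wit q xs (subst (1 ≤_) (sym c) (s≤s z≤n)))

≤ᵇ-true : ∀ {m n} → (m ≤ᵇ n) ≡ true → m ≤ n
≤ᵇ-true {m} {n} h = ≤ᵇ⇒≤ m n (subst T (sym h) tt)

≤ᵇ-false : ∀ {m n} → (m ≤ᵇ n) ≡ false → n < m
≤ᵇ-false {m} {n} h = ≰⇒> (λ le → subst T h (≤⇒≤ᵇ le))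

∈-remove : ∀ v xs → v ∈ xs → Σ (List ℕ) λ R → Split xs (v ∷ []) R
∈-remove v xs m with ∈-split v xs m
... | X , Y , refl = X ++ Y , sp: λ p → (lin≡ (env p (v ∷ []) (X ∷ Y ∷ []) []) 1 (# (L0 ⧺ 0 ▹ L1)) ((# (0 ▹ nil)) ⊕ (# (L0 ⧺ L1))) [])

succs-adj : ∀ {e u v} p C → Walk e u C v → e v u ≡ true → ∀ y → y ∈ succs p C u →
  Σ ℕ λ x → (p x ≡ true) × (e x y ≡ true)
succs-adj {e} {u₀} p C W cl y m = go C u₀ W cl m
  where
  go : ∀ {u v} C w → Walk e u C v → e v w ≡ true → y ∈ succs p C w → Σ ℕ λ x → (p x ≡ true) × (e x y ≡ true)
  go (x ∷ []) w [ x ] cl m with p x in eq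
  ... | true with ∈-∷⁻ y w [] m
  ... | inj₁ refl = x , eq , cl
  go (x ∷ C) w (h ◂ W) cl m with p x in eq
  ... | false = go C w W cl m
  ... | true with ∈-∷⁻ y (hd C w) (succs p C w) m
  ... | inj₂ m' = go C w W cl m'
  ... | inj₁ refl = x , eq , subst (λ z → e x z ≡ true) (sym (whd w W)) h

Bip : Rel → (ℕ → Bool) → Set
Bip e side = ∀ x y → e x y ≡ true → side x ≡ not (side y)

-- The cycle absorbs the vertices of `A` one at a time, each together with a vertex of `B`. If the
-- next vertex a cannot be absorbed, then a and the successors of its neighbours on the cycle have
-- pairwise disjoint neighbourhoods among the free vertices of `B`, and these would need one vertex
-- more than |B| ≤ 2k - 2 provides.
module Jackson (e : Rel) (sy : SymR e) (side : ℕ → Bool) (bip : Bip e side) (A B : List ℕ)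
  (inA : ∀ v → v ∈ A → side v ≡ true) (inB : ∀ v → v ∈ B → side v ≡ false)
  (k : ℕ) (deg : ∀ a → a ∈ A → k ≤ cnt (e a) B) (hB : length B + 2 ≤ 2 * k) (hA : length A ≤ k) where

  record Stage (p : ℕ) (Ar : List ℕ) : Set where
    constructor stage
    field
      {u v} : ℕ
      C As Bs Br : List ℕ
      W : Walk e u C v
      cl : e v u ≡ true
      sA : Split A As Ar
      sB : Split B Bs Br
      sC : Split C As Bs
      lA : length As ≡ p
      lB : length Bs ≡ p

  side-∈A : ∀ {C As Ar Bs Br} → Split A As Ar → Split B Bs Br → Split C As Bs → ∀ v → v ∈ C → side v ≡ true → v ∈ A
  side-∈A sA sB sC v m sv with split-∈ sC v m
  ... | inj₁ a = ∈-⊑ v (splitˡ sA) a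
  ... | inj₂ b = ⊥-elim (t≢f sv (inB v (∈-⊑ v (splitˡ sB) b)))

  offdeg : ∀ {p Bs Br} → Split B Bs Br → length Bs ≡ p → ∀ a → a ∈ A → k ≤ cnt (e a) Br + p
  offdeg {p} {Bs} {Br} sB lB a m = (lin (env (e a) [] (Br ∷ B ∷ Bs ∷ []) (k ∷ p ∷ [])) 1 x0 ((# L0) ⊕ x1) (≤! x0 (# L1) (deg a m) ∷ ≡! (# L1) ((# L2) ⊕ (# L0)) (spl sB (e a)) ∷ ≤! (# L2) (∥ L2) (cnt-≤ (e a) Bs) ∷ ≡! (∥ L2) x1 lB ∷ []))

  noA : ∀ {As Ar} → Split A As Ar → ∀ a → side a ≡ true → cnt (e a) As ≡ 0
  noA {As} {Ar} sA a sa = none⇒zero (e a) As λ v m h →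
    t≢f sa (trans (bip a v h) (cong not (inA v (∈-⊑ v (splitˡ sA) m))))

  absorb : ∀ {p a Ar} (S : Stage p (a ∷ Ar)) b Br' → Split (Stage.Br S) (b ∷ []) Br' →
    CycleOn e (λ q → b2n (q a) + b2n (q b) + cnt q (Stage.C S)) → Stage (suc p) Ar
  absorb {p} {a} {Ar} (stage C As Bs Br W cl sA sB sC lA lB) b Br' sb (cycle C' W' cl' count) =
    stage C' (a ∷ As) (b ∷ Bs) Br' W' cl'
      (sp: λ q → (lin≡ (env q (a ∷ []) (A ∷ As ∷ Ar ∷ []) []) 1 (# L0) ((# (0 ▹ L1)) ⊕ (# L2)) (≡! (# L0) ((# L1) ⊕ (# (0 ▹ L2))) (spl sA q) ∷ [])))
      (sp: λ q → (lin≡ (env q (b ∷ []) (B ∷ Bs ∷ Br' ∷ Br ∷ []) []) 1 (# L0) ((# (0 ▹ L1)) ⊕ (# L2)) (≡! (# L0) ((# L1) ⊕ (# L3)) (spl sB q) ∷ ≡! (# L3) ((# (0 ▹ nil)) ⊕ (# L2)) (spl sb q) ∷ [])))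
      (sp: λ q → (lin≡ (env q (a ∷ b ∷ []) (C' ∷ As ∷ Bs ∷ C ∷ []) []) 1 (# L0) ((# (0 ▹ L1)) ⊕ (# (1 ▹ L2))) (≡! (# L0) (((bit 0) ⊕ (bit 1)) ⊕ (# L3)) (count q) ∷ ≡! (# L3) ((# L1) ⊕ (# L2)) (spl sC q) ∷ [])))
      (cong suc lA) (cong suc lB)

  grow : ∀ {p a Ar} → 1 ≤ p → Stage p (a ∷ Ar) → Stage (suc p) Ar
  grow {p} {a} {Ar} 1≤p S@(stage {u} C As Bs Br W cl sA sB sC lA lB) = go
    where
    aA : a ∈ A
    aA = ∈-⊑ a (splitʳ sA) (∈-here a Ar)
    sa = inA a aA
    p<k : suc p ≤ k
    p<k = (lin (lists (a ∷ []) (A ∷ As ∷ Ar ∷ []) (p ∷ k ∷ [])) 1 (1+ x0) x1 (≤! (∥ L0) x1 hA ∷ ≡˘ ((∥ L1) ⊕ (∥ (0 ▹ L2))) (∥ L0) (split-len A As (a ∷ Ar) sA) ∷ ≡˘ x0 (∥ L1) lA ∷ []))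
    lBr : length Br + p + 2 ≤ 2 * k
    lBr = (lin (lists [] (Br ∷ B ∷ Bs ∷ []) (p ∷ k ∷ [])) 1 (((∥ L0) ⊕ x0) ⊕ (` 2)) (2 ⊛ x1) (≤! ((∥ L1) ⊕ (` 2)) (2 ⊛ x1) hB ∷ ≡˘ ((∥ L2) ⊕ (∥ L0)) (∥ L1) (split-len B Bs Br sB) ∷ ≡˘ x0 (∥ L2) lB ∷ []))
    t = cnt (e a) C
    t≡ : t ≡ cnt (e a) Bs
    t≡ = trans (spl sC (e a)) (cong (_+ cnt (e a) Bs) (noA sA a sa))
    Sc = succs (e a) C u
    -- If f b ≥ 2, then a and b can be absorbed: either b is adjacent to a and to a successor of a
    -- neighbour of a (`insertPair`), or b is adjacent to two such successors (`cross`).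
    f : ℕ → ℕ
    f b = b2n (e a b) + cnt (e b) Sc
    -- Inclusion and exclusion inside `Br`: the two neighbourhoods have at least k and k - p
    -- vertices there, while |Br| ≤ 2k - 2 - p.
    common : ∀ a' → a' ∈ A → k ≤ cnt (e a) Br → 2 ≤ cnt (λ x → e a x ∧ e a' x) Br
    common a' m h = (lin (env (λ x → e a x ∧ e a' x) [] (Br ∷ []) (k ∷ (cnt (e a) Br) ∷ (cnt (e a') Br) ∷ p ∷ (cnt (λ x → e a x ∨ e a' x) Br) ∷ [])) 1 (` 2) (# L0) (≤! x0 x1 h ∷ ≤! x0 (x2 ⊕ x3) (offdeg sB lB a' m) ∷ ≤! (((∥ L0) ⊕ x3) ⊕ (` 2)) (2 ⊛ x0) lBr ∷ ≡! (x1 ⊕ x2) (x4 ⊕ (# L0)) (cnt-∨∧ (e a) (e a') Br) ∷ ≤! x4 (∥ L0) (cnt-≤ (λ x → e a x ∨ e a' x) Br) ∷ []))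
    go : Stage (suc p) Ar
    go with t in teq
    go | zero = isolated Bs refl
      where
      k≤ : k ≤ cnt (e a) Br
      k≤ = (lin (env (e a) [] (Br ∷ B ∷ Bs ∷ []) (k ∷ t ∷ [])) 1 x0 (# L0) (≤! x0 (# L1) (deg a aA) ∷ ≡! (# L1) ((# L2) ⊕ (# L0)) (spl sB (e a)) ∷ ≡˘ (# L2) x1 t≡ ∷ ≡! x1 (` 0) teq ∷ []))
      -- All k neighbours of a are off the cycle. A vertex b₁ of `B` on the cycle is replaced by b',
      -- a, b'', where b' and b'' are common neighbours of a and of the two vertices next to b₁.
      isolated : ∀ Bs' → Bs ≡ Bs' → Stage (suc p) Ar
      isolated [] refl = (⊥-elim (1+n≰n (lin (nums (p ∷ [])) 1 (` 1) (` 0) (≡˘ x0 (` 0) lB ∷ ≤! (` 1) x0 1≤p ∷ []))))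
      isolated (b₁ ∷ Bs') refl = cutAt (∈-split b₁ C (∈-⊑ b₁ (splitʳ sC) (∈-here b₁ Bs')))
        where
        b₁B : side b₁ ≡ false
        b₁B = inB b₁ (∈-⊑ b₁ (splitˡ sB) (∈-here b₁ Bs'))
        cutAt : (Σ (List ℕ) λ X → Σ (List ℕ) λ Y → C ≡ X ++ b₁ ∷ Y) → Stage (suc p) Ar
        cutAt (X , Y , refl) = open-up (wunsnoc R b₁ lR (subst (λ l → Walk e a₂ l b₁) (sym (++-assoc Y X (b₁ ∷ []))) (proj₁ rotated)))
          where
          R = Y ++ X
          a₂ = hd Y u
          rotated = rot X b₁ Y W cl
          lR : 1 ≤ length R
          lR = (lin (lists (b₁ ∷ []) (Y ∷ X ∷ As ∷ Bs ∷ []) (p ∷ [])) 1 (` 1) (∥ (L0 ⧺ L1)) (≡˘ ((∥ L2) ⊕ (∥ L3)) (∥ (L1 ⧺ 0 ▹ L0)) (split-len C As Bs sC) ∷ ≡˘ x0 (∥ L2) lA ∷ 2 ×! ≤! (` 1) x0 1≤p ∷ ≡˘ x0 (∥ L3) lB ∷ []))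
          onA : ∀ x → x ∈ R → e x b₁ ≡ true → x ∈ A
          onA x m h = side-∈A sA sB sC x (lin (env (x ≡ᵇ_) (b₁ ∷ []) (X ∷ Y ∷ []) []) 1 (` 1) (# (L0 ⧺ 0 ▹ L1)) (≤! (` 1) (# (L1 ⧺ L0)) m ∷ [])) (trans (bip x b₁ h) (cong not b₁B))
          open-up : (Σ ℕ λ a₁ → Walk e a₂ R a₁ × (e a₁ b₁ ≡ true)) → Stage (suc p) Ar
          open-up (a₁ , W₂ , h₂) = first (pick (λ x → e a x ∧ e a₁ x) Br (≤-trans (s≤s z≤n) (common a₁ (onA a₁ (w∈ʳ W₂) h₂) k≤)))
            where
            c₂ : 2 ≤ cnt (λ x → e a x ∧ e a₂ x) Br
            c₂ = common a₂ (onA a₂ (w∈ˡ W₂) (trans (sy a₂ b₁) (proj₂ rotated))) k≤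
            first : (Σ ℕ λ b → Σ (List ℕ) λ R → Split Br (b ∷ []) R × (e a b ∧ e a₁ b ≡ true)) → Stage (suc p) Ar
            first (b' , Br₁ , sb , q) = second (pick (λ x → e a x ∧ e a₂ x) Br₁ (lin (env (λ x → e a x ∧ e a₂ x) [] (Br₁ ∷ Br ∷ []) ((b2n (e a b' ∧ e a₂ b')) ∷ [])) 1 (` 1) (# L0) (≤! (` 2) (# L1) c₂ ∷ ≡! (# L1) ((x0 ⊕ (` 0)) ⊕ (# L0)) (spl sb (λ x → e a x ∧ e a₂ x)) ∷ ≤! x0 (` 1) (b2n-≤1 (e a b' ∧ e a₂ b')) ∷ [])))
              where
              second : (Σ ℕ λ b → Σ (List ℕ) λ R → Split Br₁ (b ∷ []) R × (e a b ∧ e a₂ b ≡ true)) → Stage (suc p) Ar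
              second (b'' , Br₂ , sb' , q') = stage (R ++ b' ∷ a ∷ b'' ∷ []) (a ∷ As) (b' ∷ b'' ∷ Bs') (b₁ ∷ Br₂)
                (join W₂ (proj₂ (∧-true q)) (trans (sy b' a) (proj₁ (∧-true q)) ◂ proj₁ (∧-true q') ◂ [ b'' ]))
                (trans (sy b'' a₂) (proj₂ (∧-true q')))
                (sp: λ q → (lin≡ (env q (a ∷ []) (A ∷ As ∷ Ar ∷ []) []) 1 (# L0) ((# (0 ▹ L1)) ⊕ (# L2)) (≡! (# L0) ((# L1) ⊕ (# (0 ▹ L2))) (spl sA q) ∷ [])))
                (sp: λ q → (lin≡ (env q (b' ∷ b'' ∷ b₁ ∷ []) (B ∷ Bs' ∷ Br₂ ∷ Br ∷ Br₁ ∷ []) []) 1 (# L0) ((# (0 ▹ 1 ▹ L1)) ⊕ (# (2 ▹ L2))) (≡! (# L0) ((# (2 ▹ L1)) ⊕ (# L3)) (spl sB q) ∷ ≡! (# L3) ((# (0 ▹ nil)) ⊕ (# L4)) (spl sb q) ∷ ≡! (# L4) ((# (1 ▹ nil)) ⊕ (# L2)) (spl sb' q) ∷ [])))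
                (sp: λ q → (lin≡ (env q (b' ∷ a ∷ b'' ∷ b₁ ∷ []) (Y ∷ X ∷ As ∷ Bs' ∷ []) []) 1 (# ((L0 ⧺ L1) ⧺ 0 ▹ 1 ▹ 2 ▹ nil)) ((# (1 ▹ L2)) ⊕ (# (0 ▹ 2 ▹ L3))) (≡! (# (L1 ⧺ 3 ▹ L0)) ((# L2) ⊕ (# (3 ▹ L3))) (spl sC q) ∷ [])))
                (cong suc lA) (cong suc lB)
    go | suc t' with search (λ b → 2 ≤ᵇ f b) Br
    ... | inj₁ (b , bBr , h) with ∈-remove b Br bBr
    ... | Br' , sb = absorb S b Br' sb absorbed
      where
      pc : cnt (e b) Sc ≡ pcnt (λ x y → e a x ∧ e b y) C u
      pc = cnt-succs (e a) (e b) C u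
      absorbed : CycleOn e (λ q → b2n (q a) + b2n (q b) + cnt q C)
      absorbed with bool (e a b)
      ... | inj₁ ab = insertPair C W cl a b sy ab (lin (nums ((pcnt (λ x y → e a x ∧ e b y) C u) ∷ (cnt (e b) Sc) ∷ (b2n (e a b)) ∷ [])) 1 (` 1) x0 (≡! x1 x0 pc ∷ ≤! (` 2) (x2 ⊕ x1) (≤ᵇ-true {2} h) ∷ ≤! x2 (` 1) (b2n-≤1 (e a b)) ∷ []))
      ... | inj₂ ab = cross C W cl a b sy (lin (nums ((pcnt (λ x y → e a x ∧ e b y) C u) ∷ (cnt (e b) Sc) ∷ (b2n (e a b)) ∷ [])) 1 (` 2) x0 (≡! x1 x0 pc ∷ ≤! (` 2) (x2 ⊕ x1) (≤ᵇ-true {2} h) ∷ ≡! x2 (` 0) (b2n-f ab) ∷ []))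
    go | suc t' | inj₂ small = ⊥-elim contra
      where
      total : cnt (e a) Br + sumL (λ y → cnt (λ b → e b y) Br) Sc ≤ length Br
      total = ≤-trans (≤-reflexive (trans
          (cong₂ _+_ (sym (sumL-cnt (e a) Br)) (sym (double-count e Br Sc)))
          (sym (sumL-+ (λ b → b2n (e a b)) (λ b → cnt (e b) Sc) Br))))
        (sumL-≤ f Br (λ v m → s≤s⁻¹ (≤ᵇ-false {2} (small v m))))
      each : ∀ y → y ∈ Sc → k ≤ cnt (λ b → e b y) Br + p
      each y m with succs-adj (e a) C W cl y m
      ... | x , ax , xy = subst (λ z → k ≤ z + p) (cnt-cong (λ b → sy y b) Br)
        (offdeg sB lB y (side-∈A sA sB sC y (∈-⊑ y (succs-⊑ (e a) W) m)
          (flip (side x) (side y) (trans (sym (cong not sa)) (trans (cong not (bip a x ax)) (nn (side x)))) (bip x y xy))))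
        where
        nn : ∀ b → not (not b) ≡ b
        nn true = refl
        nn false = refl
        flip : ∀ a b → false ≡ a → a ≡ not b → b ≡ true
        flip a true _ _ = refl
        flip true false () _
        flip false false _ ()
      j = k ∸ suc p
      kj : k ≡ suc p + j
      kj = sym (m+[n∸m]≡n p<k)
      tk : suc t' * k ≡ suc t' * p + suc t' + suc t' * j
      tk = trans (cong (suc t' *_) (trans kj (sym (+-suc p j)))) (trans (*-distribˡ-+ (suc t') p (suc j))
        (trans (cong (suc t' * p +_) (*-suc (suc t') j)) (sym (+-assoc (suc t' * p) (suc t') _))))
      big : suc t' * k ≤ sumL (λ y → cnt (λ b → e b y) Br) Sc + suc t' * p
      big = subst (λ l → l * k ≤ sumL (λ y → cnt (λ b → e b y) Br) Sc + l * p) (trans (length-succs (e a) C u) teq)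
        (sumL-≥ (λ y → cnt (λ b → e b y) Br) k p Sc each)
      -- Write k = p + 1 + j and let a have t ≥ 1 neighbours on the cycle. The disjoint
      -- neighbourhoods have together at least (k - t) + t(1 + j) ≥ k + j vertices, but |Br| ≤ 2k -
      -- 2 - p = k + j - 1.
      contra : ⊥
      contra = (⊥-elim (1+n≰n (lin (env (e a) [] (Br ∷ B ∷ Bs ∷ []) ((sumL (λ y → cnt (λ b → e b y) Br) Sc) ∷ (suc t' * k) ∷ (suc t' * p) ∷ t' ∷ (suc t' * j) ∷ j ∷ (t' * j) ∷ k ∷ p ∷ t ∷ [])) 1 (` 1) (` 0) (≤! ((# L0) ⊕ x0) (∥ L0) total ∷ ≤! x1 (x0 ⊕ x2) big ∷ ≡˘ ((x2 ⊕ (1+ x3)) ⊕ x4) x1 tk ∷ ≡˘ (x5 ⊕ x6) x4 (refl {x = suc t' * j}) ∷ ≡! x7 ((1+ x8) ⊕ x5) kj ∷ ≤! (((∥ L0) ⊕ x8) ⊕ (` 2)) (2 ⊛ x7) lBr ∷ ≤! x7 (# L1) (deg a aA) ∷ ≡! (# L1) ((# L2) ⊕ (# L0)) (spl sB (e a)) ∷ ≡˘ (# L2) x9 t≡ ∷ ≡! x9 (1+ x3) teq ∷ []))))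

  start : ∀ a₁ a₂ Ar → A ≡ a₁ ∷ a₂ ∷ Ar → Stage 2 Ar
  start a₁ a₂ Ar refl = go
    where
    q : ℕ → Bool
    q x = e a₁ x ∧ e a₂ x
    c2 : 2 ≤ cnt q B
    c2 = (lin (env q [] (B ∷ []) (k ∷ (cnt (e a₁) B) ∷ (cnt (e a₂) B) ∷ (cnt (λ x → e a₁ x ∨ e a₂ x) B) ∷ [])) 1 (` 2) (# L0) (≤! x0 x1 (deg a₁ (∈-here a₁ (a₂ ∷ Ar))) ∷ ≤! x0 x2 (deg a₂ (∈-there a₂ a₁ (a₂ ∷ Ar) (∈-here a₂ Ar))) ∷ ≡! (x1 ⊕ x2) (x3 ⊕ (# L0)) (cnt-∨∧ (e a₁) (e a₂) B) ∷ ≤! x3 (∥ L0) (cnt-≤ (λ x → e a₁ x ∨ e a₂ x) B) ∷ ≤! ((∥ L0) ⊕ (` 2)) (2 ⊛ x0) hB ∷ []))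
    go : Stage 2 Ar
    go with pick q B (≤-trans (s≤s z≤n) c2)
    ... | b , B₁ , s₁ , q₁ with pick q B₁ (lin (env q (b ∷ []) (B₁ ∷ B ∷ []) []) 1 (` 1) (# L0) (≤! (` 2) (# L1) c2 ∷ ≡! (# L1) ((# (0 ▹ nil)) ⊕ (# L0)) (spl s₁ q) ∷ ≤! (bit 0) (` 1) (b2n-≤1 (q b)) ∷ []))
    ... | b' , B₂ , s₂ , q₂ = stage (a₁ ∷ b ∷ a₂ ∷ b' ∷ []) (a₁ ∷ a₂ ∷ []) (b ∷ b' ∷ []) B₂
      (proj₁ (∧-true q₁) ◂ trans (sy b a₂) (proj₂ (∧-true q₁)) ◂ proj₂ (∧-true q₂) ◂ [ b' ])
      (trans (sy b' a₁) (proj₁ (∧-true q₂)))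
      (sp: λ q → (lin≡ (env q (a₁ ∷ a₂ ∷ []) (Ar ∷ []) []) 1 (# (0 ▹ 1 ▹ L0)) ((# (0 ▹ 1 ▹ nil)) ⊕ (# L0)) []))
      (sp: λ q → (lin≡ (env q (b ∷ b' ∷ []) (B ∷ B₂ ∷ B₁ ∷ []) []) 1 (# L0) ((# (0 ▹ 1 ▹ nil)) ⊕ (# L1)) (≡! (# L0) ((# (0 ▹ nil)) ⊕ (# L2)) (spl s₁ q) ∷ ≡! (# L2) ((# (1 ▹ nil)) ⊕ (# L1)) (spl s₂ q) ∷ [])))
      (sp: λ q → (lin≡ (env q (a₁ ∷ b ∷ a₂ ∷ b' ∷ []) [] []) 1 (# (0 ▹ 1 ▹ 2 ▹ 3 ▹ nil)) ((# (0 ▹ 2 ▹ nil)) ⊕ (# (1 ▹ 3 ▹ nil))) []))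
      refl refl

  finish : ∀ {p} Ar → 1 ≤ p → Stage p Ar → HasCycle e (A ++ B) (2 * length A)
  finish {p} [] _ (stage C As Bs Br W cl sA sB sC lA lB) = cyc C W cl
    (le: λ q → (lin (env q [] (C ∷ A ∷ B ∷ As ∷ Bs ∷ Br ∷ []) []) 1 (# L0) (# (L1 ⧺ L2)) (≡˘ ((# L3) ⊕ (` 0)) (# L1) (spl sA q) ∷ ≡˘ ((# L4) ⊕ (# L5)) (# L2) (spl sB q) ∷ ≡! (# L0) ((# L3) ⊕ (# L4)) (spl sC q) ∷ [])))
    (lin≡ (lists [] (C ∷ A ∷ As ∷ Bs ∷ []) (p ∷ [])) 1 (∥ L0) (2 ⊛ (∥ L1)) (≡! (∥ L0) ((∥ L2) ⊕ (∥ L3)) (split-len C As Bs sC) ∷ 2 ×! ≡˘ ((∥ L2) ⊕ (` 0)) (∥ L1) (split-len A As [] sA) ∷ ≡˘ x0 (∥ L2) lA ∷ ≡! (∥ L3) x0 lB ∷ []))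
  finish (a ∷ Ar) h S = finish Ar (s≤s z≤n) (grow h S)

  jackson : 2 ≤ length A → HasCycle e (A ++ B) (2 * length A)
  jackson h = go A refl h
    where
    go : ∀ A' → A ≡ A' → 2 ≤ length A' → HasCycle e (A ++ B) (2 * length A)
    go (a₁ ∷ a₂ ∷ Ar) eq _ = finish Ar (s≤s z≤n) (start a₁ a₂ Ar eq)
    go (a₁ ∷ []) eq (s≤s ())

-- Even cycle versus even cycle: R(C_{2m}, C_{2n}) ≤ 2n + m + K

co : Rel → Rel
co e x y = not (e x y)

co-sym : ∀ {e} → SymR e → SymR (co e)
co-sym sy x y = cong not (sy x y)

not-true : ∀ {b} → not b ≡ true → b ≡ false
not-true {false} _ = refl

takeSplit : ∀ m xs → m ≤ length xs → Σ (List ℕ) λ A → Σ (List ℕ) λ R → Split xs A R × length A ≡ m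
takeSplit zero xs _ = [] , xs , sp: (λ p → refl) , refl
takeSplit (suc m) (x ∷ xs) (s≤s h) =
  let A , R , S , l = takeSplit m xs h
  in x ∷ A , R , sp: (λ p → (lin≡ (env p (x ∷ []) (xs ∷ A ∷ R ∷ []) []) 1 (# (0 ▹ L0)) ((# (0 ▹ L1)) ⊕ (# L2)) (≡! (# L0) ((# L1) ⊕ (# L2)) (spl S p) ∷ []))) , cong suc l

-- The pair must lie below `Y` as a multiset, so no loop is demanded at a vertex that occurs once.
Clique : Rel → List ℕ → Set
Clique e Y = ∀ x y → (x ∷ y ∷ []) ⊑ Y → e x y ≡ true

all-∈ : ∀ {P : ℕ → Set} {xs} → All P xs → ∀ v → v ∈ xs → P v
all-∈ {xs = x ∷ xs} (p ∷ ps) v m with ∈-∷⁻ v x xs m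
... | inj₁ refl = p
... | inj₂ k = all-∈ ps v k

allPairs⇒clique : ∀ {e} Y → SymR e → AllPairs (λ x y → e x y ≡ true) Y → Clique e Y
allPairs⇒clique [] sy _ x y h with ⊑at h (λ _ → true)
... | ()
allPairs⇒clique {e} (z ∷ Y) sy (hz ∷ hs) x y h with bool (x ≡ᵇ z)
... | inj₁ xz with ==-true {x} xz
... | refl = all-∈ hz y (lin (env (y ≡ᵇ_) (x ∷ y ∷ []) (Y ∷ []) []) 1 (` 1) (# L0) (≤! (# (0 ▹ 1 ▹ nil)) (# (0 ▹ L0)) (⊑at h (y ≡ᵇ_)) ∷ ≡˘ (` 1) (bit 1) (b2n-t (==-refl y)) ∷ []))
allPairs⇒clique {e} (z ∷ Y) sy (hz ∷ hs) x y h | inj₂ xz with bool (y ≡ᵇ z)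
... | inj₁ yz with ==-true {y} yz
... | refl = trans (sy x y) (all-∈ hz x (lin (env (x ≡ᵇ_) (x ∷ y ∷ []) (Y ∷ []) []) 1 (` 1) (# L0) (≤! (# (0 ▹ 1 ▹ nil)) (# (1 ▹ L0)) (⊑at h (x ≡ᵇ_)) ∷ ≡˘ (` 1) (bit 0) (b2n-t (==-refl x)) ∷ [])))
allPairs⇒clique {e} (z ∷ Y) sy (hz ∷ hs) x y h | inj₂ xz | inj₂ yz = allPairs⇒clique Y sy hs x y (occ⇒⊑ (x ∷ y ∷ []) Y go)
  where
  ≢ : ∀ {a b} → (a ≡ᵇ b) ≡ false → (b ≡ᵇ a) ≡ false
  ≢ {a} {b} q with b ≡ᵇ a in eq
  ... | false = refl
  ... | true = ⊥-elim (t≢f (trans (cong (_≡ᵇ b) (sym (==-true {b} {a} eq))) (==-refl b)) q)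
  go : ∀ v → occ v (x ∷ y ∷ []) ≤ occ v Y
  go v with v ≡ᵇ z in eq
  ... | false = subst (λ b → occ v (x ∷ y ∷ []) ≤ b2n b + occ v Y) eq (⊑at h (v ≡ᵇ_))
  ... | true with ==-true {v} {z} eq
  ... | refl rewrite ≢ {x} xz | ≢ {y} yz = z≤n

cliqueWalk : ∀ {e Y} → Clique e Y → ∀ x xs y → (x ∷ xs ++ y ∷ []) ⊑ Y → Walk e x (x ∷ xs ++ y ∷ []) y
cliqueWalk {e} {Y} c x [] y h = c x y h ◂ [ y ]
cliqueWalk {e} {Y} c x (z ∷ xs) y h =
  c x z (le: λ p → (lin (env p (x ∷ z ∷ y ∷ []) (Y ∷ xs ∷ []) []) 1 (# (0 ▹ 1 ▹ nil)) (# L0) (≤! (# (0 ▹ 1 ▹ L1 ⧺ 2 ▹ nil)) (# L0) (⊑at h p) ∷ [])))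
  ◂ cliqueWalk c z xs y (le: λ p → ≤-trans (m≤n+m _ (b2n (p x))) (⊑at h p))

cliqueCycle : ∀ {e Y} ℓ → SymR e → Clique e Y → 2 + ℓ ≤ length Y → HasCycle e Y (2 + ℓ)
cliqueCycle {e} {Y} ℓ sy c h = go (takeSplit (2 + ℓ) Y h)
  where
  go : (Σ (List ℕ) λ A → Σ (List ℕ) λ R → Split Y A R × length A ≡ 2 + ℓ) → HasCycle e Y (2 + ℓ)
  go (x ∷ y ∷ A , R , S , l) = cyc (x ∷ A ++ y ∷ []) (cliqueWalk c x A y sb)
    (c y x (le: λ p → (lin (env p (y ∷ x ∷ []) (Y ∷ A ∷ []) []) 1 (# (0 ▹ 1 ▹ nil)) (# L0) (≤! (# (1 ▹ L1 ⧺ 0 ▹ nil)) (# L0) (⊑at sb p) ∷ [])))) sb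
    (lin≡ (lists (x ∷ y ∷ []) (A ∷ []) (ℓ ∷ [])) 1 (∥ (0 ▹ L0 ⧺ 1 ▹ nil)) ((` 2) ⊕ x0) (≡! (∥ (0 ▹ 1 ▹ L0)) ((` 2) ⊕ x0) l ∷ []))
    where
    sb : (x ∷ A ++ y ∷ []) ⊑ Y
    sb = le: λ p → (lin (env p (x ∷ y ∷ []) (A ∷ Y ∷ R ∷ []) []) 1 (# (0 ▹ L0 ⧺ 1 ▹ nil)) (# L1) (≡˘ ((# (0 ▹ 1 ▹ L0)) ⊕ (# L2)) (# L1) (spl S p) ∷ []))

ramsey : ∀ e s t U → 2 ^ (s + t) ≤ length U →
  (Σ (List ℕ) λ Q → Q ⊑ U × length Q ≡ s × AllPairs (λ x y → e x y ≡ true) Q) ⊎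
  (Σ (List ℕ) λ Q → Q ⊑ U × length Q ≡ t × AllPairs (λ x y → co e x y ≡ true) Q)
ramsey e zero t U h = inj₁ ([] , le: (λ p → z≤n) , refl , [])
ramsey e (suc s) zero U h = inj₂ ([] , le: (λ p → z≤n) , refl , [])
ramsey e (suc s) (suc t) [] h = ⊥-elim (n≮0 (≤-trans (m^n>0 2 (suc s + suc t)) h))
ramsey e (suc s) (suc t) (x ∷ U) h = go (≤-total (2 ^ (s + suc t)) (length red))
  where
  red = filt (e x) U
  blue = filt (co e x) U
  Goal = (Σ (List ℕ) λ Q → Q ⊑ (x ∷ U) × length Q ≡ suc s × AllPairs (λ x y → e x y ≡ true) Q) ⊎
    (Σ (List ℕ) λ Q → Q ⊑ (x ∷ U) × length Q ≡ suc t × AllPairs (λ x y → co e x y ≡ true) Q)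
  filt-all : ∀ (q : ℕ → Bool) V → All (λ y → q y ≡ true) (filt q V)
  filt-all q [] = []
  filt-all q (v ∷ V) with q v in eq
  ... | true = eq ∷ filt-all q V
  ... | false = filt-all q V
  all-⊑ : ∀ {P : ℕ → Set} Q {V} → Q ⊑ V → All P V → All P Q
  all-⊑ [] h a = []
  all-⊑ (q ∷ Q) h a = all-∈ a q (∈-⊑ q h (∈-here q Q)) ∷ all-⊑ Q (le: λ p → ≤-trans (m≤n+m _ _) (⊑at h p)) a
  filt-⊑ : ∀ q V → filt q V ⊑ V
  filt-⊑ q V = le: λ p → ≤-trans (≤-reflexive (cnt-filt q p V)) (cnt-imp (λ y → q y ∧ p y) p V (λ v _ k → proj₂ (∧-true k)))
  cons-⊑ : ∀ {Q V} → Q ⊑ V → (x ∷ Q) ⊑ (x ∷ V)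
  cons-⊑ h = le: λ p → +-monoʳ-≤ (b2n (p x)) (⊑at h p)
  there : ∀ {Q V} → Q ⊑ V → Q ⊑ (x ∷ V)
  there h = le: λ p → ≤-trans (⊑at h p) (m≤n+m _ _)
  fin : (Σ (List ℕ) λ Q → Q ⊑ red × length Q ≡ s × AllPairs (λ x y → e x y ≡ true) Q) ⊎
    (Σ (List ℕ) λ Q → Q ⊑ red × length Q ≡ suc t × AllPairs (λ x y → co e x y ≡ true) Q) → Goal
  fin (inj₁ (Q , h , l , c)) = inj₁ (x ∷ Q , cons-⊑ (⊑-trans h (filt-⊑ (e x) U)) , cong suc l , all-⊑ Q h (filt-all (e x) U) ∷ c)
  fin (inj₂ (Q , h , l , c)) = inj₂ (Q , there (⊑-trans h (filt-⊑ (e x) U)) , l , c)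
  fin' : (Σ (List ℕ) λ Q → Q ⊑ blue × length Q ≡ suc s × AllPairs (λ x y → e x y ≡ true) Q) ⊎
    (Σ (List ℕ) λ Q → Q ⊑ blue × length Q ≡ t × AllPairs (λ x y → co e x y ≡ true) Q) → Goal
  fin' (inj₁ (Q , h , l , c)) = inj₁ (Q , there (⊑-trans h (filt-⊑ (co e x) U)) , l , c)
  fin' (inj₂ (Q , h , l , c)) = inj₂ (x ∷ Q , cons-⊑ (⊑-trans h (filt-⊑ (co e x) U)) , cong suc l , all-⊑ Q h (filt-all (co e x) U) ∷ c)
  go : (2 ^ (s + suc t) ≤ length red) ⊎ (length red ≤ 2 ^ (s + suc t)) → Goal
  go (inj₁ k) = fin (ramsey e s (suc t) red k)
  go (inj₂ k) with m≤n⇒m<n∨m≡n k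
  ... | inj₂ k' = fin (ramsey e s (suc t) red (≤-reflexive (sym k')))
  ... | inj₁ k' = fin' (ramsey e (suc s) t blue (subst (λ z → 2 ^ z ≤ length blue) (+-suc s t)
      (lin (env (e x) [] (blue ∷ red ∷ U ∷ []) ((2 ^ (s + suc t)) ∷ (cnt (co e x) U) ∷ [])) 1 x0 (∥ L0) (≤! (1+ (∥ L1)) x0 k' ∷ ≤! (2 ⊛ x0) (1+ (∥ L2)) h ∷ ≡˘ (# L2) (∥ L1) (length-filt (e x) U) ∷ ≡˘ x1 (∥ L0) (length-filt (co e x) U) ∷ ≡˘ (∥ L2) ((# L2) ⊕ x1) (cnt-not (e x) U) ∷ []))))

-- Cycles threaded through a nearly complete bipartite graph

record Seg (e : Rel) : Set where
  constructor seg
  field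
    {a b} : ℕ
    L : List ℕ
    W : Walk e a L b

flatten : ∀ {e} → List (Seg e) → List ℕ
flatten [] = []
flatten (S ∷ Ss) = Seg.L S ++ flatten Ss

-- The ends of the segments have at most one non-neighbour in `F`, so any two of them have a common
-- neighbour among three free vertices of `F`. Each segment consumes one vertex of `F`; a cycle
-- through s segments thus asks for |F| ≥ s + 2.
module Thread (e : Rel) (sy : SymR e) where

  Good : List ℕ → Seg e → Set
  Good F S = (cnt (co e (Seg.a S)) F ≤ 1) × (cnt (co e (Seg.b S)) F ≤ 1)

  common : ∀ x y F → cnt (co e x) F ≤ 1 → cnt (co e y) F ≤ 1 → 3 ≤ length F → 1 ≤ cnt (λ z → e x z ∧ e y z) F
  common x y F hx hy h = (lin (env (λ z → e x z ∧ e y z) [] (F ∷ []) ((cnt (co e x) F) ∷ (cnt (co e y) F) ∷ (cnt (e x) F) ∷ (cnt (e y) F) ∷ (cnt (λ z → e x z ∨ e y z) F) ∷ [])) 1 (` 1) (# L0) (≤! x0 (` 1) hx ∷ ≤! x1 (` 1) hy ∷ ≤! (` 3) (∥ L0) h ∷ ≡˘ (∥ L0) (x2 ⊕ x0) (cnt-not (e x) F) ∷ ≡˘ (∥ L0) (x3 ⊕ x1) (cnt-not (e y) F) ∷ ≡! (x2 ⊕ x3) (x4 ⊕ (# L0)) (cnt-∨∧ (e x) (e y) F) ∷ ≤! x4 (∥ L0) (cnt-≤ (λ z → e x z ∨ e y z) F) ∷ []))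

  record Path (a : ℕ) (F fl : List ℕ) (n : ℕ) : Set where
    constructor path
    field
      {b} : ℕ
      L used R : List ℕ
      W : Walk e a L b
      gb : cnt (co e b) R ≤ 1
      sF : Split F used R
      sL : Split L fl used
      lu : length used ≡ n

  thread : ∀ (S : Seg e) Ss F → Good F S → All (Good F) Ss → length Ss + 3 ≤ length F →
    Path (Seg.a S) F (flatten (S ∷ Ss)) (length Ss)
  thread (seg {a} {b} L W) [] F (_ , gb) _ h = path L [] F W gb (sp: λ p → refl)
    (sp: λ p → (lin≡ (env p [] (L ∷ []) []) 1 (# L0) ((# (L0 ⧺ nil)) ⊕ (` 0)) [])) refl
  thread (seg {a} {b} L W) (S' ∷ Ss) F (ga , gb) (gS ∷ gSs) h =
    join1 (pick (λ z → e b z ∧ e (Seg.a S') z) F (common b (Seg.a S') F gb (proj₁ gS) (≤-trans (m≤n+m 3 (suc (length Ss))) h)))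
    where
    join1 : (Σ ℕ λ f → Σ (List ℕ) λ R → Split F (f ∷ []) R × (e b f ∧ e (Seg.a S') f ≡ true)) → Path a F (L ++ flatten (S' ∷ Ss)) (suc (length Ss))
    join1 (f , F' , sf , q) = fin (thread S' Ss F' (sh {S'} gS) (shs gSs) lF')
      where
      F'⊑ : F' ⊑ F
      F'⊑ = splitʳ sf
      lF' : length Ss + 3 ≤ length F'
      lF' = (lin (lists [] (F' ∷ F ∷ []) ((length Ss) ∷ [])) 1 (x0 ⊕ (` 3)) (∥ L0) (≤! ((1+ x0) ⊕ (` 3)) (∥ L1) h ∷ ≡! (∥ L1) ((` 1) ⊕ (∥ L0)) (split-len F (f ∷ []) F' sf) ∷ []))
      sh : ∀ {S} → Good F S → Good F' S
      sh {S} (x , y) = ≤-trans (⊑at F'⊑ (co e (Seg.a S))) x , ≤-trans (⊑at F'⊑ (co e (Seg.b S))) y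
      shs : ∀ {Ss} → All (Good F) Ss → All (Good F') Ss
      shs [] = []
      shs {S ∷ _} (g ∷ gs) = sh {S} g ∷ shs gs
      fin : Path (Seg.a S') F' (flatten (S' ∷ Ss)) (length Ss) → Path a F (L ++ flatten (S' ∷ Ss)) (suc (length Ss))
      fin (path {b'} L' used R W' gb' sF sL lu) = path (L ++ f ∷ L') (f ∷ used) R
        (join W (proj₁ (∧-true q)) (trans (sy f _) (proj₂ (∧-true q)) ◂ W')) gb'
        (sp: λ p → (lin≡ (env p (f ∷ []) (F ∷ used ∷ R ∷ F' ∷ []) []) 1 (# L0) ((# (0 ▹ L1)) ⊕ (# L2)) (≡! (# L0) ((# (0 ▹ nil)) ⊕ (# L3)) (spl sf p) ∷ ≡! (# L3) ((# L1) ⊕ (# L2)) (spl sF p) ∷ [])))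
        (sp: λ p → (lin≡ (env p (f ∷ []) (L ∷ L' ∷ (flatten (S' ∷ Ss)) ∷ used ∷ []) []) 1 (# (L0 ⧺ 0 ▹ L1)) ((# (L0 ⧺ L2)) ⊕ (# (0 ▹ L3))) (≡! (# L1) ((# L2) ⊕ (# L3)) (spl sL p) ∷ [])))
        (cong suc lu)

  threadCycle : ∀ S Ss F → Good F S → All (Good F) Ss → length Ss + 3 ≤ length F → ∀ ℓ → ℓ ≡ length (flatten (S ∷ Ss)) + suc (length Ss) →
    HasCycle e (flatten (S ∷ Ss) ++ F) ℓ
  threadCycle S Ss F gS gSs h ℓ eℓ = go (thread S Ss F gS gSs h)
    where
    fl = flatten (S ∷ Ss)
    go : Path (Seg.a S) F fl (length Ss) → HasCycle e (fl ++ F) ℓ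
    go (path {b} L used R W gb sF sL lu) = close (pick (λ z → e b z ∧ e (Seg.a S) z) R
        (common b (Seg.a S) R gb (≤-trans (⊑at (splitʳ sF) _) (proj₁ gS)) lR))
      where
      lR : 3 ≤ length R
      lR = (lin (lists [] (R ∷ F ∷ used ∷ []) ((length Ss) ∷ [])) 1 (` 3) (∥ L0) (≡! (∥ L1) ((∥ L2) ⊕ (∥ L0)) (split-len F used R sF) ∷ ≡! (∥ L2) x0 lu ∷ ≤! (x0 ⊕ (` 3)) (∥ L1) h ∷ []))
      close : (Σ ℕ λ f → Σ (List ℕ) λ R' → Split R (f ∷ []) R' × (e b f ∧ e (Seg.a S) f ≡ true)) → HasCycle e (fl ++ F) ℓ
      close (f , R' , sf , q) = cyc (L ++ f ∷ []) (join W (proj₁ (∧-true q)) [ f ]) (trans (sy f _) (proj₂ (∧-true q)))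
        (le: λ p → (lin (env p (f ∷ []) (L ∷ fl ∷ F ∷ used ∷ R ∷ R' ∷ []) []) 1 (# (L0 ⧺ 0 ▹ nil)) (# (L1 ⧺ L2)) (≡˘ ((# L3) ⊕ (# L4)) (# L2) (spl sF p) ∷ ≡! (# L0) ((# L1) ⊕ (# L3)) (spl sL p) ∷ ≡˘ ((# (0 ▹ nil)) ⊕ (# L5)) (# L4) (spl sf p) ∷ [])))
        (lin≡ (lists (f ∷ []) (L ∷ fl ∷ used ∷ []) (ℓ ∷ (length Ss) ∷ [])) 1 (∥ (L0 ⧺ 0 ▹ nil)) x0 (≡˘ ((∥ L1) ⊕ (1+ x1)) x0 eℓ ∷ ≡! (∥ L0) ((∥ L1) ⊕ (∥ L2)) (split-len L fl used sL) ∷ ≡! (∥ L2) x1 lu ∷ []))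

singles : ∀ e → List ℕ → List (Seg e)
singles e [] = []
singles e (x ∷ xs) = seg (x ∷ []) [ x ] ∷ singles e xs

flatten-singles : ∀ e xs → flatten (singles e xs) ≡ xs
flatten-singles e [] = refl
flatten-singles e (x ∷ xs) = cong (x ∷_) (flatten-singles e xs)

length-singles : ∀ e xs → length (singles e xs) ≡ length xs
length-singles e [] = refl
length-singles e (x ∷ xs) = cong suc (length-singles e xs)

flatten-++ : ∀ {e} (S S' : List (Seg e)) p → cnt p (flatten (S ++ S')) ≡ cnt p (flatten S) + cnt p (flatten S')
flatten-++ [] S' p = refl
flatten-++ (S ∷ Ss) S' p = (lin≡ (env p [] ((Seg.L S) ∷ (flatten (Ss ++ S')) ∷ (flatten Ss) ∷ (flatten S') ∷ []) []) 1 (# (L0 ⧺ L1)) ((# (L0 ⧺ L2)) ⊕ (# L3)) (≡! (# L1) ((# L2) ⊕ (# L3)) (flatten-++ Ss S' p) ∷ []))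

data Matching (e : Rel) (X : List ℕ) (j : ℕ) : Set where
  matched : ∀ (Ss : List (Seg e)) R → Split X (flatten Ss) R → length Ss ≡ j → length (flatten Ss) ≡ 2 * j → Matching e X j
  clique : ∀ D Y → Split X D Y → length D ≤ 2 * j → Clique (co e) Y → Matching e X j

-- Edges are taken greedily. If the process stops early, the vertices not yet covered span no edge,
-- which is a clique of the complement.
matching : ∀ e → SymR e → ∀ j X → Matching e X j
matching e sy zero X = matched [] X (sp: λ p → refl) refl refl
matching e sy (suc j) X = go (findPair e X)
  where
  go : (Σ (List ℕ) λ as → Σ ℕ λ x → Σ (List ℕ) λ bs → Σ ℕ λ y → Σ (List ℕ) λ cs → (X ≡ as ++ x ∷ bs ++ y ∷ cs) × (e x y ≡ true))
    ⊎ AllPairs (λ x y → e x y ≡ false) X → Matching e X (suc j)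
  go (inj₂ h) = clique [] X (sp: λ p → refl) z≤n (allPairs⇒clique X (co-sym sy) (imp h))
    where
    impA : ∀ {x Y} → All (λ y → e x y ≡ false) Y → All (λ y → co e x y ≡ true) Y
    impA [] = []
    impA (h ∷ hs) = cong not h ∷ impA hs
    imp : ∀ {Y} → AllPairs (λ x y → e x y ≡ false) Y → AllPairs (λ x y → co e x y ≡ true) Y
    imp [] = []
    imp (h ∷ hs) = impA h ∷ imp hs
  go (inj₁ (as , x , bs , y , cs , refl , xy)) = rec (matching e sy j (as ++ bs ++ cs))
    where
    rec : Matching e (as ++ bs ++ cs) j → Matching e (as ++ x ∷ bs ++ y ∷ cs) (suc j)
    rec (matched Ss R s l l') = matched (seg (x ∷ y ∷ []) (xy ◂ [ y ]) ∷ Ss) R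
      (sp: λ p → (lin≡ (env p (x ∷ y ∷ []) (as ∷ bs ∷ cs ∷ (flatten Ss) ∷ R ∷ []) []) 1 (# (L0 ⧺ 0 ▹ L1 ⧺ 1 ▹ L2)) ((# (0 ▹ 1 ▹ L3)) ⊕ (# L4)) (≡! (# (L0 ⧺ L1 ⧺ L2)) ((# L3) ⊕ (# L4)) (spl s p) ∷ [])))
      (cong suc l) (lin≡ (lists [] ((flatten Ss) ∷ []) (j ∷ [])) 1 (1+ (1+ (∥ L0))) (2 ⊛ (1+ x0)) (≡! (∥ L0) (2 ⊛ x0) l' ∷ []))
    rec (clique D Y s l c) = clique (x ∷ y ∷ D) Y
      (sp: λ p → (lin≡ (env p (x ∷ y ∷ []) (as ∷ bs ∷ cs ∷ D ∷ Y ∷ []) []) 1 (# (L0 ⧺ 0 ▹ L1 ⧺ 1 ▹ L2)) ((# (0 ▹ 1 ▹ L3)) ⊕ (# L4)) (≡! (# (L0 ⧺ L1 ⧺ L2)) ((# L3) ⊕ (# L4)) (spl s p) ∷ [])))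
      (lin (lists [] (D ∷ []) (j ∷ [])) 1 (1+ (1+ (∥ L0))) (2 ⊛ (1+ x0)) (≤! (∥ L0) (2 ⊛ x0) l ∷ [])) c

CC : Rel → List ℕ → ℕ → ℕ → Set
CC e U n m = HasCycle e U (2 * m) ⊎ HasCycle (co e) U (2 * n)

-- For cutting a cycle at the first blue neighbour of a vertex: the other blue neighbours all come
-- later, so the remaining arc is long.
first-none : ∀ q R → 1 ≤ cnt q R → Σ (List ℕ) λ R₁ → Σ ℕ λ c → Σ (List ℕ) λ R₂ →
  (R ≡ R₁ ++ c ∷ R₂) × (q c ≡ true) × (cnt q R ≤ suc (length R₂))
first-none q R h with cnt-first q R h
... | R₁ , c , R₂ , refl , qc , z = R₁ , c , R₂ , refl , qc ,
  (lin (env q (c ∷ []) (R₁ ∷ R₂ ∷ []) []) 1 (# (L0 ⧺ 0 ▹ L1)) (1+ (∥ L1)) (≡! (# L0) (` 0) z ∷ ≤! (# L1) (∥ L1) (cnt-≤ q R₂) ∷ ≡! (bit 0) (` 1) (b2n-t qc) ∷ []))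

-- The blue cycle C is extended by two vertices, unless the vertices outside of it are so red towards C
-- that they carry a red cycle of length 2m.
module Extend (e : Rel) (sy : SymR e) (K n' m : ℕ) (U : List ℕ) (dU : NoDup U) (hK : 30 ≤ K)
  (10≤m : 10 ≤ m) (m≤n : m ≤ suc n') (hU : K + 2 * suc n' + m ≤ length U)
  {u₀ v₀ : ℕ} (C X : List ℕ) (W : Walk (co e) u₀ C v₀) (cl : co e v₀ u₀ ≡ true) (sU : Split U C X)
  (lC : length C ≡ 2 * n') where

  n = suc n'
  blue = co e

  Goal : Set
  Goal = CC e U n m

  lX : K + 2 + m ≤ length X
  lX = (lin (lists [] (X ∷ U ∷ C ∷ []) (K ∷ m ∷ n' ∷ [])) 1 ((x0 ⊕ (` 2)) ⊕ x1) (∥ L0) (≡! (∥ L1) ((∥ L2) ⊕ (∥ L0)) (split-len U C X sU) ∷ ≡! (∥ L2) (2 ⊛ x2) lC ∷ ≤! ((x0 ⊕ (2 ⊛ (1+ x2))) ⊕ x1) (∥ L1) hU ∷ []))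

  done : ∀ x z → (x ∷ z ∷ []) ⊑ X → 2 ≤ pcnt (λ a b → blue x a ∧ blue z b) C u₀ → Goal
  done x z h c = inj₂ (fin (cross C W cl x z (co-sym sy) c))
    where
    fin : CycleOn blue (λ p → b2n (p x) + b2n (p z) + cnt p C) → HasCycle blue U (2 * n)
    fin (cycle C' W' cl' ct) = cyc C' W' cl'
      (le: λ p → (lin (env p (x ∷ z ∷ []) (C' ∷ U ∷ C ∷ X ∷ []) []) 1 (# L0) (# L1) (≡! (# L0) (((bit 0) ⊕ (bit 1)) ⊕ (# L2)) (ct p) ∷ ≡˘ ((# L2) ⊕ (# L3)) (# L1) (spl sU p) ∷ ≤! (# (0 ▹ 1 ▹ nil)) (# L3) (⊑at h p) ∷ [])))
      (lin≡ (lists [] (C' ∷ C ∷ []) (n' ∷ [])) 1 (∥ L0) (2 ⊛ (1+ x0)) (≡˘ (∥ L0) (# L0) (cnt-all C') ∷ ≡! (# L1) (∥ L1) (cnt-all C) ∷ ≡! (# L0) ((` 2) ⊕ (# L1)) (ct (λ _ → true)) ∷ ≡! (∥ L1) (2 ⊛ x0) lC ∷ []))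

  -- The threshold n is the degree for which Jackson's lemma tolerates the 2n - 2 vertices of the
  -- cycle. A vertex below it has at least n - 1 blue neighbours on the cycle.
  redHigh : ℕ → Bool
  redHigh x = n ≤ᵇ cnt (e x) C

  viaJackson : m ≤ cnt redHigh X → Goal
  viaJackson h = go (takeSplit m (filt redHigh X) (≤-trans h (≤-reflexive (sym (length-filt redHigh X)))))
    where
    go : (Σ (List ℕ) λ A → Σ (List ℕ) λ R → Split (filt redHigh X) A R × length A ≡ m) → Goal
    go (A , R , S , lA) = inj₁ (fin jackson)
      where
      side : ℕ → Bool
      side v = 1 ≤ᵇ occ v A
      A⊑X : A ⊑ X
      A⊑X = ⊑-trans (splitˡ S) (le: λ p → ≤-trans (≤-reflexive (cnt-filt redHigh p X)) (cnt-imp (λ y → redHigh y ∧ p y) p X (λ v _ k → proj₂ (∧-true k))))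
      -- Only the red edges leaving `A` are kept, which makes the graph bipartite.
      e' : Rel
      e' x y = e x y ∧ (side x xor side y)
      xor-sym : ∀ a b → (a xor b) ≡ (b xor a)
      xor-sym true true = refl
      xor-sym true false = refl
      xor-sym false true = refl
      xor-sym false false = refl
      xor-not : ∀ a b → (a xor b) ≡ true → a ≡ not b
      xor-not true false _ = refl
      xor-not false true _ = refl
      inA : ∀ v → v ∈ A → side v ≡ true
      inA v mem with side v in eq
      ... | true = refl
      ... | false = (⊥-elim (1+n≰n (lin (env (v ≡ᵇ_) [] (A ∷ []) []) 1 (` 1) (` 0) (≤! (` 1) (# L0) mem ∷ ≤! (1+ (# L0)) (` 1) (≤ᵇ-false {1} eq) ∷ []))))
      inC : ∀ v → v ∈ C → side v ≡ false
      inC v mem with side v in eq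
      ... | false = refl
      ... | true = ⊥-elim (∉-rest dU sU v mem (∈-⊑ v A⊑X (≤ᵇ-true {1} eq)))
      deg : ∀ a → a ∈ A → n ≤ cnt (e' a) C
      deg a mem with cnt-wit (λ y → redHigh y ∧ (a ≡ᵇ y)) X (≤-trans mem (≤-trans (⊑at (splitˡ S) (a ≡ᵇ_)) (≤-reflexive (cnt-filt redHigh (a ≡ᵇ_) X))))
      ... | y , _ , q with ==-true {a} {y} (proj₂ (∧-true q))
      ... | refl = ≤-trans (≤ᵇ-true {n} (proj₁ (∧-true q))) (cnt-imp (e a) (e' a) C (λ v mv ev →
        ∧-intro ev (cong₂ _xor_ (inA a mem) (inC v mv))))
      open Jackson e' (λ x y → cong₂ _∧_ (sy x y) (xor-sym (side x) (side y))) side (λ x y h → xor-not _ _ (proj₂ (∧-true {e x y} h)))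
        A C inA inC n deg (lin (lists [] (C ∷ []) (n' ∷ [])) 1 ((∥ L0) ⊕ (` 2)) (2 ⊛ (1+ x0)) (≡! (∥ L0) (2 ⊛ x0) lC ∷ [])) (≤-trans (≤-reflexive lA) m≤n) renaming (jackson to jk)
      jackson : HasCycle e' (A ++ C) (2 * length A)
      jackson = jk (lin (lists [] (A ∷ []) (m ∷ [])) 5 (` 2) (∥ L0) (≡˘ x0 (∥ L0) lA ∷ ≤! (` 10) x0 10≤m ∷ []))
      fin : HasCycle e' (A ++ C) (2 * length A) → HasCycle e U (2 * m)
      fin h = cyc-mono (le: λ p → (lin (env p [] (A ∷ C ∷ U ∷ X ∷ []) []) 1 (# (L0 ⧺ L1)) (# L2) (≤! (# L0) (# L3) (⊑at A⊑X p) ∷ ≡˘ ((# L1) ⊕ (# L3)) (# L2) (spl sU p) ∷ [])))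
        (cyc-map (λ x y k → proj₁ (∧-true k)) (subst (λ z → HasCycle e' (A ++ C) (2 * z)) lA h))

  -- `F` consists of n - 1 successors of blue neighbours of `x₀`. A second outside vertex with two
  -- blue neighbours in `F` would allow `cross`, so the red graph between `X₁` and `F` is nearly
  -- complete, and red cycles can alternate between segments in `X₁` and vertices of `F`.
  module Rich (x₀ : ℕ) (X₁ : List ℕ) (sX : Split X (x₀ ∷ []) X₁) (F R : List ℕ)
    (sF : Split (succs (blue x₀) C u₀) F R) (lF : length F ≡ n')
    (good : ∀ x → x ∈ X₁ → cnt (blue x) F ≤ 1) (few : cnt redHigh X < m) where

    open Thread e sy

    F⊑C : F ⊑ C
    F⊑C = ⊑-trans (splitˡ sF) (succs-⊑ (blue x₀) W)

    lX₁ : K + 1 + m ≤ length X₁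
    lX₁ = (lin (lists [] (X₁ ∷ X ∷ []) (K ∷ m ∷ [])) 1 ((x0 ⊕ (` 1)) ⊕ x1) (∥ L0) (≡! (∥ L1) ((` 1) ⊕ (∥ L0)) (split-len X (x₀ ∷ []) X₁ sX) ∷ ≤! ((x0 ⊕ (` 2)) ⊕ x1) (∥ L1) lX ∷ []))

    goodSeg : ∀ {L} (S : Seg e) → Seg.L S ⊑ L → L ⊑ X₁ → Good F S
    goodSeg S h k = good _ (∈-⊑ (Seg.a S) (⊑-trans h k) (w∈ˡ (Seg.W S))) , good _ (∈-⊑ (Seg.b S) (⊑-trans h k) (w∈ʳ (Seg.W S)))

    goodSegs : ∀ (Ss : List (Seg e)) → flatten Ss ⊑ X₁ → All (Good F) Ss
    goodSegs [] h = []
    goodSegs (S ∷ Ss) h = goodSeg S (le: λ p → ≤-trans (m≤m+n _ _) (≤-reflexive (sym (cnt-++ p (Seg.L S) (flatten Ss))))) h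
      ∷ goodSegs Ss (⊑-trans (le: λ p → ≤-trans (m≤n+m _ _) (≤-reflexive (sym (cnt-++ p (Seg.L S) (flatten Ss))))) h)

    close : ∀ (Ss : List (Seg e)) → flatten Ss ⊑ X₁ → 1 ≤ length Ss → length Ss + 2 ≤ n' → length (flatten Ss) + length Ss ≡ 2 * m → Goal
    close (S ∷ Ss) h _ h2 h3 with goodSegs (S ∷ Ss) h
    ... | g ∷ gs = inj₁ (cyc-mono (le: λ p → (lin (env p (x₀ ∷ []) ((flatten (S ∷ Ss)) ∷ F ∷ U ∷ X₁ ∷ X ∷ C ∷ []) []) 1 (# (L0 ⧺ L1)) (# L2) (≤! (# L0) (# L3) (⊑at h p) ∷ ≡˘ ((# (0 ▹ nil)) ⊕ (# L3)) (# L4) (spl sX p) ∷ ≡˘ ((# L5) ⊕ (# L4)) (# L2) (spl sU p) ∷ ≤! (# L1) (# L5) (⊑at F⊑C p) ∷ [])))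
      (threadCycle S Ss F g gs (lin (lists [] (F ∷ []) ((length Ss) ∷ n' ∷ [])) 1 (x0 ⊕ (` 3)) (∥ L0) (≡˘ x1 (∥ L0) lF ∷ ≤! ((1+ x0) ⊕ (` 2)) x1 h2 ∷ [])) (2 * m) (sym h3)))

    plain : m + 2 ≤ n' → Goal
    plain h = go (takeSplit m X₁ (lin (lists [] (X₁ ∷ []) (m ∷ K ∷ [])) 1 x0 (∥ L0) (≤! ((x1 ⊕ (` 1)) ⊕ x0) (∥ L0) lX₁ ∷ [])))
      where
      go : (Σ (List ℕ) λ A → Σ (List ℕ) λ R → Split X₁ A R × length A ≡ m) → Goal
      go (A , _ , S , lA) = close (singles e A) (⊑-trans (≡⇒⊑ (flatten-singles e A)) (splitˡ S))
        (lin (lists [] (A ∷ []) ((length (singles e A)) ∷ m ∷ [])) 10 (` 1) x0 (≡˘ (∥ L0) x0 (length-singles e A) ∷ ≡˘ x1 (∥ L0) lA ∷ ≤! (` 10) x1 10≤m ∷ []))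
        (lin (lists [] (A ∷ []) ((length (singles e A)) ∷ n' ∷ m ∷ [])) 1 (x0 ⊕ (` 2)) x1 (≡! x0 (∥ L0) (length-singles e A) ∷ ≡! (∥ L0) x2 lA ∷ ≤! (x2 ⊕ (` 2)) x1 h ∷ []))
        (lin≡ (lists [] ((flatten (singles e A)) ∷ A ∷ []) ((length (singles e A)) ∷ m ∷ [])) 1 ((∥ L0) ⊕ x0) (2 ⊛ x1) (≡! x0 (∥ L1) (length-singles e A) ∷ 2 ×! ≡! (∥ L1) x1 lA ∷ ≡! (∥ L0) (∥ L1) (cong length (flatten-singles e A)) ∷ []))

    -- For n close to m the set `F` is too small to alternate with m single vertices. Six red edges
    -- inside `X₁` save vertices of `F`: with m - 9 single vertices there are m - 3 segments, and 12
    -- + (m - 9) + (m - 3) = 2m.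
    withMatching : ∀ (Ss : List (Seg e)) R₁ → Split X₁ (flatten Ss) R₁ → length Ss ≡ 6 → length (flatten Ss) ≡ 12 → Goal
    withMatching Ss R₁ sR lS lfl = go (takeSplit (m ∸ 9) R₁ (lin (lists [] (R₁ ∷ X₁ ∷ (flatten Ss) ∷ []) ((m ∸ 9) ∷ K ∷ m ∷ [])) 15 x0 (∥ L0) (15 ×! ≤! ((x1 ⊕ (` 1)) ⊕ x2) (∥ L1) lX₁ ∷ ≤! (` 30) x1 hK ∷ 15 ×! ≡˘ ((` 9) ⊕ x0) x2 j9 ∷ 15 ×! ≡! (∥ L1) ((∥ L2) ⊕ (∥ L0)) (split-len X₁ (flatten Ss) R₁ sR) ∷ 15 ×! ≡! (∥ L2) (` 12) lfl ∷ [])))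
      where
      j9 : m ≡ 9 + (m ∸ 9)
      j9 = sym (m+[n∸m]≡n (≤-trans (n≤1+n 9) 10≤m))
      go : (Σ (List ℕ) λ A → Σ (List ℕ) λ R → Split R₁ A R × length A ≡ m ∸ 9) → Goal
      go (A , R' , S , lA) = close all
          (le: λ p → (lin (nums ((cnt p (flatten all)) ∷ (cnt p X₁) ∷ (cnt p (flatten Ss)) ∷ (cnt p (flatten (singles e A))) ∷ (cnt p A) ∷ (cnt p R') ∷ (cnt p R₁) ∷ [])) 1 x0 x1 (≡! x0 (x2 ⊕ x3) (flatten-++ Ss (singles e A) p) ∷ ≡! x3 x4 (cong (cnt p) (flatten-singles e A)) ∷ ≡˘ (x4 ⊕ x5) x6 (spl S p) ∷ ≡˘ (x2 ⊕ x6) x1 (spl sR p) ∷ [])))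
          (lin (nums ((length all) ∷ (m ∸ 9) ∷ [])) 6 (` 1) x0 (≡˘ ((` 6) ⊕ x1) x0 lall ∷ []))
          (lin (nums ((length all) ∷ n' ∷ (m ∸ 9) ∷ m ∷ [])) 1 (x0 ⊕ (` 2)) x1 (≡! x0 ((` 6) ⊕ x2) lall ∷ ≡˘ ((` 9) ⊕ x2) x3 j9 ∷ ≤! x3 (1+ x1) m≤n ∷ []))
          (lin≡ (lists [] ((flatten all) ∷ []) ((length all) ∷ m ∷ (m ∸ 9) ∷ [])) 1 ((∥ L0) ⊕ x0) (2 ⊛ x1) (≡! (∥ L0) ((` 12) ⊕ x2) lfa ∷ ≡! x0 ((` 6) ⊕ x2) lall ∷ 2 ×! ≡˘ ((` 9) ⊕ x2) x1 j9 ∷ []))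
        where
        all = Ss ++ singles e A
        lall : length all ≡ 6 + (m ∸ 9)
        lall = trans (length-++ Ss) (cong₂ _+_ lS (trans (length-singles e A) lA))
        lfa : length (flatten all) ≡ 12 + (m ∸ 9)
        lfa = trans (sym (cnt-all (flatten all))) (trans (flatten-++ Ss (singles e A) (λ _ → true))
          (cong₂ _+_ (trans (cnt-all (flatten Ss)) lfl) (trans (cnt-all (flatten (singles e A))) (trans (cong length (flatten-singles e A)) lA))))

    -- A blue clique can lengthen a blue path by any number of vertices. Two clique vertices y₁, y₂
    -- have blue neighbours c₁, c₂ on the cycle; c₂ is the first one of y₂ after c₁, so the arc from
    -- c₂ on to c₁ keeps nearly all blue neighbours of y₂, and at most n - 1 further clique vertices
    -- are needed.
    withClique : n' ≤ m + 1 → ∀ D Y → Split X₁ D Y → length D ≤ 12 → Clique blue Y → Goal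
    withClique n'≤ D Y sY lD cY = go (pick bh Y two₁)
      where
      bh : ℕ → Bool
      bh x = not (redHigh x)
      two : 2 ≤ cnt bh Y
      two = (lin (env bh (x₀ ∷ []) (Y ∷ X ∷ X₁ ∷ D ∷ []) ((cnt redHigh X) ∷ m ∷ K ∷ [])) 10 (` 2) (# L0) (≡˘ (∥ L1) (x0 ⊕ (# L1)) (cnt-not redHigh X) ∷ ≤! (1+ x0) x1 few ∷ ≤! ((x2 ⊕ (` 2)) ⊕ x1) (∥ L1) lX ∷ ≤! (` 30) x2 hK ∷ ≡! (# L1) ((# (0 ▹ nil)) ⊕ (# L2)) (spl sX bh) ∷ ≤! (bit 0) (` 1) (b2n-≤1 (bh x₀)) ∷ ≡! (# L2) ((# L3) ⊕ (# L0)) (spl sY bh) ∷ ≤! (# L3) (∥ L3) (cnt-≤ bh D) ∷ ≤! (∥ L3) (` 12) lD ∷ []))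
      two₁ : 1 ≤ cnt bh Y
      two₁ = ≤-trans (s≤s z≤n) two
      blueDeg : ∀ x → bh x ≡ true → n' ≤ cnt (blue x) C
      blueDeg x h = (lin (env (blue x) [] (C ∷ []) (n' ∷ (cnt (e x) C) ∷ [])) 1 x0 (# L0) (≡˘ (∥ L0) (x1 ⊕ (# L0)) (cnt-not (e x) C) ∷ ≡˘ (2 ⊛ x0) (∥ L0) lC ∷ ≤! (1+ x1) (1+ x0) (≤ᵇ-false {n} (not-true h)) ∷ []))
      go : (Σ ℕ λ y₁ → Σ (List ℕ) λ Y₁ → Split Y (y₁ ∷ []) Y₁ × (bh y₁ ≡ true)) → Goal
      go (y₁ , Y₁ , s₁ , h₁) = go₂ (pick bh Y₁ (lin (env bh (y₁ ∷ []) (Y₁ ∷ Y ∷ []) []) 1 (` 1) (# L0) (≤! (` 2) (# L1) two ∷ ≡! (# L1) ((# (0 ▹ nil)) ⊕ (# L0)) (spl s₁ bh) ∷ ≤! (bit 0) (` 1) (b2n-≤1 (bh y₁)) ∷ [])))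
        where
        go₂ : (Σ ℕ λ y₂ → Σ (List ℕ) λ Y₂ → Split Y₁ (y₂ ∷ []) Y₂ × (bh y₂ ≡ true)) → Goal
        go₂ (y₂ , Y₂ , s₂ , h₂) = go₃ (cnt-first (blue y₁) C (lin (env (blue y₁) [] (C ∷ []) (n' ∷ m ∷ [])) 9 (` 1) (# L0) (≤! x0 (# L0) (blueDeg y₁ h₁) ∷ ≤! x1 (1+ x0) m≤n ∷ ≤! (` 10) x1 10≤m ∷ [])))
          where
          go₃ : (Σ (List ℕ) λ ys → Σ ℕ λ x → Σ (List ℕ) λ zs → (C ≡ ys ++ x ∷ zs) × (blue y₁ x ≡ true) × (cnt (blue y₁) ys ≡ 0)) → Goal
          go₃ (Xc , c₁ , Yc , eC , q₁ , _) = go₄ (rot Xc c₁ Yc (subst (λ l → Walk blue u₀ l v₀) eC W) cl)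
            where
            Rc = Yc ++ Xc
            cR : ∀ p → cnt p C ≡ b2n (p c₁) + cnt p Rc
            cR p = trans (cong (cnt p) eC) (lin≡ (env p (c₁ ∷ []) (Xc ∷ Yc ∷ Rc ∷ []) []) 1 (# (L0 ⧺ 0 ▹ L1)) ((bit 0) ⊕ (# L2)) (≡˘ (# (L1 ⧺ L0)) (# L2) (refl {x = cnt p Rc}) ∷ []))
            lRc : length C ≡ suc (length Rc)
            lRc = trans (sym (cnt-all C)) (trans (cR (λ _ → true)) (cong suc (cnt-all Rc)))
            many : n' ≤ suc (cnt (blue y₂) Rc)
            many = (lin (env (blue y₂) [] (Rc ∷ C ∷ []) (n' ∷ (b2n (blue y₂ c₁)) ∷ [])) 1 x0 (1+ (# L0)) (≤! x0 (# L1) (blueDeg y₂ h₂) ∷ ≡! (# L1) (x1 ⊕ (# L0)) (cR (blue y₂)) ∷ ≤! x1 (` 1) (b2n-≤1 (blue y₂ c₁)) ∷ []))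
            go₄ : Walk blue (hd Yc u₀) (Yc ++ Xc ++ c₁ ∷ []) c₁ × (blue c₁ (hd Yc u₀) ≡ true) → Goal
            go₄ (W' , _) = go₅ (first-none (blue y₂) Rc (lin (env (blue y₂) [] (Rc ∷ []) (n' ∷ m ∷ [])) 8 (` 1) (# L0) (≤! x0 (1+ (# L0)) many ∷ ≤! x1 (1+ x0) m≤n ∷ ≤! (` 10) x1 10≤m ∷ [])))
              where
              go₅ : (Σ (List ℕ) λ R₁ → Σ ℕ λ c → Σ (List ℕ) λ R₂ → (Rc ≡ R₁ ++ c ∷ R₂) × (blue y₂ c ≡ true) × (cnt (blue y₂) Rc ≤ suc (length R₂))) → Goal
              go₅ (R₁ , c₂ , R₂ , eR , q₂ , lR₂) = go₆ (takeSplit j Y₂ jle)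
                where
                lRR : length Rc ≡ length R₁ + suc (length R₂)
                lRR = trans (cong length eR) (length-++ R₁)
                small : length R₂ + 2 ≤ 2 * n'
                small = (lin (lists [] (R₂ ∷ R₁ ∷ Rc ∷ C ∷ []) (n' ∷ [])) 1 ((∥ L0) ⊕ (` 2)) (2 ⊛ x0) (≡˘ ((∥ L1) ⊕ (1+ (∥ L0))) (∥ L2) lRR ∷ ≡˘ (1+ (∥ L2)) (∥ L3) lRc ∷ ≡! (∥ L3) (2 ⊛ x0) lC ∷ []))
                -- Besides `R₂` the cycle contains c₁, c₂, y₁, y₂ and j further clique vertices, so
                -- that |R₂| + 4 + j = 2n.
                j = 2 * n' ∸ (length R₂ + 2)
                jeq : length R₂ + 2 + j ≡ 2 * n'
                jeq = m+[n∸m]≡n small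
                jle : j ≤ length Y₂
                jle = (lin (env (blue y₂) [] (Y₂ ∷ R₂ ∷ Rc ∷ X₁ ∷ D ∷ Y ∷ Y₁ ∷ []) (j ∷ n' ∷ m ∷ K ∷ [])) 15 x0 (∥ L0) (15 ×! ≡! (((∥ L1) ⊕ (` 2)) ⊕ x0) (2 ⊛ x1) jeq ∷ 15 ×! ≤! (# L2) (1+ (∥ L1)) lR₂ ∷ 15 ×! ≤! x1 (1+ (# L2)) many ∷ 15 ×! ≤! x1 (x2 ⊕ (` 1)) n'≤ ∷ 15 ×! ≤! ((x3 ⊕ (` 1)) ⊕ x2) (∥ L3) lX₁ ∷ 7 ×! ≤! (` 30) x3 hK ∷ 15 ×! ≡! (∥ L3) ((∥ L4) ⊕ (∥ L5)) (split-len X₁ D Y sY) ∷ 15 ×! ≤! (∥ L4) (` 12) lD ∷ 15 ×! ≡! (∥ L5) ((` 1) ⊕ (∥ L6)) (split-len Y (y₁ ∷ []) Y₁ s₁) ∷ 15 ×! ≡! (∥ L6) ((` 1) ⊕ (∥ L0)) (split-len Y₁ (y₂ ∷ []) Y₂ s₂) ∷ []))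
                W'' : Walk blue (hd Yc u₀) (R₁ ++ c₂ ∷ R₂ ++ c₁ ∷ []) c₁
                W'' = subst (λ l → Walk blue (hd Yc u₀) l c₁) (trans (sym (++-assoc Yc Xc (c₁ ∷ [])))
                  (trans (cong (_++ c₁ ∷ []) eR) (++-assoc R₁ (c₂ ∷ R₂) (c₁ ∷ [])))) W'
                arc : Walk blue c₂ (c₂ ∷ R₂ ++ c₁ ∷ []) c₁
                arc = proj₂ (wcut R₁ c₂ (R₂ ++ c₁ ∷ []) W'')
                go₆ : (Σ (List ℕ) λ A → Σ (List ℕ) λ R → Split Y₂ A R × length A ≡ j) → Goal
                go₆ (A , R , sA , lA) = inj₂ (cyc ((c₂ ∷ R₂ ++ c₁ ∷ []) ++ y₁ ∷ A ++ y₂ ∷ [])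
                  (join arc (trans (co-sym sy c₁ y₁) q₁) (cliqueWalk cY y₁ A y₂ (le: λ p →
                    (lin (env p (y₁ ∷ y₂ ∷ []) (A ∷ Y ∷ Y₁ ∷ Y₂ ∷ R ∷ []) []) 1 (# (0 ▹ L0 ⧺ 1 ▹ nil)) (# L1) (≡˘ ((# (0 ▹ nil)) ⊕ (# L2)) (# L1) (spl s₁ p) ∷ ≡˘ ((# (1 ▹ nil)) ⊕ (# L3)) (# L2) (spl s₂ p) ∷ ≡˘ ((# L0) ⊕ (# L4)) (# L3) (spl sA p) ∷ []))))) q₂
                  (le: λ p → (lin (env p (c₂ ∷ c₁ ∷ y₁ ∷ y₂ ∷ x₀ ∷ []) (R₂ ∷ A ∷ U ∷ Y₁ ∷ Y ∷ Y₂ ∷ R ∷ D ∷ X₁ ∷ X ∷ C ∷ Rc ∷ R₁ ∷ []) []) 1 (# ((0 ▹ L0 ⧺ 1 ▹ nil) ⧺ 2 ▹ L1 ⧺ 3 ▹ nil)) (# L2) (≡˘ ((# (2 ▹ nil)) ⊕ (# L3)) (# L4) (spl s₁ p) ∷ ≡˘ ((# (3 ▹ nil)) ⊕ (# L5)) (# L3) (spl s₂ p) ∷ ≡˘ ((# L1) ⊕ (# L6)) (# L5) (spl sA p) ∷ ≡˘ ((# L7) ⊕ (# L4)) (# L8) (spl sY p) ∷ ≡˘ ((# (4 ▹ nil)) ⊕ (# L8)) (# L9) (spl sX p) ∷ ≡˘ ((# (atom 10)) ⊕ (# L9)) (# L2) (spl sU p) ∷ ≡˘ ((bit 1) ⊕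 (# (atom 11))) (# (atom 10)) (cR p) ∷ ≡˘ ((# (atom 12)) ⊕ (# (0 ▹ L0))) (# (atom 11)) (trans (cong (cnt p) eR) (cnt-++ p R₁ (c₂ ∷ R₂))) ∷ [])))
                  (lin≡ (lists (c₂ ∷ c₁ ∷ y₁ ∷ y₂ ∷ []) (R₂ ∷ A ∷ []) (n' ∷ j ∷ [])) 1 (∥ ((0 ▹ L0 ⧺ 1 ▹ nil) ⧺ 2 ▹ L1 ⧺ 3 ▹ nil)) (2 ⊛ (1+ x0)) (≡! (∥ L1) x1 lA ∷ ≡! (((∥ L0) ⊕ (` 2)) ⊕ x1) (2 ⊛ x0) jeq ∷ [])))

    result : Goal
    result = go (≤-total (m + 2) n')
      where
      byMatching : n' ≤ m + 1 → Matching e X₁ 6 → Goal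
      byMatching h (matched Ss R₁ sR lS lfl) = withMatching Ss R₁ sR lS lfl
      byMatching h (clique D Y sY lD cY) = withClique h D Y sY lD cY
      go : (m + 2 ≤ n') ⊎ (n' ≤ m + 2) → Goal
      go (inj₁ h) = plain h
      go (inj₂ h) with m≤n⇒m<n∨m≡n h
      ... | inj₂ h' = plain (≤-reflexive (sym h'))
      ... | inj₁ h' = byMatching (lin (nums (n' ∷ m ∷ [])) 1 x0 (x1 ⊕ (` 1)) (≤! (1+ x0) (x1 ⊕ (` 2)) h' ∷ [])) (matching e sy 6 X₁)

  extend : Goal
  extend = go (≤-total m (cnt redHigh X))
    where
    rich : cnt redHigh X < m → Goal
    rich few = pk (pick (λ x → not (redHigh x)) X (lin (env (λ x → not (redHigh x)) [] (X ∷ []) ((cnt redHigh X) ∷ m ∷ K ∷ [])) 3 (` 1) (# L0) (≡˘ (∥ L0) (x0 ⊕ (# L0)) (cnt-not redHigh X) ∷ ≤! (1+ x0) x1 few ∷ ≤! ((x2 ⊕ (` 2)) ⊕ x1) (∥ L0) lX ∷ [])))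
      where
      pk : (Σ ℕ λ x₀ → Σ (List ℕ) λ X₁ → Split X (x₀ ∷ []) X₁ × (not (redHigh x₀) ≡ true)) → Goal
      pk (x₀ , X₁ , sX , h) = tk (takeSplit n' (succs (blue x₀) C u₀) (lin (env (blue x₀) [] ((succs (blue x₀) C u₀) ∷ C ∷ []) (n' ∷ (cnt (e x₀) C) ∷ [])) 1 x0 (∥ L0) (≡˘ (# L1) (∥ L0) (length-succs (blue x₀) C u₀) ∷ ≡˘ (∥ L1) (x1 ⊕ (# L1)) (cnt-not (e x₀) C) ∷ ≡˘ (2 ⊛ x0) (∥ L1) lC ∷ ≤! (1+ x1) (1+ x0) (≤ᵇ-false {n} (not-true h)) ∷ [])))
        where
        tk : (Σ (List ℕ) λ F → Σ (List ℕ) λ R → Split (succs (blue x₀) C u₀) F R × length F ≡ n') → Goal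
        tk (F , R , sF , lF) = sr (search (λ x → 2 ≤ᵇ cnt (blue x) F) X₁)
          where
          sr : (Σ ℕ λ v → (v ∈ X₁) × ((2 ≤ᵇ cnt (blue v) F) ≡ true)) ⊎ (∀ v → v ∈ X₁ → (2 ≤ᵇ cnt (blue v) F) ≡ false) → Goal
          sr (inj₂ good) = Rich.result x₀ X₁ sX F R sF lF (λ x mem → s≤s⁻¹ (≤ᵇ-false {2} (good x mem))) few
          sr (inj₁ (z , mem , hz)) = done x₀ z (le: pr) (≤-trans (≤ᵇ-true {2} hz) (≤-trans (⊑at (splitˡ sF) (blue z)) (≤-reflexive (cnt-succs (blue x₀) (blue z) C u₀))))
            where
            pr : ∀ p → cnt p (x₀ ∷ z ∷ []) ≤ cnt p X
            pr p with ∈-remove z X₁ mem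
            ... | Z , sZ = (lin (env p (x₀ ∷ z ∷ []) (X ∷ X₁ ∷ Z ∷ []) []) 1 (# (0 ▹ 1 ▹ nil)) (# L0) (≡˘ ((# (0 ▹ nil)) ⊕ (# L1)) (# L0) (spl sX p) ∷ ≡˘ ((# (1 ▹ nil)) ⊕ (# L2)) (# L1) (spl sZ p) ∷ []))
    go : (m ≤ cnt redHigh X) ⊎ (cnt redHigh X ≤ m) → Goal
    go (inj₁ h) = viaJackson h
    go (inj₂ h) with m≤n⇒m<n∨m≡n h
    ... | inj₂ h' = viaJackson (≤-reflexive (sym h'))
    ... | inj₁ h' = rich h'

-- Induction on n + m. For m < n a blue cycle on 2n - 2 vertices comes from the pair (n - 1, m) and
-- is extended. For m = n the colours are exchanged: the pair (n, n - 1) gives a red cycle on 2n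
-- vertices, as desired, or again a blue cycle on 2n - 2 vertices. Only m = n = 10 is left for
-- Ramsey's theorem.
cycle-cycle : ∀ K → 30 ≤ K → 2 ^ 40 ≤ K → ∀ f n m e U → n + m ≤ f → SymR e → NoDup U → 10 ≤ m → m ≤ n →
  K + 2 * n + m ≤ length U → CC e U n m
cycle-cycle K hK hK' zero n m e U hf sy dU 10≤m m≤n hU = (⊥-elim (1+n≰n (lin (nums (n ∷ m ∷ [])) 10 (` 1) (` 0) (≤! (x0 ⊕ x1) (` 0) hf ∷ ≤! (` 10) x1 10≤m ∷ []))))
cycle-cycle K hK hK' (suc f) zero m e U hf sy dU 10≤m m≤n hU = (⊥-elim (1+n≰n (lin (nums (m ∷ [])) 10 (` 1) (` 0) (≤! x0 (` 0) m≤n ∷ ≤! (` 10) x0 10≤m ∷ []))))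
cycle-cycle K hK hK' (suc f) (suc n') m e U hf sy dU 10≤m m≤n hU = go (m≤n⇒m<n∨m≡n m≤n)
  where
  step : HasCycle (co e) U (2 * n') → CC e U (suc n') m
  step (cyc C W cl C⊑U lC) = ex (diff⊑ C U C⊑U)
    where
    ex : Σ (List ℕ) (λ X → Split U C X) → CC e U (suc n') m
    ex (X , sU) = Extend.extend e sy K n' m U dU hK 10≤m m≤n hU C X W cl sU lC
  unco : ∀ x y → co (co e) x y ≡ true → e x y ≡ true
  unco x y h with e x y
  ... | true = refl
  go : m < suc n' ⊎ m ≡ suc n' → CC e U (suc n') m
  go (inj₁ lt) = [_,_]′ inj₁ step (cycle-cycle K hK hK' f n' m e U (s≤s⁻¹ hf) sy dU 10≤m (s≤s⁻¹ lt)
      (lin (lists [] (U ∷ []) (K ∷ n' ∷ m ∷ [])) 1 ((x0 ⊕ (2 ⊛ x1)) ⊕ x2) (∥ L0) (≤! ((x0 ⊕ (2 ⊛ (1+ x1))) ⊕ x2) (∥ L0) hU ∷ [])))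
  go (inj₂ refl) with m≤n⇒m<n∨m≡n 10≤m
  ... | inj₁ lt = [_,_]′ step (λ h → inj₁ (cyc-map unco h))
      (cycle-cycle K hK hK' f (suc n') n' (co e) U (lin (nums (n' ∷ f ∷ [])) 1 ((1+ x0) ⊕ x0) x1 (≤! ((1+ x0) ⊕ (1+ x0)) (1+ x1) hf ∷ [])) (co-sym sy) dU (s≤s⁻¹ lt) (n≤1+n n')
        (lin (lists [] (U ∷ []) (K ∷ n' ∷ [])) 1 ((x0 ⊕ (2 ⊛ (1+ x1))) ⊕ x1) (∥ L0) (≤! ((x0 ⊕ (2 ⊛ (1+ x1))) ⊕ (1+ x1)) (∥ L0) hU ∷ [])))
  ... | inj₂ refl = base (ramsey e 20 20 U (≤-trans hK' (lin (lists [] (U ∷ []) (K ∷ [])) 1 x0 (∥ L0) (≤! ((x0 ⊕ (` 20)) ⊕ (` 10)) (∥ L0) hU ∷ []))))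
    where
    base : (Σ (List ℕ) λ Q → Q ⊑ U × length Q ≡ 20 × AllPairs (λ x y → e x y ≡ true) Q) ⊎
      (Σ (List ℕ) λ Q → Q ⊑ U × length Q ≡ 20 × AllPairs (λ x y → co e x y ≡ true) Q) → CC e U 10 10
    base (inj₁ (Q , h , l , a)) = inj₁ (cyc-mono h (cliqueCycle 18 sy (allPairs⇒clique Q sy a) (≤-reflexive (sym l))))
    base (inj₂ (Q , h , l , a)) = inj₂ (cyc-mono h (cliqueCycle 18 (co-sym sy) (allPairs⇒clique Q (co-sym sy) a) (≤-reflexive (sym l))))

-- Robustly connected graphs and short connections

-- This is (k + 1)-connectedness without a condition on the order, stated as a refutation of
-- separators, which is the form in which a cut and its absence are distinguished under double
-- negation.
Robust : Rel → ℕ → List ℕ → Set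
Robust e k G = ∀ D G' A B → Split G D G' → Split G' A B → length D ≤ k → 1 ≤ length A → 1 ≤ length B →
  (∀ a b → a ∈ A → b ∈ B → e a b ≡ false) → ⊥

MinDeg : Rel → ℕ → List ℕ → Set
MinDeg e d G = ∀ v → v ∈ G → d ≤ cnt (e v) G

robust-restrict : ∀ {e k k' G D G'} → Split G D G' → length D + k' ≤ k → Robust e k G → Robust e k' G'
robust-restrict {k = k} {k'} {G} {D} {G'} s h rob D' G'' A B s' t lD' = rob (D ++ D') G'' A B
  (sp: λ p → (lin≡ (env p [] (G ∷ D ∷ D' ∷ G'' ∷ G' ∷ []) []) 1 (# L0) ((# (L1 ⧺ L2)) ⊕ (# L3)) (≡! (# L0) ((# L1) ⊕ (# L4)) (spl s p) ∷ ≡! (# L4) ((# L2) ⊕ (# L3)) (spl s' p) ∷ []))) t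
  (lin (lists [] (D ∷ D' ∷ []) (k ∷ k' ∷ [])) 1 (∥ (L0 ⧺ L1)) x0 (≤! ((∥ L0) ⊕ x1) x0 h ∷ ≤! (∥ L1) x1 lD' ∷ []))

minDeg-restrict : ∀ {e d c G D G'} → Split G D G' → length D ≤ c → MinDeg e (d + c) G → MinDeg e d G'
minDeg-restrict {e} {d} {c} {G} {D} {G'} s h md v m = (lin (env (e v) [] (G' ∷ G ∷ D ∷ []) (d ∷ c ∷ [])) 1 x0 (# L0) (≤! (x0 ⊕ x1) (# L1) (md v (∈-⊑ v (splitʳ s) m)) ∷ ≡! (# L1) ((# L2) ⊕ (# L0)) (spl s (e v)) ∷ ≤! (# L2) (∥ L2) (cnt-≤ (e v) D) ∷ ≤! (∥ L2) x1 h ∷ []))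

wglue : ∀ {e u v} as x cs → Walk e u (as ++ x ∷ []) x → Walk e x (x ∷ cs) v → Walk e u (as ++ x ∷ cs) v
wglue [] x cs P Q with whd x P
... | refl = Q
wglue (a ∷ []) x cs (h ◂ P) Q with whd x P
... | refl = h ◂ Q
wglue (a ∷ b ∷ as) x cs (h ◂ P) Q = h ◂ wglue (b ∷ as) x cs P Q

wcut₂ : ∀ {e u v} as x bs y cs → Walk e u (as ++ x ∷ bs ++ y ∷ cs) v →
  Walk e u (as ++ x ∷ []) x × Walk e x (x ∷ bs ++ y ∷ []) y × Walk e y (y ∷ cs) v
wcut₂ as x bs y cs W =
  let P , Q = wcut as x (bs ++ y ∷ cs) W
      Q₁ , Q₂ = wcut (x ∷ bs) y cs Q
  in P , Q₁ , Q₂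

detour : ∀ {e u v w₁ w₂} as x bs y cs D → Walk e u (as ++ x ∷ bs ++ y ∷ cs) v → e x w₁ ≡ true → Walk e w₁ D w₂ → e w₂ y ≡ true →
  Walk e u ((as ++ x ∷ []) ++ D ++ y ∷ cs) v
detour as x bs y cs D W h V h' =
  let P , _ , Q = wcut₂ as x bs y cs W in join P h (join V h' Q)

∷-tail : ∀ {a b : ℕ} {xs ys : List ℕ} → a ∷ xs ≡ b ∷ ys → xs ≡ ys
∷-tail refl = refl

-- Two sampled vertices have at least two vertices between them, so a detour through a single common
-- neighbour shortens the path.
thirds : ℕ → List ℕ → List ℕ
thirds (suc n) (x ∷ y ∷ z ∷ r) = x ∷ thirds n r
thirds _ _ = []

third₁ : ∀ n xs as x R → thirds n xs ≡ as ++ x ∷ R → Σ (List ℕ) λ as' → Σ ℕ λ a → Σ ℕ λ b → Σ (List ℕ) λ r → Σ ℕ λ n' →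
  (xs ≡ as' ++ x ∷ a ∷ b ∷ r) × (thirds n' r ≡ R) × (length as' + 3 + 3 * n' ≤ 3 * n)
third₁ zero xs [] x R ()
third₁ zero xs (_ ∷ _) x R ()
third₁ (suc n) [] [] x R ()
third₁ (suc n) [] (_ ∷ _) x R ()
third₁ (suc n) (_ ∷ []) [] x R ()
third₁ (suc n) (_ ∷ []) (_ ∷ _) x R ()
third₁ (suc n) (_ ∷ _ ∷ []) [] x R ()
third₁ (suc n) (_ ∷ _ ∷ []) (_ ∷ _) x R ()
third₁ (suc n) (.x ∷ y ∷ z ∷ r) [] x .(thirds n r) refl = [] , y , z , r , n , refl , refl , (lin (nums (n ∷ [])) 1 ((` 3) ⊕ (3 ⊛ x0)) (3 ⊛ (1+ x0)) [])
third₁ (suc n) (w ∷ y ∷ z ∷ r) (a ∷ as) x R eq with third₁ n r as x R (∷-tail eq)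
... | as' , c , d , r' , n' , refl , t , l =
  w ∷ y ∷ z ∷ as' , c , d , r' , n' , refl , t , (lin (lists [] (as' ∷ []) (n' ∷ n ∷ [])) 1 ((((` 3) ⊕ (∥ L0)) ⊕ (` 3)) ⊕ (3 ⊛ x0)) (3 ⊛ (1+ x1)) (≤! (((∥ L0) ⊕ (` 3)) ⊕ (3 ⊛ x0)) (3 ⊛ x1) l ∷ []))

third₂ : ∀ n xs as x bs y cs → thirds n xs ≡ as ++ x ∷ bs ++ y ∷ cs → Σ (List ℕ) λ as' → Σ (List ℕ) λ bs' → Σ (List ℕ) λ cs' →
  (xs ≡ as' ++ x ∷ bs' ++ y ∷ cs') × (2 ≤ length bs') × (length as' + length bs' + 2 ≤ 3 * n)
third₂ n xs as x bs y cs eq with third₁ n xs as x (bs ++ y ∷ cs) eq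
... | as' , a , b , r , n' , refl , t , l with third₁ n' r bs y cs t
... | bs' , c , d , r' , n'' , refl , _ , l' = as' , a ∷ b ∷ bs' , c ∷ d ∷ r' , refl , s≤s (s≤s z≤n) ,
  (lin (lists [] (as' ∷ bs' ∷ []) (n ∷ n' ∷ n'' ∷ [])) 1 (((∥ L0) ⊕ (1+ (1+ (∥ L1)))) ⊕ (` 2)) (3 ⊛ x0) (≤! (((∥ L0) ⊕ (` 3)) ⊕ (3 ⊛ x1)) (3 ⊛ x0) l ∷ ≤! (((∥ L1) ⊕ (` 3)) ⊕ (3 ⊛ x2)) (3 ⊛ x1) l' ∷ []))

thirds-len : ∀ n xs → 3 * n ≤ length xs → length (thirds n xs) ≡ n
thirds-len zero xs h = refl
thirds-len (suc n) [] h = (⊥-elim (1+n≰n (lin (nums (n ∷ [])) 3 (` 1) (` 0) (≤! (3 ⊛ (1+ x0)) (` 0) h ∷ []))))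
thirds-len (suc n) (_ ∷ []) h = (⊥-elim (1+n≰n (lin (nums (n ∷ [])) 2 (` 1) (` 0) (≤! (3 ⊛ (1+ x0)) (` 1) h ∷ []))))
thirds-len (suc n) (_ ∷ _ ∷ []) h = (⊥-elim (1+n≰n (lin (nums (n ∷ [])) 1 (` 1) (` 0) (≤! (3 ⊛ (1+ x0)) (` 2) h ∷ []))))
thirds-len (suc n) (x ∷ y ∷ z ∷ r) h = cong suc (thirds-len n r (lin (lists [] (r ∷ []) (n ∷ [])) 1 (3 ⊛ x0) (∥ L0) (≤! (3 ⊛ (1+ x0)) ((` 3) ⊕ (∥ L0)) h ∷ [])))

thirds-⊑ : ∀ n xs → thirds n xs ⊑ xs
thirds-⊑ zero xs = le: λ p → z≤n
thirds-⊑ (suc n) [] = le: λ p → z≤n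
thirds-⊑ (suc n) (_ ∷ []) = le: λ p → z≤n
thirds-⊑ (suc n) (_ ∷ _ ∷ []) = le: λ p → z≤n
thirds-⊑ (suc n) (x ∷ y ∷ z ∷ r) = le: λ p → (lin (env p (x ∷ y ∷ z ∷ []) ((thirds n r) ∷ r ∷ []) []) 1 ((bit 0) ⊕ (# L0)) (# (0 ▹ 1 ▹ 2 ▹ L1)) (≤! (# L0) (# L1) (⊑at (thirds-⊑ n r) p) ∷ []))

anyE : Rel → List ℕ → ℕ → Bool
anyE e [] y = false
anyE e (x ∷ hs) y = e x y ∨ anyE e hs y

-- The number of pairs among n sets times `c`, built up in the order of the induction in
-- `bonferroni`.
pairBound : ℕ → ℕ → ℕ
pairBound zero c = 0
pairBound (suc n) c = n * c + pairBound n c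

bonferroni : ∀ e c d G hs → AllPairs (λ x y → (suc c ≤ᵇ cnt (λ z → e x z ∧ e y z) G) ≡ false) hs →
  (∀ x → x ∈ hs → d ≤ cnt (e x) G) → length hs * d ≤ cnt (anyE e hs) G + pairBound (length hs) c
bonferroni e c d G [] _ _ = z≤n
bonferroni e c d G (x ∷ hs) (hx ∷ hp) deg =
  (lin (env (anyE e (x ∷ hs)) [] (G ∷ []) (d ∷ (length hs * d) ∷ (length hs * c) ∷ (pairBound (length hs) c) ∷ (cnt (anyE e hs) G) ∷ (cnt (e x) G) ∷ (cnt (λ z → e x z ∧ anyE e hs z) G) ∷ [])) 1 (x0 ⊕ x1) ((# L0) ⊕ (x2 ⊕ x3)) (≤! x1 (x4 ⊕ x3) (bonferroni e c d G hs hp (λ y m → deg y (∈-there y x hs m))) ∷ ≤! x0 x5 (deg x (∈-here x hs)) ∷ ≡! (x5 ⊕ x4) ((# L0) ⊕ x6) (cnt-∨∧ (e x) (anyE e hs) G) ∷ ≤! x6 x2 (meet hs hx) ∷ []))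
  where
  ∧∨ : ∀ a b c → b2n (a ∧ (b ∨ c)) ≤ b2n (a ∧ b) + b2n (a ∧ c)
  ∧∨ false b c = z≤n
  ∧∨ true true c = s≤s z≤n
  ∧∨ true false c = ≤-refl
  cnt-∧∨ : ∀ (p q r : ℕ → Bool) xs → cnt (λ z → p z ∧ (q z ∨ r z)) xs ≤ cnt (λ z → p z ∧ q z) xs + cnt (λ z → p z ∧ r z) xs
  cnt-∧∨ p q r [] = z≤n
  cnt-∧∨ p q r (z ∷ xs) = ≤-trans (+-mono-≤ (∧∨ (p z) (q z) (r z)) (cnt-∧∨ p q r xs))
    (≤-reflexive (swap4 (b2n (p z ∧ q z)) (b2n (p z ∧ r z)) _ _))
  meet : ∀ hs → All (λ y → (suc c ≤ᵇ cnt (λ z → e x z ∧ e y z) G) ≡ false) hs → cnt (λ z → e x z ∧ anyE e hs z) G ≤ length hs * c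
  meet [] _ = ≤-reflexive (none⇒zero _ G λ v _ h → false≢ (proj₂ (∧-true {e x v} h)))
    where
    false≢ : false ≡ true → ⊥
    false≢ ()
  meet (y ∷ hs) (hy ∷ h) = ≤-trans (cnt-∧∨ (e x) (e y) (anyE e hs) G) (+-mono-≤ (s≤s⁻¹ (≤ᵇ-false {suc c} hy)) (meet hs h))

record CommonPair (e : Rel) (c : ℕ) (G : List ℕ) (hs : List ℕ) : Set where
  constructor commonPair
  field
    {as} : List ℕ
    {x} : ℕ
    {bs} : List ℕ
    {y} : ℕ
    {cs} : List ℕ
    eq : hs ≡ as ++ x ∷ bs ++ y ∷ cs
    many : suc c ≤ cnt (λ z → e x z ∧ e y z) G

-- If all 28 pairwise intersections had at most `c` elements, the eight neighbourhoods would cover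
-- at least 8d - 28c vertices by Bonferroni's inequality. Eight is the right number for graphs on at
-- most 7m vertices with degrees above m.
findCommon : ∀ e c d G hs → length hs ≡ 8 → (∀ x → x ∈ hs → d ≤ cnt (e x) G) → length G + 28 * c < 8 * d → CommonPair e c G hs
findCommon e c d G hs l8 deg h = go (findPair (λ x y → suc c ≤ᵇ cnt (λ z → e x z ∧ e y z) G) hs)
  where
  go : (Σ (List ℕ) λ as → Σ ℕ λ x → Σ (List ℕ) λ bs → Σ ℕ λ y → Σ (List ℕ) λ cs →
    (hs ≡ as ++ x ∷ bs ++ y ∷ cs) × ((suc c ≤ᵇ cnt (λ z → e x z ∧ e y z) G) ≡ true))
    ⊎ AllPairs (λ x y → (suc c ≤ᵇ cnt (λ z → e x z ∧ e y z) G) ≡ false) hs → CommonPair e c G hs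
  go (inj₁ (as , x , bs , y , cs , eq , q)) = commonPair eq (≤ᵇ-true {suc c} q)
  go (inj₂ none) = (⊥-elim (1+n≰n (lin (env (anyE e hs) [] (G ∷ []) (d ∷ c ∷ [])) 1 (` 1) (` 0) (≤! (8 ⊛ x0) ((# L0) ⊕ ((7 ⊛ x1) ⊕ ((6 ⊛ x1) ⊕ ((5 ⊛ x1) ⊕ ((4 ⊛ x1) ⊕ ((3 ⊛ x1) ⊕ ((2 ⊛ x1) ⊕ ((1 ⊛ x1) ⊕ ((0 ⊛ x1) ⊕ (` 0)))))))))) (subst (λ l → l * d ≤ cnt (anyE e hs) G + pairBound l c) l8 (bonferroni e c d G hs none deg)) ∷ ≤! (# L0) (∥ L0) (cnt-≤ (anyE e hs) G) ∷ ≤! (1+ ((∥ L0) ⊕ (28 ⊛ x1))) (8 ⊛ x0) h ∷ []))))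

WalkIn : Rel → List ℕ → ℕ → ℕ → Set
WalkIn e G u v = Σ (List ℕ) λ xs → Walk e u xs v × (∀ x → x ∈ xs → x ∈ G)

-- A set of reachable vertices grows along edges that leave it; robustness with nothing deleted
-- supplies such an edge.
connected : ∀ {e k G} → Robust e k G → ∀ u v → u ∈ G → v ∈ G → WalkIn e G u v
connected {e} {k} {G} rob u v mu mv = go (length G) (u ∷ []) (proj₁ rm) (proj₂ rm)
    (≤-trans (m≤n+m _ 1) (≤-reflexive (sym (split-len G (u ∷ []) (proj₁ rm) (proj₂ rm))))) (s≤s z≤n) here
  where
  rm = ∈-remove u G mu
  here : ∀ a → a ∈ (u ∷ []) → WalkIn e G u a
  here a m with ∈-∷⁻ a u [] m
  ... | inj₁ refl = u ∷ [] , [ u ] , λ x mx → one x (∈-∷⁻ x u [] mx)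
    where
    one : ∀ x → x ≡ u ⊎ x ∈ [] → x ∈ G
    one x (inj₁ refl) = mu
  go : ∀ f A B → Split G A B → length B ≤ f → 1 ≤ length A → (∀ a → a ∈ A → WalkIn e G u a) → WalkIn e G u v
  go f A B s hf lA h with split-∈ s v mv
  ... | inj₁ m = h v m
  go zero A [] s hf lA h | inj₂ ()
  go (suc f) A B s hf lA h | inj₂ m with search (λ a → 1 ≤ᵇ cnt (e a) B) A
  ... | inj₂ none = ⊥-elim (rob [] G A B (sp: λ p → refl) s z≤n lA (≤-trans m (cnt-≤ (v ≡ᵇ_) B))
          λ a b ma mb → cnt-zero (e a) B (n<1⇒n≡0 (≤ᵇ-false {1} (none a ma))) b mb)
  ... | inj₁ (a , ma , q) with pick (e a) B (≤ᵇ-true {1} q)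
  ... | b , B' , sB , ab = go f (b ∷ A) B' (sp: λ p → (lin≡ (env p (b ∷ []) (G ∷ A ∷ B' ∷ B ∷ []) []) 1 (# L0) ((# (0 ▹ L1)) ⊕ (# L2)) (≡! (# L0) ((# L1) ⊕ (# L3)) (spl s p) ∷ ≡! (# L3) ((# (0 ▹ nil)) ⊕ (# L2)) (spl sB p) ∷ [])))
          (lin (lists [] (B' ∷ B ∷ []) (f ∷ [])) 1 (∥ L0) x0 (≡˘ ((` 1) ⊕ (∥ L0)) (∥ L1) (split-len B (b ∷ []) B' sB) ∷ ≤! (∥ L1) (1+ x0) hf ∷ [])) (s≤s z≤n) ext
    where
    ext : ∀ x → x ∈ (b ∷ A) → WalkIn e G u x
    ext x mx with ∈-∷⁻ x b A mx
    ... | inj₂ mA = h x mA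
    ... | inj₁ refl with h a ma
    ... | xs , W , inG = xs ++ b ∷ [] , snoc W ab , λ y my → [_,_]′ (inG y) (λ q → one y (∈-∷⁻ y b [] q)) (∈-++⁻ y xs (b ∷ []) my)
      where
      one : ∀ y → y ≡ b ⊎ y ∈ [] → y ∈ G
      one y (inj₁ refl) = ∈-⊑ b (⊑-trans (splitˡ sB) (splitʳ s)) (∈-here b [])

record PathIn (e : Rel) (G : List ℕ) (u v : ℕ) : Set where
  constructor pathIn
  field
    xs : List ℕ
    W : Walk e u xs v
    inG : xs ⊑ G

record ShortPath (e : Rel) (G : List ℕ) (u v : ℕ) : Set where
  constructor shortPath
  field
    xs : List ℕ
    W : Walk e u xs v
    inG : xs ⊑ G
    short : length xs ≤ 24

-- A long walk has two vertices at distance at least 3 along it with a common neighbour.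
shorten-walk : ∀ {e d G} → SymR e → MinDeg e d G → length G < 8 * d → ∀ f {u v} xs → length xs ≤ f → Walk e u xs v → (∀ x → x ∈ xs → x ∈ G) →
  ShortPath e G u v
shorten-walk sy md lG zero xs hf W inG = (⊥-elim (1+n≰n (lin (lists [] (xs ∷ []) []) 1 (` 1) (` 0) (≤! (∥ L0) (` 0) hf ∷ ≤! (` 1) (∥ L0) (wlen W) ∷ []))))
shorten-walk {e} {d} {G} sy md lG (suc f) {u} {v} xs hf W inG = go (≤-total 24 (length xs)) (dup? xs)
  where
  rec : ∀ ys → length ys < length xs → Walk e u ys v → (∀ y → y ∈ ys → y ∈ G) → ShortPath e G u v
  rec ys l V h = shorten-walk sy md lG f ys (lin (lists [] (ys ∷ xs ∷ []) (f ∷ [])) 1 (∥ L0) x0 (≤! (1+ (∥ L0)) (∥ L1) l ∷ ≤! (∥ L1) (1+ x0) hf ∷ [])) V h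
  cutDup : ∀ as x bs cs → xs ≡ as ++ x ∷ bs ++ x ∷ cs → ShortPath e G u v
  cutDup as x bs cs refl = rec (as ++ x ∷ cs) (lin (lists (x ∷ []) (as ∷ cs ∷ bs ∷ []) []) 1 (1+ (∥ (L0 ⧺ 0 ▹ L1))) (∥ (L0 ⧺ 0 ▹ L2 ⧺ 0 ▹ L1)) [])
    (let P , _ , Q = wcut₂ as x bs x cs W in wglue as x cs P Q)
    λ y my → inG y (lin (env (y ≡ᵇ_) (x ∷ []) (as ∷ bs ∷ cs ∷ []) []) 1 (` 1) (# (L0 ⧺ 0 ▹ L1 ⧺ 0 ▹ L2)) (≤! (` 1) (# (L0 ⧺ 0 ▹ L2)) my ∷ []))
  long : 24 ≤ length xs → ShortPath e G u v
  long h = go₁ (findCommon e 0 d G (thirds 8 xs) (thirds-len 8 xs h) (λ x m → md x (inG x (∈-⊑ x (thirds-⊑ 8 xs) m)))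
      (lin (lists [] (G ∷ []) (d ∷ [])) 1 (1+ ((∥ L0) ⊕ (28 ⊛ (` 0)))) (8 ⊛ x0) (≤! (1+ (∥ L0)) (8 ⊛ x0) lG ∷ [])))
    where
    go₁ : CommonPair e 0 G (thirds 8 xs) → ShortPath e G u v
    go₁ (commonPair {as} {x} {bs} {y} {cs} eq many) with third₂ 8 xs as x bs y cs eq | cnt-wit (λ z → e x z ∧ e y z) G many
    ... | as' , bs' , cs' , refl , l , _ | w , mw , q =
      rec ((as' ++ x ∷ []) ++ (w ∷ []) ++ y ∷ cs') (lin (lists (x ∷ w ∷ y ∷ []) (as' ∷ cs' ∷ bs' ∷ []) []) 1 (1+ (∥ ((L0 ⧺ 0 ▹ nil) ⧺ (1 ▹ nil) ⧺ 2 ▹ L1))) (∥ (L0 ⧺ 0 ▹ L2 ⧺ 2 ▹ L1)) (≤! (` 2) (∥ L2) l ∷ []))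
        (detour as' x bs' y cs' (w ∷ []) W (proj₁ (∧-true q)) [ w ] (trans (sy w y) (proj₂ (∧-true q))))
        mem
      where
      mem : ∀ z → z ∈ ((as' ++ x ∷ []) ++ (w ∷ []) ++ y ∷ cs') → z ∈ G
      mem z m with bool (z ≡ᵇ w)
      ... | inj₁ t rewrite ==-true {z} {w} t = mw
      ... | inj₂ t = inG z (lin (env (z ≡ᵇ_) (x ∷ y ∷ w ∷ []) (as' ∷ bs' ∷ cs' ∷ []) []) 1 (` 1) (# (L0 ⧺ 0 ▹ L1 ⧺ 1 ▹ L2)) (≤! (` 1) (# ((L0 ⧺ 0 ▹ nil) ⧺ (2 ▹ nil) ⧺ 1 ▹ L2)) m ∷ ≡! (bit 2) (` 0) (b2n-f t) ∷ []))
  go : (24 ≤ length xs) ⊎ (length xs ≤ 24) → NoDup xs ⊎ (Σ (List ℕ) λ as → Σ ℕ λ x → Σ (List ℕ) λ bs → Σ (List ℕ) λ cs → xs ≡ as ++ x ∷ bs ++ x ∷ cs) → ShortPath e G u v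
  go (inj₁ h) _ = long h
  go (inj₂ h) (inj₁ nd) = shortPath xs W (sub xs G nd inG) h
  go (inj₂ h) (inj₂ (as , x , bs , cs , eq)) = cutDup as x bs cs eq

link : ∀ {e k d G} → SymR e → Robust e k G → MinDeg e d G → length G < 8 * d → ∀ u v → u ∈ G → v ∈ G → ShortPath e G u v
link sy rob md lG u v mu mv = let xs , W , inG = connected rob u v mu mv in shorten-walk sy md lG (length xs) xs ≤-refl W inG

-- Long paths

splitAt' : ∀ n (xs : List ℕ) → Σ (List ℕ) λ X → Σ (List ℕ) λ Y → (xs ≡ X ++ Y) × (length X ≤ n) × (length X ≡ n ⊎ Y ≡ [])
splitAt' zero xs = [] , xs , refl , z≤n , inj₁ refl
splitAt' (suc n) [] = [] , [] , refl , z≤n , inj₂ refl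
splitAt' (suc n) (x ∷ xs) with splitAt' n xs
... | X , Y , refl , l , inj₁ q = x ∷ X , Y , refl , s≤s l , inj₁ (cong suc q)
... | X , Y , refl , l , inj₂ q = x ∷ X , Y , refl , s≤s l , inj₂ q

module Gaps (s a : ℕ → Bool) (g : ℕ) where

  data Close (x z : ℕ) (l : ℕ) : Set where
    near-ss : s x ≡ true → s z ≡ true → l ≡ 0 → Close x z l
    near-sa : s x ≡ true → a z ≡ true → l ≤ g → Close x z l
    near-as : a x ≡ true → s z ≡ true → l ≤ g → Close x z l
    near-aa : a x ≡ true → a z ≡ true → l ≤ g → Close x z l

  ClosePair : List ℕ → Set
  ClosePair P = Σ (List ℕ) λ as → Σ ℕ λ x → Σ (List ℕ) λ bs → Σ ℕ λ z → Σ (List ℕ) λ cs →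
    (P ≡ as ++ x ∷ bs ++ z ∷ cs) × Close x z (length bs)

  prefix : ∀ X {P} → ClosePair P → ClosePair (X ++ P)
  prefix X (as , x , bs , z , cs , refl , c) = X ++ as , x , bs , z , cs , sym (++-assoc X as _) , c

  -- Without a close pair, an a-mark is followed by g + 1 unmarked vertices, and the block of g + 2
  -- pays for its weight g and for a possible s-mark at the same vertex. Any other s-mark is
  -- followed by one unmarked vertex and pays for its weight 2. Only the last block may be cut off,
  -- at a cost of at most 1 + g.
  gaps : ∀ f P → length P ≤ f → ClosePair P ⊎ (2 * cnt s P + g * cnt a P ≤ length P + 1 + g)
  gaps f [] hf = inj₂ (lin (nums ((g * cnt a []) ∷ g ∷ [])) 1 x0 ((` 1) ⊕ x1) (≡! x0 (` 0) (*-zeroʳ g) ∷ []))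
  gaps (suc f) (x ∷ xs) hf with bool (a x)
  ... | inj₁ ax = far (splitAt' (suc g) xs)
    where
    far : (Σ (List ℕ) λ X → Σ (List ℕ) λ Y → (xs ≡ X ++ Y) × (length X ≤ suc g) × (length X ≡ suc g ⊎ Y ≡ [])) →
      ClosePair (x ∷ xs) ⊎ (2 * cnt s (x ∷ xs) + g * cnt a (x ∷ xs) ≤ length (x ∷ xs) + 1 + g)
    far (X , Y , refl , lX , end) with search (λ z → s z ∨ a z) X
    ... | inj₁ (z , mz , q) = inj₁ (hit (∈-split z X mz))
      where
      kind : ∀ l → l ≤ g → Close x z l
      kind l h with s z in eq
      ... | true = near-as ax eq h
      ... | false = near-aa ax q h
      hit : (Σ (List ℕ) λ ys → Σ (List ℕ) λ zs → X ≡ ys ++ z ∷ zs) → ClosePair (x ∷ X ++ Y)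
      hit (ys , zs , refl) = [] , x , ys , z , zs ++ Y , cong (x ∷_) (++-assoc ys (z ∷ zs) Y) ,
        kind (length ys) (lin (lists (z ∷ []) (ys ∷ zs ∷ []) (g ∷ [])) 1 (∥ L0) x0 (≤! (∥ (L0 ⧺ 0 ▹ L1)) (1+ x0) lX ∷ []))
    ... | inj₂ none with gaps f Y (lin (lists [] (Y ∷ X ∷ []) (f ∷ [])) 1 (∥ L0) x0 (≤! (1+ (∥ (L1 ⧺ L0))) (1+ x0) hf ∷ []))
    ... | inj₁ c = inj₁ (prefix (x ∷ X) c)
    ... | inj₂ ih = inj₂ (fin end)
      where
      s0 : cnt s X ≡ 0
      s0 = none⇒zero s X λ v m h → t≢f (cong (_∨ a v) h) (none v m)
      a0 : cnt a X ≡ 0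
      a0 = none⇒zero a X λ v m h → t≢f h (∨-f {s v} (none v m))
        where
        ∨-f : ∀ {p q} → p ∨ q ≡ false → q ≡ false
        ∨-f {false} h = h
      sx = b2n-≤1 (s x)
      ae : g * cnt a (x ∷ X ++ Y) ≡ g + g * cnt a Y
      ae = trans (cong (g *_) (trans (cong₂ _+_ (b2n-t ax) (trans (cnt-++ a X Y) (cong (_+ cnt a Y) a0))) refl)) (*-suc g (cnt a Y))
      fin : length X ≡ suc g ⊎ Y ≡ [] → 2 * cnt s (x ∷ X ++ Y) + g * cnt a (x ∷ X ++ Y) ≤ length (x ∷ X ++ Y) + 1 + g
      fin (inj₁ l) = (lin (env s (x ∷ []) (X ∷ Y ∷ []) ((g * cnt a (x ∷ X ++ Y)) ∷ g ∷ (g * cnt a Y) ∷ [])) 1 ((2 ⊛ (# (0 ▹ L0 ⧺ L1))) ⊕ x0) (((∥ (0 ▹ L0 ⧺ L1)) ⊕ (` 1)) ⊕ x1) (≤! ((2 ⊛ (# L1)) ⊕ x2) (((∥ L1) ⊕ (` 1)) ⊕ x1) ih ∷ 2 ×! ≡! (# L0) (` 0) s0 ∷ ≡! x0 (x1 ⊕ x2) ae ∷ 2 ×! ≤! (bit 0) (` 1) sx ∷ ≡˘ (1+ x1) (∥ L0) l ∷ []))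
      fin (inj₂ refl) = (lin (env s (x ∷ []) (X ∷ []) ((g * cnt a (x ∷ X ++ [])) ∷ g ∷ (g * cnt a []) ∷ [])) 1 ((2 ⊛ (# (0 ▹ L0 ⧺ nil))) ⊕ x0) (((∥ (0 ▹ L0 ⧺ nil)) ⊕ (` 1)) ⊕ x1) (2 ×! ≡! (# L0) (` 0) s0 ∷ ≡! x0 (x1 ⊕ x2) ae ∷ ≡! x2 (` 0) (*-zeroʳ g) ∷ 2 ×! ≤! (bit 0) (` 1) sx ∷ []))
  gaps (suc f) (x ∷ xs) hf | inj₂ ax with bool (s x)
  gaps (suc f) (x ∷ xs) hf | inj₂ ax | inj₂ sx with gaps f xs (s≤s⁻¹ hf)
  ... | inj₁ c = inj₁ (prefix (x ∷ []) c)
  ... | inj₂ ih = inj₂ (subst₂ (λ p q → 2 * (b2n p + cnt s xs) + g * (b2n q + cnt a xs) ≤ suc (length xs) + 1 + g) (sym sx) (sym ax) (m≤n⇒m≤1+n ih))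
  gaps (suc f) (x ∷ []) hf | inj₂ ax | inj₁ sx = inj₂ (lin (env s (x ∷ []) [] ((g * cnt a (x ∷ [])) ∷ g ∷ [])) 1 ((2 ⊛ (# (0 ▹ nil))) ⊕ x0) (((` 1) ⊕ (` 1)) ⊕ x1) (2 ×! ≤! (bit 0) (` 1) (b2n-≤1 (s x)) ∷ ≡! x0 (` 0) (trans (cong (λ b → g * (b2n b + 0)) ax) (*-zeroʳ g)) ∷ []))
  gaps (suc f) (x ∷ z ∷ D) hf | inj₂ ax | inj₁ sx with bool (a z) | bool (s z)
  ... | inj₁ az | _ = inj₁ ([] , x , [] , z , D , refl , near-sa sx az z≤n)
  ... | inj₂ az | inj₁ sz = inj₁ ([] , x , [] , z , D , refl , near-ss sx sz refl)
  ... | inj₂ az | inj₂ sz with gaps f D (≤-trans (n≤1+n _) (s≤s⁻¹ hf))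
  ... | inj₁ c = inj₁ (prefix (x ∷ z ∷ []) c)
  ... | inj₂ ih = inj₂ (lin (env s (x ∷ z ∷ []) (D ∷ []) ((g * cnt a (x ∷ z ∷ D)) ∷ g ∷ (g * cnt a D) ∷ [])) 1 ((2 ⊛ (# (0 ▹ 1 ▹ L0))) ⊕ x0) (((∥ (0 ▹ 1 ▹ L0)) ⊕ (` 1)) ⊕ x1) (2 ×! ≤! (bit 0) (` 1) (b2n-≤1 (s x)) ∷ 2 ×! ≡! (bit 1) (` 0) (b2n-f sz) ∷ ≡! x0 x2 (cong₂ (λ p q → g * (b2n p + (b2n q + cnt a D))) ax az) ∷ ≤! ((2 ⊛ (# L0)) ⊕ x2) (((∥ L0) ⊕ (` 1)) ⊕ x1) ih ∷ []))

half : ∀ r → Σ ℕ λ g → (2 * g ≤ r) × (r ≤ 2 * g + 1)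
half zero = 0 , z≤n , z≤n
half (suc zero) = 0 , z≤n , ≤-refl
half (suc (suc r)) = let g , l , h = half r in suc g , (lin (nums (g ∷ r ∷ [])) 1 (2 ⊛ (1+ x0)) (1+ (1+ x1)) (≤! (2 ⊛ x0) x1 l ∷ [])) , (lin (nums (r ∷ g ∷ [])) 1 (1+ (1+ x0)) ((2 ⊛ (1+ x1)) ⊕ (` 1)) (≤! x0 ((2 ⊛ x1) ⊕ (` 1)) h ∷ []))

record Arc (e : Rel) (O : List ℕ) (g o₁ o₂ : ℕ) : Set where
  constructor arc
  field
    M : List ℕ
    W : Walk e o₁ (o₁ ∷ M ++ o₂ ∷ []) o₂
    inO : (o₁ ∷ M ++ o₂ ∷ []) ⊑ O
    long : g ≤ suc (length M)

-- The two arcs between o₁ and o₂ share out all |O| edges of the cycle, so one of them has at least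
-- g edges; `suc (length M)` is its number of edges.
longArc : ∀ {e u v} O → SymR e → Walk e u O v → e v u ≡ true → ∀ g → 2 * g ≤ length O → ∀ o₁ o₂ → (o₁ ∷ o₂ ∷ []) ⊑ O → Arc e O g o₁ o₂
longArc {e} {u} {v} O sy W cl g hg o₁ o₂ h = go (∈-split o₁ O (≤-trans (∈-here o₁ (o₂ ∷ [])) (⊑at h (o₁ ≡ᵇ_))))
  where
  go : (Σ (List ℕ) λ X → Σ (List ℕ) λ Y → O ≡ X ++ o₁ ∷ Y) → Arc e O g o₁ o₂
  go (X , Y , refl) = go₂ (∈-split o₂ (Y ++ X) (lin (env (o₂ ≡ᵇ_) (o₁ ∷ o₂ ∷ []) (Y ∷ X ∷ []) []) 1 (` 1) (# (L0 ⧺ L1)) (≤! (# (0 ▹ 1 ▹ nil)) (# (L1 ⧺ 0 ▹ L0)) (⊑at h (o₂ ≡ᵇ_)) ∷ ≡˘ (` 1) (bit 1) (b2n-t (==-refl o₂)) ∷ [])))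
    where
    closed : Walk e o₁ (o₁ ∷ Y ++ X ++ o₁ ∷ []) o₁
    closed = let V , h' = rot X o₁ Y W cl in h' ◂ V
    go₂ : (Σ (List ℕ) λ R₁ → Σ (List ℕ) λ R₂ → Y ++ X ≡ R₁ ++ o₂ ∷ R₂) → Arc e (X ++ o₁ ∷ Y) g o₁ o₂
    go₂ (R₁ , R₂ , eq) = pickArc (≤-total g (suc (length R₁)))
      where
      closed' : Walk e o₁ (o₁ ∷ R₁ ++ o₂ ∷ (R₂ ++ o₁ ∷ [])) o₁
      closed' = subst (λ l → Walk e o₁ (o₁ ∷ l) o₁) (trans (sym (++-assoc Y X (o₁ ∷ []))) (trans (cong (_++ o₁ ∷ []) eq) (++-assoc R₁ (o₂ ∷ R₂) (o₁ ∷ [])))) closed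
      parts = wcut (o₁ ∷ R₁) o₂ (R₂ ++ o₁ ∷ []) closed'
      ce : ∀ p → cnt p Y + cnt p X ≡ cnt p R₁ + (b2n (p o₂) + cnt p R₂)
      ce p = trans (sym (cnt-++ p Y X)) (trans (cong (cnt p) eq) (cnt-++ p R₁ (o₂ ∷ R₂)))
      le' : length Y + length X ≡ length R₁ + suc (length R₂)
      le' = trans (sym (length-++ Y)) (trans (cong length eq) (length-++ R₁))
      revEq : reverse (o₂ ∷ R₂ ++ o₁ ∷ []) ≡ o₁ ∷ reverse R₂ ++ o₂ ∷ []
      revEq = trans (unfold-reverse o₂ (R₂ ++ o₁ ∷ [])) (cong (_++ o₂ ∷ []) (reverse-++ R₂ (o₁ ∷ [])))
      pickArc : g ≤ suc (length R₁) ⊎ suc (length R₁) ≤ g → Arc e (X ++ o₁ ∷ Y) g o₁ o₂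
      pickArc (inj₁ l) = arc R₁ (proj₁ parts) (le: λ p → (lin (env p (o₁ ∷ o₂ ∷ []) (R₁ ∷ X ∷ Y ∷ R₂ ∷ []) []) 1 (# (0 ▹ L0 ⧺ 1 ▹ nil)) (# (L1 ⧺ 0 ▹ L2)) (≡˘ ((# L0) ⊕ ((bit 1) ⊕ (# L3))) ((# L2) ⊕ (# L1)) (ce p) ∷ []))) l
      pickArc (inj₂ l) = arc (reverse R₂) (subst (λ l → Walk e o₁ l o₂) revEq (wrev sy (proj₂ parts)))
        (le: λ p → (lin (env p (o₁ ∷ o₂ ∷ []) (R₂ ∷ X ∷ Y ∷ R₁ ∷ []) []) 1 (# (0 ▹ (rev L0) ⧺ 1 ▹ nil)) (# (L1 ⧺ 0 ▹ L2)) (≡˘ ((# L3) ⊕ ((bit 1) ⊕ (# L0))) ((# L2) ⊕ (# L1)) (ce p) ∷ [])))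
        (lin (lists (o₁ ∷ []) (R₂ ∷ R₁ ∷ X ∷ Y ∷ []) (g ∷ [])) 1 x0 (1+ (∥ (rev L0))) (≤! (1+ (∥ L1)) x0 l ∷ ≤! (2 ⊛ x0) (∥ (L2 ⧺ 0 ▹ L3)) hg ∷ ≡! ((∥ L3) ⊕ (∥ L2)) ((∥ L1) ⊕ (1+ (∥ L0))) le' ∷ []))

record MaxPath (e : Rel) (X : List ℕ) : Set where
  constructor maxPath
  field
    {y z} : ℕ
    Q X' : List ℕ
    W : Walk e y Q z
    sX : Split X Q X'
    stuck : cnt (e y) X' ≡ 0

maximal : ∀ {e X} → SymR e → ∀ f {y z} Q X' → Walk e y Q z → Split X Q X' → length X' ≤ f → MaxPath e X
maximal {e} {X} sy f {y} Q X' W s hf with cnt (e y) X' in eq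
... | zero = maxPath Q X' W s eq
maximal {e} {X} sy zero {y} Q X' W s hf | suc c = (⊥-elim (1+n≰n (lin (env (e y) [] (X' ∷ []) (c ∷ [])) 1 (` 1) (` 0) (≡˘ (1+ x0) (# L0) eq ∷ ≤! (# L0) (∥ L0) (cnt-≤ (e y) X') ∷ ≤! (∥ L0) (` 0) hf ∷ []))))
maximal {e} {X} sy (suc f) {y} Q X' W s hf | suc c with pick (e y) X' (subst (1 ≤_) (sym eq) (s≤s z≤n))
... | w , X'' , sX , yw = maximal sy f (w ∷ Q) X'' (trans (sy w y) yw ◂ W)
  (sp: λ p → (lin≡ (env p (w ∷ []) (X ∷ Q ∷ X'' ∷ X' ∷ []) []) 1 (# L0) ((# (0 ▹ L1)) ⊕ (# L2)) (≡! (# L0) ((# L1) ⊕ (# L3)) (spl s p) ∷ ≡! (# L3) ((# (0 ▹ nil)) ⊕ (# L2)) (spl sX p) ∷ [])))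
  (lin (lists [] (X'' ∷ X' ∷ []) (f ∷ [])) 1 (∥ L0) x0 (≡˘ ((` 1) ⊕ (∥ L0)) (∥ L1) (split-len X' (w ∷ []) X'' sX) ∷ ≤! (∥ L1) (1+ x0) hf ∷ []))

-- A path from `o` to `p` with inside `I`, where `q` is the last vertex before `p`. The walk leaves
-- out `p` itself, which is listed with the path that the link hits; for empty `I` the vertices `o`
-- and `q` coincide.
record Link (e : Rel) : Set where
  constructor mkLink
  field
    {o q} p : ℕ
    I : List ℕ
    W : Walk e o (o ∷ I) q
    qp : e q p ≡ true

links-I links-o links-p : ∀ {e} → List (Link e) → List ℕ
links-I [] = []
links-I (l ∷ ls) = Link.I l ++ links-I ls
links-o [] = []
links-o (l ∷ ls) = Link.o l ∷ links-o ls
links-p [] = []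
links-p (l ∷ ls) = Link.p l ∷ links-p ls

find-link : ∀ {e} (ls : List (Link e)) x → x ∈ links-p ls → Σ (Link e) λ l → Σ (List (Link e)) λ ls' → (Link.p l ≡ x) ×
  Split (links-I ls) (Link.I l) (links-I ls') × Split (links-o ls) (Link.o l ∷ []) (links-o ls') × Split (links-p ls) (x ∷ []) (links-p ls')
find-link (l ∷ ls) x m with ∈-∷⁻ x (Link.p l) (links-p ls) m
... | inj₁ refl = l , ls , refl , sp: (λ p → cnt-++ p (Link.I l) (links-I ls)) ,
  sp: (λ p → (lin≡ (env p ((Link.o l) ∷ []) ((links-o ls) ∷ []) []) 1 (# (0 ▹ L0)) ((# (0 ▹ nil)) ⊕ (# L0)) [])) ,
  sp: (λ p → (lin≡ (env p (x ∷ []) ((links-p ls) ∷ []) []) 1 (# (0 ▹ L0)) ((# (0 ▹ nil)) ⊕ (# L0)) []))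
... | inj₂ m' with find-link ls x m'
... | k , ls' , eq , sI , so , sP = k , l ∷ ls' , eq ,
  sp: (λ p → (lin≡ (env p [] ((Link.I l) ∷ (links-I ls) ∷ (Link.I k) ∷ (links-I ls') ∷ []) []) 1 (# (L0 ⧺ L1)) ((# L2) ⊕ (# (L0 ⧺ L3))) (≡! (# L1) ((# L2) ⊕ (# L3)) (spl sI p) ∷ []))) ,
  sp: (λ p → (lin≡ (env p ((Link.o l) ∷ (Link.o k) ∷ []) ((links-o ls) ∷ (links-o ls') ∷ []) []) 1 (# (0 ▹ L0)) ((# (1 ▹ nil)) ⊕ (# (0 ▹ L1))) (≡! (# L0) ((# (1 ▹ nil)) ⊕ (# L1)) (spl so p) ∷ []))) ,
  sp: (λ p → (lin≡ (env p ((Link.p l) ∷ x ∷ []) ((links-p ls) ∷ (links-p ls') ∷ []) []) 1 (# (0 ▹ L0)) ((# (1 ▹ nil)) ⊕ (# (0 ▹ L1))) (≡! (# L0) ((# (1 ▹ nil)) ⊕ (# L1)) (spl sP p) ∷ [])))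

LongerPath : Rel → List ℕ → ℕ → ℕ → ℕ → Set
LongerPath e G u v n = Σ (PathIn e G u v) λ P → n < length (PathIn.xs P)

Irr : Rel → Set
Irr e = ∀ x → e x x ≡ false

-- Let y be the end of a maximal path outside of P, and O the cycle that y closes with its last neighbour
-- on that path. Five disjoint links lead from O to P; a detour through O between two of the link ends and
-- neighbours of y on P makes P longer unless these marks are so far apart that P is long anyway.
module Improve (e : Rel) (sy : SymR e) (irr : Irr e) (G : List ℕ) (dG : NoDup G) (k m c : ℕ) (md : MinDeg e (m + c) G) (hc : 140 ≤ c)
  (rob : Robust e k G) (hk : 131 ≤ k) (lG : length G ≤ 7 * m) {u v : ℕ} (P : List ℕ) (W : Walk e u P v) (P⊑G : P ⊑ G)
  (lP : 6 ≤ length P) (P<2m : length P < 2 * m) where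

  Goal : Set
  Goal = LongerPath e G u v (length P)

  reroute : ∀ as x bs z cs {w₁ w₂} D → P ≡ as ++ x ∷ bs ++ z ∷ cs → e x w₁ ≡ true → Walk e w₁ D w₂ → e w₂ z ≡ true → (D ++ P) ⊑ G →
    length bs < length D → Goal
  reroute as x bs z cs D refl h V h' inG l = pathIn ((as ++ x ∷ []) ++ D ++ z ∷ cs) (detour as x bs z cs D W h V h')
    (le: λ p → (lin (env p (x ∷ z ∷ []) (as ∷ D ∷ cs ∷ G ∷ bs ∷ []) []) 1 (# ((L0 ⧺ 0 ▹ nil) ⧺ L1 ⧺ 1 ▹ L2)) (# L3) (≤! (# (L1 ⧺ L0 ⧺ 0 ▹ L4 ⧺ 1 ▹ L2)) (# L3) (⊑at inG p) ∷ []))) ,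
    (lin (lists (x ∷ z ∷ []) (as ∷ bs ∷ cs ∷ D ∷ []) []) 1 (1+ (∥ (L0 ⧺ 0 ▹ L1 ⧺ 1 ▹ L2))) (∥ ((L0 ⧺ 0 ▹ nil) ⧺ L3 ⧺ 1 ▹ L2)) (≤! (1+ (∥ L1)) (∥ L3) l ∷ []))

  module Round {y w : ℕ} (O : List ℕ) (WO : Walk e y O w) (clO : e w y ≡ true) (OP : (O ++ P) ⊑ G) (lO : 9 ≤ length O) where

    -- Below the duplicate-free `G`, these inclusions say that the insides are disjoint from each
    -- other, from `O` and from `P`, and that the ends on either side are distinct. The vertex `y`
    -- is kept free of links, as it serves as an end itself.
    record Links (j : ℕ) : Set where
      constructor links
      field
        ls : List (Link e)
        inG : (O ++ P ++ links-I ls) ⊑ G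
        os : (y ∷ links-o ls) ⊑ O
        ps : links-p ls ⊑ P
        len : length ls ≡ j
        lenI : length (links-I ls) ≤ 24 * j

    length-o : ∀ (ls : List (Link e)) → length (links-o ls) ≡ length ls
    length-o [] = refl
    length-o (l ∷ ls) = cong suc (length-o ls)
    length-p : ∀ (ls : List (Link e)) → length (links-p ls) ≡ length ls
    length-p [] = refl
    length-p (l ∷ ls) = cong suc (length-p ls)

    -- Greedy choice in place of Menger's theorem: `y`, the earlier links and their ends are few
    -- vertices since links are short, so robustness still joins `O` to `P` after they are deleted.
    -- On the joining path, the stretch from the last vertex of `O` before the first vertex of `P`
    -- up to this vertex is a new link.
    next : ∀ {j} → j ≤ 4 → Links j → Links (suc j)
    next {j} hj (links ls inG os ps len lenI) = go (diff⊑ D G D⊑G)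
      where
      I = links-I ls
      D = y ∷ links-o ls ++ links-p ls ++ I
      D⊑G : D ⊑ G
      D⊑G = le: λ p → (lin (env p (y ∷ []) ((links-o ls) ∷ (links-p ls) ∷ I ∷ G ∷ O ∷ P ∷ []) []) 1 (# (0 ▹ L0 ⧺ L1 ⧺ L2)) (# L3) (≤! (# (L4 ⧺ L5 ⧺ L2)) (# L3) (⊑at inG p) ∷ ≤! (# (0 ▹ L0)) (# L4) (⊑at os p) ∷ ≤! (# L1) (# L5) (⊑at ps p) ∷ []))
      lD : length D ≤ 131
      lD = (lin (lists (y ∷ []) (D ∷ (links-o ls) ∷ (links-p ls) ∷ I ∷ []) ((length ls) ∷ j ∷ [])) 1 (∥ L0) (` 131) (≡! (∥ L0) (∥ (0 ▹ L1 ⧺ L2 ⧺ L3)) (refl {x = length D}) ∷ ≡! (∥ L1) x0 (length-o ls) ∷ ≡! (∥ L2) x0 (length-p ls) ∷ 2 ×! ≡! x0 x1 len ∷ ≤! (∥ L3) (24 ⊛ x1) lenI ∷ 26 ×! ≤! x1 (` 4) hj ∷ []))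
      go : Σ (List ℕ) (λ G' → Split G D G') → Links (suc j)
      go (G' , sG) = fresh (diff⊑ (y ∷ links-o ls) O os) (diff⊑ (links-p ls) P ps)
        where
        notD : ∀ x → x ∈ G' → occ x D ≡ 0
        notD x m = (≤-antisym (lin (env (x ≡ᵇ_) [] (D ∷ G' ∷ G ∷ []) []) 1 (# L0) (` 0) (≡˘ ((# L0) ⊕ (# L1)) (# L2) (spl sG (x ≡ᵇ_)) ∷ ≤! (# L2) (` 1) (dG x) ∷ ≤! (` 1) (# L1) m ∷ [])) (lin (env (x ≡ᵇ_) [] (D ∷ []) []) 1 (` 0) (# L0) []))
        fresh : Σ (List ℕ) (λ O' → Split O (y ∷ links-o ls) O') → Σ (List ℕ) (λ P' → Split P (links-p ls) P') → Links (suc j)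
        fresh (O' , sO) (P' , sP) = connect (member O' lO') (member P' lP')
          where
          lO' : 1 ≤ length O'
          lO' = (lin (lists [] (O' ∷ O ∷ (links-o ls) ∷ []) ((length ls) ∷ j ∷ [])) 4 (` 1) (∥ L0) (≡! (∥ L1) ((1+ (∥ L2)) ⊕ (∥ L0)) (split-len O (y ∷ links-o ls) O' sO) ∷ ≤! (` 9) (∥ L1) lO ∷ ≡! (∥ L2) x0 (length-o ls) ∷ ≡! x0 x1 len ∷ ≤! x1 (` 4) hj ∷ []))
          lP' : 1 ≤ length P'
          lP' = (lin (lists [] (P' ∷ P ∷ (links-p ls) ∷ []) ((length ls) ∷ j ∷ [])) 2 (` 1) (∥ L0) (≡! (∥ L1) ((∥ L2) ⊕ (∥ L0)) (split-len P (links-p ls) P' sP) ∷ ≤! (` 6) (∥ L1) lP ∷ ≡! (∥ L2) x0 (length-p ls) ∷ ≡! x0 x1 len ∷ ≤! x1 (` 4) hj ∷ []))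
          member : ∀ xs → 1 ≤ length xs → Σ ℕ λ x → x ∈ xs
          member (x ∷ xs) _ = x , ∈-here x xs
          o∈G' : ∀ x → x ∈ O' → x ∈ G'
          o∈G' x m = (lin (env (x ≡ᵇ_) (y ∷ []) (G' ∷ O' ∷ (links-o ls) ∷ O ∷ (links-p ls) ∷ P ∷ I ∷ G ∷ []) []) 1 (` 1) (# L0) (≤! (` 1) (# L1) m ∷ ≡˘ ((# (0 ▹ L2)) ⊕ (# L1)) (# L3) (spl sO (x ≡ᵇ_)) ∷ ≤! (# L4) (# L5) (⊑at ps (x ≡ᵇ_)) ∷ ≤! (# (L3 ⧺ L5 ⧺ L6)) (# L7) (⊑at inG (x ≡ᵇ_)) ∷ ≡! (# L7) ((# (0 ▹ L2 ⧺ L4 ⧺ L6)) ⊕ (# L0)) (spl sG (x ≡ᵇ_)) ∷ []))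
          p∈G' : ∀ x → x ∈ P' → x ∈ G'
          p∈G' x m = (lin (env (x ≡ᵇ_) (y ∷ []) (G' ∷ P' ∷ (links-p ls) ∷ P ∷ (links-o ls) ∷ O ∷ I ∷ G ∷ []) []) 1 (` 1) (# L0) (≤! (` 1) (# L1) m ∷ ≡˘ ((# L2) ⊕ (# L1)) (# L3) (spl sP (x ≡ᵇ_)) ∷ ≤! (# (0 ▹ L4)) (# L5) (⊑at os (x ≡ᵇ_)) ∷ ≤! (# (L5 ⧺ L3 ⧺ L6)) (# L7) (⊑at inG (x ≡ᵇ_)) ∷ ≡! (# L7) ((# (0 ▹ L4 ⧺ L2 ⧺ L6)) ⊕ (# L0)) (spl sG (x ≡ᵇ_)) ∷ []))
          connect : (Σ ℕ λ x → x ∈ O') → (Σ ℕ λ x → x ∈ P') → Links (suc j)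
          connect (o₀ , mo) (p₀ , mp) = trim (link sy
              (robust-restrict {k' = 0} sG (lin (lists [] (D ∷ []) (k ∷ [])) 1 ((∥ L0) ⊕ (` 0)) x0 (≤! (∥ L0) (` 131) lD ∷ ≤! (` 131) x0 hk ∷ [])) rob)
              (minDeg-restrict {d = suc m} {c = 131} sG lD λ x mx → (lin (env (e x) [] (G ∷ []) (m ∷ c ∷ [])) 35 ((1+ x0) ⊕ (` 131)) (# L0) (35 ×! ≤! (x0 ⊕ x1) (# L0) (md x mx) ∷ 33 ×! ≤! (` 140) x1 hc ∷ [])))
              (lin (lists [] (G' ∷ D ∷ G ∷ []) (m ∷ [])) 1 (1+ (∥ L0)) (8 ⊛ (1+ x0)) (≡˘ ((∥ L1) ⊕ (∥ L0)) (∥ L2) (split-len G D G' sG) ∷ ≤! (∥ L2) (7 ⊛ x0) lG ∷ []))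
              o₀ p₀ (o∈G' o₀ mo) (p∈G' p₀ mp))
            where
            inP inO : ℕ → Bool
            inP x = 1 ≤ᵇ occ x P
            inO x = 1 ≤ᵇ occ x O
            isIn : ∀ {x xs} → x ∈ xs → (1 ≤ᵇ occ x xs) ≡ true
            isIn {x} {xs} m with 1 ≤ᵇ occ x xs in eq
            ... | true = refl
            ... | false = (⊥-elim (1+n≰n (lin (env (x ≡ᵇ_) [] (xs ∷ []) []) 1 (` 1) (` 0) (≤! (` 1) (# L0) m ∷ ≤! (1+ (# L0)) (` 1) (≤ᵇ-false {1} eq) ∷ []))))
            o₀∈O : o₀ ∈ O
            o₀∈O = ∈-⊑ o₀ (splitʳ sO) mo
            trim : ShortPath e G' o₀ p₀ → Links (suc j)
            trim (shortPath xs V xs⊑ short) = trim₁ (cnt-first inP xs (cnt-∈ inP p₀ xs (w∈ʳ V) (isIn {p₀} {P} (∈-⊑ p₀ (splitʳ sP) mp))))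
              where
              trim₁ : (Σ (List ℕ) λ A → Σ ℕ λ x → Σ (List ℕ) λ B → (xs ≡ A ++ x ∷ B) × (inP x ≡ true) × (cnt inP A ≡ 0)) → Links (suc j)
              trim₁ ([] , p , B , refl , ip , _) with whd p V
              ... | refl = (⊥-elim (1+n≰n (lin (env (p ≡ᵇ_) [] (O ∷ P ∷ G ∷ []) []) 1 (` 1) (` 0) (≤! (# (L0 ⧺ L1)) (# L2) (⊑at OP (p ≡ᵇ_)) ∷ ≤! (# L2) (` 1) (dG p) ∷ ≤! (` 1) (# L0) o₀∈O ∷ ≤! (` 1) (# L1) (≤ᵇ-true {1} ip) ∷ []))))
              trim₁ (A@(a ∷ A') , p , B , refl , ip , zA) = trim₂ (wunsnoc A p (s≤s z≤n) (proj₁ (wcut A p B V)))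
                where
                trim₂ : (Σ ℕ λ q → Walk e o₀ A q × (e q p ≡ true)) → Links (suc j)
                trim₂ (q , VA , qp) = trim₃ (cnt-last inO A (cnt-∈ inO o₀ A (w∈ˡ VA) (isIn {o₀} {O} o₀∈O)))
                  where
                  trim₃ : (Σ (List ℕ) λ A₁ → Σ ℕ λ x → Σ (List ℕ) λ J → (A ≡ A₁ ++ x ∷ J) × (inO x ≡ true) × (cnt inO J ≡ 0)) → Links (suc j)
                  trim₃ (A₁ , o , J , eqA , io , zJ) = links (mkLink p J VJ qp ∷ ls)
                      (occ⇒⊑ (O ++ P ++ J ++ I) G inG') (occ⇒⊑ (y ∷ o ∷ links-o ls) O os') (occ⇒⊑ (p ∷ links-p ls) P ps')
                      (cong suc len) (lin (lists [] (J ∷ I ∷ []) (j ∷ [])) 1 (∥ (L0 ⧺ L1)) (24 ⊛ (1+ x0)) (≤! (∥ L1) (24 ⊛ x0) lenI ∷ ≤! (∥ L0) (` 24) lJ ∷ []))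
                    where
                    VJ : Walk e o (o ∷ J) q
                    VJ = proj₂ (wcut A₁ o J (subst (λ l → Walk e o₀ l q) eqA VA))
                    cA : ∀ r → cnt r A ≡ cnt r A₁ + (b2n (r o) + cnt r J)
                    cA r = trans (cong (cnt r) eqA) (cnt-++ r A₁ (o ∷ J))
                    cxs : ∀ r → cnt r (A ++ p ∷ B) ≤ cnt r G'
                    cxs r = ⊑at xs⊑ r
                    lJ : length J ≤ 24
                    lJ = (lin (lists (p ∷ []) (J ∷ A ∷ B ∷ A₁ ∷ []) []) 1 (∥ L0) (` 24) (≤! (∥ (L1 ⧺ 0 ▹ L2)) (` 24) short ∷ ≡˘ ((∥ L3) ⊕ (1+ (∥ L0))) (∥ L1) (trans (cong length eqA) (length-++ A₁)) ∷ []))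
                    o∈G'' : 1 ≤ cnt (o ≡ᵇ_) G'
                    o∈G'' = (lin (env (o ≡ᵇ_) (p ∷ o ∷ []) (G' ∷ A ∷ B ∷ A₁ ∷ J ∷ []) []) 1 (` 1) (# L0) (≤! (# (L1 ⧺ 0 ▹ L2)) (# L0) (cxs (o ≡ᵇ_)) ∷ ≡˘ ((# L3) ⊕ ((bit 1) ⊕ (# L4))) (# L1) (cA (o ≡ᵇ_)) ∷ ≡˘ (` 1) (bit 1) (b2n-t (==-refl o)) ∷ []))
                    p∈G'' : 1 ≤ cnt (p ≡ᵇ_) G'
                    p∈G'' = (lin (env (p ≡ᵇ_) (p ∷ []) (G' ∷ A ∷ B ∷ []) []) 1 (` 1) (# L0) (≤! (# (L1 ⧺ 0 ▹ L2)) (# L0) (cxs (p ≡ᵇ_)) ∷ ≡˘ (` 1) (bit 0) (b2n-t (==-refl p)) ∷ []))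
                    os' : ∀ x → occ x (y ∷ o ∷ links-o ls) ≤ occ x O
                    os' x with bool (x ≡ᵇ o)
                    ... | inj₂ f = (lin (env (x ≡ᵇ_) (y ∷ o ∷ []) ((links-o ls) ∷ O ∷ []) []) 1 (# (0 ▹ 1 ▹ L0)) (# L1) (≤! (# (0 ▹ L0)) (# L1) (⊑at os (x ≡ᵇ_)) ∷ ≡! (bit 1) (` 0) (b2n-f f) ∷ []))
                    ... | inj₁ t with ==-true {x} {o} t
                    ... | refl = (lin (env (o ≡ᵇ_) (y ∷ o ∷ []) ((links-o ls) ∷ O ∷ (links-p ls) ∷ I ∷ []) []) 1 (# (0 ▹ 1 ▹ L0)) (# L1) (≤! (` 1) (# L1) (≤ᵇ-true {1} io) ∷ ≤! (bit 1) (` 1) (b2n-≤1 (o ≡ᵇ o)) ∷ ≡! (# (0 ▹ L0 ⧺ L2 ⧺ L3)) (` 0) (notD o o∈G'') ∷ []))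
                    ps' : ∀ x → occ x (p ∷ links-p ls) ≤ occ x P
                    ps' x with bool (x ≡ᵇ p)
                    ... | inj₂ f = (lin (env (x ≡ᵇ_) (p ∷ []) ((links-p ls) ∷ P ∷ []) []) 1 (# (0 ▹ L0)) (# L1) (≤! (# L0) (# L1) (⊑at ps (x ≡ᵇ_)) ∷ ≡! (bit 0) (` 0) (b2n-f f) ∷ []))
                    ... | inj₁ t with ==-true {x} {p} t
                    ... | refl = (lin (env (p ≡ᵇ_) (p ∷ y ∷ []) ((links-p ls) ∷ P ∷ (links-o ls) ∷ I ∷ []) []) 1 (# (0 ▹ L0)) (# L1) (≤! (` 1) (# L1) (≤ᵇ-true {1} ip) ∷ ≤! (bit 0) (` 1) (b2n-≤1 (p ≡ᵇ p)) ∷ ≡! (# (1 ▹ L2 ⧺ L0 ⧺ L3)) (` 0) (notD p p∈G'') ∷ []))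
                    inG' : ∀ x → occ x (O ++ P ++ J ++ I) ≤ occ x G
                    inG' x with x ∈? J
                    ... | inj₂ z = (lin (env (x ≡ᵇ_) [] (O ∷ P ∷ J ∷ I ∷ G ∷ []) []) 1 (# (L0 ⧺ L1 ⧺ L2 ⧺ L3)) (# L4) (≡! (# L2) (` 0) z ∷ ≤! (# (L0 ⧺ L1 ⧺ L3)) (# L4) (⊑at inG (x ≡ᵇ_)) ∷ []))
                    ... | inj₁ mJ = (lin (env (x ≡ᵇ_) (y ∷ []) (O ∷ P ∷ J ∷ I ∷ G ∷ G' ∷ (links-o ls) ∷ (links-p ls) ∷ []) []) 1 (# (L0 ⧺ L1 ⧺ L2 ⧺ L3)) (# L4) (≡! (# L0) (` 0) (n<1⇒n≡0 (≤ᵇ-false {1} (cnt-zero inO J zJ x mJ))) ∷ ≡! (# L1) (` 0) (n<1⇒n≡0 (≤ᵇ-false {1} (cnt-zero inP A zA x mA))) ∷ ≤! (# L2) (# L5) J≤ ∷ ≡˘ ((# (0 ▹ L6 ⧺ L7 ⧺ L3)) ⊕ (# L5)) (# L4) (spl sG (x ≡ᵇ_)) ∷ []))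
                      where
                      mA : x ∈ A
                      mA = (lin (env (x ≡ᵇ_) (o ∷ []) (A ∷ A₁ ∷ J ∷ []) []) 1 (` 1) (# L0) (≡˘ ((# L1) ⊕ ((bit 0) ⊕ (# L2))) (# L0) (cA (x ≡ᵇ_)) ∷ ≤! (` 1) (# L2) mJ ∷ []))
                      J≤ : cnt (x ≡ᵇ_) J ≤ cnt (x ≡ᵇ_) G'
                      J≤ = (lin (env (x ≡ᵇ_) (o ∷ p ∷ []) (J ∷ G' ∷ A₁ ∷ A ∷ B ∷ []) []) 1 (# L0) (# L1) (≡˘ ((# L2) ⊕ ((bit 0) ⊕ (# L0))) (# L3) (cA (x ≡ᵇ_)) ∷ ≤! (# (L3 ⧺ 1 ▹ L4)) (# L1) (cxs (x ≡ᵇ_)) ∷ []))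

    fiveLinks : Links 5
    fiveLinks = next ≤-refl (next (m≤m+n 3 1) (next (m≤m+n 2 2) (next (m≤m+n 1 3) (next z≤n zeroLinks))))
      where
      zeroLinks : Links 0
      zeroLinks = links [] (le: λ p → (lin (env p [] (O ∷ P ∷ G ∷ []) []) 1 (# (L0 ⧺ L1 ⧺ nil)) (# L2) (≤! (# (L0 ⧺ L1)) (# L2) (⊑at OP p) ∷ [])))
        (occ⇒⊑ (y ∷ []) O one) (le: λ p → z≤n) refl z≤n
        where
        one : ∀ x → occ x (y ∷ []) ≤ occ x O
        one x with bool (x ≡ᵇ y)
        ... | inj₂ f rewrite f = z≤n
        ... | inj₁ t with ==-true {x} {y} t
        ... | refl = ≤-trans (≤-reflexive (cong (λ b → b2n b + 0) (==-refl y))) (w∈ˡ WO)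

    -- The detour runs back along the first link, over the longer arc of `O` and along the second
    -- link. The arc alone has more than g vertices, whereas the stretch that it replaces has at
    -- most g.
    through : ∀ g → 2 * g ≤ length O → ∀ as x bs z cs → P ≡ as ++ x ∷ bs ++ z ∷ cs → ∀ (l₁ l₂ : Link e) → Link.p l₁ ≡ x → Link.p l₂ ≡ z →
      (Link.o l₁ ∷ Link.o l₂ ∷ []) ⊑ O → (O ++ P ++ Link.I l₁ ++ Link.I l₂) ⊑ G → length bs ≤ g → Goal
    through g hg as x bs z cs eq (mkLink {o₁} {q₁} _ I₁ V₁ h₁) (mkLink {o₂} {q₂} _ I₂ V₂ h₂) refl refl o⊑ inG lb = go (longArc O sy WO clO g hg o₁ o₂ o⊑)
      where
      go : Arc e O g o₁ o₂ → Goal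
      go (arc M WM M⊑ lM) = reroute as x bs z cs D eq (trans (sy x q₁) h₁) WD h₂
          (le: λ p → (lin (env p (o₁ ∷ o₂ ∷ []) (D ∷ P ∷ G ∷ I₁ ∷ M ∷ I₂ ∷ O ∷ []) []) 1 (# (L0 ⧺ L1)) (# L2) (≡! (# L0) (# (((rev L3) ⧺ 0 ▹ L4) ⧺ 1 ▹ L5)) (refl {x = cnt p D}) ∷ ≤! (# (0 ▹ L4 ⧺ 1 ▹ nil)) (# L6) (⊑at M⊑ p) ∷ ≤! (# (L6 ⧺ L1 ⧺ L3 ⧺ L5)) (# L2) (⊑at inG p) ∷ [])))
          (lin (lists (o₁ ∷ o₂ ∷ []) (bs ∷ D ∷ I₁ ∷ M ∷ I₂ ∷ []) (g ∷ [])) 1 (1+ (∥ L0)) (∥ L1) (≡˘ (∥ (((rev L2) ⧺ 0 ▹ L3) ⧺ 1 ▹ L4)) (∥ L1) (refl {x = length D}) ∷ ≤! (∥ L0) x0 lb ∷ ≤! x0 (1+ (∥ L3)) lM ∷ []))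
        where
        D = (reverse I₁ ++ o₁ ∷ M) ++ o₂ ∷ I₂
        WD : Walk e q₁ D q₂
        WD = wglue (reverse I₁ ++ o₁ ∷ M) o₂ I₂ (subst (λ l → Walk e q₁ l o₂) (sym (++-assoc (reverse I₁) (o₁ ∷ M) (o₂ ∷ [])))
          (wglue (reverse I₁) o₁ (M ++ o₂ ∷ []) (subst (λ l → Walk e q₁ l o₁) (unfold-reverse o₁ I₁) (wrev sy V₁)) WM)) V₂

  viaVertex : ∀ y → (y ∷ P) ⊑ G → ∀ as x z cs → P ≡ as ++ x ∷ z ∷ cs → e y x ≡ true → e y z ≡ true → Goal
  viaVertex y inG as x z cs eq yx yz = reroute as x [] z cs (y ∷ []) eq (trans (sy x y) yx) [ y ] yz inG (s≤s z≤n)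

  fewOutside : ∀ y → (y ∷ P) ⊑ G → m + 1 ≤ cnt (e y) P → Goal
  fewOutside y inG h = go (gaps (length P) P ≤-refl)
    where
    open Gaps (e y) (λ _ → false) 0
    go : ClosePair P ⊎ (2 * cnt (e y) P + 0 * cnt (λ _ → false) P ≤ length P + 1 + 0) → Goal
    go (inj₁ (as , x , [] , z , cs , eq , near-ss yx yz l)) = viaVertex y inG as x z cs eq yx yz
    go (inj₁ (as , x , _ ∷ _ , z , cs , eq , near-ss yx yz ()))
    go (inj₂ l) = (⊥-elim (1+n≰n (lin (env (e y) [] (P ∷ []) (m ∷ [])) 2 (` 1) (` 0) (≤! ((2 ⊛ (# L0)) ⊕ (` 0)) (((∥ L0) ⊕ (` 1)) ⊕ (` 0)) l ∷ 2 ×! ≤! (x0 ⊕ (` 1)) (# L0) h ∷ ≤! (1+ (∥ L0)) (2 ⊛ x0) P<2m ∷ []))))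

  manyOutside : ∀ {y w} O → Walk e y O w → e w y ≡ true → (O ++ P) ⊑ G → 9 ≤ length O → m + c ≤ cnt (e y) P + length O → Goal
  manyOutside {y} {w} O WO clO OP lO h = go fiveLinks (half (length O))
    where
    open Round O WO clO OP lO
    go : Links 5 → (Σ ℕ λ g → (2 * g ≤ length O) × (length O ≤ 2 * g + 1)) → Goal
    go (links ls inG os ps len lenI) (g , hg , hg') = fin (gaps (length P) P ≤-refl)
      where
      a : ℕ → Bool
      a x = 1 ≤ᵇ occ x (links-p ls)
      open Gaps (e y) a g
      dP : NoDup P
      dP = nodup-⊑ P⊑G dG
      aP : 5 ≤ cnt a P
      aP = ≤-trans (≤-reflexive (sym (trans (length-p ls) len))) (≤-trans (≤-reflexive (sym (cnt-allp (links-p ls) (λ x m → m)))) (⊑at ps a))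
        where
        cnt-allp : ∀ xs → (∀ x → x ∈ xs → x ∈ links-p ls) → cnt a xs ≡ length xs
        cnt-allp [] _ = refl
        cnt-allp (x ∷ xs) h with 1 ≤ᵇ occ x (links-p ls) in eq
        ... | true = cong suc (cnt-allp xs (λ z m → h z (∈-there z x xs m)))
        ... | false = (⊥-elim (1+n≰n (lin (env (x ≡ᵇ_) [] ((links-p ls) ∷ []) []) 1 (` 1) (` 0) (≤! (` 1) (# L0) (h x (∈-here x xs)) ∷ ≤! (1+ (# L0)) (` 1) (≤ᵇ-false {1} eq) ∷ []))))
      -- As `y` lies on `O`, an edge from `y` to the path is a link with empty inside.
      yLink : ∀ x → e y x ≡ true → Link e
      yLink x h = mkLink x [] [ y ] h
      with-y : (l : Link e) → (ls' : List (Link e)) → Split (links-o ls) (Link.o l ∷ []) (links-o ls') → (y ∷ Link.o l ∷ []) ⊑ O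
      with-y l ls' so = le: λ p → (lin (env p (y ∷ (Link.o l) ∷ []) (O ∷ (links-o ls) ∷ (links-o ls') ∷ []) []) 1 (# (0 ▹ 1 ▹ nil)) (# L0) (≤! (# (0 ▹ L1)) (# L0) (⊑at os p) ∷ ≡˘ ((# (1 ▹ nil)) ⊕ (# L2)) (# L1) (spl so p) ∷ []))
      close : ∀ as x bs z cs → P ≡ as ++ x ∷ bs ++ z ∷ cs → Close x z (length bs) → Goal
      close as x [] z cs eq (near-ss yx yz _) = viaVertex y yP as x z cs eq yx yz
        where
        yP : (y ∷ P) ⊑ G
        yP = le: λ p → (lin (env p (y ∷ []) (P ∷ G ∷ O ∷ (links-o ls) ∷ []) []) 1 (# (0 ▹ L0)) (# L1) (≤! (# (L2 ⧺ L0)) (# L1) (⊑at OP p) ∷ ≤! (# (0 ▹ L3)) (# L2) (⊑at os p) ∷ []))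
      close as x (_ ∷ _) z cs eq (near-ss yx yz ())
      close as x bs z cs eq (near-sa yx az lb) with find-link ls z (≤ᵇ-true {1} az)
      ... | l , ls' , refl , sI , so , _ = through g hg as x bs z cs eq (yLink x yx) l refl refl (with-y l ls' so)
        (le: λ p → (lin (env p [] (O ∷ P ∷ (Link.I l) ∷ G ∷ (links-I ls) ∷ (links-I ls') ∷ []) []) 1 (# (L0 ⧺ L1 ⧺ nil ⧺ L2)) (# L3) (≤! (# (L0 ⧺ L1 ⧺ L4)) (# L3) (⊑at inG p) ∷ ≡˘ ((# L2) ⊕ (# L5)) (# L4) (spl sI p) ∷ []))) lb
      close as x bs z cs eq (near-as ax yz lb) with find-link ls x (≤ᵇ-true {1} ax)
      ... | l , ls' , refl , sI , so , _ = through g hg as x bs z cs eq l (yLink z yz) refl refl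
        (le: λ p → (lin (env p ((Link.o l) ∷ y ∷ []) (O ∷ []) []) 1 (# (0 ▹ 1 ▹ nil)) (# L0) (≤! (# (1 ▹ 0 ▹ nil)) (# L0) (⊑at (with-y l ls' so) p) ∷ [])))
        (le: λ p → (lin (env p [] (O ∷ P ∷ (Link.I l) ∷ G ∷ (links-I ls) ∷ (links-I ls') ∷ []) []) 1 (# (L0 ⧺ L1 ⧺ L2 ⧺ nil)) (# L3) (≤! (# (L0 ⧺ L1 ⧺ L4)) (# L3) (⊑at inG p) ∷ ≡˘ ((# L2) ⊕ (# L5)) (# L4) (spl sI p) ∷ []))) lb
      close as x bs z cs eq (near-aa ax az lb) with find-link ls x (≤ᵇ-true {1} ax)
      ... | l , ls' , refl , sI , so , sp' = second (find-link ls' z z∈)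
        where
        z≢x : ¬ z ≡ x
        z≢x refl = (⊥-elim (1+n≰n (lin (env (z ≡ᵇ_) (z ∷ []) (P ∷ as ∷ bs ∷ cs ∷ []) []) 1 (` 1) (` 0) (≤! (# L0) (` 1) (dP z) ∷ ≡˘ (# (L1 ⧺ 0 ▹ L2 ⧺ 0 ▹ L3)) (# L0) (cong (cnt (z ≡ᵇ_)) eq) ∷ 2 ×! ≡˘ (` 1) (bit 0) (b2n-t (==-refl z)) ∷ []))))
        z∈ : z ∈ links-p ls'
        z∈ = (lin (env (z ≡ᵇ_) (x ∷ []) ((links-p ls') ∷ (links-p ls) ∷ []) []) 1 (` 1) (# L0) (≡! (# L1) ((# (0 ▹ nil)) ⊕ (# L0)) (spl sp' (z ≡ᵇ_)) ∷ ≤! (` 1) (# L1) (≤ᵇ-true {1} az) ∷ ≡! (bit 0) (` 0) (b2n-f (==-false z≢x)) ∷ []))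
        second : (Σ (Link e) λ l₂ → Σ (List (Link e)) λ ls'' → (Link.p l₂ ≡ z) × Split (links-I ls') (Link.I l₂) (links-I ls'') ×
          Split (links-o ls') (Link.o l₂ ∷ []) (links-o ls'') × Split (links-p ls') (z ∷ []) (links-p ls'')) → Goal
        second (l₂ , ls'' , eqz , sI₂ , so₂ , _) = through g hg as x bs z cs eq l l₂ refl eqz
          (le: λ p → (lin (env p ((Link.o l) ∷ (Link.o l₂) ∷ y ∷ []) (O ∷ (links-o ls) ∷ (links-o ls') ∷ (links-o ls'') ∷ []) []) 1 (# (0 ▹ 1 ▹ nil)) (# L0) (≤! (# (2 ▹ L1)) (# L0) (⊑at os p) ∷ ≡˘ ((# (0 ▹ nil)) ⊕ (# L2)) (# L1) (spl so p) ∷ ≡˘ ((# (1 ▹ nil)) ⊕ (# L3)) (# L2) (spl so₂ p) ∷ [])))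
          (le: λ p → (lin (env p [] (O ∷ P ∷ (Link.I l) ∷ (Link.I l₂) ∷ G ∷ (links-I ls) ∷ (links-I ls') ∷ (links-I ls'') ∷ []) []) 1 (# (L0 ⧺ L1 ⧺ L2 ⧺ L3)) (# L4) (≤! (# (L0 ⧺ L1 ⧺ L5)) (# L4) (⊑at inG p) ∷ ≡˘ ((# L2) ⊕ (# L6)) (# L5) (spl sI p) ∷ ≡˘ ((# L3) ⊕ (# L7)) (# L6) (spl sI₂ p) ∷ []))) lb
      fin : ClosePair P ⊎ (2 * cnt (e y) P + g * cnt a P ≤ length P + 1 + g) → Goal
      fin (inj₁ (as , x , bs , z , cs , eq , c')) = close as x bs z cs eq c'
      -- This is where five links are needed. With d the number of neighbours of `y` on `P`, there
      -- are no close marks only if 2d + 5g ≤ |P| + 1 + g, and 2d ≥ 2(m + c) - 2|O| with |O| ≤ 2g +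
      -- 1. The terms 4g cancel and |P| ≥ 2m + 2c - 3, against |P| < 2m.
      fin (inj₂ l) = (⊥-elim (1+n≰n (lin (env (e y) [] (P ∷ O ∷ []) ((g * cnt a P) ∷ g ∷ (g * 5) ∷ m ∷ c ∷ [])) 278 (` 1) (` 0) (≤! ((2 ⊛ (# L0)) ⊕ x0) (((∥ L0) ⊕ (` 1)) ⊕ x1) l ∷ ≤! x2 x0 (*-monoʳ-≤ g aP) ∷ ≡˘ (5 ⊛ x1) x2 (*-comm g 5) ∷ 2 ×! ≤! (x3 ⊕ x4) ((# L0) ⊕ (∥ L1)) h ∷ 2 ×! ≤! (∥ L1) ((2 ⊛ x1) ⊕ (` 1)) hg' ∷ 2 ×! ≤! (` 140) x4 hc ∷ ≤! (1+ (∥ L0)) (2 ⊛ x3) P<2m ∷ []))))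

  improve : 2 * m ≤ length G → Goal
  improve hG = go (diff⊑ P G P⊑G)
    where
    go : Σ (List ℕ) (λ X → Split G P X) → Goal
    go ([] , sX) = (⊥-elim (1+n≰n (lin (lists [] (G ∷ P ∷ []) (m ∷ [])) 1 (` 1) (` 0) (≡! (∥ L0) ((∥ L1) ⊕ (` 0)) (split-len G P [] sX) ∷ ≤! (2 ⊛ x0) (∥ L0) hG ∷ ≤! (1+ (∥ L1)) (2 ⊛ x0) P<2m ∷ []))))
    go (X@(x ∷ X₁) , sX) = go₂ (maximal sy (length X₁) (x ∷ []) X₁ [ x ] (sp: λ p → (lin≡ (env p (x ∷ []) (X₁ ∷ []) []) 1 (# (0 ▹ L0)) ((# (0 ▹ nil)) ⊕ (# L0)) [])) ≤-refl)
      where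
      go₂ : MaxPath e X → Goal
      go₂ (maxPath {y} {z} Q X' WQ sQ stuck) = go₃ (≤-total 8 (cnt (e y) Q))
        where
        y∈G : y ∈ G
        y∈G = ∈-⊑ y (⊑-trans (splitˡ sQ) (splitʳ sX)) (w∈ˡ WQ)
        deg : m + c ≤ cnt (e y) P + cnt (e y) Q
        deg = (lin (env (e y) [] (P ∷ Q ∷ G ∷ X ∷ X' ∷ []) (m ∷ c ∷ [])) 1 (x0 ⊕ x1) ((# L0) ⊕ (# L1)) (≤! (x0 ⊕ x1) (# L2) (md y y∈G) ∷ ≡! (# L2) ((# L0) ⊕ (# L3)) (spl sX (e y)) ∷ ≡! (# L3) ((# L1) ⊕ (# L4)) (spl sQ (e y)) ∷ ≡! (# L4) (` 0) stuck ∷ []))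
        -- With at most 8 neighbours on `Q`, the vertex `y` has at least m + 1 on `P`, two of which
        -- are consecutive. Otherwise the cycle through `y` and all its neighbours on `Q` has at
        -- least nine vertices, enough for `y` and five link ends.
        go₃ : 8 ≤ cnt (e y) Q ⊎ cnt (e y) Q ≤ 8 → Goal
        go₃ (inj₂ l) = fewOutside y (occ⇒⊑ (y ∷ P) G one) (lin (env (e y) [] (P ∷ Q ∷ []) (m ∷ c ∷ [])) 140 (x0 ⊕ (` 1)) (# L0) (140 ×! ≤! (x0 ⊕ x1) ((# L0) ⊕ (# L1)) deg ∷ 140 ×! ≤! (# L1) (` 8) l ∷ 9 ×! ≤! (` 140) x1 hc ∷ []))
          where
          one : ∀ x → occ x (y ∷ P) ≤ occ x G
          one x with bool (x ≡ᵇ y)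
          ... | inj₂ f = (lin (env (x ≡ᵇ_) (y ∷ []) (P ∷ G ∷ []) []) 1 (# (0 ▹ L0)) (# L1) (≤! (# L0) (# L1) (⊑at P⊑G (x ≡ᵇ_)) ∷ ≡! (bit 0) (` 0) (b2n-f f) ∷ []))
          ... | inj₁ t with ==-true {x} {y} t
          ... | refl = (lin (env (y ≡ᵇ_) (y ∷ []) (P ∷ G ∷ X ∷ []) []) 1 (# (0 ▹ L0)) (# L1) (≡˘ ((# L0) ⊕ (# L2)) (# L1) (spl sX (y ≡ᵇ_)) ∷ ≤! (` 1) (# L2) (∈-⊑ y (splitˡ sQ) (w∈ˡ WQ)) ∷ ≤! (bit 0) (` 1) (b2n-≤1 (y ≡ᵇ y)) ∷ []))
        go₃ (inj₁ l) = go₄ (cnt-last (e y) Q (≤-trans (s≤s z≤n) l))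
          where
          go₄ : (Σ (List ℕ) λ Q₁ → Σ ℕ λ w → Σ (List ℕ) λ Q₂ → (Q ≡ Q₁ ++ w ∷ Q₂) × (e y w ≡ true) × (cnt (e y) Q₂ ≡ 0)) → Goal
          go₄ (Q₁ , w , Q₂ , refl , yw , z₂) = manyOutside O WO (trans (sy w y) yw)
              (le: λ p → (lin (env p (w ∷ []) (O ∷ P ∷ G ∷ Q₁ ∷ X ∷ Q₂ ∷ X' ∷ []) []) 1 (# (L0 ⧺ L1)) (# L2) (≡! (# L0) (# (L3 ⧺ 0 ▹ nil)) (refl {x = cnt p O}) ∷ ≡˘ ((# L1) ⊕ (# L4)) (# L2) (spl sX p) ∷ ≡˘ ((# (L3 ⧺ 0 ▹ L5)) ⊕ (# L6)) (# L4) (spl sQ p) ∷ [])))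
              (lin (env (e y) (w ∷ []) (O ∷ Q₁ ∷ Q₂ ∷ []) []) 1 (` 9) (∥ L0) (≤! ((# L0) ⊕ (` 1)) (∥ L0) lO ∷ ≡! (# (L1 ⧺ 0 ▹ L2)) (# L0) cO ∷ ≤! (` 8) (# (L1 ⧺ 0 ▹ L2)) l ∷ []))
              (lin (env (e y) (w ∷ []) (P ∷ O ∷ Q₁ ∷ Q₂ ∷ []) (m ∷ c ∷ [])) 1 (x0 ⊕ x1) ((# L0) ⊕ (∥ L1)) (≤! ((# L1) ⊕ (` 1)) (∥ L1) lO ∷ ≡! (# (L2 ⧺ 0 ▹ L3)) (# L1) cO ∷ ≤! (x0 ⊕ x1) ((# L0) ⊕ (# (L2 ⧺ 0 ▹ L3))) deg ∷ []))
            where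
            O = Q₁ ++ w ∷ []
            WO : Walk e y O w
            WO = proj₁ (wcut Q₁ w Q₂ WQ)
            cO : cnt (e y) (Q₁ ++ w ∷ Q₂) ≡ cnt (e y) O
            cO = (lin≡ (env (e y) (w ∷ []) (Q₁ ∷ Q₂ ∷ O ∷ []) []) 1 (# (L0 ⧺ 0 ▹ L1)) (# L2) (≡˘ (# (L0 ⧺ 0 ▹ nil)) (# L2) (refl {x = cnt (e y) O}) ∷ ≡! (# L1) (` 0) z₂ ∷ []))
            lO : cnt (e y) O + 1 ≤ length O
            lO with ∈-remove y O (w∈ˡ WO)
            ... | O' , sO = (lin (env (e y) [] (O ∷ O' ∷ []) ((b2n (e y y)) ∷ [])) 1 ((# L0) ⊕ (` 1)) (∥ L0) (≡˘ ((` 1) ⊕ (∥ L1)) (∥ L0) (split-len O (y ∷ []) O' sO) ∷ ≤! (# L1) (∥ L1) (cnt-≤ (e y) O') ∷ ≡! (# L0) ((x0 ⊕ (` 0)) ⊕ (# L1)) (spl sO (e y)) ∷ ≡! x0 (` 0) (b2n-f (irr y)) ∷ []))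

wshape : ∀ {e u xs v} → Walk e u xs v → Σ (List ℕ) λ xs' → xs ≡ u ∷ xs'
wshape [ u ] = [] , refl
wshape (h ◂ W) = _ , refl

pair-⊑ : ∀ {G u v} → ¬ u ≡ v → u ∈ G → v ∈ G → (u ∷ v ∷ []) ⊑ G
pair-⊑ {G} {u} {v} ne mu mv = sub (u ∷ v ∷ []) G (nodup-∷ u (v ∷ []) (trans (+-identityʳ _) (b2n-f (==-false ne))) (λ x → ≤-trans (≤-reflexive (+-identityʳ _)) (b2n-≤1 (x ≡ᵇ v))))
  mem
  where
  mem : ∀ x → x ∈ (u ∷ v ∷ []) → x ∈ G
  mem x m with ∈-∷⁻ x u (v ∷ []) m
  ... | inj₁ refl = mu
  ... | inj₂ m' with ∈-∷⁻ x v [] m'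
  ... | inj₁ refl = mv

module LongPaths (e : Rel) (sy : SymR e) (irr : Irr e) (G : List ℕ) (dG : NoDup G) (k m c : ℕ) (md : MinDeg e (m + c) G) (hc : 140 ≤ c)
  (rob : Robust e k G) (hk : 131 ≤ k) (lG : length G ≤ 7 * m) where

  record Grown (u v j : ℕ) : Set where
    constructor grown
    field
      w : ℕ
      xs : List ℕ
      W : Walk e w (w ∷ xs) u
      len : length xs ≡ j
      inG : (v ∷ w ∷ xs) ⊑ G

  grow : ∀ {u v} → (v ∷ u ∷ []) ⊑ G → ∀ j → j ≤ 5 → Grown u v j
  grow {u} h zero _ = grown u [] [ u ] refl h
  grow {u} {v} h (suc j) hj = go (grow h j (≤-trans (n≤1+n j) hj))
    where
    go : Grown u v j → Grown u v (suc j)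
    go (grown w xs W len inG) = go₂ (diff⊑ (v ∷ w ∷ xs) G inG)
      where
      go₂ : Σ (List ℕ) (λ R → Split G (v ∷ w ∷ xs) R) → Grown u v (suc j)
      go₂ (R , sR) = go₃ (pick (e w) R (lin (env (e w) (v ∷ w ∷ []) (R ∷ G ∷ xs ∷ []) (m ∷ c ∷ j ∷ [])) 134 (` 1) (# L0) (≤! (x0 ⊕ x1) (# L1) (md w (∈-⊑ w inG (∈-there w v (w ∷ xs) (∈-here w xs)))) ∷ ≡! (# L1) ((# (0 ▹ 1 ▹ L2)) ⊕ (# L0)) (spl sR (e w)) ∷ ≤! (# (0 ▹ 1 ▹ L2)) ((` 2) ⊕ (∥ L2)) (cnt-≤ (e w) (v ∷ w ∷ xs)) ∷ ≡! (∥ L2) x2 len ∷ ≤! (1+ x2) (` 5) hj ∷ ≤! (` 140) x1 hc ∷ [])))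
        where
        go₃ : (Σ ℕ λ b → Σ (List ℕ) λ R' → Split R (b ∷ []) R' × (e w b ≡ true)) → Grown u v (suc j)
        go₃ (b , R' , sb , wb) = grown b (w ∷ xs) (trans (sy b w) wb ◂ W) (cong suc len)
          (le: λ p → (lin (env p (v ∷ b ∷ w ∷ []) (xs ∷ G ∷ R ∷ R' ∷ []) []) 1 (# (0 ▹ 1 ▹ 2 ▹ L0)) (# L1) (≡˘ ((# (0 ▹ 2 ▹ L0)) ⊕ (# L2)) (# L1) (spl sR p) ∷ ≡˘ ((# (1 ▹ nil)) ⊕ (# L3)) (# L2) (spl sb p) ∷ [])))

  PathOfLength≥ : ℕ → ℕ → ℕ → Set
  PathOfLength≥ n u v = Σ (PathIn e G u v) λ P → n ≤ length (PathIn.xs P)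

  -- `Improve` wants a path with room for five link ends. Five steps from `u` that avoid `v`, and
  -- then a short path to `v` in the rest, give six vertices.
  initial : ∀ u v → ¬ u ≡ v → u ∈ G → v ∈ G → PathOfLength≥ 6 u v
  initial u v ne mu mv = go (grow (pair-⊑ (λ q → ne (sym q)) mv mu) 5 ≤-refl)
    where
    go : Grown u v 5 → PathOfLength≥ 6 u v
    go (grown w xs W len inG) = go₂ (diff⊑ xs G (le: λ p → (lin (env p (v ∷ w ∷ []) (xs ∷ G ∷ []) []) 1 (# L0) (# L1) (≤! (# (0 ▹ 1 ▹ L0)) (# L1) (⊑at inG p) ∷ []))))
      where
      go₂ : Σ (List ℕ) (λ G' → Split G xs G') → PathOfLength≥ 6 u v
      go₂ (G' , sG) = go₃ (link sy (robust-restrict {k' = 0} sG (lin (lists [] (xs ∷ []) (k ∷ [])) 131 ((∥ L0) ⊕ (` 0)) x0 (131 ×! ≡! (∥ L0) (` 5) len ∷ 5 ×! ≤! (` 131) x0 hk ∷ [])) rob)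
          (minDeg-restrict {d = suc m} {c = 5} sG (≤-reflexive len) λ x mx → (lin (env (e x) [] (G ∷ []) (m ∷ c ∷ [])) 70 ((1+ x0) ⊕ (` 5)) (# L0) (70 ×! ≤! (x0 ⊕ x1) (# L0) (md x mx) ∷ 3 ×! ≤! (` 140) x1 hc ∷ [])))
          (lin (lists [] (G' ∷ xs ∷ G ∷ []) (m ∷ [])) 1 (1+ (∥ L0)) (8 ⊛ (1+ x0)) (≡˘ ((∥ L1) ⊕ (∥ L0)) (∥ L2) (split-len G xs G' sG) ∷ ≤! (∥ L2) (7 ⊛ x0) lG ∷ [])) w v
          (lin (env (w ≡ᵇ_) (v ∷ w ∷ []) (G' ∷ xs ∷ G ∷ []) []) 1 (` 1) (# L0) (≤! (# (0 ▹ 1 ▹ L1)) (# L2) (⊑at inG (w ≡ᵇ_)) ∷ ≡˘ (` 1) (bit 1) (b2n-t (==-refl w)) ∷ ≡! (# L2) ((# L1) ⊕ (# L0)) (spl sG (w ≡ᵇ_)) ∷ []))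
          (lin (env (v ≡ᵇ_) (v ∷ w ∷ []) (G' ∷ xs ∷ G ∷ []) []) 1 (` 1) (# L0) (≤! (# (0 ▹ 1 ▹ L1)) (# L2) (⊑at inG (v ≡ᵇ_)) ∷ ≡˘ (` 1) (bit 0) (b2n-t (==-refl v)) ∷ ≡! (# L2) ((# L1) ⊕ (# L0)) (spl sG (v ≡ᵇ_)) ∷ [])))
        where
        go₃ : ShortPath e G' w v → PathOfLength≥ 6 u v
        go₃ (shortPath zs V zs⊑ _) with wshape V
        ... | zs' , refl = pathIn (reverse xs ++ w ∷ zs')
            (wglue (reverse xs) w zs' (subst (λ l → Walk e u l w) (unfold-reverse w xs) (wrev sy W)) V)
            (le: λ p → (lin (env p (w ∷ []) (xs ∷ zs' ∷ G ∷ G' ∷ []) []) 1 (# ((rev L0) ⧺ 0 ▹ L1)) (# L2) (≡˘ ((# L0) ⊕ (# L3)) (# L2) (spl sG p) ∷ ≤! (# (0 ▹ L1)) (# L3) (⊑at zs⊑ p) ∷ [])))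
          , (lin (lists (w ∷ []) (xs ∷ zs' ∷ []) []) 1 (` 6) (∥ ((rev L0) ⧺ 0 ▹ L1)) (≡˘ (` 5) (∥ L0) len ∷ []))

  longPath : 2 * m ≤ length G → ∀ u v → ¬ u ≡ v → u ∈ G → v ∈ G → PathOfLength≥ (2 * m) u v
  longPath hG u v ne mu mv = let P , h = initial u v ne mu mv in go (2 * m) P h (m≤m+n (2 * m) _)
    where
    go : ∀ f (P : PathIn e G u v) → 6 ≤ length (PathIn.xs P) → 2 * m ≤ f + length (PathIn.xs P) → PathOfLength≥ (2 * m) u v
    go zero P h hf = P , hf
    go (suc f) P h hf = step (≤-total (2 * m) (length (PathIn.xs P)))
      where
      better : length (PathIn.xs P) < 2 * m → PathOfLength≥ (2 * m) u v
      better lt =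
        let P' , l = Improve.improve e sy irr G dG k m c md hc rob hk lG (PathIn.xs P) (PathIn.W P) (PathIn.inG P) h lt hG
        in go f P' (≤-trans h (<⇒≤ l)) (lin (lists [] ((PathIn.xs P') ∷ (PathIn.xs P) ∷ []) (m ∷ f ∷ [])) 1 (2 ⊛ x0) (x1 ⊕ (∥ L0)) (≤! (2 ⊛ x0) ((1+ x1) ⊕ (∥ L1)) hf ∷ ≤! (1+ (∥ L1)) (∥ L0) l ∷ []))
      step : 2 * m ≤ length (PathIn.xs P) ⊎ length (PathIn.xs P) ≤ 2 * m → PathOfLength≥ (2 * m) u v
      step (inj₁ l) = P , l
      step (inj₂ l) with m≤n⇒m<n∨m≡n l
      ... | inj₁ lt = better lt
      ... | inj₂ eq = P , ≤-reflexive (sym eq)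

-- Shortening a path by a bounded amount

module Shorten (e : Rel) (sy : SymR e) (G : List ℕ) (d j w : ℕ) (md : MinDeg e d G) (hd : length G + 28 * (23 + j) < 8 * d)
  (hw : length G + 1 + w < w * j) {u v : ℕ} where

  Shorter : ℕ → Set
  Shorter n = Σ (PathIn e G u v) λ P → (length (PathIn.xs P) < n) × (n ≤ length (PathIn.xs P) + (24 + w))

  -- Among the first 24 vertices, two vertices x and y with at least two others between them have 24
  -- + j common neighbours. One of these off the path gives a detour. Otherwise at least j of them
  -- come after the first 24 vertices, and by `hw` two, z₁ before z₂, have at most w vertices
  -- between them: the new path goes from x to z₁, back to y, and on from z₂.
  shorter : ∀ P → Walk e u P v → P ⊑ G → 24 ≤ length P → Shorter (length P)
  shorter P W P⊑ lP = go (splitAt' 24 P)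
    where
    go : (Σ (List ℕ) λ X → Σ (List ℕ) λ Y → (P ≡ X ++ Y) × (length X ≤ 24) × (length X ≡ 24 ⊎ Y ≡ [])) → Shorter (length P)
    go (P₁ , P₂ , refl , l≤ , end) = go₂ (findCommon e (23 + j) d G (thirds 8 P₁) (thirds-len 8 P₁ (l≥ end))
        (λ x m → md x (∈-⊑ x P⊑ (∈-++ˡ x P₁ P₂ (∈-⊑ x (thirds-⊑ 8 P₁) m)))) hd)
      where
      l≥ : length P₁ ≡ 24 ⊎ P₂ ≡ [] → 24 ≤ length P₁
      l≥ (inj₁ q) = ≤-reflexive (sym q)
      l≥ (inj₂ refl) = (lin (lists [] (P₁ ∷ []) []) 1 (` 24) (∥ L0) (≤! (` 24) (∥ (L0 ⧺ nil)) lP ∷ []))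
      go₂ : CommonPair e (23 + j) G (thirds 8 P₁) → Shorter (length (P₁ ++ P₂))
      go₂ (commonPair {as} {x} {bs} {y} {cs} eq many) = go₃ (third₂ 8 P₁ as x bs y cs eq)
        where
        q : ℕ → Bool
        q z = e x z ∧ e y z
        go₃ : (Σ (List ℕ) λ as' → Σ (List ℕ) λ bs' → Σ (List ℕ) λ cs' →
          (P₁ ≡ as' ++ x ∷ bs' ++ y ∷ cs') × (2 ≤ length bs') × (length as' + length bs' + 2 ≤ 3 * 8)) → Shorter (length (P₁ ++ P₂))
        go₃ (as , bs , cs , refl , lb , lab) = go₄ (diff⊑ (P₁ ++ P₂) G P⊑)
          where
          W' : Walk e u (as ++ x ∷ bs ++ y ∷ (cs ++ P₂)) v
          W' = subst (λ l → Walk e u l v) (trans (++-assoc as (x ∷ bs ++ y ∷ cs) P₂) (cong (λ l → as ++ x ∷ l) (++-assoc bs (y ∷ cs) P₂))) W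
          go₄ : Σ (List ℕ) (λ R → Split G (P₁ ++ P₂) R) → Shorter (length (P₁ ++ P₂))
          go₄ (R , sR) with cnt q R in cR
          ... | suc _ = off (pick q R (subst (1 ≤_) (sym cR) (s≤s z≤n)))
            where
            off : (Σ ℕ λ b → Σ (List ℕ) λ R' → Split R (b ∷ []) R' × (q b ≡ true)) → Shorter (length (P₁ ++ P₂))
            off (b , R' , sb , qb) = pathIn N (detour as x bs y (cs ++ P₂) (b ∷ []) W' (proj₁ (∧-true qb)) [ b ] (trans (sy b y) (proj₂ (∧-true qb))))
                (le: λ p → (lin (env p (x ∷ b ∷ y ∷ []) (as ∷ cs ∷ P₂ ∷ G ∷ bs ∷ R ∷ R' ∷ []) []) 1 (# ((L0 ⧺ 0 ▹ nil) ⧺ (1 ▹ nil) ⧺ 2 ▹ L1 ⧺ L2)) (# L3) (≡˘ ((# ((L0 ⧺ 0 ▹ L4 ⧺ 2 ▹ L1) ⧺ L2)) ⊕ (# L5)) (# L3) (spl sR p) ∷ ≡˘ ((# (1 ▹ nil)) ⊕ (# L6)) (# L5) (spl sb p) ∷ [])))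
              , (lin (lists (x ∷ b ∷ y ∷ []) (as ∷ cs ∷ P₂ ∷ bs ∷ []) []) 1 (1+ (∥ ((L0 ⧺ 0 ▹ nil) ⧺ (1 ▹ nil) ⧺ 2 ▹ L1 ⧺ L2))) (∥ ((L0 ⧺ 0 ▹ L3 ⧺ 2 ▹ L1) ⧺ L2)) (≤! (` 2) (∥ L3) lb ∷ []))
              , (lin (lists (x ∷ y ∷ b ∷ []) (as ∷ bs ∷ cs ∷ P₂ ∷ []) (w ∷ [])) 1 (∥ ((L0 ⧺ 0 ▹ L1 ⧺ 1 ▹ L2) ⧺ L3)) ((∥ ((L0 ⧺ 0 ▹ nil) ⧺ (2 ▹ nil) ⧺ 1 ▹ L2 ⧺ L3)) ⊕ ((` 24) ⊕ x0)) (≤! (((∥ L0) ⊕ (∥ L1)) ⊕ (` 2)) (` 24) lab ∷ []))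
              where
              N = (as ++ x ∷ []) ++ (b ∷ []) ++ y ∷ (cs ++ P₂)
          ... | zero = on (gaps (length P₂) P₂ ≤-refl)
            where
            open Gaps (λ _ → false) q w
            marks : j ≤ cnt q P₂
            marks = (lin (env q [] (P₂ ∷ G ∷ P₁ ∷ R ∷ []) (j ∷ [])) 1 x0 (# L0) (≤! (1+ ((` 23) ⊕ x0)) (# L1) many ∷ ≡! (# L1) ((# (L2 ⧺ L0)) ⊕ (# L3)) (spl sR q) ∷ ≡! (# L3) (` 0) cR ∷ ≤! (# L2) (∥ L2) (cnt-≤ q P₁) ∷ ≤! (∥ L2) (` 24) l≤ ∷ []))
            on : ClosePair P₂ ⊎ (2 * cnt (λ _ → false) P₂ + w * cnt q P₂ ≤ length P₂ + 1 + w) → Shorter (length (P₁ ++ P₂))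
            on (inj₂ l) = (⊥-elim (1+n≰n (lin (env (λ _ → false) [] (P₂ ∷ G ∷ P₁ ∷ R ∷ []) ((w * cnt q P₂) ∷ w ∷ (w * j) ∷ [])) 1 (` 1) (` 0) (≤! ((2 ⊛ (# L0)) ⊕ x0) (((∥ L0) ⊕ (` 1)) ⊕ x1) l ∷ ≤! x2 x0 (*-monoʳ-≤ w marks) ∷ ≤! (1+ (((∥ L1) ⊕ (` 1)) ⊕ x1)) x2 hw ∷ ≡˘ ((∥ (L2 ⧺ L0)) ⊕ (∥ L3)) (∥ L1) (split-len G (P₁ ++ P₂) R sR) ∷ []))))
            on (inj₁ (ds , z₁ , es , z₂ , fs , refl , near-aa q₁ q₂ lw)) = cross-over (wcut₂ as x bs y (cs ++ P₂) W')
              where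
              B = y ∷ (cs ++ ds)
              cross-over : Walk e u (as ++ x ∷ []) x × Walk e x (x ∷ bs ++ y ∷ []) y × Walk e y (y ∷ cs ++ P₂) v → Shorter (length (P₁ ++ P₂))
              cross-over (WA , _ , WB) = build (wcut₂ B z₁ es z₂ fs (subst (λ l → Walk e y (y ∷ l) v) (sym (++-assoc cs ds (z₁ ∷ es ++ z₂ ∷ fs))) WB))
                where
                build : Walk e y (B ++ z₁ ∷ []) z₁ × Walk e z₁ (z₁ ∷ es ++ z₂ ∷ []) z₂ × Walk e z₂ (z₂ ∷ fs) v → Shorter (length (P₁ ++ P₂))
                build (W₁ , _ , W₂) = pathIn N (join WA (proj₁ (∧-true q₁)) (join (wrev sy W₁) (proj₂ (∧-true q₂)) W₂))
                    (le: λ p → (lin (env p (x ∷ y ∷ z₁ ∷ z₂ ∷ []) (as ∷ cs ∷ ds ∷ fs ∷ G ∷ bs ∷ es ∷ []) []) 1 (# ((L0 ⧺ 0 ▹ nil) ⧺ (rev ((1 ▹ L1 ⧺ L2) ⧺ 2 ▹ nil)) ⧺ 3 ▹ L3)) (# L4) (≤! (# ((L0 ⧺ 0 ▹ L5 ⧺ 1 ▹ L1) ⧺ L2 ⧺ 2 ▹ L6 ⧺ 3 ▹ L3)) (# L4) (⊑at P⊑ p) ∷ [])))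
                  , (lin (lists (x ∷ y ∷ z₁ ∷ z₂ ∷ []) (as ∷ cs ∷ ds ∷ fs ∷ bs ∷ es ∷ []) []) 2 (1+ (∥ ((L0 ⧺ 0 ▹ nil) ⧺ (rev ((1 ▹ L1 ⧺ L2) ⧺ 2 ▹ nil)) ⧺ 3 ▹ L3))) (∥ ((L0 ⧺ 0 ▹ L4 ⧺ 1 ▹ L1) ⧺ L2 ⧺ 2 ▹ L5 ⧺ 3 ▹ L3)) (≤! (` 2) (∥ L4) lb ∷ []))
                  , (lin (lists (x ∷ y ∷ z₁ ∷ z₂ ∷ []) (as ∷ bs ∷ cs ∷ ds ∷ es ∷ fs ∷ []) (w ∷ [])) 1 (∥ ((L0 ⧺ 0 ▹ L1 ⧺ 1 ▹ L2) ⧺ L3 ⧺ 2 ▹ L4 ⧺ 3 ▹ L5)) ((∥ ((L0 ⧺ 0 ▹ nil) ⧺ (rev ((1 ▹ L2 ⧺ L3) ⧺ 2 ▹ nil)) ⧺ 3 ▹ L5)) ⊕ ((` 24) ⊕ x0)) (≤! (((∥ L0) ⊕ (∥ L1)) ⊕ (` 2)) (` 24) lab ∷ ≤! (∥ L4) x0 lw ∷ []))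
                  where
                  N = (as ++ x ∷ []) ++ reverse (B ++ z₁ ∷ []) ++ z₂ ∷ fs

  -- One shortening loses at most 24 + w vertices, so it cannot jump over the window from above.
  window : ∀ t f P → Walk e u P v → P ⊑ G → t ≤ length P → length P ≤ f → Σ (PathIn e G u v) λ P' →
    (t ≤ length (PathIn.xs P')) × (length (PathIn.xs P') ≤ t + (24 + w))
  window t f P W P⊑ ht hf with ≤-total (length P) (t + (24 + w))
  ... | inj₁ h = pathIn P W P⊑ , ht , h
  window t zero P W P⊑ ht hf | inj₂ h = (⊥-elim (1+n≰n (lin (lists [] (P ∷ []) (t ∷ w ∷ [])) 24 (` 1) (` 0) (≤! (∥ L0) (` 0) hf ∷ ≤! (x0 ⊕ ((` 24) ⊕ x1)) (∥ L0) h ∷ []))))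
  window t (suc f) P W P⊑ ht hf | inj₂ h =
    let P' , l , l' = shorter P W P⊑ (lin (lists [] (P ∷ []) (t ∷ w ∷ [])) 1 (` 24) (∥ L0) (≤! (x0 ⊕ ((` 24) ⊕ x1)) (∥ L0) h ∷ []))
    in window t f (PathIn.xs P') (PathIn.W P') (PathIn.inG P')
      (lin (lists [] ((PathIn.xs P') ∷ P ∷ []) (t ∷ w ∷ [])) 1 x0 (∥ L0) (≤! (x0 ⊕ ((` 24) ⊕ x1)) (∥ L1) h ∷ ≤! (∥ L1) ((∥ L0) ⊕ ((` 24) ⊕ x1)) l' ∷ []))
      (lin (lists [] ((PathIn.xs P') ∷ P ∷ []) (f ∷ [])) 1 (∥ L0) x0 (≤! (1+ (∥ L0)) (∥ L1) l ∷ ≤! (∥ L1) (1+ x0) hf ∷ []))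

-- Flexible connectors and odd cycles

PathLen : Rel → List ℕ → ℕ → ℕ → ℕ → Set
PathLen e S u v n = Σ (List ℕ) λ xs → Walk e u xs v × xs ⊑ S × length xs ≡ n

Flex : Rel → List ℕ → ℕ → ℕ → ℕ → ℕ → Set
Flex e S u v a t = ∀ i → i ≤ t → PathLen e S u v (a + 2 * i)

parity : ∀ n → (Σ ℕ λ h → n ≡ 2 * h) ⊎ (Σ ℕ λ h → n ≡ 2 * h + 1)
parity zero = inj₁ (0 , refl)
parity (suc n) with parity n
... | inj₁ (h , q) = inj₂ (h , (lin≡ (nums (n ∷ h ∷ [])) 1 (1+ x0) ((2 ⊛ x1) ⊕ (` 1)) (≡! x0 (2 ⊛ x1) q ∷ [])))
... | inj₂ (h , q) = inj₁ (suc h , (lin≡ (nums (n ∷ h ∷ [])) 1 (1+ x0) (2 ⊛ (1+ x1)) (≡! x0 ((2 ⊛ x1) ⊕ (` 1)) q ∷ [])))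

odd≢even : ∀ a b → 2 * a + 1 ≡ 2 * b → ⊥
odd≢even zero zero ()
odd≢even (suc a) zero ()
odd≢even zero (suc b) q = (⊥-elim (1+n≰n (lin (nums (b ∷ [])) 1 (` 1) (` 0) (≡˘ (2 ⊛ (1+ x0)) (` 1) q ∷ []))))
odd≢even (suc a) (suc b) q = odd≢even a b (lin≡ (nums (a ∷ b ∷ [])) 1 ((2 ⊛ x0) ⊕ (` 1)) (2 ⊛ x1) (≡! ((2 ⊛ (1+ x0)) ⊕ (` 1)) (2 ⊛ (1+ x1)) q ∷ []))

-- The bound is 24 + 24 - 1, the order of a closed walk formed by two short paths from a common root
-- and an edge between their ends. If a robust piece has no odd cycle this short, it has no odd
-- closed walk at all, by `EvenWalks`.
record OddCycle (e : Rel) (G : List ℕ) : Set where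
  constructor oddCycle
  field
    {u v} : ℕ
    C : List ℕ
    W : Walk e u C v
    cl : e v u ≡ true
    inG : C ⊑ G
    h : ℕ
    odd : length C ≡ 2 * h + 1
    short : length C ≤ 47

-- At a repeated vertex an odd closed walk falls apart into two closed walks, one of which is odd
-- again.
odd-closed : ∀ {e G} f {u v} C → length C ≤ f → Walk e u C v → e v u ≡ true → (∀ x → x ∈ C → x ∈ G) → length C ≤ 47 →
  ∀ h → length C ≡ 2 * h + 1 → OddCycle e G
odd-closed zero C hf W cl inG l47 h odd = (⊥-elim (1+n≰n (lin (lists [] (C ∷ []) []) 1 (` 1) (` 0) (≤! (∥ L0) (` 0) hf ∷ ≤! (` 1) (∥ L0) (wlen W) ∷ []))))
odd-closed {e} {G} (suc f) {u} {v} C hf W cl inG l47 h odd with dup? C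
... | inj₁ nd = oddCycle C W cl (sub C G nd inG) h odd l47
... | inj₂ (as , x , bs , cs , refl) = split (wcut₂ as x bs x cs W) (parity (length (x ∷ bs)))
  where
  inner : ∀ {x} bs → Walk e x (x ∷ bs ++ x ∷ []) x → Σ ℕ λ z → Walk e x (x ∷ bs) z × (e z x ≡ true)
  inner {x} bs V = wunsnoc (x ∷ bs) x (s≤s z≤n) V
  split : Walk e u (as ++ x ∷ []) x × Walk e x (x ∷ bs ++ x ∷ []) x × Walk e x (x ∷ cs) v →
    (Σ ℕ λ h → length (x ∷ bs) ≡ 2 * h) ⊎ (Σ ℕ λ h → length (x ∷ bs) ≡ 2 * h + 1) → OddCycle e G
  split (W₁ , W₂ , W₃) (inj₂ (h' , q)) with inner bs W₂
  ... | z , V , zx = odd-closed f (x ∷ bs) (lin (lists (x ∷ []) (bs ∷ as ∷ cs ∷ []) (f ∷ [])) 1 (∥ (0 ▹ L0)) x0 (≤! (∥ (L1 ⧺ 0 ▹ L0 ⧺ 0 ▹ L2)) (1+ x0) hf ∷ [])) V zx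
    (λ y m → inG y (lin (env (y ≡ᵇ_) (x ∷ []) (as ∷ bs ∷ cs ∷ []) []) 1 (` 1) (# (L0 ⧺ 0 ▹ L1 ⧺ 0 ▹ L2)) (≤! (` 1) (# (0 ▹ L1)) m ∷ [])))
    (lin (lists (x ∷ []) (bs ∷ as ∷ cs ∷ []) []) 1 (∥ (0 ▹ L0)) (` 47) (≤! (∥ (L1 ⧺ 0 ▹ L0 ⧺ 0 ▹ L2)) (` 47) l47 ∷ [])) h' q
  split (W₁ , W₂ , W₃) (inj₁ (h' , q)) = rest (parity (length (as ++ x ∷ cs)))
    where
    rest : (Σ ℕ λ h → length (as ++ x ∷ cs) ≡ 2 * h) ⊎ (Σ ℕ λ h → length (as ++ x ∷ cs) ≡ 2 * h + 1) → OddCycle e G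
    rest (inj₁ (h'' , q')) = ⊥-elim (odd≢even h (h' + h'') (lin≡ (lists (x ∷ []) (as ∷ bs ∷ cs ∷ []) (h ∷ h' ∷ h'' ∷ [])) 1 ((2 ⊛ x0) ⊕ (` 1)) (2 ⊛ (x1 ⊕ x2)) (≡˘ ((2 ⊛ x0) ⊕ (` 1)) (∥ (L0 ⧺ 0 ▹ L1 ⧺ 0 ▹ L2)) odd ∷ ≡! (1+ (∥ L1)) (2 ⊛ x1) q ∷ ≡! (∥ (L0 ⧺ 0 ▹ L2)) (2 ⊛ x2) q' ∷ [])))
    rest (inj₂ (h'' , q')) = odd-closed f (as ++ x ∷ cs) (lin (lists (x ∷ []) (as ∷ cs ∷ bs ∷ []) (f ∷ [])) 1 (∥ (L0 ⧺ 0 ▹ L1)) x0 (≤! (∥ (L0 ⧺ 0 ▹ L2 ⧺ 0 ▹ L1)) (1+ x0) hf ∷ []))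
      (wglue as x cs W₁ W₃) cl
      (λ y m → inG y (lin (env (y ≡ᵇ_) (x ∷ []) (as ∷ bs ∷ cs ∷ []) []) 1 (` 1) (# (L0 ⧺ 0 ▹ L1 ⧺ 0 ▹ L2)) (≤! (` 1) (# (L0 ⧺ 0 ▹ L2)) m ∷ [])))
      (lin (lists (x ∷ []) (as ∷ cs ∷ bs ∷ []) []) 1 (∥ (L0 ⧺ 0 ▹ L1)) (` 47) (≤! (∥ (L0 ⧺ 0 ▹ L2 ⧺ 0 ▹ L1)) (` 47) l47 ∷ [])) h'' q'

-- The parity of a walk is read off from short paths to its vertices from a fixed root.
module EvenWalks (e : Rel) (sy : SymR e) (G : List ℕ) (short : ∀ u v → u ∈ G → v ∈ G → ShortPath e G u v)
  (nbr : ∀ v → v ∈ G → 1 ≤ cnt (e v) G) (noOdd : OddCycle e G → ⊥) (ρ : ℕ) (mρ : ρ ∈ G) where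

  S : ℕ → Set
  S x = ShortPath e G ρ x
  len : ∀ {x} → S x → ℕ
  len P = length (ShortPath.xs P)

  Odd : ℕ → Set
  Odd n = Σ ℕ λ h → n ≡ 2 * h + 1

  edge : ∀ {x x'} (P : S x) (P' : S x') → e x x' ≡ true → Odd (len P + len P')
  edge {x} {x'} (shortPath as W inG l) (shortPath as' W' inG' l') xx' with wshape W'
  ... | as'' , refl = go as'' W' inG' l' (parity (length as + length (ρ ∷ as'')))
    where
    go : ∀ as'' → Walk e ρ (ρ ∷ as'') x' → (ρ ∷ as'') ⊑ G → length (ρ ∷ as'') ≤ 24 →
      (Σ ℕ λ h → length as + length (ρ ∷ as'') ≡ 2 * h) ⊎ Odd (length as + length (ρ ∷ as'')) → Odd (length as + length (ρ ∷ as''))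
    go as'' W' inG' l' (inj₂ o) = o
    go as'' W' inG' l' (inj₁ (zero , q)) = (⊥-elim (1+n≰n (lin (lists [] (as ∷ as'' ∷ []) []) 1 (` 1) (` 0) (≡! ((∥ L0) ⊕ (1+ (∥ L1))) (` 0) q ∷ []))))
    go [] W' inG' l' (inj₁ (suc h , q)) with wsingle W'
    ... | refl = ⊥-elim (noOdd (odd-closed (length as) as ≤-refl W xx' (λ y m → ∈-⊑ y inG m) (lin (lists [] (as ∷ []) []) 1 (∥ L0) (` 47) (≤! (∥ L0) (` 24) l ∷ []))
        h (lin≡ (lists [] (as ∷ []) (h ∷ [])) 1 (∥ L0) ((2 ⊛ x0) ⊕ (` 1)) (≡! ((∥ L0) ⊕ (` 1)) (2 ⊛ (1+ x0)) q ∷ []))))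
    go (r ∷ R) W' inG' l' (inj₁ (suc h , q)) with wtail (r ∷ R) r (s≤s z≤n) W'
    ... | ρr , V = ⊥-elim (noOdd (odd-closed (length L) L ≤-refl (join W xx' (wrev sy V)) (trans (sy r ρ) ρr)
        (λ y m → mem y (∈-++⁻ y as (reverse (r ∷ R)) m)) (lin (lists (r ∷ ρ ∷ []) (as ∷ R ∷ []) []) 1 (∥ (L0 ⧺ (rev (0 ▹ L1)))) (` 47) (≤! (∥ L0) (` 24) l ∷ ≤! (∥ (1 ▹ 0 ▹ L1)) (` 24) l' ∷ []))
        h (lin≡ (lists (r ∷ ρ ∷ []) (as ∷ R ∷ []) (h ∷ [])) 1 (∥ (L0 ⧺ (rev (0 ▹ L1)))) ((2 ⊛ x0) ⊕ (` 1)) (≡! ((∥ L0) ⊕ (∥ (1 ▹ 0 ▹ L1))) (2 ⊛ (1+ x0)) q ∷ []))))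
      where
      L = as ++ reverse (r ∷ R)
      mem : ∀ y → y ∈ as ⊎ y ∈ reverse (r ∷ R) → y ∈ G
      mem y (inj₁ m) = ∈-⊑ y inG m
      mem y (inj₂ m) = ∈-⊑ y inG' (lin (env (y ≡ᵇ_) (ρ ∷ r ∷ []) (R ∷ []) []) 1 (` 1) (# (0 ▹ 1 ▹ L0)) (≤! (` 1) (# (rev (1 ▹ L0))) m ∷ []))

  walk-odd : ∀ {x y xs} → Walk e x xs y → (∀ z → z ∈ xs → z ∈ G) → (P : S x) (P' : S y) → Odd (len P + length xs + len P')
  walk-odd [ x ] inG P P' = base (cnt-wit (e x) G (nbr x (inG x (∈-here x []))))
    where
    -- Two paths from the root to the same vertex have equal parity because both are compared, by
    -- `edge`, with one path to a neighbour of that vertex.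
    base : (Σ ℕ λ x' → (x' ∈ G) × (e x x' ≡ true)) → Odd (len P + 1 + len P')
    base (x' , m , xx') = fix (edge P Q xx') (edge P' Q xx') (parity (len P + 1 + len P'))
      where
      Q : S x'
      Q = short ρ x' mρ m
      fix : Odd (len P + len Q) → Odd (len P' + len Q) → (Σ ℕ λ h → len P + 1 + len P' ≡ 2 * h) ⊎ Odd (len P + 1 + len P') → Odd (len P + 1 + len P')
      fix _ _ (inj₂ o) = o
      fix (h , q) (h' , q') (inj₁ (g , r)) = ⊥-elim (odd≢even (h + h' + 1) (g + len Q) (lin≡ (nums (h ∷ h' ∷ g ∷ (len Q) ∷ (len P) ∷ (len P') ∷ [])) 1 ((2 ⊛ ((x0 ⊕ x1) ⊕ (` 1))) ⊕ (` 1)) (2 ⊛ (x2 ⊕ x3)) (≡˘ ((2 ⊛ x0) ⊕ (` 1)) (x4 ⊕ x3) q ∷ ≡˘ ((2 ⊛ x1) ⊕ (` 1)) (x5 ⊕ x3) q' ∷ ≡! ((x4 ⊕ (` 1)) ⊕ x5) (2 ⊛ x2) r ∷ [])))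
  walk-odd (_◂_ {x} {x'} {xs} xx' W) inG P P' = fix (edge P Q xx') (walk-odd W (λ z m → inG z (∈-there z x xs m)) Q P') (parity (len P + suc (length xs) + len P'))
    where
    Q = short ρ x' mρ (inG x' (∈-there x' x xs (w∈ˡ W)))
    fix : Odd (len P + len Q) → Odd (len Q + length xs + len P') →
      (Σ ℕ λ h → len P + suc (length xs) + len P' ≡ 2 * h) ⊎ Odd (len P + suc (length xs) + len P') → Odd (len P + suc (length xs) + len P')
    fix _ _ (inj₂ o) = o
    fix (h , q) (h' , q') (inj₁ (g , r)) = ⊥-elim (odd≢even (h + h' + 1) (g + len Q) (lin≡ (lists [] (xs ∷ []) (h ∷ h' ∷ g ∷ (len Q) ∷ (len P) ∷ (len P') ∷ [])) 1 ((2 ⊛ ((x0 ⊕ x1) ⊕ (` 1))) ⊕ (` 1)) (2 ⊛ (x2 ⊕ x3)) (≡˘ ((2 ⊛ x0) ⊕ (` 1)) (x4 ⊕ x3) q ∷ ≡˘ ((2 ⊛ x1) ⊕ (` 1)) ((x3 ⊕ (∥ L0)) ⊕ x5) q' ∷ ≡! ((x4 ⊕ (1+ (∥ L0))) ⊕ x5) (2 ⊛ x2) r ∷ [])))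

  closed-even : ∀ {v C} → Walk e ρ C v → (∀ z → z ∈ C → z ∈ G) → e v ρ ≡ true → ∀ h → length C ≡ 2 * h + 1 → ⊥
  closed-even {v} {C} W inG cl h q = clash (walk-odd W inG P₀ Q) (edge Q P₀ cl)
    where
    P₀ : S ρ
    P₀ = shortPath (ρ ∷ []) [ ρ ] (sub (ρ ∷ []) G (nodup-∷ ρ [] refl (λ _ → z≤n)) one) (s≤s z≤n)
      where
      one : ∀ x → x ∈ (ρ ∷ []) → x ∈ G
      one x m with ∈-∷⁻ x ρ [] m
      ... | inj₁ refl = mρ
    Q : S v
    Q = short ρ v mρ (inG v (w∈ʳ W))
    clash : Odd (1 + length C + len Q) → Odd (len Q + 1) → ⊥
    clash (g , r) (g' , r') = odd≢even g (h + g' + 1) (lin≡ (lists [] (C ∷ []) (g ∷ h ∷ g' ∷ (len Q) ∷ [])) 1 ((2 ⊛ x0) ⊕ (` 1)) (2 ⊛ ((x1 ⊕ x2) ⊕ (` 1))) (≡˘ ((2 ⊛ x0) ⊕ (` 1)) (((` 1) ⊕ (∥ L0)) ⊕ x3) r ∷ ≡! (x3 ⊕ (` 1)) ((2 ⊛ x2) ⊕ (` 1)) r' ∷ ≡! (∥ L0) ((2 ⊛ x1) ⊕ (` 1)) q ∷ []))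

-- There are two families of paths, based at `a` and at `a + δ`, each adjustable in steps of two.
-- The initial odd cycle or vertex accounts for 47. A step adds at most 23 vertices of the link,
-- including p, and the vertices x, q, y, and it raises the base lengths by at most 24.
record Connector (e : Rel) (G : List ℕ) (u δ t : ℕ) : Set where
  constructor connector
  field
    S : List ℕ
    v a : ℕ
    fa : Flex e S u v a t
    fb : Flex e S u v (a + δ) t
    inG : S ⊑ G
    size : length S ≤ 47 + 26 * t
    aSize : a ≤ 2 + 24 * t
    mu : u ∈ S
    mv : v ∈ S

-- Each step appends a short link and a 4-cycle p x q y, which is left through p x or through p y q x.
module Gadget (e : Rel) (sy : SymR e) (irr : Irr e) (G : List ℕ) (dG : NoDup G) (k m c : ℕ) (md : MinDeg e (m + c) G)
  (rob : Robust e k G) (lG : length G ≤ 7 * m) (lG' : 2 * m + 8 ≤ length G) where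

  four : ∀ {G₁} → G₁ ⊑ G → MinDeg e (m + 5) G₁ → length G₁ ≤ 7 * m → 8 ≤ length G₁ →
    Σ ℕ λ p → Σ ℕ λ q → Σ ℕ λ x → Σ ℕ λ y → ((x ∷ y ∷ p ∷ q ∷ []) ⊑ G₁) × (e p x ≡ true) × (e p y ≡ true) × (e q x ≡ true) × (e q y ≡ true)
  four {G₁} G₁⊑ md₁ l₁ l8 = go (takeSplit 8 G₁ l8)
    where
    Goal = Σ ℕ λ p → Σ ℕ λ q → Σ ℕ λ x → Σ ℕ λ y → ((x ∷ y ∷ p ∷ q ∷ []) ⊑ G₁) × (e p x ≡ true) × (e p y ≡ true) × (e q x ≡ true) × (e q y ≡ true)
    go : (Σ (List ℕ) λ A → Σ (List ℕ) λ R → Split G₁ A R × length A ≡ 8) → Goal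
    go (hs , R , sh , l) = go₂ (findCommon e 1 (m + 5) G₁ hs l (λ x mx → md₁ x (∈-⊑ x (splitˡ sh) mx)) (lin (lists [] (G₁ ∷ []) (m ∷ [])) 1 (1+ ((∥ L0) ⊕ (28 ⊛ (` 1)))) (8 ⊛ (x0 ⊕ (` 5))) (≤! (∥ L0) (7 ⊛ x0) l₁ ∷ [])))
      where
      go₂ : CommonPair e 1 G₁ hs → Goal
      go₂ (commonPair {as} {p} {bs} {q} {cs} refl many) = go₃ (pick Q G₁ (≤-trans (s≤s z≤n) many))
        where
        Q : ℕ → Bool
        Q z = e p z ∧ e q z
        pq : (p ∷ q ∷ []) ⊑ G₁
        pq = le: λ r → (lin (env r (p ∷ q ∷ []) (G₁ ∷ as ∷ bs ∷ cs ∷ R ∷ []) []) 1 (# (0 ▹ 1 ▹ nil)) (# L0) (≡˘ ((# (L1 ⧺ 0 ▹ L2 ⧺ 1 ▹ L3)) ⊕ (# L4)) (# L0) (spl sh r) ∷ []))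
        go₃ : (Σ ℕ λ x → Σ (List ℕ) λ R → Split G₁ (x ∷ []) R × (Q x ≡ true)) → Goal
        go₃ (x , R₁ , s₁ , qx) = go₄ (pick Q R₁ (lin (env Q (x ∷ []) (R₁ ∷ G₁ ∷ []) []) 1 (` 1) (# L0) (≤! (` 2) (# L1) many ∷ ≡! (# L1) ((# (0 ▹ nil)) ⊕ (# L0)) (spl s₁ Q) ∷ ≤! (bit 0) (` 1) (b2n-≤1 (Q x)) ∷ [])))
          where
          go₄ : (Σ ℕ λ y → Σ (List ℕ) λ R → Split R₁ (y ∷ []) R × (Q y ≡ true)) → Goal
          go₄ (y , R₂ , s₂ , qy) = p , q , x , y , occ⇒⊑ (x ∷ y ∷ p ∷ q ∷ []) G₁ inc , proj₁ (∧-true qx) , proj₁ (∧-true qy) , proj₂ (∧-true qx) , proj₂ (∧-true qy)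
            where
            differ : ∀ z w → Q z ≡ true → Q w ≡ false → b2n (w ≡ᵇ z) ≡ 0
            differ z w t f = b2n-f (==-false {w} {z} λ { refl → t≢f t f })
            differ' : ∀ z w → Q z ≡ false → Q w ≡ true → b2n (w ≡ᵇ z) ≡ 0
            differ' z w f t = b2n-f (==-false {w} {z} λ { refl → t≢f t f })
            -- By irreflexivity neither p nor q is a common neighbour of both, which keeps x and y
            -- apart from them.
            Qp : Q p ≡ false
            Qp = cong (_∧ e q p) (irr p)
            Qq : Q q ≡ false
            Qq with e p q | irr q
            ... | true | h = h
            ... | false | h = refl
            inc : ∀ z → occ z (x ∷ y ∷ p ∷ q ∷ []) ≤ occ z G₁
            inc z with bool (Q z)
            ... | inj₁ t = (lin (env (z ≡ᵇ_) (x ∷ y ∷ p ∷ q ∷ []) (G₁ ∷ R₁ ∷ R₂ ∷ []) []) 1 (# (0 ▹ 1 ▹ 2 ▹ 3 ▹ nil)) (# L0) (≡! (bit 2) (` 0) (differ' p z Qp t) ∷ ≡! (bit 3) (` 0) (differ' q z Qq t) ∷ ≡˘ ((# (0 ▹ nil)) ⊕ (# L1)) (# L0) (spl s₁ (z ≡ᵇ_)) ∷ ≡˘ ((# (1 ▹ nil)) ⊕ (# L2)) (# L1) (spl s₂ (z ≡ᵇ_)) ∷ []))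
            ... | inj₂ f = (lin (env (z ≡ᵇ_) (x ∷ y ∷ p ∷ q ∷ []) (G₁ ∷ []) []) 1 (# (0 ▹ 1 ▹ 2 ▹ 3 ▹ nil)) (# L0) (≡! (bit 0) (` 0) (differ x z qx f) ∷ ≡! (bit 1) (` 0) (differ y z qy f) ∷ ≤! (# (2 ▹ 3 ▹ nil)) (# L0) (⊑at pq (z ≡ᵇ_)) ∷ []))

  step : ∀ {u δ t} → 47 + 26 * t + 10 ≤ k → 47 + 26 * t + 20 ≤ c → 47 + 26 * t ≤ m → Connector e G u δ t →
    Σ (Connector e G u δ (suc t)) λ K → ¬ u ≡ Connector.v K
  step {u} {δ} {t} hk hc hm (connector S v a fa fb inG size aSize mu mv) = go (diff⊑ S G inG) (∈-remove v S mv)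
    where
    Goal = Σ (Connector e G u δ (suc t)) λ K → ¬ u ≡ Connector.v K
    go : Σ (List ℕ) (λ G₁ → Split G S G₁) → Σ (List ℕ) (λ S⁻ → Split S (v ∷ []) S⁻) → Goal
    go (G₁ , sG) (S⁻ , sS) = go₂ (four (splitʳ sG) (minDeg-restrict {d = m + 5} {c = 47 + 26 * t} sG size
          λ x mx → (lin (env (e x) [] (G ∷ []) (m ∷ t ∷ c ∷ [])) 1 ((x0 ⊕ (` 5)) ⊕ ((` 47) ⊕ (26 ⊛ x1))) (# L0) (≤! (x0 ⊕ x2) (# L0) (md x mx) ∷ ≤! (((` 47) ⊕ (26 ⊛ x1)) ⊕ (` 20)) x2 hc ∷ [])))
        (lin (lists [] (G₁ ∷ S ∷ G ∷ []) (m ∷ [])) 1 (∥ L0) (7 ⊛ x0) (≡˘ ((∥ L1) ⊕ (∥ L0)) (∥ L2) (split-len G S G₁ sG) ∷ ≤! (∥ L2) (7 ⊛ x0) lG ∷ []))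
        (lin (lists [] (G₁ ∷ G ∷ S ∷ []) (m ∷ t ∷ [])) 55 (` 8) (∥ L0) (8 ×! ≡! (∥ L1) ((∥ L2) ⊕ (∥ L0)) (split-len G S G₁ sG) ∷ 8 ×! ≤! ((2 ⊛ x0) ⊕ (` 8)) (∥ L1) lG' ∷ 8 ×! ≤! (∥ L2) ((` 47) ⊕ (26 ⊛ x1)) size ∷ 16 ×! ≤! ((` 47) ⊕ (26 ⊛ x1)) x0 hm ∷ [])))
      where
      go₂ : (Σ ℕ λ p → Σ ℕ λ q → Σ ℕ λ x → Σ ℕ λ y → ((x ∷ y ∷ p ∷ q ∷ []) ⊑ G₁) × (e p x ≡ true) × (e p y ≡ true) × (e q x ≡ true) × (e q y ≡ true)) → Goal
      go₂ (p , q , x , y , h4 , px , py , qx , qy) = go₃ (diff⊑ D G (le: λ r → (lin (env r (v ∷ p ∷ []) (D ∷ G ∷ []) []) 1 (# L0) (# L1) (≤! ((# L0) ⊕ ((bit 0) ⊕ (bit 1))) (# L1) (room r) ∷ []))))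
        where
        -- Deleted before `v` is linked to p: the old connector except `v`, and the 4-cycle except
        -- p.
        D = S⁻ ++ x ∷ q ∷ y ∷ []
        room : ∀ r → cnt r D + (b2n (r v) + b2n (r p)) ≤ cnt r G
        room r = (lin (env r (v ∷ p ∷ x ∷ q ∷ y ∷ []) (D ∷ G ∷ S⁻ ∷ S ∷ G₁ ∷ []) []) 1 ((# L0) ⊕ ((bit 0) ⊕ (bit 1))) (# L1) (≡! (# L0) (# (L2 ⧺ 2 ▹ 3 ▹ 4 ▹ nil)) (refl {x = cnt r D}) ∷ ≡˘ ((# (0 ▹ nil)) ⊕ (# L2)) (# L3) (spl sS r) ∷ ≡˘ ((# L3) ⊕ (# L4)) (# L1) (spl sG r) ∷ ≤! (# (2 ▹ 4 ▹ 1 ▹ 3 ▹ nil)) (# L4) (⊑at h4 r) ∷ []))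
        lD : length D ≤ 47 + 26 * t + 3
        lD = (lin (lists (x ∷ q ∷ y ∷ []) (D ∷ S⁻ ∷ S ∷ []) (t ∷ [])) 1 (∥ L0) (((` 47) ⊕ (26 ⊛ x0)) ⊕ (` 3)) (≡! (∥ L0) (∥ (L1 ⧺ 0 ▹ 1 ▹ 2 ▹ nil)) (refl {x = length D}) ∷ ≡˘ ((` 1) ⊕ (∥ L1)) (∥ L2) (split-len S (v ∷ []) S⁻ sS) ∷ ≤! (∥ L2) ((` 47) ⊕ (26 ⊛ x0)) size ∷ []))
        go₃ : Σ (List ℕ) (λ G₂ → Split G D G₂) → Goal
        go₃ (G₂ , s₂) = go₄ (link sy (robust-restrict {k' = 0} s₂ (lin (lists [] (D ∷ []) (k ∷ t ∷ [])) 1 ((∥ L0) ⊕ (` 0)) x0 (≤! (∥ L0) (((` 47) ⊕ (26 ⊛ x1)) ⊕ (` 3)) lD ∷ ≤! (((` 47) ⊕ (26 ⊛ x1)) ⊕ (` 10)) x0 hk ∷ [])) rob)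
            (minDeg-restrict {d = suc m} {c = 47 + 26 * t + 3} s₂ lD λ z mz → (lin (env (e z) [] (G ∷ []) (m ∷ t ∷ c ∷ [])) 1 ((1+ x0) ⊕ (((` 47) ⊕ (26 ⊛ x1)) ⊕ (` 3))) (# L0) (≤! (x0 ⊕ x2) (# L0) (md z mz) ∷ ≤! (((` 47) ⊕ (26 ⊛ x1)) ⊕ (` 20)) x2 hc ∷ [])))
            (lin (lists [] (G₂ ∷ D ∷ G ∷ []) (m ∷ [])) 1 (1+ (∥ L0)) (8 ⊛ (1+ x0)) (≡˘ ((∥ L1) ⊕ (∥ L0)) (∥ L2) (split-len G D G₂ s₂) ∷ ≤! (∥ L2) (7 ⊛ x0) lG ∷ [])) v p
            (lin (env (v ≡ᵇ_) (v ∷ p ∷ []) (G₂ ∷ D ∷ G ∷ []) []) 1 (` 1) (# L0) (≤! ((# L1) ⊕ ((bit 0) ⊕ (bit 1))) (# L2) (room (v ≡ᵇ_)) ∷ ≡! (# L2) ((# L1) ⊕ (# L0)) (spl s₂ (v ≡ᵇ_)) ∷ ≡˘ (` 1) (bit 0) (b2n-t (==-refl v)) ∷ []))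
            (lin (env (p ≡ᵇ_) (v ∷ p ∷ []) (G₂ ∷ D ∷ G ∷ []) []) 1 (` 1) (# L0) (≤! ((# L1) ⊕ ((bit 0) ⊕ (bit 1))) (# L2) (room (p ≡ᵇ_)) ∷ ≡! (# L2) ((# L1) ⊕ (# L0)) (spl s₂ (p ≡ᵇ_)) ∷ ≡˘ (` 1) (bit 1) (b2n-t (==-refl p)) ∷ [])))
          where
          go₄ : ShortPath e G₂ v p → Goal
          go₄ (shortPath zs V zs⊑ lz) with wshape V
          ... | [] , refl with wsingle V
          ... | refl = (⊥-elim (1+n≰n (lin (env (v ≡ᵇ_) (v ∷ []) (D ∷ G ∷ []) []) 1 (` 1) (` 0) (≤! ((# L0) ⊕ ((bit 0) ⊕ (bit 0))) (# L1) (room (v ≡ᵇ_)) ∷ 2 ×! ≡˘ (` 1) (bit 0) (b2n-t (==-refl v)) ∷ ≤! (# L1) (` 1) (dG v) ∷ []))))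
          go₄ (shortPath zs V zs⊑ lz) | Λ@(λ₀ ∷ Λ') , refl with wtail Λ v (s≤s z≤n) V
          ... | vλ , VΛ = connector S' x (a + suc (length Λ)) (flex a fa)
              (subst (λ z → Flex e S' u x z (suc t)) (lin≡ (lists [] (Λ ∷ []) (a ∷ δ ∷ [])) 1 ((x0 ⊕ x1) ⊕ (1+ (∥ L0))) ((x0 ⊕ (1+ (∥ L0))) ⊕ x1) []) (flex (a + δ) fb))
              (le: λ r → (lin (env r (x ∷ q ∷ y ∷ v ∷ []) (S' ∷ G ∷ S ∷ Λ ∷ S⁻ ∷ D ∷ G₂ ∷ []) []) 1 (# L0) (# L1) (≡! (# L0) ((# L2) ⊕ ((# L3) ⊕ (# (0 ▹ 1 ▹ 2 ▹ nil)))) (cS' r) ∷ ≡! (# L2) ((# (3 ▹ nil)) ⊕ (# L4)) (spl sS r) ∷ ≡˘ (# (L4 ⧺ 0 ▹ 1 ▹ 2 ▹ nil)) (# L5) (refl {x = cnt r D}) ∷ ≡˘ ((# L5) ⊕ (# L6)) (# L1) (spl s₂ r) ∷ ≤! (# (3 ▹ L3)) (# L6) (⊑at zs⊑ r) ∷ [])))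
              (lin (lists (x ∷ q ∷ y ∷ v ∷ []) (S' ∷ S ∷ Λ ∷ []) (t ∷ [])) 1 (∥ L0) ((` 47) ⊕ (26 ⊛ (1+ x0))) (≡! (∥ L0) (∥ (L1 ⧺ L2 ⧺ 0 ▹ 1 ▹ 2 ▹ nil)) (refl {x = length S'}) ∷ ≤! (∥ L1) ((` 47) ⊕ (26 ⊛ x0)) size ∷ ≤! (∥ (3 ▹ L2)) (` 24) lz ∷ []))
              (lin (lists (v ∷ []) (Λ ∷ []) (a ∷ t ∷ [])) 1 (x0 ⊕ (1+ (∥ L0))) ((` 2) ⊕ (24 ⊛ (1+ x1))) (≤! x0 ((` 2) ⊕ (24 ⊛ x1)) aSize ∷ ≤! (∥ (0 ▹ L0)) (` 24) lz ∷ []))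
              (∈-++ˡ u S (Λ ++ x ∷ q ∷ y ∷ []) mu) (∈-++ʳ x S (Λ ++ x ∷ q ∷ y ∷ []) (∈-mid Λ x (q ∷ y ∷ []))) , u≢x
            where
            S' = S ++ Λ ++ x ∷ q ∷ y ∷ []
            cS' : ∀ r → cnt r S' ≡ cnt r S + (cnt r Λ + cnt r (x ∷ q ∷ y ∷ []))
            cS' r = trans (cnt-++ r S _) (cong (cnt r S +_) (cnt-++ r Λ _))
            u≢x : ¬ u ≡ x
            u≢x refl = (⊥-elim (1+n≰n (lin (env (u ≡ᵇ_) (u ∷ y ∷ p ∷ q ∷ []) (S ∷ G₁ ∷ G ∷ []) []) 1 (` 1) (` 0) (≤! (` 1) (# L0) mu ∷ ≤! (# (0 ▹ 1 ▹ 2 ▹ 3 ▹ nil)) (# L1) (⊑at h4 (u ≡ᵇ_)) ∷ ≡˘ (` 1) (bit 0) (b2n-t (==-refl u)) ∷ ≡˘ ((# L0) ⊕ (# L1)) (# L2) (spl sG (u ≡ᵇ_)) ∷ ≤! (# L2) (` 1) (dG u) ∷ []))))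
            append : ∀ n → PathLen e S u v n → (PathLen e S' u x (n + suc (length Λ))) × (PathLen e S' u x (n + (3 + length Λ)))
            append n (F , WF , F⊑ , lF) =
              (F ++ Λ ++ x ∷ [] , join WF vλ (join VΛ px [ x ]) ,
                (le: λ r → (lin (env r (x ∷ q ∷ y ∷ []) (F ∷ Λ ∷ S' ∷ S ∷ []) []) 1 (# (L0 ⧺ L1 ⧺ 0 ▹ nil)) (# L2) (≡˘ ((# L3) ⊕ ((# L1) ⊕ (# (0 ▹ 1 ▹ 2 ▹ nil)))) (# L2) (cS' r) ∷ ≤! (# L0) (# L3) (⊑at F⊑ r) ∷ []))) ,
                (lin≡ (lists (x ∷ []) (F ∷ Λ ∷ []) (n ∷ [])) 1 (∥ (L0 ⧺ L1 ⧺ 0 ▹ nil)) (x0 ⊕ (1+ (∥ L1))) (≡! (∥ L0) x0 lF ∷ []))) ,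
              (F ++ Λ ++ y ∷ q ∷ x ∷ [] , join WF vλ (join VΛ py (trans (sy y q) qy ◂ qx ◂ [ x ])) ,
                (le: λ r → (lin (env r (y ∷ q ∷ x ∷ []) (F ∷ Λ ∷ S' ∷ S ∷ []) []) 1 (# (L0 ⧺ L1 ⧺ 0 ▹ 1 ▹ 2 ▹ nil)) (# L2) (≡˘ ((# L3) ⊕ ((# L1) ⊕ (# (2 ▹ 1 ▹ 0 ▹ nil)))) (# L2) (cS' r) ∷ ≤! (# L0) (# L3) (⊑at F⊑ r) ∷ []))) ,
                (lin≡ (lists (y ∷ q ∷ x ∷ []) (F ∷ Λ ∷ []) (n ∷ [])) 1 (∥ (L0 ⧺ L1 ⧺ 0 ▹ 1 ▹ 2 ▹ nil)) (x0 ⊕ ((` 3) ⊕ (∥ L1))) (≡! (∥ L0) x0 lF ∷ [])))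
            flex : ∀ a → Flex e S u v a t → Flex e S' u x (a + suc (length Λ)) (suc t)
            flex a F zero h = let xs , W , i , l = proj₁ (append (a + 0) (F 0 z≤n)) in xs , W , i , trans l (lin≡ (lists [] (Λ ∷ []) (a ∷ [])) 1 ((x0 ⊕ (` 0)) ⊕ (1+ (∥ L0))) ((x0 ⊕ (1+ (∥ L0))) ⊕ (` 0)) [])
            flex a F (suc i) (s≤s h) = let xs , W , j , l = proj₂ (append (a + 2 * i) (F i h)) in xs , W , j , trans l (lin≡ (lists [] (Λ ∷ []) (a ∷ i ∷ [])) 1 ((x0 ⊕ (2 ⊛ x1)) ⊕ ((` 3) ⊕ (∥ L0))) ((x0 ⊕ (1+ (∥ L0))) ⊕ (2 ⊛ (1+ x1))) [])

  chain : ∀ {u δ} t → 47 + 26 * t + 10 ≤ k → 47 + 26 * t + 20 ≤ c → 47 + 26 * t ≤ m → Connector e G u δ 0 → Connector e G u δ t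
  chain zero _ _ _ K = K
  chain (suc t) hk hc hm K = proj₁ (step k' c' m' (chain t k' c' m' K))
    where
    k' = (lin (nums (t ∷ k ∷ [])) 1 (((` 47) ⊕ (26 ⊛ x0)) ⊕ (` 10)) x1 (≤! (((` 47) ⊕ (26 ⊛ (1+ x0))) ⊕ (` 10)) x1 hk ∷ []))
    c' = (lin (nums (t ∷ c ∷ [])) 1 (((` 47) ⊕ (26 ⊛ x0)) ⊕ (` 20)) x1 (≤! (((` 47) ⊕ (26 ⊛ (1+ x0))) ⊕ (` 20)) x1 hc ∷ []))
    m' = (lin (nums (t ∷ m ∷ [])) 1 ((` 47) ⊕ (26 ⊛ x0)) x1 (≤! ((` 47) ⊕ (26 ⊛ (1+ x0))) x1 hm ∷ []))

-- A robust graph of minimum degree m + c on at least 2m + O(1) vertices contains C_{2m}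

-- A connector has at most 47 + 26(t' + 1) = 73 + 26t' vertices. The surplus over this number in
-- `hk` and `hc` is left when its inside is deleted and meets the demands 131 and 140 of the long
-- path. In `ht`, 67 + w is the window 24 + w plus the largest δ, which is 45, less the two shared
-- ends.
module Exact (e : Rel) (sy : SymR e) (irr : Irr e) (G : List ℕ) (dG : NoDup G) (k m c : ℕ) (md : MinDeg e (m + c) G)
  (rob : Robust e k G) (lG : length G ≤ 7 * m) (t' w j : ℕ) (ht : 67 + w ≤ 2 * t') (hk : 73 + 26 * t' + 141 ≤ k) (hc : 73 + 26 * t' + 160 ≤ c)
  (hm : 73 + 26 * t' + 10 ≤ m) (hG : 2 * m + (73 + 26 * t') ≤ length G) (hj : 28 * (23 + j) < m) (hw : 7 * m + 1 + w < w * j) where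

  t = suc t'
  open Gadget e sy irr G dG k m c md rob lG (lin (lists [] (G ∷ []) (m ∷ t' ∷ [])) 1 ((2 ⊛ x0) ⊕ (` 8)) (∥ L0) (≤! ((2 ⊛ x0) ⊕ ((` 73) ⊕ (26 ⊛ x1))) (∥ L0) hG ∷ []))

  short : ∀ u v → u ∈ G → v ∈ G → ShortPath e G u v
  short = link sy rob md (lin (lists [] (G ∷ []) (m ∷ c ∷ t' ∷ [])) 233 (1+ (∥ L0)) (8 ⊛ (x0 ⊕ x1)) (233 ×! ≤! (∥ L0) (7 ⊛ x0) lG ∷ ≤! (((` 73) ⊕ (26 ⊛ x2)) ⊕ (` 160)) x1 hc ∷ []))

  nbr : ∀ v → v ∈ G → 1 ≤ cnt (e v) G
  nbr v mv = (lin (env (e v) [] (G ∷ []) (m ∷ c ∷ t' ∷ [])) 233 (` 1) (# L0) (≤! (x0 ⊕ x1) (# L0) (md v mv) ∷ ≤! (((` 73) ⊕ (26 ⊛ x2)) ⊕ (` 160)) x1 hc ∷ []))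

  Parity : ℕ → Set
  Parity δ = (Σ ℕ λ h → δ ≡ 2 * h + 1) ⊎ ((δ ≡ 0) × (OddCycle e G → ⊥))

  -- δ is the difference of the two base lengths of the connector
  close : ∀ {u δ} → δ ≤ 45 → Parity δ → (K : Connector e G u δ t) → ¬ u ≡ Connector.v K → HasCycle e G (2 * m)
  close {u} {δ} hδ par (connector S v a fa fb inG size aSize mu mv) ne = go (diff⊑ (u ∷ v ∷ []) S (pair-⊑ ne mu mv))
    where
    go : Σ (List ℕ) (λ S₀ → Split S (u ∷ v ∷ []) S₀) → HasCycle e G (2 * m)
    go (S₀ , sS) = go₁ (diff⊑ S₀ G (⊑-trans (splitʳ sS) inG))
      where
      lS : length S ≡ 2 + length S₀
      lS = split-len S (u ∷ v ∷ []) S₀ sS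
      go₁ : Σ (List ℕ) (λ G₃ → Split G S₀ G₃) → HasCycle e G (2 * m)
      go₁ (G₃ , sG) = go₂ (longPath (lin (lists [] (G₃ ∷ G ∷ S₀ ∷ S ∷ []) (m ∷ t' ∷ [])) 1 (2 ⊛ x0) (∥ L0) (≡! (∥ L1) ((∥ L2) ⊕ (∥ L0)) lG₃ ∷ ≡˘ ((` 2) ⊕ (∥ L2)) (∥ L3) lS ∷ ≤! (∥ L3) ((` 47) ⊕ (26 ⊛ (1+ x1))) size ∷ ≤! ((2 ⊛ x0) ⊕ ((` 73) ⊕ (26 ⊛ x1))) (∥ L1) hG ∷ [])) v u (λ q → ne (sym q)) mv₃ mu₃)
        where
        lG₃ : length G ≡ length S₀ + length G₃
        lG₃ = split-len G S₀ G₃ sG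
        both : ∀ r → cnt r S₀ + (b2n (r u) + b2n (r v)) ≤ cnt r S₀ + cnt r G₃
        both r = (lin (env r (u ∷ v ∷ []) (S₀ ∷ G₃ ∷ S ∷ G ∷ []) []) 1 ((# L0) ⊕ ((bit 0) ⊕ (bit 1))) ((# L0) ⊕ (# L1)) (≡˘ ((# (0 ▹ 1 ▹ nil)) ⊕ (# L0)) (# L2) (spl sS r) ∷ ≤! (# L2) (# L3) (⊑at inG r) ∷ ≡! (# L3) ((# L0) ⊕ (# L1)) (spl sG r) ∷ []))
        mu₃ : u ∈ G₃
        mu₃ = (lin (env (u ≡ᵇ_) (u ∷ v ∷ []) (G₃ ∷ S₀ ∷ []) []) 1 (` 1) (# L0) (≤! ((# L1) ⊕ ((bit 0) ⊕ (bit 1))) ((# L1) ⊕ (# L0)) (both (u ≡ᵇ_)) ∷ ≡˘ (` 1) (bit 0) (b2n-t (==-refl u)) ∷ []))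
        mv₃ : v ∈ G₃
        mv₃ = (lin (env (v ≡ᵇ_) (u ∷ v ∷ []) (G₃ ∷ S₀ ∷ []) []) 1 (` 1) (# L0) (≤! ((# L1) ⊕ ((bit 0) ⊕ (bit 1))) ((# L1) ⊕ (# L0)) (both (v ≡ᵇ_)) ∷ ≡˘ (` 1) (bit 1) (b2n-t (==-refl v)) ∷ []))
        s₀ = 47 + 26 * suc t'
        lS₀ : length S₀ ≤ s₀
        lS₀ = (lin (lists [] (S₀ ∷ S ∷ []) (t' ∷ [])) 1 (∥ L0) ((` 47) ⊕ (26 ⊛ (1+ x0))) (≡˘ ((` 2) ⊕ (∥ L0)) (∥ L1) lS ∷ ≤! (∥ L1) ((` 47) ⊕ (26 ⊛ (1+ x0))) size ∷ []))
        l₃ : length G₃ ≤ 7 * m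
        l₃ = (lin (lists [] (G₃ ∷ S₀ ∷ G ∷ []) (m ∷ [])) 1 (∥ L0) (7 ⊛ x0) (≡˘ ((∥ L1) ⊕ (∥ L0)) (∥ L2) lG₃ ∷ ≤! (∥ L2) (7 ⊛ x0) lG ∷ []))
        md₃ : MinDeg e (m + 140) G₃
        md₃ = minDeg-restrict {d = m + 140} {c = s₀} sG lS₀ λ x mx → (lin (env (e x) [] (G ∷ []) (m ∷ t' ∷ c ∷ [])) 1 ((x0 ⊕ (` 140)) ⊕ ((` 47) ⊕ (26 ⊛ (1+ x1)))) (# L0) (≤! (x0 ⊕ x2) (# L0) (md x mx) ∷ ≤! (((` 73) ⊕ (26 ⊛ x1)) ⊕ (` 160)) x2 hc ∷ []))
        open LongPaths e sy irr G₃ (nodup-⊑ (splitʳ sG) dG) 131 m 140 md₃ ≤-refl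
          (robust-restrict sG (lin (lists [] (S₀ ∷ []) (k ∷ t' ∷ [])) 1 ((∥ L0) ⊕ (` 131)) x0 (≤! (∥ L0) ((` 47) ⊕ (26 ⊛ (1+ x1))) lS₀ ∷ ≤! (((` 73) ⊕ (26 ⊛ x1)) ⊕ (` 141)) x0 hk ∷ [])) rob) ≤-refl l₃
        open Shorten e sy G₃ (m + 140) j w md₃ (lin (lists [] (G₃ ∷ []) (j ∷ m ∷ [])) 1 (1+ ((∥ L0) ⊕ (28 ⊛ ((` 23) ⊕ x0)))) (8 ⊛ (x1 ⊕ (` 140))) (≤! (∥ L0) (7 ⊛ x1) l₃ ∷ ≤! (1+ (28 ⊛ ((` 23) ⊕ x0))) x1 hj ∷ []))
          (lin (lists [] (G₃ ∷ []) (w ∷ (w * j) ∷ m ∷ [])) 1 (1+ (((∥ L0) ⊕ (` 1)) ⊕ x0)) x1 (≤! (∥ L0) (7 ⊛ x2) l₃ ∷ ≤! (1+ (((7 ⊛ x2) ⊕ (` 1)) ⊕ x0)) x1 hw ∷ [])) {v} {u}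
        -- The order of a path that makes a cycle of 2m vertices with the longest connector of the
        -- first family, the two common ends being counted twice. A path with up to 24 + w more
        -- vertices is compensated by a shorter connector.
        Θ = 2 * m + 2 ∸ (a + 2 * suc t')
        hT : a + 2 * suc t' + Θ ≡ 2 * m + 2
        hT = m+[n∸m]≡n (lin (nums (a ∷ t' ∷ m ∷ [])) 1 (x0 ⊕ (2 ⊛ (1+ x1))) ((2 ⊛ x2) ⊕ (` 2)) (≤! x0 ((` 2) ⊕ (24 ⊛ (1+ x1))) aSize ∷ ≤! (((` 73) ⊕ (26 ⊛ x1)) ⊕ (` 10)) x2 hm ∷ []))
        go₂ : PathOfLength≥ (2 * m) v u → HasCycle e G (2 * m)
        go₂ (pathIn P W P⊑ , lP) = go₃ (window Θ (length P) P W P⊑ (lin (lists [] (P ∷ []) (Θ ∷ a ∷ t' ∷ m ∷ [])) 1 x0 (∥ L0) (≡! ((x1 ⊕ (2 ⊛ (1+ x2))) ⊕ x0) ((2 ⊛ x3) ⊕ (` 2)) hT ∷ ≤! (2 ⊛ x3) (∥ L0) lP ∷ [])) ≤-refl)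
          where
          go₃ : (Σ (PathIn e G₃ v u) λ P' → (Θ ≤ length (PathIn.xs P')) × (length (PathIn.xs P') ≤ Θ + (24 + w))) → HasCycle e G (2 * m)
          go₃ (pathIn P' W' P'⊑ , lT , hT') with wshape W'
          ... | P'' , refl = go₄ (wtail P'' u l'' W') (last P'' l'' W')
            where
            l'' : 1 ≤ length P''
            l'' = (lin (lists [] (P'' ∷ []) (Θ ∷ m ∷ a ∷ t' ∷ [])) 139 (` 1) (∥ L0) (≤! x0 (1+ (∥ L0)) lT ∷ ≡˘ ((2 ⊛ x1) ⊕ (` 2)) ((x2 ⊕ (2 ⊛ (1+ x3))) ⊕ x0) hT ∷ ≤! x2 ((` 2) ⊕ (24 ⊛ (1+ x3))) aSize ∷ 2 ×! ≤! (((` 73) ⊕ (26 ⊛ x3)) ⊕ (` 10)) x1 hm ∷ []))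
            last : ∀ {a b} R → 1 ≤ length R → Walk e a (a ∷ R) b → Σ (List ℕ) λ R₀ → R ≡ R₀ ++ b ∷ []
            last (x ∷ []) _ (h ◂ [ .x ]) = [] , refl
            last (x ∷ y ∷ R) _ (h ◂ V) with whd x V
            ... | refl with last (y ∷ R) (s≤s z≤n) V
            ... | R₀ , q = x ∷ R₀ , cong (x ∷_) q
            go₄ : (e v (hd P'' u) ≡ true) × Walk e (hd P'' u) P'' u → (Σ (List ℕ) λ R₀ → P'' ≡ R₀ ++ u ∷ []) → HasCycle e G (2 * m)
            go₄ (vh , V) (P₀ , refl) = go₅ (wunsnoc P₀ u lP₀ V)
              where
              lP₀ : 1 ≤ length P₀
              lP₀ = (lin (lists (v ∷ u ∷ []) (P₀ ∷ []) (Θ ∷ m ∷ a ∷ t' ∷ [])) 138 (` 1) (∥ L0) (≤! x0 (∥ (0 ▹ L0 ⧺ 1 ▹ nil)) lT ∷ ≡˘ ((2 ⊛ x1) ⊕ (` 2)) ((x2 ⊕ (2 ⊛ (1+ x3))) ⊕ x0) hT ∷ ≤! x2 ((` 2) ⊕ (24 ⊛ (1+ x3))) aSize ∷ 2 ×! ≤! (((` 73) ⊕ (26 ⊛ x3)) ⊕ (` 10)) x1 hm ∷ []))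
              go₅ : (Σ ℕ λ z → Walk e (hd (P₀ ++ u ∷ []) u) P₀ z × (e z u ≡ true)) → HasCycle e G (2 * m)
              go₅ (z , VP , zu) = select (parity r)
                where
                cycle-of : ∀ n → PathLen e S u v n → HasCycle e G (n + length P₀)
                cycle-of n (F , WF , F⊑ , lF) = cyc (F ++ P₀) (join WF vh VP) zu
                  (le: λ p → (lin (env p (u ∷ v ∷ []) (F ∷ P₀ ∷ G ∷ S ∷ S₀ ∷ G₃ ∷ []) []) 1 (# (L0 ⧺ L1)) (# L2) (≤! (# L0) (# L3) (⊑at F⊑ p) ∷ ≡! (# L3) ((# (0 ▹ 1 ▹ nil)) ⊕ (# L4)) (spl sS p) ∷ ≡˘ ((# L4) ⊕ (# L5)) (# L2) (spl sG p) ∷ ≤! (# (1 ▹ L1 ⧺ 0 ▹ nil)) (# L5) (⊑at P'⊑ p) ∷ [])))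
                  (lin≡ (lists [] (F ∷ P₀ ∷ []) (n ∷ [])) 1 (∥ (L0 ⧺ L1)) (x0 ⊕ (∥ L1)) (≡! (∥ L0) x0 lF ∷ []))
                lo : a + δ + length P₀ ≤ 2 * m
                lo = (lin (lists (v ∷ u ∷ []) (P₀ ∷ []) (a ∷ δ ∷ m ∷ Θ ∷ w ∷ t' ∷ [])) 1 ((x0 ⊕ x1) ⊕ (∥ L0)) (2 ⊛ x2) (≤! (∥ (0 ▹ L0 ⧺ 1 ▹ nil)) (x3 ⊕ ((` 24) ⊕ x4)) hT' ∷ ≡! ((x0 ⊕ (2 ⊛ (1+ x5))) ⊕ x3) ((2 ⊛ x2) ⊕ (` 2)) hT ∷ ≤! x1 (` 45) hδ ∷ ≤! ((` 67) ⊕ x4) (2 ⊛ x5) ht ∷ []))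
                hi : 2 * m ≤ a + 2 * t + length P₀
                hi = (lin (lists (v ∷ u ∷ []) (P₀ ∷ []) (m ∷ a ∷ t' ∷ Θ ∷ [])) 1 (2 ⊛ x0) ((x1 ⊕ (2 ⊛ (1+ x2))) ⊕ (∥ L0)) (≤! x3 (∥ (0 ▹ L0 ⧺ 1 ▹ nil)) lT ∷ ≡˘ ((2 ⊛ x0) ⊕ (` 2)) ((x1 ⊕ (2 ⊛ (1+ x2))) ⊕ x3) hT ∷ []))
                r = 2 * m ∸ (a + length P₀)
                hr : a + length P₀ + r ≡ 2 * m
                hr = m+[n∸m]≡n (lin (lists [] (P₀ ∷ []) (a ∷ m ∷ δ ∷ [])) 1 (x0 ⊕ (∥ L0)) (2 ⊛ x1) (≤! ((x0 ⊕ x2) ⊕ (∥ L0)) (2 ⊛ x1) lo ∷ []))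
                select : (Σ ℕ λ h → r ≡ 2 * h) ⊎ (Σ ℕ λ h → r ≡ 2 * h + 1) → HasCycle e G (2 * m)
                select (inj₁ (h , q)) = subst (HasCycle e G) (lin≡ (lists [] (P₀ ∷ []) (a ∷ h ∷ m ∷ r ∷ [])) 1 ((x0 ⊕ (2 ⊛ x1)) ⊕ (∥ L0)) (2 ⊛ x2) (≡˘ (2 ⊛ x1) x3 q ∷ ≡! ((x0 ⊕ (∥ L0)) ⊕ x3) (2 ⊛ x2) hr ∷ []))
                  (cycle-of (a + 2 * h) (fa h (lin (lists [] (P₀ ∷ []) (h ∷ t' ∷ r ∷ a ∷ m ∷ [])) 2 x0 (1+ x1) (≡˘ (2 ⊛ x0) x2 q ∷ ≡! ((x3 ⊕ (∥ L0)) ⊕ x2) (2 ⊛ x4) hr ∷ ≤! (2 ⊛ x4) ((x3 ⊕ (2 ⊛ (1+ x1))) ⊕ (∥ L0)) hi ∷ []))))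
                select (inj₂ (h , q)) = odd par
                  where
                  odd : Parity δ → HasCycle e G (2 * m)
                  odd (inj₁ (h' , q')) = subst (HasCycle e G) (lin≡ (lists [] (P₀ ∷ []) (a ∷ δ ∷ (h ∸ h') ∷ m ∷ h ∷ r ∷ h' ∷ [])) 1 (((x0 ⊕ x1) ⊕ (2 ⊛ x2)) ⊕ (∥ L0)) (2 ⊛ x3) (≡˘ ((2 ⊛ x4) ⊕ (` 1)) x5 q ∷ ≡! x1 ((2 ⊛ x6) ⊕ (` 1)) q' ∷ 2 ×! ≡! (x6 ⊕ x2) x4 hh ∷ ≡! ((x0 ⊕ (∥ L0)) ⊕ x5) (2 ⊛ x3) hr ∷ []))
                    (cycle-of (a + δ + 2 * (h ∸ h')) (fb (h ∸ h') (lin (lists [] (P₀ ∷ []) ((h ∸ h') ∷ t' ∷ h ∷ r ∷ h' ∷ a ∷ m ∷ [])) 2 x0 (1+ x1) (≡˘ ((2 ⊛ x2) ⊕ (` 1)) x3 q ∷ 2 ×! ≡! (x4 ⊕ x0) x2 hh ∷ ≡! ((x5 ⊕ (∥ L0)) ⊕ x3) (2 ⊛ x6) hr ∷ ≤! (2 ⊛ x6) ((x5 ⊕ (2 ⊛ (1+ x1))) ⊕ (∥ L0)) hi ∷ []))))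
                    where
                    hh : h' + (h ∸ h') ≡ h
                    hh = m+[n∸m]≡n (lin (lists [] (P₀ ∷ []) (h' ∷ h ∷ r ∷ δ ∷ a ∷ m ∷ [])) 2 x0 x1 (≡! x2 ((2 ⊛ x1) ⊕ (` 1)) q ∷ ≡˘ ((2 ⊛ x0) ⊕ (` 1)) x3 q' ∷ ≤! ((x4 ⊕ x3) ⊕ (∥ L0)) (2 ⊛ x5) lo ∷ ≡˘ (2 ⊛ x5) ((x4 ⊕ (∥ L0)) ⊕ x2) hr ∷ []))
                  -- In the bipartite case `r` cannot be odd: the shortest connector of the first
                  -- family would close a cycle with 2m - r vertices, which is an odd number.
                  odd (inj₂ (_ , noOdd)) = absurd (cycle-of (a + 0) (fa 0 z≤n))
                    where
                    absurd : HasCycle e G (a + 0 + length P₀) → HasCycle e G (2 * m)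
                    absurd (cyc {x} C WC clC C⊑ lC) = ⊥-elim (EvenWalks.closed-even e sy G short nbr noOdd x (∈-⊑ x C⊑ (w∈ˡ WC)) WC (λ z mz → ∈-⊑ z C⊑ mz) clC
                        (m ∸ suc h) (lin≡ (lists [] (C ∷ P₀ ∷ []) ((m ∸ suc h) ∷ a ∷ r ∷ m ∷ h ∷ [])) 1 (∥ L0) ((2 ⊛ x0) ⊕ (` 1)) (≡! (∥ L0) ((x1 ⊕ (` 0)) ⊕ (∥ L1)) lC ∷ ≡! ((x1 ⊕ (∥ L1)) ⊕ x2) (2 ⊛ x3) hr ∷ ≡˘ ((2 ⊛ x4) ⊕ (` 1)) x2 q ∷ 2 ×! ≡˘ x3 ((1+ x4) ⊕ x0) hm' ∷ [])))
                      where
                      hm' : suc h + (m ∸ suc h) ≡ m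
                      hm' = m+[n∸m]≡n (lin (lists [] (P₀ ∷ []) (h ∷ m ∷ a ∷ r ∷ [])) 2 (1+ x0) x1 (≡! ((x2 ⊕ (∥ L0)) ⊕ x3) (2 ⊛ x1) hr ∷ ≡˘ ((2 ⊛ x0) ⊕ (` 1)) x3 q ∷ []))

  -- The last step is taken apart from `chain` because it reports distinct ends, which the initial
  -- connector lacks when it is a single vertex.
  complete : ∀ {u δ} → δ ≤ 45 → Parity δ → Connector e G u δ 0 → HasCycle e G (2 * m)
  complete hδ par K =
    let K' , ne = step (lin (nums (t' ∷ k ∷ [])) 1 (((` 47) ⊕ (26 ⊛ x0)) ⊕ (` 10)) x1 (≤! (((` 73) ⊕ (26 ⊛ x0)) ⊕ (` 141)) x1 hk ∷ [])) (lin (nums (t' ∷ c ∷ [])) 1 (((` 47) ⊕ (26 ⊛ x0)) ⊕ (` 20)) x1 (≤! (((` 73) ⊕ (26 ⊛ x0)) ⊕ (` 160)) x1 hc ∷ []))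
                       (lin (nums (t' ∷ m ∷ [])) 1 ((` 47) ⊕ (26 ⊛ x0)) x1 (≤! (((` 73) ⊕ (26 ⊛ x0)) ⊕ (` 10)) x1 hm ∷ []))
          (chain t' (lin (nums (t' ∷ k ∷ [])) 1 (((` 47) ⊕ (26 ⊛ x0)) ⊕ (` 10)) x1 (≤! (((` 73) ⊕ (26 ⊛ x0)) ⊕ (` 141)) x1 hk ∷ [])) (lin (nums (t' ∷ c ∷ [])) 1 (((` 47) ⊕ (26 ⊛ x0)) ⊕ (` 20)) x1 (≤! (((` 73) ⊕ (26 ⊛ x0)) ⊕ (` 160)) x1 hc ∷ []))
                       (lin (nums (t' ∷ m ∷ [])) 1 ((` 47) ⊕ (26 ⊛ x0)) x1 (≤! (((` 73) ⊕ (26 ⊛ x0)) ⊕ (` 10)) x1 hm ∷ [])) K)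
    in close hδ par K' ne

  fromOdd : OddCycle e G → HasCycle e G (2 * m)
  fromOdd (oddCycle {u} {v} C W cl inG zero odd short) = single C W cl odd
    where
    single : ∀ C → Walk e u C v → e v u ≡ true → length C ≡ 1 → HasCycle e G (2 * m)
    single (x ∷ []) [ .x ] cl _ = ⊥-elim (t≢f cl (irr x))
  -- The ends of one edge of the cycle are joined by 2 vertices directly and by all 2h + 3 the other
  -- way around, so δ = 2h + 1, which is at most 45.
  fromOdd (oddCycle {u} {v} C W cl inG (suc h) odd short) =
    complete {u} {2 * h + 1} (lin (lists [] (C ∷ []) (h ∷ [])) 1 ((2 ⊛ x0) ⊕ (` 1)) (` 45) (≡˘ ((2 ⊛ (1+ x0)) ⊕ (` 1)) (∥ L0) odd ∷ ≤! (∥ L0) (` 47) short ∷ [])) (inj₁ (h , refl))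
      (connector C v 2 fa fb inG (≤-trans short (lin (nums []) 1 (` 47) ((` 47) ⊕ (26 ⊛ (` 0))) [])) ≤-refl (w∈ˡ W) (w∈ʳ W))
    where
    u≢v : ¬ u ≡ v
    u≢v q = t≢f cl (subst (λ z → e v z ≡ false) (sym q) (irr v))
    fa : Flex e C u v 2 0
    fa zero _ = u ∷ v ∷ [] , trans (sy u v) cl ◂ [ v ] , pair-⊑ u≢v (w∈ˡ W) (w∈ʳ W) , refl
    fb : Flex e C u v (2 + (2 * h + 1)) 0
    fb zero _ = C , W , ⊑-refl , (lin≡ (lists [] (C ∷ []) (h ∷ [])) 1 (∥ L0) (((` 2) ⊕ ((2 ⊛ x0) ⊕ (` 1))) ⊕ (` 0)) (≡! (∥ L0) ((2 ⊛ (1+ x0)) ⊕ (` 1)) odd ∷ []))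

  fromEven : (OddCycle e G → ⊥) → HasCycle e G (2 * m)
  fromEven noOdd = go G refl
    where
    go : ∀ H → G ≡ H → HasCycle e G (2 * m)
    go [] refl = (⊥-elim (1+n≰n (lin (nums (m ∷ t' ∷ [])) 73 (` 1) (` 0) (≤! ((2 ⊛ x0) ⊕ ((` 73) ⊕ (26 ⊛ x1))) (` 0) hG ∷ []))))
    go (u ∷ H) eq = complete {u} {0} z≤n (inj₂ (refl , noOdd))
        (connector (u ∷ []) u 1 fa fa (le: λ p → subst (λ l → cnt p (u ∷ []) ≤ cnt p l) (sym eq) (+-monoʳ-≤ (b2n (p u)) z≤n))
          (lin (nums []) 1 (` 1) ((` 47) ⊕ (26 ⊛ (` 0))) []) (lin (nums []) 1 (` 1) ((` 2) ⊕ (24 ⊛ (` 0))) []) (∈-here u []) (∈-here u []))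
      where
      fa : Flex e (u ∷ []) u u 1 0
      fa zero _ = u ∷ [] , [ u ] , ⊑-refl , refl

  exact : DN (HasCycle e G (2 * m))
  exact k = em λ { (inj₁ o) → k (fromOdd o) ; (inj₂ n) → k (fromEven n) }

-- Decomposition into robust pieces without edges between them

record Sep (e : Rel) (A B : List ℕ) : Set where
  constructor sep:
  field noEdge : ∀ a b → a ∈ A → b ∈ B → e a b ≡ false
open Sep

sep-sym : ∀ {e A B} → SymR e → Sep e A B → Sep e B A
sep-sym sy h = sep: λ b a mb ma → trans (sy b a) (noEdge h a b ma mb)

concat-++ : ∀ (As Bs : List (List ℕ)) p → cnt p (concat (As ++ Bs)) ≡ cnt p (concat As) + cnt p (concat Bs)
concat-++ [] Bs p = refl
concat-++ (A ∷ As) Bs p = (lin≡ (env p [] (A ∷ (concat (As ++ Bs)) ∷ (concat As) ∷ (concat Bs) ∷ []) []) 1 (# (L0 ⧺ L1)) ((# (L0 ⧺ L2)) ⊕ (# L3)) (≡! (# L1) ((# L2) ⊕ (# L3)) (concat-++ As Bs p) ∷ []))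

all-++ : ∀ {A : Set} {P : A → Set} {xs ys} → All P xs → All P ys → All P (xs ++ ys)
all-++ [] q = q
all-++ (p ∷ ps) q = p ∷ all-++ ps q

all-++⁻ : ∀ {A : Set} {P : A → Set} xs {ys} → All P (xs ++ ys) → All P xs × All P ys
all-++⁻ [] q = [] , q
all-++⁻ (x ∷ xs) (p ∷ ps) = let a , b = all-++⁻ xs ps in p ∷ a , b

all-map : ∀ {A : Set} {P Q : A → Set} → (∀ x → P x → Q x) → ∀ {xs} → All P xs → All Q xs
all-map f [] = []
all-map f (p ∷ ps) = f _ p ∷ all-map f ps

pairs-++ : ∀ {A : Set} {R : A → A → Set} {xs ys} → AllPairs R xs → AllPairs R ys → All (λ x → All (R x) ys) xs → AllPairs R (xs ++ ys)
pairs-++ [] q _ = q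
pairs-++ (p ∷ ps) q (r ∷ rs) = all-++ p r ∷ pairs-++ ps q rs

each-⊑ : ∀ (Hs : List (List ℕ)) → All (λ H → H ⊑ concat Hs) Hs
each-⊑ [] = []
each-⊑ (H ∷ Hs) = le: (λ p → (lin (env p [] (H ∷ (concat Hs) ∷ []) []) 1 (# L0) (# (L0 ⧺ L1)) [])) ∷
  all-map (λ x h → le: λ p → (lin (env p [] (x ∷ H ∷ (concat Hs) ∷ []) []) 1 (# L0) (# (L1 ⧺ L2)) (≤! (# L0) (# L2) (⊑at h p) ∷ []))) (each-⊑ Hs)

-- In closed form (2^f - 1) * k: each cut costs k vertices and both of its sides may be cut again.
waste : ℕ → ℕ → ℕ
waste zero k = 0
waste (suc f) k = k + 2 * waste f k

record Decomposition (e : Rel) (k d f : ℕ) (H : List ℕ) : Set where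
  constructor decomposition
  field
    Hs : List (List ℕ)
    W : List ℕ
    sH : Split H (concat Hs) W
    lW : length W ≤ waste f k
    sep : AllPairs (Sep e) Hs
    good : All (λ H' → Robust e k H' × MinDeg e d H') Hs

record Cut (e : Rel) (k : ℕ) (H : List ℕ) : Set where
  constructor cut
  field
    D G' A B : List ℕ
    s₁ : Split H D G'
    s₂ : Split G' A B
    lD : length D ≤ k
    lA : 1 ≤ length A
    lB : 1 ≤ length B
    sep : Sep e A B

-- A cut lowers degrees by at most k, and for this f * k is held in reserve. Degrees of at least d
-- force at least d vertices on either side, so the other side shrinks by d; hence f bounds the
-- depth.
decompose : ∀ {e} → SymR e → ∀ k d f H → length H ≤ f * d → MinDeg e (d + f * k) H → DN (Decomposition e k d f H)
decompose sy k d zero [] _ _ = ret (decomposition [] [] (sp: λ p → refl) z≤n [] [])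
decompose {e} sy k d (suc f) H hl md = em >>= go
  where
  side : ∀ {A B D G'} → Split H D G' → Split G' A B → length D ≤ k → Sep e A B → MinDeg e (d + f * k) A
  side {A} {B} {D} {G'} s₁ s₂ lD sep a ma = (lin (env (e a) [] (A ∷ H ∷ D ∷ G' ∷ B ∷ []) (d ∷ (f * k) ∷ k ∷ [])) 1 (x0 ⊕ x1) (# L0) (≤! (x0 ⊕ (x2 ⊕ x1)) (# L1) (md a (∈-⊑ a (⊑-trans (splitˡ s₂) (splitʳ s₁)) ma)) ∷ ≡! (# L1) ((# L2) ⊕ (# L3)) (spl s₁ (e a)) ∷ ≡! (# L3) ((# L0) ⊕ (# L4)) (spl s₂ (e a)) ∷ ≤! (# L2) (∥ L2) (cnt-≤ (e a) D) ∷ ≤! (∥ L2) x2 lD ∷ ≡! (# L4) (` 0) (none⇒zero (e a) B (λ b mb h → t≢f h (noEdge sep a b ma mb))) ∷ []))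
  large : ∀ A → 1 ≤ length A → MinDeg e (d + f * k) A → d ≤ length A
  large (a ∷ A) _ h = (lin (env (e a) (a ∷ []) (A ∷ []) (d ∷ (f * k) ∷ [])) 1 x0 (∥ (0 ▹ L0)) (≤! (x0 ⊕ x1) (# (0 ▹ L0)) (h a (∈-here a A)) ∷ ≤! (# (0 ▹ L0)) (∥ (0 ▹ L0)) (cnt-≤ (e a) (a ∷ A)) ∷ []))
  go : Cut e k H ⊎ (Cut e k H → ⊥) → DN (Decomposition e k d (suc f) H)
  go (inj₂ n) = ret (decomposition (H ∷ []) [] (sp: λ p → (lin≡ (env p [] (H ∷ []) []) 1 (# L0) ((# (L0 ⧺ nil)) ⊕ (` 0)) [])) z≤n ([] ∷ [])
    (((λ D G' A B s₁ s₂ lD lA lB h → n (cut D G' A B s₁ s₂ lD lA lB (sep: h))) , λ v mv → ≤-trans (m≤m+n d _) (md v mv)) ∷ []))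
  go (inj₁ (cut D G' A B s₁ s₂ lD lA lB sep)) =
    decompose sy k d f A (lin (lists [] (A ∷ B ∷ D ∷ H ∷ []) ((f * d) ∷ d ∷ [])) 1 (∥ L0) x0 (≤! x1 (∥ L1) (large B lB mdB) ∷ ≡˘ ((∥ L2) ⊕ ((∥ L0) ⊕ (∥ L1))) (∥ L3) lens ∷ ≤! (∥ L3) (x1 ⊕ x0) hl ∷ [])) mdA >>= λ X →
    decompose sy k d f B (lin (lists [] (B ∷ A ∷ D ∷ H ∷ []) ((f * d) ∷ d ∷ [])) 1 (∥ L0) x0 (≤! x1 (∥ L1) (large A lA mdA) ∷ ≡˘ ((∥ L2) ⊕ ((∥ L1) ⊕ (∥ L0))) (∥ L3) lens ∷ ≤! (∥ L3) (x1 ⊕ x0) hl ∷ [])) mdB >>= λ Y →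
    ret (combine X Y)
    where
    s₂' : Split G' B A
    s₂' = sp: λ p → (lin≡ (env p [] (G' ∷ B ∷ A ∷ []) []) 1 (# L0) ((# L1) ⊕ (# L2)) (≡! (# L0) ((# L2) ⊕ (# L1)) (spl s₂ p) ∷ []))
    mdA = side s₁ s₂ lD sep
    mdB = side s₁ s₂' lD (sep-sym sy sep)
    lens : length H ≡ length D + (length A + length B)
    lens = trans (split-len H D G' s₁) (cong (length D +_) (split-len G' A B s₂))
    combine : Decomposition e k d f A → Decomposition e k d f B → Decomposition e k d (suc f) H
    combine (decomposition As WA sA lWA sepA gA) (decomposition Bs WB sB lWB sepB gB) =
      decomposition (As ++ Bs) (D ++ WA ++ WB)
        (sp: λ p → (lin≡ (env p [] (H ∷ (concat (As ++ Bs)) ∷ D ∷ WA ∷ WB ∷ (concat As) ∷ (concat Bs) ∷ G' ∷ A ∷ B ∷ []) []) 1 (# L0) ((# L1) ⊕ (# (L2 ⧺ L3 ⧺ L4))) (≡˘ ((# L5) ⊕ (# L6)) (# L1) (concat-++ As Bs p) ∷ ≡! (# L0) ((# L2) ⊕ (# L7)) (spl s₁ p) ∷ ≡! (# L7) ((# L8) ⊕ (# L9)) (spl s₂ p) ∷ ≡! (# L8) ((# L5) ⊕ (# L3)) (spl sA p) ∷ ≡! (# L9) ((# L6) ⊕ (# L4)) (spl sB p) ∷ [])))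
        (lin (lists [] (D ∷ WA ∷ WB ∷ []) (k ∷ (waste f k) ∷ [])) 1 (∥ (L0 ⧺ L1 ⧺ L2)) (x0 ⊕ (2 ⊛ x1)) (≤! (∥ L0) x0 lD ∷ ≤! (∥ L1) x1 lWA ∷ ≤! (∥ L2) x1 lWB ∷ []))
        (pairs-++ sepA sepB (all-map (λ X hX → all-map (λ Y hY → sep: λ a b ma mb → noEdge sep a b (∈-⊑ a (⊑-trans hX (splitˡ sA)) ma) (∈-⊑ b (⊑-trans hY (splitˡ sB)) mb)) (each-⊑ Bs)) (each-⊑ As)))
        (all-++ gA gB)

-- Blue wheels in complete multipartite graphs

record BlueWheel (e : Rel) (V : List ℕ) (n : ℕ) : Set where
  constructor blueWheel
  field
    {u v} h : ℕ
    C : List ℕ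
    W : Walk (co e) u C v
    cl : co e v u ≡ true
    inV : (h ∷ C) ⊑ V
    len : length C ≡ 2 * n
    hub : ∀ c → c ∈ C → e h c ≡ false

nth-∈ : ∀ L i → i < length L → nth L i ∈ L
nth-∈ (x ∷ L) zero _ = ∈-here x L
nth-∈ (x ∷ L) (suc i) (s≤s h) = ∈-there (nth L i) x L (nth-∈ L i h)

nth-++ˡ : ∀ X Y i → i < length X → nth (X ++ Y) i ∈ X
nth-++ˡ (x ∷ X) Y zero _ = ∈-here x X
nth-++ˡ (x ∷ X) Y (suc i) (s≤s h) = ∈-there (nth (X ++ Y) i) x X (nth-++ˡ X Y i h)

nth-++ʳ : ∀ X Y i → nth (X ++ Y) (length X + i) ≡ nth Y i
nth-++ʳ [] Y i = refl
nth-++ʳ (x ∷ X) Y i = nth-++ʳ X Y i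

run : (ℕ → ℕ) → ℕ → ℕ → List ℕ
run f i zero = []
run f i (suc j) = f i ∷ run f (suc i) j

run-split : ∀ (f : ℕ → ℕ) p a i j → cnt p (run f a (i + j)) ≡ cnt p (run f a i) + cnt p (run f (a + i) j)
run-split f p a zero j = cong (λ z → cnt p (run f z j)) (sym (+-identityʳ a))
run-split f p a (suc i) j = trans (cong (b2n (p (f a)) +_) (trans (run-split f p (suc a) i j)
  (cong (λ z → cnt p (run f (suc a) i) + cnt p (run f z j)) (sym (+-suc a i))))) (sym (+-assoc (b2n (p (f a))) _ _))

segment-⊑ : ∀ L i j → i + j ≤ length L → run (nth L) i j ⊑ L
segment-⊑ L i j h = le: λ p → ≤-trans (m≤n+m _ _) (≤-trans (≤-reflexive (sym (run-split (nth L) p 0 i j))) (upto p L (i + j) h))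
  where
  shift : ∀ x L i j → run (nth (x ∷ L)) (suc i) j ≡ run (nth L) i j
  shift x L i zero = refl
  shift x L i (suc j) = cong (nth L i ∷_) (shift x L (suc i) j)
  upto : ∀ p L j → j ≤ length L → cnt p (run (nth L) 0 j) ≤ cnt p L
  upto p L zero _ = z≤n
  upto p (x ∷ L) (suc j) (s≤s h) = +-monoʳ-≤ (b2n (p x)) (≤-trans (≤-reflexive (cong (cnt p) (shift x L 0 j))) (upto p L j h))

segments-⊑ : ∀ L n → 2 * n ≤ length L → (run (nth L) 0 n ++ run (nth L) n n) ⊑ L
segments-⊑ L n h = le: λ p → ≤-trans (≤-reflexive (trans (cnt-++ p (run (nth L) 0 n) (run (nth L) n n)) (sym (run-split (nth L) p 0 n n)))) (⊑at (segment-⊑ L 0 (n + n) (lin (lists [] (L ∷ []) (n ∷ [])) 1 (x0 ⊕ x0) (∥ L0) (≤! (2 ⊛ x0) (∥ L0) h ∷ []))) p)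

zig : (ℕ → ℕ) → (ℕ → ℕ) → ℕ → ℕ → List ℕ
zig f g i zero = []
zig f g i (suc j) = f i ∷ g i ∷ zig f g (suc i) j

zig-cnt : ∀ f g i j p → cnt p (zig f g i j) ≡ cnt p (run f i j) + cnt p (run g i j)
zig-cnt f g i zero p = refl
zig-cnt f g i (suc j) p = (lin≡ (env p ((f i) ∷ (g i) ∷ []) ((zig f g (suc i) j) ∷ (run f (suc i) j) ∷ (run g (suc i) j) ∷ []) []) 1 (# (0 ▹ 1 ▹ L0)) ((# (0 ▹ L1)) ⊕ (# (1 ▹ L2))) (≡! (# L0) ((# L1) ⊕ (# L2)) (zig-cnt f g (suc i) j p) ∷ []))

zig-len : ∀ f g i j → length (zig f g i j) ≡ 2 * j
zig-len f g i zero = refl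
zig-len f g i (suc j) = (lin≡ (lists [] ((zig f g (suc i) j) ∷ []) (j ∷ [])) 1 (1+ (1+ (∥ L0))) (2 ⊛ (1+ x0)) (≡! (∥ L0) (2 ⊛ x0) (zig-len f g (suc i) j) ∷ []))

zig-walk : ∀ {e f g} i j → (∀ x → x ≤ i + j → e (f x) (g x) ≡ true) → (∀ x → x < i + j → e (g x) (f (suc x)) ≡ true) → Walk e (f i) (zig f g i (suc j)) (g (i + j))
zig-walk {e} {f} {g} i zero h h' = subst (λ z → Walk e (f i) (f i ∷ g i ∷ []) (g z)) (sym (+-identityʳ i)) (h i (m≤m+n i 0) ◂ [ g i ])
zig-walk {e} {f} {g} i (suc j) h h' = h i (m≤m+n i _) ◂ h' i (≤-trans (≤-reflexive (+-comm 1 i)) (+-monoʳ-≤ i (s≤s z≤n))) ◂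
  subst (λ z → Walk e (f (suc i)) (zig f g (suc i) (suc j)) (g z)) (sym (+-suc i j))
    (zig-walk (suc i) j (λ x l → h x (≤-trans l (≤-reflexive (sym (+-suc i j))))) (λ x l → h' x (≤-trans l (≤-reflexive (sym (+-suc i j))))))

findPart : ∀ {A : Set} (p : A → Bool) xs → (Σ (List A) λ as → Σ A λ x → Σ (List A) λ bs → (xs ≡ as ++ x ∷ bs) × (p x ≡ true)) ⊎ All (λ x → p x ≡ false) xs
findPart p [] = inj₂ []
findPart p (x ∷ xs) with p x in eq
... | true = inj₁ ([] , x , xs , refl , eq)
... | false with findPart p xs
... | inj₁ (as , y , bs , q , py) = inj₁ (x ∷ as , y , bs , cong (x ∷_) q , py)
... | inj₂ h = inj₂ (eq ∷ h)

sep-concat : ∀ {e H} Rs → All (Sep e H) Rs → Sep e H (concat Rs)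
sep-concat [] [] = sep: λ { a b ma () }
sep-concat {e} {H} (R ∷ Rs) (h ∷ hs) = sep: λ a b ma mb → [_,_]′ (noEdge h a b ma) (noEdge (sep-concat Rs hs) a b ma) (∈-++⁻ b R (concat Rs) mb)

module Multipartite (e : Rel) (sy : SymR e) (n' bd : ℕ) where

  n = suc n'

  -- A part occupies at most n' consecutive positions of the concatenation, so positions at least n'
  -- apart belong to different parts.
  far : ∀ Rs → AllPairs (Sep e) Rs → All (λ R → length R ≤ n') Rs → ∀ i j → i + n' ≤ j → j < length (concat Rs) →
    e (nth (concat Rs) i) (nth (concat Rs) j) ≡ false
  far [] _ _ i j _ ()
  far (R ∷ Rs) (hR ∷ hs) (l ∷ ls) i j hij hj with ≤-total (suc i) (length R)
  ... | inj₁ i< = subst (λ z → e (nth (R ++ concat Rs) i) z ≡ false) (trans (sym (nth-++ʳ R (concat Rs) (j ∸ length R))) (cong (nth (R ++ concat Rs)) jq))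
      (noEdge (sep-concat Rs hR) _ _ (nth-++ˡ R (concat Rs) i i<) (nth-∈ (concat Rs) (j ∸ length R) (lin (lists [] ((concat Rs) ∷ R ∷ []) ((j ∸ length R) ∷ j ∷ [])) 1 (1+ x0) (∥ L0) (≡! ((∥ L1) ⊕ x0) x1 jq ∷ ≤! (1+ x1) (∥ (L1 ⧺ L0)) hj ∷ []))))
    where
    jq : length R + (j ∸ length R) ≡ j
    jq = m+[n∸m]≡n (lin (lists [] (R ∷ []) (j ∷ n' ∷ i ∷ [])) 1 (∥ L0) x0 (≤! (∥ L0) x1 l ∷ ≤! (x2 ⊕ x1) x0 hij ∷ []))
  ... | inj₂ i≥ = split (m≤n⇒m<n∨m≡n i≥)
    where
    later : length R ≤ i → e (nth (R ++ concat Rs) i) (nth (R ++ concat Rs) j) ≡ false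
    later h = subst₂ (λ y z → e y z ≡ false) (trans (sym (nth-++ʳ R (concat Rs) (i ∸ length R))) (cong (nth (R ++ concat Rs)) iq))
        (trans (sym (nth-++ʳ R (concat Rs) (j ∸ length R))) (cong (nth (R ++ concat Rs)) jq))
        (far Rs hs ls (i ∸ length R) (j ∸ length R) (lin (lists [] (R ∷ []) ((i ∸ length R) ∷ n' ∷ (j ∸ length R) ∷ i ∷ j ∷ [])) 1 (x0 ⊕ x1) x2 (≡! ((∥ L0) ⊕ x0) x3 iq ∷ ≡˘ x4 ((∥ L0) ⊕ x2) jq ∷ ≤! (x3 ⊕ x1) x4 hij ∷ []))
          (lin (lists [] ((concat Rs) ∷ R ∷ []) ((j ∸ length R) ∷ j ∷ [])) 1 (1+ x0) (∥ L0) (≡! ((∥ L1) ⊕ x0) x1 jq ∷ ≤! (1+ x1) (∥ (L1 ⧺ L0)) hj ∷ [])))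
      where
      iq : length R + (i ∸ length R) ≡ i
      iq = m+[n∸m]≡n h
      jq : length R + (j ∸ length R) ≡ j
      jq = m+[n∸m]≡n (lin (lists [] (R ∷ []) (j ∷ i ∷ n' ∷ [])) 1 (∥ L0) x0 (≤! (∥ L0) x1 h ∷ ≤! (x1 ⊕ x2) x0 hij ∷ []))
    split : length R < suc i ⊎ length R ≡ suc i → e (nth (R ++ concat Rs) i) (nth (R ++ concat Rs) j) ≡ false
    split (inj₁ lt) = later (s≤s⁻¹ lt)
    split (inj₂ eq) = ex
      where
      jq : length R + (j ∸ length R) ≡ j
      jq = m+[n∸m]≡n (lin (lists [] (R ∷ []) (j ∷ n' ∷ i ∷ [])) 1 (∥ L0) x0 (≤! (∥ L0) x1 l ∷ ≤! (x2 ⊕ x1) x0 hij ∷ []))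
      ex = subst (λ z → e (nth (R ++ concat Rs) i) z ≡ false) (trans (sym (nth-++ʳ R (concat Rs) (j ∸ length R))) (cong (nth (R ++ concat Rs)) jq))
        (noEdge (sep-concat Rs hR) _ _ (nth-++ˡ R (concat Rs) i (≤-reflexive (sym eq))) (nth-∈ (concat Rs) (j ∸ length R) (lin (lists [] ((concat Rs) ∷ R ∷ []) ((j ∸ length R) ∷ j ∷ [])) 1 (1+ x0) (∥ L0) (≡! ((∥ L1) ⊕ x0) x1 jq ∷ ≤! (1+ x1) (∥ (L1 ⧺ L0)) hj ∷ []))))

  blue : ∀ {x y} → e x y ≡ false → co e x y ≡ true
  blue h = cong not h

  -- The rim visits the positions 0, n, 1, n + 1, ..., n - 1, 2n - 1. Neighbouring positions differ
  -- by n, by n - 1, or by 2n - 1 at the closing edge, and n' = n - 1 is enough for `far`.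
  spread : ∀ h H Rs → h ∈ H → All (Sep e H) Rs → AllPairs (Sep e) Rs → All (λ R → length R ≤ n') Rs → 2 * n ≤ length (concat Rs) → BlueWheel e (H ++ concat Rs) n
  spread h H Rs mh hH hs ls hl = blueWheel h C (zig-walk 0 n' pairs next) clos
      (le: λ p → (lin (env p (h ∷ []) (C ∷ H ∷ L ∷ []) []) 1 (# (0 ▹ L0)) (# (L1 ⧺ L2)) (≤! (# L0) (# L2) (⊑at C⊑L p) ∷ ≤! (# (0 ▹ nil)) (# L1) (⊑at h⊑ p) ∷ []))) (zig-len f g 0 n)
      (λ c mc → noEdge (sep-concat Rs hH) h c mh (∈-⊑ c C⊑L mc))
    where
    L = concat Rs
    f g : ℕ → ℕ
    f = nth L
    g i = nth L (n + i)
    C = zig f g 0 n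
    h⊑ : (h ∷ []) ⊑ H
    h⊑ = splitˡ (proj₂ (∈-remove h H mh))
    grun : ∀ i j → run g i j ≡ run f (n + i) j
    grun i zero = refl
    grun i (suc j) = cong (g i ∷_) (trans (grun (suc i) j) (cong (λ z → run f z j) (+-suc n i)))
    C⊑L : C ⊑ L
    C⊑L = le: λ p → ≤-trans (≤-reflexive (trans (zig-cnt f g 0 n p) (trans (cong (cnt p (run f 0 n) +_) (cong (cnt p) (trans (grun 0 n) (cong (λ z → run f z n) (+-identityʳ n)))))
      (sym (cnt-++ p (run f 0 n) (run f n n)))))) (⊑at (segments-⊑ L n hl) p)
    pairs : ∀ x → x ≤ n' → co e (f x) (g x) ≡ true
    pairs x hx = blue (far Rs hs ls x (n + x) (lin (nums (x ∷ n' ∷ [])) 1 (x0 ⊕ x1) ((1+ x1) ⊕ x0) []) (lin (lists [] (L ∷ []) (n' ∷ x ∷ [])) 1 (1+ ((1+ x0) ⊕ x1)) (∥ L0) (≤! (2 ⊛ (1+ x0)) (∥ L0) hl ∷ ≤! x1 x0 hx ∷ [])))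
    next : ∀ x → x < n' → co e (g x) (f (suc x)) ≡ true
    next x hx = blue (trans (sy (g x) (f (suc x))) (far Rs hs ls (suc x) (n + x) (lin (nums (x ∷ n' ∷ [])) 1 ((1+ x0) ⊕ x1) ((1+ x1) ⊕ x0) []) (lin (lists [] (L ∷ []) (n' ∷ x ∷ [])) 1 (1+ ((1+ x0) ⊕ x1)) (∥ L0) (≤! (2 ⊛ (1+ x0)) (∥ L0) hl ∷ ≤! (1+ x1) x0 hx ∷ []))))
    clos : co e (g n') (f 0) ≡ true
    clos = blue (trans (sy (g n') (f 0)) (far Rs hs ls 0 (n + n') (lin (nums (n' ∷ [])) 1 x0 ((1+ x0) ⊕ x0) []) (lin (lists [] (L ∷ []) (n' ∷ [])) 1 (1+ ((1+ x0) ⊕ x0)) (∥ L0) (≤! (2 ⊛ (1+ x0)) (∥ L0) hl ∷ []))))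

  twoParts : ∀ h H₁ H₂ R → h ∈ R → Sep e H₁ H₂ → Sep e R H₁ → Sep e R H₂ → n ≤ length H₁ → n ≤ length H₂ → BlueWheel e (H₁ ++ H₂ ++ R) n
  twoParts h H₁ H₂ R mh s₁₂ sR₁ sR₂ l₁ l₂ = blueWheel h C (zig-walk 0 n' pairs next) (blue (trans (sy _ _) (across 0 n' z≤n ≤-refl)))
      (le: λ p → (lin (env p (h ∷ []) (C ∷ H₁ ∷ H₂ ∷ R ∷ []) []) 1 (# (0 ▹ L0)) (# (L1 ⧺ L2 ⧺ L3)) (≤! (# L0) (# (L1 ⧺ L2)) (⊑at C⊑ p) ∷ ≤! (# (0 ▹ nil)) (# L3) (⊑at h⊑ p) ∷ []))) (zig-len f g 0 n)
      (λ c mc → [_,_]′ (noEdge sR₁ h c mh) (noEdge sR₂ h c mh) (∈-++⁻ c H₁ H₂ (∈-⊑ c C⊑ mc)))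
    where
    f g : ℕ → ℕ
    f = nth H₁
    g = nth H₂
    C = zig f g 0 n
    h⊑ : (h ∷ []) ⊑ R
    h⊑ = splitˡ (proj₂ (∈-remove h R mh))
    C⊑ : C ⊑ (H₁ ++ H₂)
    C⊑ = le: λ p → (lin (env p [] (C ∷ H₁ ∷ H₂ ∷ (run f 0 n) ∷ (run g 0 n) ∷ []) []) 1 (# L0) (# (L1 ⧺ L2)) (≡! (# L0) ((# L3) ⊕ (# L4)) (zig-cnt f g 0 n p) ∷ ≤! (# L3) (# L1) (⊑at (segment-⊑ H₁ 0 n l₁) p) ∷ ≤! (# L4) (# L2) (⊑at (segment-⊑ H₂ 0 n l₂) p) ∷ []))
    across : ∀ x y → x ≤ n' → y ≤ n' → e (f x) (g y) ≡ false
    across x y hx hy = noEdge s₁₂ _ _ (nth-∈ H₁ x (≤-trans (s≤s hx) l₁)) (nth-∈ H₂ y (≤-trans (s≤s hy) l₂))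
    pairs : ∀ x → x ≤ n' → co e (f x) (g x) ≡ true
    pairs x hx = blue (across x x hx hx)
    next : ∀ x → x < n' → co e (g x) (f (suc x)) ≡ true
    next x hx = blue (trans (sy (g x) (f (suc x))) (across (suc x) x hx (<⇒≤ hx)))

  extract : ∀ pre H post → AllPairs (Sep e) (pre ++ H ∷ post) → AllPairs (Sep e) (pre ++ post) × All (Sep e H) (pre ++ post)
  extract [] H post (h ∷ hs) = hs , h
  extract (P ∷ pre) H post (h ∷ hs) with extract pre H post hs | all-++⁻ pre h
  ... | hs' , hH | a , (b ∷ c) = all-++ a c ∷ hs' , sep-sym sy b ∷ hH

  extract-split : ∀ pre H post → Split (concat (pre ++ H ∷ post)) H (concat (pre ++ post))
  extract-split pre H post = sp: λ p → (lin≡ (env p [] ((concat (pre ++ H ∷ post)) ∷ H ∷ (concat (pre ++ post)) ∷ (concat pre) ∷ (concat post) ∷ []) []) 1 (# L0) ((# L1) ⊕ (# L2)) (≡! (# L0) ((# L3) ⊕ (# (L1 ⧺ L4))) (concat-++ pre (H ∷ post) p) ∷ ≡˘ ((# L3) ⊕ (# L4)) (# L2) (concat-++ pre post p) ∷ []))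

  extract-all : ∀ {P : List ℕ → Set} pre H post → All P (pre ++ H ∷ post) → P H × All P (pre ++ post)
  extract-all pre H post h with all-++⁻ pre h
  ... | a , (b ∷ c) = b , all-++ a c

  wheel-mono : ∀ {V V'} → V ⊑ V' → BlueWheel e V n → BlueWheel e V' n
  wheel-mono h (blueWheel x C W cl i l b) = blueWheel x C W cl (⊑-trans i h) l b

  member : ∀ xs → 1 ≤ length xs → Σ ℕ λ x → x ∈ xs
  member (x ∷ xs) _ = x , ∈-here x xs

  -- The cases are the numbers of parts with at least n vertices. Two such parts carry the rim
  -- alternately, and a vertex elsewhere is the hub, which exists since two parts hold at most 2 *
  -- bd vertices. If there is just one, the hub lies in it, otherwise in any nonempty part; the
  -- remaining parts are small and still have 2n vertices for `spread`.
  multipartite : ∀ Hs → AllPairs (Sep e) Hs → All (λ H → length H ≤ bd) Hs → 2 * n + bd ≤ length (concat Hs) → 2 * bd + 1 ≤ length (concat Hs) → BlueWheel e (concat Hs) n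
  multipartite Hs sep hb h₁ h₂ = go (findPart (λ H → n ≤ᵇ length H) Hs)
    where
    smallParts : ∀ {Rs} → All (λ H → (n ≤ᵇ length H) ≡ false) Rs → All (λ R → length R ≤ n') Rs
    smallParts = all-map (λ x h → s≤s⁻¹ (≤ᵇ-false {n} h))
    oneHub : ∀ H Rs → Split (concat Hs) H (concat Rs) → All (Sep e H) Rs → AllPairs (Sep e) Rs → All (λ R → length R ≤ n') Rs → length H ≤ bd → 1 ≤ length H → BlueWheel e (concat Hs) n
    oneHub H Rs sH hH hs ls lH lH' = let h , mh = member H lH' in
      wheel-mono (le: λ p → (lin (env p [] (H ∷ (concat Rs) ∷ (concat Hs) ∷ []) []) 1 (# (L0 ⧺ L1)) (# L2) (≡˘ ((# L0) ⊕ (# L1)) (# L2) (spl sH p) ∷ [])))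
        (spread h H Rs mh hH hs ls (lin (lists [] ((concat Rs) ∷ (concat Hs) ∷ H ∷ []) (n' ∷ bd ∷ [])) 1 (2 ⊛ (1+ x0)) (∥ L0) (≤! ((2 ⊛ (1+ x0)) ⊕ x1) (∥ L1) h₁ ∷ ≤! (∥ L2) x1 lH ∷ ≡! (∥ L1) ((∥ L2) ⊕ (∥ L0)) (split-len (concat Hs) H (concat Rs) sH) ∷ [])))
    go : (Σ (List (List ℕ)) λ as → Σ (List ℕ) λ x → Σ (List (List ℕ)) λ bs → (Hs ≡ as ++ x ∷ bs) × ((n ≤ᵇ length x) ≡ true)) ⊎ All (λ x → (n ≤ᵇ length x) ≡ false) Hs → BlueWheel e (concat Hs) n
    go (inj₂ none) = go' (findPart (λ H → 1 ≤ᵇ length H) Hs)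
      where
      go' : (Σ (List (List ℕ)) λ as → Σ (List ℕ) λ x → Σ (List (List ℕ)) λ bs → (Hs ≡ as ++ x ∷ bs) × ((1 ≤ᵇ length x) ≡ true)) ⊎ All (λ x → (1 ≤ᵇ length x) ≡ false) Hs → BlueWheel e (concat Hs) n
      go' (inj₁ (pre , H , post , refl , q)) =
        let hs , hH = extract pre H post sep ; lH , _ = extract-all pre H post hb ; _ , ls = extract-all pre H post none
        in oneHub H (pre ++ post) (extract-split pre H post) hH hs (smallParts ls) lH (≤ᵇ-true {1} q)
      go' (inj₂ empty) = (⊥-elim (1+n≰n (lin (lists [] ((concat Hs) ∷ []) (bd ∷ [])) 1 (` 1) (` 0) (≤! ((2 ⊛ x0) ⊕ (` 1)) (∥ L0) h₂ ∷ ≡! (∥ L0) (` 0) (zero-len Hs empty) ∷ []))))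
        where
        zero-len : ∀ Hs → All (λ x → (1 ≤ᵇ length x) ≡ false) Hs → length (concat Hs) ≡ 0
        zero-len [] [] = refl
        zero-len (H ∷ Hs) (h ∷ hs) = (≤-antisym (lin (lists [] (H ∷ (concat Hs) ∷ []) []) 1 (∥ (L0 ⧺ L1)) (` 0) (≡! (∥ L1) (` 0) (zero-len Hs hs) ∷ ≤! (1+ (∥ L0)) (` 1) (≤ᵇ-false {1} h) ∷ [])) (lin (lists [] (H ∷ (concat Hs) ∷ []) []) 1 (` 0) (∥ (L0 ⧺ L1)) []))
    go (inj₁ (pre , H , post , refl , q)) = go' (findPart (λ H → n ≤ᵇ length H) Rs)
      where
      Rs = pre ++ post
      ex = extract pre H post sep
      exl = extract-all pre H post hb
      sH = extract-split pre H post
      go' : (Σ (List (List ℕ)) λ as → Σ (List ℕ) λ x → Σ (List (List ℕ)) λ bs → (Rs ≡ as ++ x ∷ bs) × ((n ≤ᵇ length x) ≡ true)) ⊎ All (λ x → (n ≤ᵇ length x) ≡ false) Rs → BlueWheel e (concat Hs) n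
      go' (inj₂ none) = oneHub H Rs sH (proj₂ ex) (proj₁ ex) (smallParts none) (proj₁ exl) (≤-trans (s≤s z≤n) (≤ᵇ-true {n} q))
      go' (inj₁ (pre₂ , H₂ , post₂ , eq , q₂)) = fin (member (concat Rs₂) (lin (lists [] ((concat Rs₂) ∷ (concat Hs) ∷ H ∷ (concat Rs) ∷ H₂ ∷ []) (bd ∷ [])) 1 (` 1) (∥ L0) (≤! ((2 ⊛ x0) ⊕ (` 1)) (∥ L1) h₂ ∷ ≡! (∥ L1) ((∥ L2) ⊕ (∥ L3)) (split-len (concat Hs) H (concat Rs) sH) ∷ ≡! (∥ L3) ((∥ L4) ⊕ (∥ L0)) (split-len (concat Rs) H₂ (concat Rs₂) sH₂) ∷ ≤! (∥ L2) x0 (proj₁ exl) ∷ ≤! (∥ L4) x0 (proj₁ exl₂) ∷ [])))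
        where
        Rs₂ = pre₂ ++ post₂
        ex₂ = extract pre₂ H₂ post₂ (subst (AllPairs (Sep e)) eq (proj₁ ex))
        exl₂ = extract-all pre₂ H₂ post₂ (subst (All (λ H → length H ≤ bd)) eq (proj₂ exl))
        exs = extract-all pre₂ H₂ post₂ (subst (All (Sep e H)) eq (proj₂ ex))
        sH₂ : Split (concat Rs) H₂ (concat Rs₂)
        sH₂ = subst (λ z → Split (concat z) H₂ (concat Rs₂)) (sym eq) (extract-split pre₂ H₂ post₂)
        fin : (Σ ℕ λ x → x ∈ concat Rs₂) → BlueWheel e (concat Hs) n
        fin (h , mh) = wheel-mono (le: λ p → (lin (env p [] (H ∷ H₂ ∷ (concat Rs₂) ∷ (concat Hs) ∷ (concat Rs) ∷ []) []) 1 (# (L0 ⧺ L1 ⧺ L2)) (# L3) (≡˘ ((# L0) ⊕ (# L4)) (# L3) (spl sH p) ∷ ≡˘ ((# L1) ⊕ (# L2)) (# L4) (spl sH₂ p) ∷ [])))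
          (twoParts h H H₂ (concat Rs₂) mh (proj₁ exs) (sep-sym sy (sep-concat Rs₂ (proj₂ exs))) (sep-sym sy (sep-concat Rs₂ (proj₂ ex₂))) (≤ᵇ-true {n} q) (≤ᵇ-true {n} q₂))

-- The upper bound

-- With q = ⌊m/28⌋ and j = q - 24 one has 28(23 + j) = 28(q - 1) < m, which is what eight
-- neighbourhoods in 7m vertices can afford. Then 400j is about 14m, well above the 7m that
-- `Shorten` has to beat.
common-budget : ∀ m → 2000 ≤ m → Σ ℕ λ j → (28 * (23 + j) < m) × (7 * m + 1 + 400 < 400 * j)
common-budget m h = q ∸ 24 , (lin (nums ((q ∸ 24) ∷ m ∷ r ∷ q ∷ [])) 1 (1+ (28 ⊛ ((` 23) ⊕ x0))) x1 (≡˘ (x2 ⊕ (28 ⊛ x3)) x1 dm ∷ 28 ×! ≡! ((` 24) ⊕ x0) x3 qj ∷ [])) ,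
  (lin (nums (m ∷ (q ∸ 24) ∷ r ∷ q ∷ [])) 1301 (1+ (((7 ⊛ x0) ⊕ (` 1)) ⊕ (` 400))) (400 ⊛ x1) (14402 ×! ≡! x0 (x2 ⊕ (28 ⊛ x3)) dm ∷ 403256 ×! ≡˘ x3 ((` 24) ⊕ x1) qj ∷ 14402 ×! ≤! (1+ x2) (` 28) hr ∷ 5295 ×! ≤! (` 2000) x0 h ∷ []))
  where
  q = m / 28
  r = m % 28
  hr : r < 28
  hr = m%n<n m 28
  dm : m ≡ r + 28 * q
  dm = trans (m≡m%n+[m/n]*n m 28) (cong (r +_) (*-comm q 28))
  qj : 24 + (q ∸ 24) ≡ q
  qj = m+[n∸m]≡n (lin (nums (q ∷ m ∷ r ∷ [])) 1973 (` 24) x0 (24 ×! ≡! x1 (x2 ⊕ (28 ⊛ x0)) dm ∷ 24 ×! ≤! (1+ x2) (` 28) hr ∷ 24 ×! ≤! (` 2000) x1 h ∷ []))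

module Upper (e : Rel) (sy : SymR e) (irr : Irr e) (K n' m : ℕ) (hK : 30 ≤ K) (hK' : 2 ^ 40 ≤ K) (hm : K + 900000 ≤ m) (m<n : m < suc n') (n≤2m : suc n' ≤ 2 * m)
  (V : List ℕ) (dV : NoDup V) (lV : length V ≡ 2 * suc n' + 2 * m + (K + 900000))
  (noCycle : HasCycle e V (2 * m) → ⊥) (noWheel : BlueWheel e V (suc n') → ⊥) where

  -- A blue cycle inside the blue neighbourhood of `v` is a rim with hub `v`. The summand 7 * 6298
  -- is spent by the seven rounds of `decompose`; 6317 must remain in every piece.
  minDegree : MinDeg e (m + 6317 + 7 * 6298) V
  minDegree v mv = go (∈-remove v V mv)
    where
    go : Σ (List ℕ) (λ V' → Split V (v ∷ []) V') → m + 6317 + 7 * 6298 ≤ cnt (e v) V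
    go (V' , sV) = test (≤-total (K + 2 * suc n' + m) (length U))
      where
      U = filt (co e v) V'
      U⊑ : U ⊑ V'
      U⊑ = le: λ p → ≤-trans (≤-reflexive (cnt-filt (co e v) p V')) (cnt-imp (λ y → co e v y ∧ p y) p V' (λ x _ h → proj₂ (∧-true h)))
      U⊑V : U ⊑ V
      U⊑V = ⊑-trans U⊑ (splitʳ sV)
      lU : length U ≡ cnt (co e v) V'
      lU = length-filt (co e v) V'
      fewBlue : length U ≤ K + 2 * suc n' + m → m + 6317 + 7 * 6298 ≤ cnt (e v) V
      fewBlue h = (lin (env (co e v) (v ∷ []) (U ∷ V' ∷ V ∷ []) (m ∷ (cnt (e v) V) ∷ K ∷ n' ∷ [])) 1 ((x0 ⊕ (` 6317)) ⊕ (7 ⊛ (` 6298))) x1 (≤! (∥ L0) ((x2 ⊕ (2 ⊛ (1+ x3))) ⊕ x0) h ∷ ≡˘ (# L1) (∥ L0) lU ∷ ≡˘ (∥ L2) (x1 ⊕ (# L2)) (cnt-not (e v) V) ∷ ≡˘ (((2 ⊛ (1+ x3)) ⊕ (2 ⊛ x0)) ⊕ (x2 ⊕ (` 900000))) (∥ L2) lV ∷ ≡! (# L2) ((# (0 ▹ nil)) ⊕ (# L1)) (spl sV (co e v)) ∷ ≤! (bit 0) (` 1) (b2n-≤1 (co e v v)) ∷ []))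
      wheel : CC e U (suc n') m → ⊥
      wheel (inj₁ c) = noCycle (cyc-mono U⊑V c)
      wheel (inj₂ (cyc C W cl C⊑ lC)) = noWheel (blueWheel v C W cl
        (le: λ p → (lin (env p (v ∷ []) (C ∷ V ∷ U ∷ V' ∷ []) []) 1 (# (0 ▹ L0)) (# L1) (≤! (# L0) (# L2) (⊑at C⊑ p) ∷ ≤! (# L2) (# L3) (⊑at U⊑ p) ∷ ≡˘ ((# (0 ▹ nil)) ⊕ (# L3)) (# L1) (spl sV p) ∷ []))) lC nonred)
        where
        nonred : ∀ c → c ∈ C → e v c ≡ false
        nonred c mc with cnt-wit (λ y → co e v y ∧ (c ≡ᵇ y)) V' (≤-trans (∈-⊑ c C⊑ mc) (≤-reflexive (cnt-filt (co e v) (c ≡ᵇ_) V')))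
        ... | y , _ , q with ==-true {c} {y} (proj₂ (∧-true q))
        ... | refl = not-true (proj₁ (∧-true q))
      test : (K + 2 * suc n' + m ≤ length U) ⊎ (length U ≤ K + 2 * suc n' + m) → m + 6317 + 7 * 6298 ≤ cnt (e v) V
      test (inj₂ h) = fewBlue h
      test (inj₁ h) = ⊥-elim (wheel (cycle-cycle K hK hK' (suc n' + m) (suc n') m e U ≤-refl sy (nodup-⊑ U⊑V dV)
        (lin (nums (m ∷ K ∷ [])) 90000 (` 10) x0 (≤! (x1 ⊕ (` 900000)) x0 hm ∷ [])) (<⇒≤ m<n) h))

  small : ∀ H → H ⊑ V → Robust e 6298 H × MinDeg e (m + 6317) H → DN (length H ≤ 2 * m + 6157)
  small H H⊑ (rob , md) = go (≤-total (length H) (2 * m + 6157)) (common-budget m (lin (nums (m ∷ K ∷ [])) 450 (` 2000) x0 (≤! (x1 ⊕ (` 900000)) x0 hm ∷ [])))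
    where
    go : length H ≤ 2 * m + 6157 ⊎ 2 * m + 6157 ≤ length H → (Σ ℕ λ j → (28 * (23 + j) < m) × (7 * m + 1 + 400 < 400 * j)) → DN (length H ≤ 2 * m + 6157)
    go (inj₁ h) _ = ret h
    go (inj₂ h) (j , hj , hw) _ = Exact.exact e sy irr H (nodup-⊑ H⊑ dV) 6298 m 6317 md rob
      (lin (lists [] (H ∷ V ∷ []) (m ∷ n' ∷ K ∷ [])) 1 (∥ L0) (7 ⊛ x0) (≤! (∥ L0) (∥ L1) (⊑-len H V H⊑) ∷ ≡! (∥ L1) (((2 ⊛ (1+ x1)) ⊕ (2 ⊛ x0)) ⊕ (x2 ⊕ (` 900000))) lV ∷ ≤! (x2 ⊕ (` 900000)) x0 hm ∷ 2 ×! ≤! (1+ x1) (2 ⊛ x0) n≤2m ∷ []))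
      -- For w = 400 the range must satisfy 467 ≤ 2 * 234. Then 73 + 26 * 234 = 6157 is the excess
      -- over 2m, and adding 141 and 160 gives 6298 and 6317.
      234 400 j (≤ᵇ⇒≤ 467 468 tt) ≤-refl ≤-refl (lin (nums (m ∷ K ∷ [])) 900000 (((` 73) ⊕ (26 ⊛ (` 234))) ⊕ (` 10)) x0 (6167 ×! ≤! (x1 ⊕ (` 900000)) x0 hm ∷ [])) h hj hw (λ c → noCycle (cyc-mono H⊑ c))

  allSmall : ∀ Hs → concat Hs ⊑ V → All (λ H → Robust e 6298 H × MinDeg e (m + 6317) H) Hs → DN (All (λ H → length H ≤ 2 * m + 6157) Hs)
  allSmall [] _ _ = ret []
  allSmall (H ∷ Hs) h (g ∷ gs) =
    small H (⊑-trans (le: λ p → (lin (env p [] (H ∷ (concat Hs) ∷ []) []) 1 (# L0) (# (L0 ⧺ L1)) [])) h) g >>= λ s →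
    allSmall Hs (⊑-trans (le: λ p → (lin (env p [] ((concat Hs) ∷ H ∷ []) []) 1 (# L0) (# (L1 ⧺ L0)) [])) h) gs >>= λ ss →
    ret (s ∷ ss)

  contradiction : ⊥
  contradiction = (decompose sy 6298 (m + 6317) 7 V
      (lin (lists [] (V ∷ []) (m ∷ n' ∷ K ∷ [])) 1 (∥ L0) (7 ⊛ (x0 ⊕ (` 6317))) (≡! (∥ L0) (((2 ⊛ (1+ x1)) ⊕ (2 ⊛ x0)) ⊕ (x2 ⊕ (` 900000))) lV ∷ ≤! (x2 ⊕ (` 900000)) x0 hm ∷ 2 ×! ≤! (1+ x1) (2 ⊛ x0) n≤2m ∷ [])) minDegree >>= finish) (λ z → z)
    where
    finish : Decomposition e 6298 (m + 6317) 7 V → DN ⊥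
    finish (decomposition Hs W sH lW sep good) = allSmall Hs (splitˡ sH) good >>= λ hb → ret (noWheel
      (Multipartite.wheel-mono e sy n' (2 * m + 6157) (splitˡ sH) (Multipartite.multipartite e sy n' (2 * m + 6157) Hs sep hb
        (lin (lists [] ((concat Hs) ∷ V ∷ W ∷ []) (n' ∷ m ∷ K ∷ [])) 1 ((2 ⊛ (1+ x0)) ⊕ ((2 ⊛ x1) ⊕ (` 6157))) (∥ L0) (≡! (∥ L1) ((∥ L0) ⊕ (∥ L2)) lens ∷ ≡˘ (((2 ⊛ (1+ x0)) ⊕ (2 ⊛ x1)) ⊕ (x2 ⊕ (` 900000))) (∥ L1) lV ∷ ≤! (∥ L2) (` 799846) lW ∷ []))
        (lin (lists [] ((concat Hs) ∷ V ∷ W ∷ []) (m ∷ n' ∷ K ∷ [])) 1 ((2 ⊛ ((2 ⊛ x0) ⊕ (` 6157))) ⊕ (` 1)) (∥ L0) (≡! (∥ L1) ((∥ L0) ⊕ (∥ L2)) lens ∷ ≡˘ (((2 ⊛ (1+ x1)) ⊕ (2 ⊛ x0)) ⊕ (x2 ⊕ (` 900000))) (∥ L1) lV ∷ ≤! (∥ L2) (` 799846) lW ∷ 2 ×! ≤! (1+ x0) (1+ x1) m<n ∷ [])))))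
      where
      lens = split-len V (concat Hs) W sH

-- Ramsey numbers exist: the arrow relation is decidable

-- Functions are enumerated only up to pointwise equality, so the predicates searched must respect
-- `_~_`.
Search : (A : Set) → (A → A → Set) → Set₁
Search A _~_ = ∀ (P : A → Set) → (∀ {a b} → a ~ b → P a → P b) → (∀ a → Dec (P a)) → Dec (Σ A P)

emptyF : ∀ {A : Set} → Fin 0 → A
emptyF ()

consF : ∀ {A : Set} {k} → A → (Fin k → A) → Fin (suc k) → A
consF a g fzero = a
consF a g (fsuc i) = g i

search-fun : ∀ {A : Set} {_~_ : A → A → Set} → (∀ {a} → a ~ a) → Search A _~_ → ∀ k → Search (Fin k → A) (λ f g → ∀ i → f i ~ g i)
search-fun rf S zero P resp P? = map′ (λ p → emptyF , p) (λ { (f , p) → resp {f} {emptyF} (λ ()) p }) (P? emptyF)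
search-fun {A} {_~_} rf S (suc k) P resp P? = map′ (λ { (a , g , p) → consF a g , p }) (λ { (f , p) → f fzero , (λ i → f (fsuc i)) , resp (eta f) p })
  (S (λ a → Σ (Fin k → A) λ g → P (consF a g)) (λ { q (g , p) → g , resp (head q) p })
    (λ a → search-fun {_~_ = _~_} rf S k (λ g → P (consF a g)) (λ q → resp (tail q)) (λ g → P? (consF a g))))
  where
  eta : ∀ f i → f i ~ consF (f fzero) (λ j → f (fsuc j)) i
  eta f fzero = rf
  eta f (fsuc i) = rf
  head : ∀ {a b g} → a ~ b → ∀ i → consF a g i ~ consF b g i
  head q fzero = q
  head q (fsuc i) = rf
  tail : ∀ {a f g} → (∀ i → f i ~ g i) → ∀ i → consF a f i ~ consF a g i
  tail q fzero = rf
  tail q (fsuc i) = q i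

search-Fin : ∀ n → Search (Fin n) _≡_
search-Fin n P _ P? = any? P?

search-Colour : Search Colour _≡_
search-Colour P _ P? with P? col1 | P? col2
... | yes p | _ = yes (col1 , p)
... | no _ | yes q = yes (col2 , q)
... | no p | no q = no λ { (col1 , r) → p r ; (col2 , r) → q r }

_≟ᶜ_ : ∀ (a b : Colour) → Dec (a ≡ b)
col1 ≟ᶜ col1 = yes refl
col1 ≟ᶜ col2 = no λ ()
col2 ≟ᶜ col1 = no λ ()
col2 ≟ᶜ col2 = yes refl

DecGraph : Graph → Set
DecGraph H = ∀ u v → Dec (E H u v)

copy? : ∀ {N} (κ : Colouring N) c H → DecGraph H → Dec (CopyIn κ c H)
copy? {N} κ c H E? = search-fun refl (search-Fin N) (V H) P resp P?
  where
  P : (Fin (V H) → Fin N) → Set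
  P f = Injective _≡_ _≡_ f × (∀ u v → E H u v → χ κ (f u) (f v) ≡ c)
  resp : ∀ {f g} → (∀ i → f i ≡ g i) → P f → P g
  resp q (inj , h) = (λ {x} {y} r → inj (trans (q x) (trans r (sym (q y))))) , λ u v uv → trans (sym (cong₂ (χ κ) (q u) (q v))) (h u v uv)
  P? : ∀ f → Dec (P f)
  P? f = map′ (λ h {x} {y} → h x y) (λ h x y → h {x} {y}) (all? λ x → all? λ y → (f x ≟ᶠ f y) →-dec (x ≟ᶠ y))
    ×-dec all? λ u → all? λ v → E? u v →-dec (χ κ (f u) (f v) ≟ᶜ c)

arrows? : ∀ N {H₁ H₂} → DecGraph H₁ → DecGraph H₂ → Dec (Arrows N H₁ H₂)
arrows? N {H₁} {H₂} E₁ E₂ = map′ (λ n κ → decide κ (copy? κ col1 H₁ E₁) (copy? κ col2 H₂ E₂) n) (λ { h (χ' , s , n) → n (h (κ-of s)) })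
  (¬? (search-fun (λ i → refl) (search-fun refl search-Colour N) N Bad resp bad?))
  where
  κ-of : ∀ {χ'} → (∀ i j → χ' i j ≡ χ' j i) → Colouring N
  κ-of {χ'} s = record { χ = χ' ; sym = s }
  Bad : (Fin N → Fin N → Colour) → Set
  Bad χ' = Σ (∀ i j → χ' i j ≡ χ' j i) λ s → ¬ (CopyIn (κ-of s) col1 H₁ ⊎ CopyIn (κ-of s) col2 H₂)
  move : ∀ {κ κ' : Colouring N} c H → (∀ i j → χ κ i j ≡ χ κ' i j) → CopyIn κ c H → CopyIn κ' c H
  move c H q (f , inj , h) = f , inj , λ u v uv → trans (sym (q (f u) (f v))) (h u v uv)
  resp : ∀ {f g} → (∀ i j → f i j ≡ g i j) → Bad f → Bad g
  resp {f} {g} q (s , n) = s' , λ { (inj₁ c) → n (inj₁ (move {κ-of s'} {κ-of s} col1 H₁ (λ i j → sym (q i j)) c)) ; (inj₂ c) → n (inj₂ (move {κ-of s'} {κ-of s} col2 H₂ (λ i j → sym (q i j)) c)) }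
    where
    s' : ∀ i j → g i j ≡ g j i
    s' i j = trans (sym (q i j)) (trans (s i j) (q j i))
  bad? : ∀ χ' → Dec (Bad χ')
  bad? χ' with all? (λ i → all? λ j → χ' i j ≟ᶜ χ' j i)
  ... | no n = no λ { (s , _) → n s }
  ... | yes s with copy? (κ-of s) col1 H₁ E₁ | copy? (κ-of s) col2 H₂ E₂
  ... | yes c | _ = no λ { (s' , n) → n (inj₁ (move {κ-of s} {κ-of s'} col1 H₁ (λ _ _ → refl) c)) }
  ... | no _ | yes c = no λ { (s' , n) → n (inj₂ (move {κ-of s} {κ-of s'} col2 H₂ (λ _ _ → refl) c)) }
  ... | no c | no c' = yes (s , λ { (inj₁ x) → c x ; (inj₂ x) → c' x })
  decide : ∀ κ → Dec (CopyIn κ col1 H₁) → Dec (CopyIn κ col2 H₂) → ¬ Σ (Fin N → Fin N → Colour) Bad → CopyIn κ col1 H₁ ⊎ CopyIn κ col2 H₂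
  decide κ (yes c) _ _ = inj₁ c
  decide κ (no _) (yes c) _ = inj₂ c
  decide κ (no c) (no c') n = ⊥-elim (n (χ κ , χ-sym κ , λ { (inj₁ x) → c x ; (inj₂ x) → c' x }))

least : ∀ {P : ℕ → Set} → (∀ n → Dec (P n)) → ∀ N → P N → Σ ℕ λ r → P r × (r ≤ N) × (∀ n → P n → r ≤ n)
least {P} P? N p = go N 0 (+-identityʳ N) (λ n ())
  where
  go : ∀ f k → f + k ≡ N → (∀ n → n < k → ¬ P n) → Σ ℕ λ r → P r × (r ≤ N) × (∀ n → P n → r ≤ n)
  go f k eq h with P? k
  ... | yes q = k , q , (lin (nums (k ∷ N ∷ f ∷ [])) 1 x0 x1 (≡! (x2 ⊕ x0) x1 eq ∷ [])) , λ n pn → ≮⇒≥ (λ lt → h n lt pn)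
  go zero k refl h | no n = ⊥-elim (n p)
  go (suc f) k eq h | no n = go f (suc k) (trans (+-suc f k) eq) λ j lt → below j (m≤n⇒m<n∨m≡n (s≤s⁻¹ lt))
    where
    below : ∀ j → j < k ⊎ j ≡ k → ¬ P j
    below j (inj₁ lt) = h j lt
    below j (inj₂ refl) = n

cycle-dec : ∀ ℓ → DecGraph (Cycle ℓ)
cycle-dec ℓ i j = (suc (toℕ i) ≟ toℕ j) ⊎-dec ((suc (toℕ i) ≟ ℓ) ×-dec (toℕ j ≟ 0))

wheel-dec : ∀ k → DecGraph (Wheel k)
wheel-dec k fzero fzero = no λ ()
wheel-dec k fzero (fsuc j) = yes tt
wheel-dec k (fsuc i) fzero = no λ ()
wheel-dec k (fsuc i) (fsuc j) = cycle-dec k i j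

even? : ∀ n → Dec (Even n)
even? zero = yes ev0
even? (suc zero) = no λ ()
even? (suc (suc n)) = map′ ev+2 (λ { (ev+2 h) → h }) (even? n)

fan-dec : ∀ n → DecGraph (Fan n)
fan-dec n fzero fzero = no λ ()
fan-dec n fzero (fsuc j) = yes tt
fan-dec n (fsuc i) fzero = no λ ()
fan-dec n (fsuc i) (fsuc j) = even? (toℕ i) ×-dec (suc (toℕ i) ≟ toℕ j)

fan⊆wheel : ∀ {N H} n → Arrows N H (Wheel (2 * n)) → Arrows N H (Fan n)
fan⊆wheel n h κ with h κ
... | inj₁ c = inj₁ c
... | inj₂ (f , inj , e) = inj₂ (f , inj , λ u v uv → e u v (edge u v uv))
  where
  edge : ∀ u v → fanAdj n u v → wheelAdj (2 * n) u v
  edge fzero (fsuc v) _ = tt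
  edge (fsuc u) (fsuc v) (_ , q) = inj₁ q

-- Colourings as symmetric relations on ℕ

down : ℕ → List ℕ
down zero = []
down (suc n) = n ∷ down n

down-len : ∀ n → length (down n) ≡ n
down-len zero = refl
down-len (suc n) = cong suc (down-len n)

down-< : ∀ n v → v ∈ down n → v < n
down-< (suc n) v m with ∈-∷⁻ v n (down n) m
... | inj₁ refl = ≤-refl
... | inj₂ m' = ≤-trans (down-< n v m') (n≤1+n n)

down-nodup : ∀ n → NoDup (down n)
down-nodup zero v = z≤n
down-nodup (suc n) = nodup-∷ n (down n) (fresh (n ∈? down n)) (down-nodup n)
  where
  fresh : n ∈ down n ⊎ occ n (down n) ≡ 0 → occ n (down n) ≡ 0
  fresh (inj₁ m) = ⊥-elim (<-irrefl refl (down-< n n m))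
  fresh (inj₂ z) = z

nth-inj : ∀ L → NoDup L → ∀ i j → i < length L → j < length L → nth L i ≡ nth L j → i ≡ j
nth-inj (x ∷ L) d zero zero _ _ _ = refl
nth-inj (x ∷ L) d zero (suc j) _ (s≤s hj) refl = (⊥-elim (1+n≰n (lin (env ((nth L j) ≡ᵇ_) ((nth L j) ∷ []) (L ∷ []) []) 1 (` 1) (` 0) (≤! (# (0 ▹ L0)) (` 1) (d (nth L j)) ∷ ≤! (` 1) (# L0) (nth-∈ L j hj) ∷ ≡˘ (` 1) (bit 0) (b2n-t (==-refl (nth L j))) ∷ []))))
nth-inj (x ∷ L) d (suc i) zero (s≤s hi) _ refl = (⊥-elim (1+n≰n (lin (env ((nth L i) ≡ᵇ_) ((nth L i) ∷ []) (L ∷ []) []) 1 (` 1) (` 0) (≤! (# (0 ▹ L0)) (` 1) (d (nth L i)) ∷ ≤! (` 1) (# L0) (nth-∈ L i hi) ∷ ≡˘ (` 1) (bit 0) (b2n-t (==-refl (nth L i))) ∷ []))))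
nth-inj (x ∷ L) d (suc i) (suc j) (s≤s hi) (s≤s hj) q = cong suc (nth-inj L (λ v → ≤-trans (m≤n+m _ _) (d v)) i j hi hj q)

walk-step : ∀ {e u v} C → Walk e u C v → ∀ i → suc i < length C → e (nth C i) (nth C (suc i)) ≡ true
walk-step (x ∷ []) W zero (s≤s ())
walk-step (x ∷ y ∷ C) (h ◂ W) zero _ with whd y W
... | refl = h
walk-step (x ∷ C) (h ◂ W) (suc i) (s≤s l) = walk-step C W i l

walk-last : ∀ {e u v} C → Walk e u C v → ∀ i → suc i ≡ length C → nth C i ≡ v
walk-last (x ∷ []) [ .x ] zero _ = refl
walk-last (x ∷ []) W (suc i) ()
walk-last (x ∷ y ∷ C) (h ◂ W) (suc i) q = walk-last (y ∷ C) W i (suc-injective q)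

walk-first : ∀ {e u v} C → Walk e u C v → nth C 0 ≡ u
walk-first (x ∷ C) W = whd x W

closed-step : ∀ {e u v} C → Walk e u C v → e v u ≡ true → ∀ {ℓ} → length C ≡ ℓ → (i j : Fin ℓ) → cycAdj ℓ i j → e (nth C (toℕ i)) (nth C (toℕ j)) ≡ true
closed-step {e} C W cl refl i j (inj₁ q) = subst (λ z → e (nth C (toℕ i)) (nth C z) ≡ true) q (walk-step C W (toℕ i) (subst (_< length C) (sym q) (toℕ<n j)))
closed-step {e} C W cl refl i j (inj₂ (q , q')) = subst₂ (λ y z → e y z ≡ true) (sym (walk-last C W (toℕ i) q)) (sym (trans (cong (nth C) q') (walk-first C W))) cl

isRed : Colour → Bool
isRed col1 = true
isRed col2 = false

module Bridge {N : ℕ} (κ : Colouring N) where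

  -- Red is made irreflexive and empty outside of the N vertices. The complement therefore contains
  -- loops, and reading off a blue edge requires distinct ends.
  e : Rel
  e x y with x <? N | y <? N
  ... | yes p | yes q = isRed (χ κ (fromℕ< p) (fromℕ< q)) ∧ not (x ≡ᵇ y)
  ... | _ | _ = false

  ≡ᵇ-sym : ∀ x y → (x ≡ᵇ y) ≡ (y ≡ᵇ x)
  ≡ᵇ-sym zero zero = refl
  ≡ᵇ-sym zero (suc y) = refl
  ≡ᵇ-sym (suc x) zero = refl
  ≡ᵇ-sym (suc x) (suc y) = ≡ᵇ-sym x y

  e-sym : SymR e
  e-sym x y with x <? N | y <? N
  ... | yes p | yes q = cong₂ (λ a b → isRed a ∧ not b) (χ-sym κ (fromℕ< p) (fromℕ< q)) (≡ᵇ-sym x y)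
  ... | yes p | no q = refl
  ... | no p | yes q = refl
  ... | no p | no q = refl

  e-irr : Irr e
  e-irr x with x <? N
  ... | no p = refl
  ... | yes p rewrite ==-refl x = ∧-false (isRed (χ κ (fromℕ< p) (fromℕ< p)))
    where
    ∧-false : ∀ b → b ∧ false ≡ false
    ∧-false true = refl
    ∧-false false = refl

  red : ∀ x y (p : x < N) (q : y < N) → e x y ≡ true → χ κ (fromℕ< p) (fromℕ< q) ≡ col1
  red x y p q h with x <? N | y <? N
  red x y p q h | yes p' | yes q' with χ κ (fromℕ< p') (fromℕ< q')
  ... | col1 = refl
  red x y p q h | no p' | _ = ⊥-elim (p' p)
  red x y p q h | yes _ | no q' = ⊥-elim (q' q)

  blue : ∀ x y (p : x < N) (q : y < N) → ¬ x ≡ y → e x y ≡ false → χ κ (fromℕ< p) (fromℕ< q) ≡ col2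
  blue x y p q ne h with x <? N | y <? N
  blue x y p q ne h | yes p' | yes q' with χ κ (fromℕ< p') (fromℕ< q')
  ... | col2 = refl
  ... | col1 rewrite ==-false ne = ⊥-elim (t≢f refl h)
  blue x y p q ne h | no p' | _ = ⊥-elim (p' p)
  blue x y p q ne h | yes _ | no q' = ⊥-elim (q' q)

  Vs = down N

  module Place (L : List ℕ) (L⊑ : L ⊑ Vs) where
    dL : NoDup L
    dL = nodup-⊑ L⊑ (down-nodup N)
    lt : ∀ i → i < length L → nth L i < N
    lt i h = down-< N (nth L i) (∈-⊑ (nth L i) L⊑ (nth-∈ L i h))
    place : Fin (length L) → Fin N
    place i = fromℕ< (lt (toℕ i) (toℕ<n i))
    place-inj : Injective _≡_ _≡_ place
    place-inj {i} {j} q = toℕ-injective (nth-inj L dL (toℕ i) (toℕ j) (toℕ<n i) (toℕ<n j)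
      (fromℕ<-injective (nth L (toℕ i)) (nth L (toℕ j)) (lt (toℕ i) (toℕ<n i)) (lt (toℕ j) (toℕ<n j)) q))

  cycle-copy : ∀ {ℓ} → HasCycle e Vs ℓ → CopyIn κ col1 (Cycle ℓ)
  cycle-copy (cyc C W cl C⊑ refl) = place , place-inj , λ i j h →
    red _ _ (lt (toℕ i) (toℕ<n i)) (lt (toℕ j) (toℕ<n j)) (closed-step C W cl refl i j h)
    where open Place C C⊑

  wheel-copy : ∀ {n} → BlueWheel e Vs n → CopyIn κ col2 (Wheel (2 * n))
  wheel-copy {n} (blueWheel h C W cl hC⊑ l hub) = subst (λ z → CopyIn κ col2 (Wheel z)) l (place , place-inj , edge)
    where
    open Place (h ∷ C) hC⊑
    apart : ∀ i j → i < suc (length C) → j < suc (length C) → ¬ i ≡ j → ¬ nth (h ∷ C) i ≡ nth (h ∷ C) j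
    apart i j hi hj ne q = ne (nth-inj (h ∷ C) dL i j hi hj q)
    cyc≢ : ∀ {ℓ} (i j : Fin ℓ) → 2 ≤ ℓ → cycAdj ℓ i j → ¬ toℕ i ≡ toℕ j
    cyc≢ i j hℓ (inj₁ q) eq = <-irrefl eq (≤-reflexive q)
    cyc≢ {ℓ} i j hℓ (inj₂ (q , q')) eq = (⊥-elim (1+n≰n (lin (nums (ℓ ∷ (toℕ i) ∷ (toℕ j) ∷ [])) 1 (` 1) (` 0) (≡˘ x0 (1+ x1) q ∷ ≡! x2 (` 0) q' ∷ ≡! x1 x2 eq ∷ ≤! (` 2) x0 hℓ ∷ []))))
    long : ∀ k → length C ≡ 2 * k → Fin (length C) → 2 ≤ length C
    long zero q i = (lin (lists [] (C ∷ []) ((toℕ i) ∷ [])) 1 (` 2) (∥ L0) (2 ×! ≤! (1+ x0) (∥ L0) (toℕ<n i) ∷ ≡! (∥ L0) (` 0) q ∷ []))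
    long (suc k) q i = (lin (lists [] (C ∷ []) (k ∷ [])) 1 (` 2) (∥ L0) (≡˘ (2 ⊛ (1+ x0)) (∥ L0) q ∷ []))
    edge : ∀ u v → wheelAdj (length C) u v → χ κ (place u) (place v) ≡ col2
    edge fzero (fsuc j) _ = blue h (nth C (toℕ j)) (lt 0 (s≤s z≤n)) (lt (suc (toℕ j)) (s≤s (toℕ<n j))) (apart 0 (suc (toℕ j)) (s≤s z≤n) (s≤s (toℕ<n j)) λ ())
      (hub (nth C (toℕ j)) (nth-∈ C (toℕ j) (toℕ<n j)))
    edge (fsuc i) (fsuc j) adj = blue (nth C (toℕ i)) (nth C (toℕ j)) (lt (suc (toℕ i)) (s≤s (toℕ<n i))) (lt (suc (toℕ j)) (s≤s (toℕ<n j)))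
      (apart (suc (toℕ i)) (suc (toℕ j)) (s≤s (toℕ<n i)) (s≤s (toℕ<n j)) (λ q → cyc≢ i j (long n l i) adj (suc-injective q)))
      (not-true (closed-step C W cl refl i j adj))

upper-arrows : ∀ K → 30 ≤ K → 2 ^ 40 ≤ K → ∀ n m → K + 900000 ≤ m → n ≤ 2 * m → m < n → Arrows (2 * n + 2 * m + (K + 900000)) (Cycle (2 * m)) (Wheel (2 * n))
upper-arrows K hK hK' (suc n') m hm n≤2m m<n κ = decide (copy? κ col1 (Cycle (2 * m)) (cycle-dec (2 * m))) (copy? κ col2 (Wheel (2 * suc n')) (wheel-dec (2 * suc n')))
  where
  open Bridge κ
  decide : Dec (CopyIn κ col1 (Cycle (2 * m))) → Dec (CopyIn κ col2 (Wheel (2 * suc n'))) → CopyIn κ col1 (Cycle (2 * m)) ⊎ CopyIn κ col2 (Wheel (2 * suc n'))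
  decide (yes c) _ = inj₁ c
  decide (no _) (yes c) = inj₂ c
  decide (no a) (no b) = ⊥-elim (Upper.contradiction e e-sym e-irr K n' m hK hK' hm m<n n≤2m Vs (down-nodup _) (down-len _) (λ c → a (cycle-copy c)) (λ w → b (wheel-copy w)))

-- The lower bound: red cliques on 2m - 1, n - 1 and n - 1 vertices

data Part : Set where
  p0 p1 p2 : Part

agree : Part → Part → Colour
agree p0 p0 = col1
agree p1 p1 = col1
agree p2 p2 = col1
agree _ _ = col2

agree-sym : ∀ a b → agree a b ≡ agree b a
agree-sym p0 p0 = refl
agree-sym p0 p1 = refl
agree-sym p0 p2 = refl
agree-sym p1 p0 = refl
agree-sym p1 p1 = refl
agree-sym p1 p2 = refl
agree-sym p2 p0 = refl
agree-sym p2 p1 = refl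
agree-sym p2 p2 = refl

agree-refl : ∀ a → agree a a ≡ col1
agree-refl p0 = refl
agree-refl p1 = refl
agree-refl p2 = refl

agree-col1 : ∀ a b → agree a b ≡ col1 → a ≡ b
agree-col1 p0 p0 _ = refl
agree-col1 p1 p1 _ = refl
agree-col1 p2 p2 _ = refl

agree-col2 : ∀ {a b} → agree a b ≡ col2 → ¬ a ≡ b
agree-col2 {a} h refl with trans (sym h) (agree-refl a)
... | ()

-- a small part other than the given one
target : Part → Part
target p0 = p1
target p1 = p2
target p2 = p1

-- The hub of a blue fan and a matching edge form a blue triangle, which meets all three parts. So
-- each matching edge has an end in the `target` of the hub's part, and this is always one of the
-- two small parts.
third : ∀ a b c → ¬ a ≡ b → ¬ a ≡ c → ¬ b ≡ c → b ≡ target a ⊎ (c ≡ target a)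
third p0 p0 c ab ac bc = ⊥-elim (ab refl)
third p0 p1 c ab ac bc = inj₁ refl
third p0 p2 p0 ab ac bc = ⊥-elim (ac refl)
third p0 p2 p1 ab ac bc = inj₂ refl
third p0 p2 p2 ab ac bc = ⊥-elim (bc refl)
third p1 p1 c ab ac bc = ⊥-elim (ab refl)
third p1 p2 c ab ac bc = inj₁ refl
third p1 p0 p1 ab ac bc = ⊥-elim (ac refl)
third p1 p0 p2 ab ac bc = inj₂ refl
third p1 p0 p0 ab ac bc = ⊥-elim (bc refl)
third p2 p2 c ab ac bc = ⊥-elim (ab refl)
third p2 p1 c ab ac bc = inj₁ refl
third p2 p0 p2 ab ac bc = ⊥-elim (ac refl)
third p2 p0 p1 ab ac bc = inj₂ refl
third p2 p0 p0 ab ac bc = ⊥-elim (bc refl)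

interval-bound : ∀ {ℓ} lo s (F : Fin ℓ → ℕ) → (∀ i j → F i ≡ F j → i ≡ j) → (∀ i → lo ≤ F i) → (∀ i → F i < lo + s) → ℓ ≤ s
interval-bound {ℓ} lo s F inj h h' = ≮⇒≥ clash
  where
  eq : ∀ i → lo + (F i ∸ lo) ≡ F i
  eq i = m+[n∸m]≡n (h i)
  lt : ∀ i → F i ∸ lo < s
  lt i = +-cancelˡ-< lo _ _ (subst (_< lo + s) (sym (eq i)) (h' i))
  clash : s < ℓ → ⊥
  clash l with pigeonhole l (λ i → fromℕ< (lt i))
  ... | i , j , i<j , q = <-irrefl (cong toℕ (inj i j (trans (sym (eq i)) (trans (cong (lo +_) (fromℕ<-injective _ _ (lt i) (lt j) q)) (eq j))))) i<j

even-double : ∀ i → Even (2 * i)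
even-double zero = ev0
even-double (suc i) = subst Even (lin≡ (nums (i ∷ [])) 1 (1+ (1+ (2 ⊛ x0))) (2 ⊛ (1+ x0)) []) (ev+2 (even-double i))

module Lower (n' m' r : ℕ) (hr : r ≤ 2 * n' + 2 * m' + 1) (m<n : m' < n') (n≤2m : n' ≤ 2 * m' + 1) where

  s₀ = 2 * m' + 1
  s₁ = s₀ + n'

  part : ℕ → Part
  part x = if x <ᵇ s₀ then p0 else (if x <ᵇ s₁ then p1 else p2)

  low size : Part → ℕ
  low p0 = 0
  low p1 = s₀
  low p2 = s₁
  size p0 = s₀
  size _ = n'

  place : ∀ x → x < r → (low (part x) ≤ x) × (x < low (part x) + size (part x))
  place x hx with x <ᵇ s₀ in eq
  ... | true = z≤n , <ᵇ⇒< x s₀ (subst T (sym eq) tt)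
  ... | false with x <ᵇ s₁ in eq'
  ... | true = ≮⇒≥ (λ l → subst T eq (<⇒<ᵇ l)) , <ᵇ⇒< x s₁ (subst T (sym eq') tt)
  ... | false = ≮⇒≥ (λ l → subst T eq' (<⇒<ᵇ l)) , (lin (nums (x ∷ s₁ ∷ n' ∷ m' ∷ r ∷ [])) 1 (1+ x0) (x1 ⊕ x2) (≡˘ (((2 ⊛ x3) ⊕ (` 1)) ⊕ x2) x1 (refl {x = s₁}) ∷ ≤! (1+ x0) x4 hx ∷ ≤! x4 (((2 ⊛ x2) ⊕ (2 ⊛ x3)) ⊕ (` 1)) hr ∷ []))

  κ : Colouring r
  κ = record { χ = λ i j → agree (part (toℕ i)) (part (toℕ j)) ; sym = λ i j → agree-sym (part (toℕ i)) (part (toℕ j)) }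

  -- Here n ≤ 2m enters: the cliques on n - 1 vertices must be too small for the cycle as well.
  size≤ : ∀ p → size p ≤ s₀
  size≤ p0 = ≤-refl
  size≤ p1 = n≤2m
  size≤ p2 = n≤2m

  noCycle : CopyIn κ col1 (Cycle (2 * suc m')) → ⊥
  noCycle (f , inj , h) = (⊥-elim (1+n≰n (lin (nums (m' ∷ (size (part (F 0 0<))) ∷ [])) 1 (` 1) (` 0) (≤! (2 ⊛ (1+ x0)) x1 bound ∷ ≤! x1 ((2 ⊛ x0) ⊕ (` 1)) (size≤ (part (F 0 0<))) ∷ []))))
    where
    ℓ = 2 * suc m'
    0< : 0 < ℓ
    0< = s≤s z≤n
    F : ∀ k → k < ℓ → ℕ
    F k l = toℕ (f (fromℕ< l))
    same : ∀ k (l : k < ℓ) → part (F k l) ≡ part (F 0 0<)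
    same zero l = refl
    same (suc k) l = trans (sym (agree-col1 _ _ (h (fromℕ< l') (fromℕ< l) (inj₁ (trans (cong suc (toℕ-fromℕ< l')) (sym (toℕ-fromℕ< l))))))) (same k l')
      where
      l' : k < ℓ
      l' = ≤-trans (n≤1+n _) l
    same' : ∀ i → part (toℕ (f i)) ≡ part (F 0 0<)
    same' i = subst (λ z → part (toℕ (f z)) ≡ part (F 0 0<)) (toℕ-injective (toℕ-fromℕ< (toℕ<n i))) (same (toℕ i) (toℕ<n i))
    bound : ℓ ≤ size (part (F 0 0<))
    bound = interval-bound (low (part (F 0 0<))) _ (λ i → toℕ (f i)) (λ i j q → inj (toℕ-injective q))
      (λ i → subst (λ z → low z ≤ toℕ (f i)) (same' i) (proj₁ (place _ (toℕ<n (f i)))))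
      (λ i → subst (λ z → toℕ (f i) < low z + size z) (same' i) (proj₂ (place _ (toℕ<n (f i)))))

  -- The n disjoint matching edges would place n distinct vertices into one part with n - 1
  -- vertices.
  noFan : CopyIn κ col2 (Fan (suc n')) → ⊥
  noFan (f , inj , h) = <-irrefl refl (≤-trans bound (≤-reflexive (small (part (toℕ (f fzero))))))
    where
    n = suc n'
    hub = part (toℕ (f fzero))
    small : ∀ p → size (target p) ≡ n'
    small p0 = refl
    small p1 = refl
    small p2 = refl
    k₀< : ∀ (i : Fin n) → 2 * toℕ i < 2 * n
    k₀< i = (lin (nums ((toℕ i) ∷ n' ∷ [])) 1 (1+ (2 ⊛ x0)) (2 ⊛ (1+ x1)) (2 ×! ≤! (1+ x0) (1+ x1) (toℕ<n i) ∷ []))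
    k₁< : ∀ (i : Fin n) → suc (2 * toℕ i) < 2 * n
    k₁< i = (lin (nums ((toℕ i) ∷ n' ∷ [])) 1 (1+ (1+ (2 ⊛ x0))) (2 ⊛ (1+ x1)) (2 ×! ≤! (1+ x0) (1+ x1) (toℕ<n i) ∷ []))
    v₀ v₁ : Fin n → Fin (2 * n)
    v₀ i = fromℕ< (k₀< i)
    v₁ i = fromℕ< (k₁< i)
    P : Fin (2 * n) → Part
    P v = part (toℕ (f (fsuc v)))
    choose : ∀ i → Σ (Fin (2 * n)) λ v → (P v ≡ target hub) × (v ≡ v₀ i ⊎ v ≡ v₁ i)
    choose i = pickVertex (third hub (P (v₀ i)) (P (v₁ i)) (agree-col2 (h fzero (fsuc (v₀ i)) tt)) (agree-col2 (h fzero (fsuc (v₁ i)) tt))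
        (agree-col2 (h (fsuc (v₀ i)) (fsuc (v₁ i)) (subst Even (sym (toℕ-fromℕ< (k₀< i))) (even-double (toℕ i)) , trans (cong suc (toℕ-fromℕ< (k₀< i))) (sym (toℕ-fromℕ< (k₁< i)))))))
      where
      pickVertex : P (v₀ i) ≡ target hub ⊎ P (v₁ i) ≡ target hub → Σ (Fin (2 * n)) λ v → (P v ≡ target hub) × (v ≡ v₀ i ⊎ v ≡ v₁ i)
      pickVertex (inj₁ q) = v₀ i , q , inj₁ refl
      pickVertex (inj₂ q) = v₁ i , q , inj₂ refl
    index : ∀ i v → v ≡ v₀ i ⊎ v ≡ v₁ i → (toℕ v ≡ 2 * toℕ i) ⊎ (toℕ v ≡ 2 * toℕ i + 1)
    index i v (inj₁ refl) = inj₁ (toℕ-fromℕ< (k₀< i))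
    index i v (inj₂ refl) = inj₂ (trans (toℕ-fromℕ< (k₁< i)) (+-comm 1 _))
    unique : ∀ v i j → (toℕ v ≡ 2 * toℕ i) ⊎ (toℕ v ≡ 2 * toℕ i + 1) → (toℕ v ≡ 2 * toℕ j) ⊎ (toℕ v ≡ 2 * toℕ j + 1) → i ≡ j
    unique v i j (inj₁ a) (inj₁ b) = toℕ-injective (lin≡ (nums ((toℕ i) ∷ (toℕ j) ∷ (toℕ v) ∷ [])) 2 x0 x1 (≡˘ (2 ⊛ x0) x2 a ∷ ≡! x2 (2 ⊛ x1) b ∷ []))
    unique v i j (inj₂ a) (inj₂ b) = toℕ-injective (lin≡ (nums ((toℕ i) ∷ (toℕ j) ∷ (toℕ v) ∷ [])) 2 x0 x1 (≡˘ ((2 ⊛ x0) ⊕ (` 1)) x2 a ∷ ≡! x2 ((2 ⊛ x1) ⊕ (` 1)) b ∷ []))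
    unique v i j (inj₁ a) (inj₂ b) = ⊥-elim (odd≢even (toℕ j) (toℕ i) (trans (sym b) a))
    unique v i j (inj₂ a) (inj₁ b) = ⊥-elim (odd≢even (toℕ i) (toℕ j) (trans (sym a) b))
    g : Fin n → ℕ
    g i = toℕ (f (fsuc (proj₁ (choose i))))
    g-inj : ∀ i j → g i ≡ g j → i ≡ j
    g-inj i j q = unique (proj₁ (choose i)) i j (index i _ (proj₂ (proj₂ (choose i)))) (subst (λ v → (toℕ v ≡ 2 * toℕ j) ⊎ (toℕ v ≡ 2 * toℕ j + 1)) (sym vq) (index j _ (proj₂ (proj₂ (choose j)))))
      where
      fsuc-inj : ∀ {k} {x y : Fin k} → fsuc x ≡ fsuc y → x ≡ y
      fsuc-inj refl = refl
      vq : proj₁ (choose i) ≡ proj₁ (choose j)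
      vq = fsuc-inj (inj (toℕ-injective q))
    bound : n ≤ size (target hub)
    bound = interval-bound (low (target hub)) _ g g-inj
      (λ i → subst (λ z → low z ≤ g i) (proj₁ (proj₂ (choose i))) (proj₁ (place _ (toℕ<n (f (fsuc (proj₁ (choose i))))))))
      (λ i → subst (λ z → g i < low z + size z) (proj₁ (proj₂ (choose i))) (proj₂ (place _ (toℕ<n (f (fsuc (proj₁ (choose i))))))))

lower-arrows : ∀ n m r → n ≤ 2 * m → m < n → Arrows r (Cycle (2 * m)) (Fan n) → 2 * n + 2 * m ∸ 2 ≤ r
lower-arrows zero m r _ () _
lower-arrows (suc n') zero r () _ _
lower-arrows (suc n') (suc m') r n≤2m (s≤s m<n) arr = ≮⇒≥ λ lt → [_,_]′ (Lower.noCycle n' m' r (hr lt) m<n n≤) (Lower.noFan n' m' r (hr lt) m<n n≤)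
  (arr (Lower.κ n' m' r (hr lt) m<n n≤))
  where
  n≤ : n' ≤ 2 * m' + 1
  n≤ = (lin (nums (n' ∷ m' ∷ [])) 1 x0 ((2 ⊛ x1) ⊕ (` 1)) (≤! (1+ x0) (2 ⊛ (1+ x1)) n≤2m ∷ []))
  total : 2 * suc n' + 2 * suc m' ≡ 2 + (2 * n' + 2 * m' + 2)
  total = (lin≡ (nums (n' ∷ m' ∷ [])) 1 ((2 ⊛ (1+ x0)) ⊕ (2 ⊛ (1+ x1))) ((` 2) ⊕ (((2 ⊛ x0) ⊕ (2 ⊛ x1)) ⊕ (` 2))) [])
  hr : r < 2 * suc n' + 2 * suc m' ∸ 2 → r ≤ 2 * n' + 2 * m' + 1
  hr lt = (lin (nums (r ∷ n' ∷ m' ∷ [])) 1 x0 (((2 ⊛ x1) ⊕ (2 ⊛ x2)) ⊕ (` 1)) (≤! (1+ x0) (((2 ⊛ x1) ⊕ (2 ⊛ x2)) ⊕ (` 2)) (subst (r <_) (cong (_∸ 2) total) lt) ∷ []))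

theorem1p6 : Σ ℕ λ C → Σ ℕ λ m₀ →
    ∀ n m → m₀ ≤ n → m₀ ≤ m → n ≤ 2 * m → m < n →
    Σ ℕ λ r₁ → Σ ℕ λ r₂ →
    IsRamseyNumber r₁ (Cycle (2 * m)) (Fan n) ×
    IsRamseyNumber r₂ (Cycle (2 * m)) (Wheel (2 * n)) ×
    (2 * n + 2 * m ∸ 2 ≤ r₁) × (r₁ ≤ r₂) × (r₂ ≤ 2 * n + 2 * m + C)
-- With m₀ equal to C the additive constant is at most m, so the graph has at most 2n + 3m ≤ 7m
-- vertices.
theorem1p6 = 2 ^ 40 + 900000 , 2 ^ 40 + 900000 , λ n m _ hm n≤2m m<n →
  let r₂ , a₂ , l₂ , min₂ = least (λ N → arrows? N (cycle-dec (2 * m)) (wheel-dec (2 * n))) (2 * n + 2 * m + (2 ^ 40 + 900000))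
                              (upper-arrows (2 ^ 40) (≤ᵇ⇒≤ 30 (2 ^ 40) tt) ≤-refl n m hm n≤2m m<n)
      r₁ , a₁ , l₁ , min₁ = least (λ N → arrows? N (cycle-dec (2 * m)) (fan-dec n)) r₂ (fan⊆wheel n a₂)
  in r₁ , r₂ , (a₁ , min₁) , (a₂ , min₂) , lower-arrows n m r₁ n≤2m m<n a₁ , l₁ , l₂
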